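{- For all $k>1$, $\Delta>1$ and $d,\mu>0$ there is $\rho>0$ such that for all sufficiently large $n$ the following holds. Let $G$ be a $(\rho,d)$-dense graph on $n$ vertices with $\delta(G)\geqslant\mu n$. Let $H$ be an $\mathcal{F}_c(k,\sqrt n/\log n)$-tiling on $n$ vertices with $\chi(H)\leqslant k$ and $\Delta(H)\leqslant\Delta$. Then $H\subseteq G$.
   Context: For $\rho,d>0$, a graph $G$ on $n$ vertices is $(\rho,d)$-dense if $e(U)\geqslant d|U|^2/2-\rho n^2$ for every $U\subseteq V(G)$, where $e(U)$ is the number of edges of $G[U]$. $\mathcal{F}_c$ is the family of graphs $F$ such that the greatest common divisor of the orders of the connected components of $F$ equals $1$. $\mathcal{F}(k,w)$ is the family of properly $k$-colourable graphs on at most $w$ vertices and $\mathcal{F}_c(k,w)=\mathcal{F}_c\cap\mathcal{F}(k,w)$. For a family $\mathcal{F}$, an $\mathcal{F}$-tiling is a disjoint union of copies of graphs in $\mathcal{F}$. -}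

module Defs where

open import Data.Bool using (Bool; true; false; if_then_else_; _∧_; _∨_)
open import Data.Nat as ℕ using (ℕ; zero; suc; _^_; _!)
open import Data.Nat.Properties using (_!≢0)
open import Data.Nat.GCD using (gcd)
open import Data.Integer using (+_)
open import Data.Fin using (Fin; _<?_; _≟_)
open import Data.List using (List; allFin; map; foldr)
open import Data.Nat.ListAction using (sum)
open import Data.Bool.ListAction using (any)
open import Data.Rational as ℚ using (ℚ; _/_; 0ℚ; _*_; _+_; _-_)
open import Data.Product using (Σ; ∃; _×_)
open import Data.Sum using (_⊎_)
open import Relation.Nullary using (¬_)
open import Relation.Nullary.Decidable using (⌊_⌋)
open import Relation.Binary.PropositionalEquality using (_≡_; _≢_)

ℕ→ℚ : ℕ → ℚ
ℕ→ℚ m = + m / 1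

count : {n : ℕ} → (Fin n → Bool) → ℕ
count {n} f = sum (map (λ i → if f i then 1 else 0) (allFin n))

record Graph (n : ℕ) : Set where
  field
    adj    : Fin n → Fin n → Bool
    sym    : ∀ i j → adj i j ≡ adj j i
    irrefl : ∀ i → adj i i ≡ false
open Graph public

edgesIn : {n : ℕ} → Graph n → (Fin n → Bool) → ℕ
edgesIn {n} G U =
  sum (map (λ i → count (λ j → ⌊ i <? j ⌋ ∧ U i ∧ U j ∧ adj G i j)) (allFin n))

Dense : {n : ℕ} → ℚ → ℚ → Graph n → Set
Dense {n} ρ d G = ∀ (U : Fin n → Bool) →
  d * ℕ→ℚ (count U) * ℕ→ℚ (count U) * (+ 1 / 2) - ρ * ℕ→ℚ n * ℕ→ℚ n
    ℚ.≤ ℕ→ℚ (edgesIn G U)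

deg : {n : ℕ} → Graph n → Fin n → ℕ
deg G v = count (adj G v)

MinDegreeAtLeast : {n : ℕ} → ℚ → Graph n → Set
MinDegreeAtLeast {n} μ G = ∀ v → μ * ℕ→ℚ n ℚ.≤ ℕ→ℚ (deg G v)

MaxDegreeAtMost : {n : ℕ} → ℕ → Graph n → Set
MaxDegreeAtMost D G = ∀ v → deg G v ℕ.≤ D

ProperColouringOn : {n : ℕ} → ℕ → Graph n → (Fin n → Bool) → Set
ProperColouringOn {n} k G S = Σ (Fin n → Fin k) λ c →
  ∀ i j → S i ≡ true → S j ≡ true → adj G i j ≡ true → c i ≢ c j

ChromaticAtMost : {n : ℕ} → ℕ → Graph n → Set
ChromaticAtMost k G = ProperColouringOn k G (λ _ → true)

reach : {n : ℕ} → Graph n → ℕ → Fin n → Fin n → Bool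
reach G zero i j = ⌊ i ≟ j ⌋
reach {n} G (suc t) i j = reach G t i j ∨ any (λ l → reach G t i l ∧ adj G l j) (allFin n)

componentOrder : {n : ℕ} → Graph n → Fin n → ℕ
componentOrder {n} G v = count (reach G n v)

-- Partial sums of e^{√x} split into even and odd parts:
--   Σ_{k<2K} (√x)^k / k!  =  expEven K x + √x · expOdd K x
expEven : ℕ → ℕ → ℚ
expEven zero x = 0ℚ
expEven (suc K) x = expEven K x + (+ (x ^ K) / ((2 ℕ.* K) !)) {{(2 ℕ.* K) !≢0}}

expOdd : ℕ → ℕ → ℚ
expOdd zero x = 0ℚ
expOdd (suc K) x = expOdd K x + (+ (x ^ K) / ((suc (2 ℕ.* K)) !)) {{(suc (2 ℕ.* K)) !≢0}}

-- m ≤ √n / log n  (natural log), for n ≥ 2.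
-- Equivalent to n^m ≤ e^{√n}, which (equality being impossible) holds iff
-- some partial sum A + √n·B of the exponential series is ≥ n^m, i.e.
-- n^m − A ≤ 0 or (n^m − A)² ≤ n·B²  (B ≥ 0).
AtMostSqrtOverLog : ℕ → ℕ → Set
AtMostSqrtOverLog m n = ∃ λ K →
  let D = ℕ→ℚ (n ^ m) - expEven K n
      B = expOdd K n
  in (D ℚ.≤ 0ℚ) ⊎ (D * D ℚ.≤ ℕ→ℚ n * B * B)

-- H is an F_c(k, w)-tiling (spanning all of its vertices), where the bound
-- "at most w vertices" is given as a predicate on the tile order.
-- Tiles are the classes of part : Fin n → Fin n; H has no edges between tiles,
-- and each tile H[T] (a copy of a graph F) is properly k-colourable, has at most w
-- vertices, and the gcd of the orders of its components is 1.
IsTiling : {n : ℕ} → ℕ → (ℕ → Set) → Graph n → Set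
IsTiling {n} k atMostW H = Σ (Fin n → Fin n) λ part →
  (∀ i j → adj H i j ≡ true → part i ≡ part j) ×
  (∀ v → let T : Fin n → Bool
             T u = ⌊ part u ≟ part v ⌋
         in atMostW (count T)
            × ProperColouringOn k H T
            × foldr gcd 0 (map (λ u → if T u then componentOrder H u else 0) (allFin n)) ≡ 1)

SubgraphOf : {n : ℕ} → Graph n → Graph n → Set
SubgraphOf {n} H G = Σ (Fin n → Fin n) λ f →
  (∀ i j → f i ≡ f j → i ≡ j) × (∀ i j → adj H i j ≡ true → adj G (f i) (f j) ≡ true)

{-# OPTIONS --safe #-}

-- The regularity method is replaced by counting. In a (ρ,d)-dense graph every linear-size set carries
-- cliques that meet any family of weighted sets with positive proportion (iterated averaging), and
-- dependent random choice nests inside it sets B₀ ⊂ … ⊂ B_k in which every Δ-tuple of B_{j+1} has at least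
-- 2√n common neighbours in B_j. Hence a k-colourable block of order O(√n) embeds greedily into any
-- linear-size set, and the images of the neighbourhoods of prescribed vertices of the block can be steered.
--
-- If G has no sparse cut, two-step walks connect every vertex u to every vertex y within boundedly many
-- levels. First a few holes are left, whose candidate sets are linear. Blocks are then embedded one by one
-- with multiplicative weights on the triples (u, y, level), so that in the end each triple is served by many
-- switchable vertices; the rest is filled greedily, and each leftover vertex of H is absorbed by a chain of
-- switches along a walk to a hole.
--
-- In general G is split along sparse cuts into boundedly many pieces without sparse cut, and the
-- components of H must be divided into families of prescribed total order. Let X be the set of popular
-- component orders and q its maximum. The sums of a few elements of ±X form a set of residues mod q that one
-- component of a fresh tile enlarges by |X|, because the orders in a tile have gcd 1; so about q/|X| tiles
-- reach every residue, and copies of q correct the remaining multiple of q. This costs O(w² log n) vertices,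
-- w the largest order of a tile, which is o(n) because n^w ≤ e^√n.
module Submission where

open import Defs renaming (sym to adj-sym)
open import Data.Bool using (Bool; true; false; if_then_else_; _∧_; _∨_; not) renaming (T to True)
open import Data.Bool.ListAction using (any)
open import Data.Bool.Properties using (∧-zeroʳ; ∧-identityʳ; ∨-identityʳ)
open import Data.Empty using (⊥; ⊥-elim)
open import Data.Fin as Fin using (Fin; zero; suc; toℕ; fromℕ<) renaming (_≟_ to _≟F_)
open import Data.Fin.Properties using (toℕ<n; toℕ-injective; toℕ-fromℕ<)
import Data.Fin.Subset.Properties
open import Data.Integer as ℤ using (-[1+_])
import Data.Integer.Properties as ℤₚ
open import Data.List using (List; []; _∷_; allFin; map; length; tabulate; _++_; foldr)
open import Data.List.Properties using (length-tabulate; map-tabulate)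
open import Data.Maybe using (Maybe; just; nothing; fromMaybe) renaming (map to mapMaybe)
open import Data.Maybe.Properties using (just-injective)
open import Data.Nat hiding (_≟_)
open import Data.Nat.DivMod using (_/_; _%_; m%n<n; m<n⇒m%n≡m; %-distribˡ-+; m%n%n≡m%n; [m+kn]%n≡m%n; m≡m%n+[m/n]*n; /-monoˡ-≤)
open import Data.Nat.Divisibility using (_∣_; ∣-trans; _∣0; ∣1⇒≡1)
open import Data.Nat.GCD using (gcd; gcd-GCD; gcd[m,n]∣m; gcd[m,n]∣n; gcd-greatest; module Bézout)
open import Data.Nat.ListAction using (sum)
open import Data.Nat.Properties hiding (_≟_)
open import Data.Nat.Tactic.RingSolver using (solve-∀)
open import Data.Product using (Σ; ∃; _×_; _,_; proj₁; proj₂)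
import Data.Rational as ℚ
open import Data.Rational using (ℚ; 0ℚ; 1ℚ)
import Data.Rational.Properties as ℚₚ
import Data.Rational.Unnormalised as ℚᵘ
import Data.Rational.Unnormalised.Properties as ℚᵘₚ
open import Data.Sum using (_⊎_; inj₁; inj₂)
open import Data.Unit using (⊤; tt)
open import Data.Vec using (Vec; []; _∷_; lookup) renaming (map to mapV; replicate to replicateV)
open import Data.Vec.Properties using (lookup-map)
open import Function using (_∘_; id; case_of_)
open import Level using (0ℓ)
open import Relation.Binary.PropositionalEquality hiding ([_]; J; isPropositional)
open import Relation.Nullary using (¬_; Dec; yes; no)
open import Relation.Nullary.Decidable using (⌊_⌋; _×-dec_; map′)
import Tactic.RingSolver
open import Tactic.RingSolver.Core.AlmostCommutativeRing using (AlmostCommutativeRing; fromCommutativeRing)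

-- Sums, counting, and vertex sets

∑ : ∀ {A : Set} → List A → (A → ℕ) → ℕ
∑ xs f = sum (map f xs)

∑V : ∀ {n} → (Fin n → ℕ) → ℕ
∑V {n} = ∑ (allFin n)

VSet : ℕ → Set
VSet n = Fin n → Bool

infix 4 _∈_ _∉_ _⊆_
infixl 6 _∖_
infixl 7 _∩_
infixl 6 _∪_

_∈_ _∉_ : ∀ {n} → Fin n → VSet n → Set
x ∈ A = A x ≡ true
x ∉ A = A x ≡ false

_⊆_ : ∀ {n} → VSet n → VSet n → Set
A ⊆ B = ∀ x → x ∈ A → x ∈ B

_∩_ _∪_ _∖_ : ∀ {n} → VSet n → VSet n → VSet n
(A ∩ B) x = A x ∧ B x
(A ∪ B) x = A x ∨ B x
(A ∖ B) x = A x ∧ not (B x)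

∅ : ∀ {n} → VSet n
∅ _ = false

⁅_⁆ : ∀ {n} → Fin n → VSet n
⁅ y ⁆ x = ⌊ y ≟F x ⌋

𝟙 : Bool → ℕ
𝟙 b = if b then 1 else 0

∣_∣ : ∀ {n} → VSet n → ℕ
∣ A ∣ = count A

∧-∈ : ∀ {a b} → a ≡ true → b ≡ true → a ∧ b ≡ true
∧-∈ refl refl = refl

∧-∈ˡ : ∀ {a b} → a ∧ b ≡ true → a ≡ true
∧-∈ˡ {true} _ = refl

∧-∈ʳ : ∀ {a b} → a ∧ b ≡ true → b ≡ true
∧-∈ʳ {true} p = p

∨-∈ˡ : ∀ {a b} → a ≡ true → a ∨ b ≡ true
∨-∈ˡ refl = refl

∨-∈ʳ : ∀ {a b} → b ≡ true → a ∨ b ≡ true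
∨-∈ʳ {true} _ = refl
∨-∈ʳ {false} p = p

∨-split : ∀ {a b} → a ∨ b ≡ true → a ≡ true ⊎ b ≡ true
∨-split {true} _ = inj₁ refl
∨-split {false} p = inj₂ p

not-∈ : ∀ {a} → a ≡ false → not a ≡ true
not-∈ refl = refl

not-∉ : ∀ {a} → not a ≡ true → a ≡ false
not-∉ {false} _ = refl

true≢false : ∀ {a} {W : Set} → a ≡ true → a ≡ false → W
true≢false refl ()

Bool-dec : (a : Bool) → a ≡ true ⊎ a ≡ false
Bool-dec true = inj₁ refl
Bool-dec false = inj₂ refl

≢true : ∀ {a} → ¬ (a ≡ true) → a ≡ false
≢true {true} f = ⊥-elim (f refl)
≢true {false} f = refl

⁅⁆-∈ : ∀ {n} (y : Fin n) → y ∈ ⁅ y ⁆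
⁅⁆-∈ y with y ≟F y
... | yes _ = refl
... | no ¬p = ⊥-elim (¬p refl)

∈-⁅⁆ : ∀ {n} {x y : Fin n} → x ∈ ⁅ y ⁆ → y ≡ x
∈-⁅⁆ {x = x} {y} p with y ≟F x
... | yes q = q

∉-⁅⁆ : ∀ {n} {x y : Fin n} → ¬ (y ≡ x) → x ∉ ⁅ y ⁆
∉-⁅⁆ {x = x} {y} p with y ≟F x
... | yes q = ⊥-elim (p q)
... | no _ = refl

𝟙-∧ : ∀ a b → 𝟙 (a ∧ b) ≡ 𝟙 a * 𝟙 b
𝟙-∧ true true = refl
𝟙-∧ true false = refl
𝟙-∧ false b = refl

𝟙≤1 : ∀ a → 𝟙 a ≤ 1
𝟙≤1 true = ≤-refl
𝟙≤1 false = z≤n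

𝟙-mono : ∀ {a b} → (a ≡ true → b ≡ true) → 𝟙 a ≤ 𝟙 b
𝟙-mono {false} f = z≤n
𝟙-mono {true} f rewrite f refl = ≤-refl

𝟙-true : ∀ {a} → a ≡ true → 𝟙 a ≡ 1
𝟙-true refl = refl

𝟙-∨ : ∀ a b → 𝟙 (a ∨ b) ≤ 𝟙 a + 𝟙 b
𝟙-∨ true b = s≤s z≤n
𝟙-∨ false b = ≤-refl

∑-cong : ∀ {A : Set} (xs : List A) {f g : A → ℕ} → (∀ x → f x ≡ g x) → ∑ xs f ≡ ∑ xs g
∑-cong [] e = refl
∑-cong (x ∷ xs) e = cong₂ _+_ (e x) (∑-cong xs e)

∑-mono : ∀ {A : Set} (xs : List A) {f g : A → ℕ} → (∀ x → f x ≤ g x) → ∑ xs f ≤ ∑ xs g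
∑-mono [] e = z≤n
∑-mono (x ∷ xs) e = +-mono-≤ (e x) (∑-mono xs e)

∑-+ : ∀ {A : Set} (xs : List A) (f g : A → ℕ) → ∑ xs (λ x → f x + g x) ≡ ∑ xs f + ∑ xs g
∑-+ [] f g = refl
∑-+ (x ∷ xs) f g rewrite ∑-+ xs f g = lem (f x) (g x) (∑ xs f) (∑ xs g)
  where lem : ∀ a b c d → a + b + (c + d) ≡ a + c + (b + d)
        lem = solve-∀

∑-*ˡ : ∀ {A : Set} (xs : List A) (c : ℕ) (f : A → ℕ) → ∑ xs (λ x → c * f x) ≡ c * ∑ xs f
∑-*ˡ [] c f = sym (*-zeroʳ c)
∑-*ˡ (x ∷ xs) c f rewrite ∑-*ˡ xs c f = sym (*-distribˡ-+ c (f x) _)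

∑-*ʳ : ∀ {A : Set} (xs : List A) (f : A → ℕ) (c : ℕ) → ∑ xs (λ x → f x * c) ≡ ∑ xs f * c
∑-*ʳ [] f c = refl
∑-*ʳ (x ∷ xs) f c rewrite ∑-*ʳ xs f c = sym (*-distribʳ-+ c (f x) _)

∑-const : ∀ {A : Set} (xs : List A) (c : ℕ) → ∑ xs (λ _ → c) ≡ length xs * c
∑-const [] c = refl
∑-const (x ∷ xs) c = cong (c +_) (∑-const xs c)

∑-0 : ∀ {A : Set} (xs : List A) → ∑ xs (λ _ → 0) ≡ 0
∑-0 xs = trans (∑-const xs 0) (*-zeroʳ (length xs))

∑-swap : ∀ {A B : Set} (xs : List A) (ys : List B) (f : A → B → ℕ) →
  ∑ xs (λ x → ∑ ys (f x)) ≡ ∑ ys (λ y → ∑ xs (λ x → f x y))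
∑-swap [] ys f = sym (∑-0 ys)
∑-swap (x ∷ xs) ys f rewrite ∑-swap xs ys f = sym (∑-+ ys (f x) _)

∑-∃ : ∀ {A : Set} (xs : List A) {f g : A → ℕ} → ∑ xs f < ∑ xs g → ∃ λ x → f x < g x
∑-∃ xs {f} {g} p with go xs p
  where
  go : (xs : List _) → ∑ xs f < ∑ xs g → ∃ λ x → f x < g x
  go (x ∷ xs) p with f x <? g x
  ... | yes q = x , q
  ... | no ¬q = go xs (+-cancelˡ-< (f x) _ _ (<-≤-trans p (+-monoˡ-≤ _ (≮⇒≥ ¬q))))
... | r = r

length-allFin : ∀ n → length (allFin n) ≡ n
length-allFin n = length-tabulate {n = n} id

∑V-suc : ∀ {n} (f : Fin (suc n) → ℕ) → ∑V f ≡ f zero + ∑V (f ∘ suc)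
∑V-suc {n} f = cong (f zero +_) (cong sum (trans (map-tabulate suc f) (sym (map-tabulate id (f ∘ suc)))))

∑V-const : ∀ {n} (c : ℕ) → ∑V {n} (λ _ → c) ≡ n * c
∑V-const {n} c = trans (∑-const (allFin n) c) (cong (_* c) (length-allFin n))

∑V-single : ∀ {n} (i : Fin n) (f : Fin n → ℕ) → f i ≤ ∑V f
∑V-single zero f rewrite ∑V-suc f = m≤m+n _ _
∑V-single (suc i) f rewrite ∑V-suc f = ≤-trans (∑V-single i (f ∘ suc)) (m≤n+m _ _)

∑V-δ : ∀ {n} (i : Fin n) (f : Fin n → ℕ) → ∑V (λ j → 𝟙 (⁅ i ⁆ j) * f j) ≡ f i
∑V-δ {suc n} zero f = trans (∑V-suc {n} _) (trans (cong (1 * f zero +_) (trans (∑-cong (allFin n) (λ j → refl)) (∑-0 (allFin n)))) (trans (+-identityʳ _) (+-identityʳ _)))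
∑V-δ {suc n} (suc i) f = trans (∑V-suc {n} (λ j → 𝟙 (⁅ suc i ⁆ j) * f j)) (trans (∑-cong (allFin n) (λ j → cong (λ b → 𝟙 b * f (suc j)) (lem j))) (∑V-δ i (f ∘ suc)))
  where lem : ∀ j → ⁅ suc i ⁆ (suc j) ≡ ⁅ i ⁆ j
        lem j with i ≟F j
        ... | yes _ = refl
        ... | no _ = refl

∣⁅⁆∣ : ∀ {n} (i : Fin n) → ∣ ⁅ i ⁆ ∣ ≡ 1
∣⁅⁆∣ {n} i = trans (∑-cong (allFin n) (λ j → sym (*-identityʳ _))) (∑V-δ i (λ _ → 1))

∣∣-mono : ∀ {n} {A B : VSet n} → A ⊆ B → ∣ A ∣ ≤ ∣ B ∣
∣∣-mono {n} s = ∑-mono (allFin n) (λ x → 𝟙-mono (s x))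

∣∣-cong : ∀ {n} {A B : VSet n} → (∀ x → A x ≡ B x) → ∣ A ∣ ≡ ∣ B ∣
∣∣-cong {n} s = ∑-cong (allFin n) (λ x → cong 𝟙 (s x))

∣∣≤n : ∀ {n} (A : VSet n) → ∣ A ∣ ≤ n
∣∣≤n {n} A = ≤-trans (∑-mono (allFin n) (λ x → 𝟙≤1 (A x))) (≤-reflexive (trans (∑V-const {n} 1) (*-identityʳ n)))

∣∅∣ : ∀ {n} → ∣ ∅ {n} ∣ ≡ 0
∣∅∣ {n} = ∑-0 (allFin n)

∣∪∣≤ : ∀ {n} (A B : VSet n) → ∣ A ∪ B ∣ ≤ ∣ A ∣ + ∣ B ∣
∣∪∣≤ {n} A B = ≤-trans (∑-mono (allFin n) (λ x → 𝟙-∨ (A x) (B x))) (≤-reflexive (∑-+ (allFin n) _ _))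

∣∣-split : ∀ {n} (A B : VSet n) → ∣ A ∣ ≡ ∣ A ∩ B ∣ + ∣ A ∖ B ∣
∣∣-split {n} A B = trans (∑-cong (allFin n) (λ x → lem (A x) (B x))) (∑-+ (allFin n) _ _)
  where lem : ∀ a b → 𝟙 a ≡ 𝟙 (a ∧ b) + 𝟙 (a ∧ not b)
        lem true true = refl
        lem true false = refl
        lem false b = refl

∣∪∣-disjoint : ∀ {n} (A B : VSet n) → (∀ x → x ∈ A → x ∈ B → ⊥) → ∣ A ∪ B ∣ ≡ ∣ A ∣ + ∣ B ∣
∣∪∣-disjoint {n} A B d = trans (∑-cong (allFin n) (λ x → lem (A x) (B x) (d x))) (∑-+ (allFin n) _ _)
  where lem : ∀ a b → (a ≡ true → b ≡ true → ⊥) → 𝟙 (a ∨ b) ≡ 𝟙 a + 𝟙 b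
        lem true true f = ⊥-elim (f refl refl)
        lem true false f = refl
        lem false b f = refl

∣∖∣-⊆ : ∀ {n} {A B : VSet n} → B ⊆ A → ∣ A ∣ ≡ ∣ B ∣ + ∣ A ∖ B ∣
∣∖∣-⊆ {A = A} {B} s = trans (∣∣-split A B) (cong (_+ ∣ A ∖ B ∣) (∣∣-cong lem))
  where lem : ∀ x → A x ∧ B x ≡ B x
        lem x with B x | s x
        ... | true | p = trans (cong (_∧ true) (p refl)) refl
        ... | false | p = ∧-zeroʳ (A x)

∣∣≤∖+ : ∀ {n} (A B : VSet n) → ∣ A ∣ ≤ ∣ A ∖ B ∣ + ∣ B ∣
∣∣≤∖+ A B = ≤-trans (≤-reflexive (trans (∣∣-split A B) (+-comm ∣ A ∩ B ∣ _))) (+-monoʳ-≤ ∣ A ∖ B ∣ (∣∣-mono {A = A ∩ B} {B} (λ x p → ∧-∈ʳ {A x} p)))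

∣∣-∃ : ∀ {n} (A : VSet n) → 0 < ∣ A ∣ → ∃ λ x → x ∈ A
∣∣-∃ {n} A p with ∑-∃ (allFin n) {λ _ → 0} {λ x → 𝟙 (A x)} (subst (_< ∣ A ∣) (sym (∑-0 (allFin n))) p)
... | x , q with A x in e
... | true = x , e

∣∣-∃< : ∀ {n} (A B : VSet n) → ∣ A ∣ < ∣ B ∣ → ∃ λ x → x ∈ B × x ∉ A
∣∣-∃< {n} A B p with ∑-∃ (allFin n) {λ x → 𝟙 (A x)} {λ x → 𝟙 (B x)} p
... | x , q with A x in e | B x in f
... | false | true = x , f , e
... | true | true = ⊥-elim (<-irrefl refl q)

∈⇒∣∣>0 : ∀ {n} (A : VSet n) {x : Fin n} → x ∈ A → 0 < ∣ A ∣
∈⇒∣∣>0 A {x} p = ≤-trans (≤-reflexive (sym (𝟙-true p))) (∑V-single x (λ y → 𝟙 (A y)))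

cancel-cert : ∀ {a b} g g' s → a ≤ b → g + b + s ≡ g' + a → g ≤ g'
cancel-cert {a} {b} g g' s p e = +-cancelʳ-≤ b g g' (≤-trans (m≤m+n (g + b) s) (≤-trans (≤-reflexive e) (+-monoʳ-≤ g' p)))

-- Weighted cliques in dense graphs

∑V-∃≤ : ∀ {n} {f g : Fin n → ℕ} → 0 < n → ∑V f ≤ ∑V g → ∃ λ x → f x ≤ g x
∑V-∃≤ {n} {f} {g} p q with ∑-∃ (allFin n) {f} {λ x → 1 + g x}
  (≤-trans (s≤s q) (≤-trans (+-monoˡ-≤ (∑V g) p) (≤-reflexive (sym
    (trans (∑-+ (allFin n) (λ _ → 1) g) (cong (_+ ∑V g) (trans (∑V-const {n} 1) (*-identityʳ n))))))))
... | x , s≤s r = x , r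

Nb : ∀ {n} → Graph n → Fin n → VSet n → ℕ
Nb G u A = ∣ adj G u ∩ A ∣

E : ∀ {n} → Graph n → VSet n → ℕ
E G U = ∑V (λ u → 𝟙 (U u) * Nb G u U)

Lin : ∀ {n} → Graph n → ℕ → ℕ → Set
Lin {n} G D C = ∀ c → c ≤ C → ∀ U → 4 * c * n * ∣ U ∣ ≤ 2 * (c * c * D) * E G U + 3 * (n * n)

allIn : ∀ {n t} → Vec (Fin n) t → VSet n → Bool
allIn [] A = true
allIn (q ∷ Q) A = A q ∧ allIn Q A

allIn-lookup : ∀ {n t} (Q : Vec (Fin n) t) {A : VSet n} → allIn Q A ≡ true → ∀ i → lookup Q i ∈ A
allIn-lookup (q ∷ Q) p zero = ∧-∈ˡ p
allIn-lookup (q ∷ Q) {A} p (suc i) = allIn-lookup Q (∧-∈ʳ {A q} p) i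

lookup-allIn : ∀ {n t} (Q : Vec (Fin n) t) {A : VSet n} → (∀ i → lookup Q i ∈ A) → allIn Q A ≡ true
lookup-allIn [] p = refl
lookup-allIn (q ∷ Q) p = ∧-∈ (p zero) (lookup-allIn Q (p ∘ suc))

allIn-mono : ∀ {n t} (Q : Vec (Fin n) t) {A B : VSet n} → A ⊆ B → allIn Q A ≡ true → allIn Q B ≡ true
allIn-mono Q s p = lookup-allIn Q (λ i → s _ (allIn-lookup Q p i))

IsClique : ∀ {n t} → Graph n → Vec (Fin n) t → Set
IsClique G [] = ⊤
IsClique G (q ∷ Q) = allIn Q (adj G q) ≡ true × IsClique G Q

clique-adj : ∀ {n t} (G : Graph n) (Q : Vec (Fin n) t) → IsClique G Q → ∀ i j → ¬ (i ≡ j) →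
  adj G (lookup Q i) (lookup Q j) ≡ true
clique-adj G (q ∷ Q) (a , b) zero zero ne = ⊥-elim (ne refl)
clique-adj G (q ∷ Q) (a , b) zero (suc j) ne = allIn-lookup Q a j
clique-adj G (q ∷ Q) (a , b) (suc i) zero ne = trans (adj-sym G _ _) (allIn-lookup Q a i)
clique-adj G (q ∷ Q) (a , b) (suc i) (suc j) ne = clique-adj G Q b i j (λ e → ne (cong suc e))

positive-term : ∀ {A : Set} (xs : List A) (f : A → ℕ) → 0 < ∑ xs f → ∃ λ x → 0 < f x
positive-term xs f p with ∑-∃ xs {λ _ → 0} {f} (subst (_< ∑ xs f) (sym (∑-0 xs)) p)
... | r = r

*-pos : ∀ a b → 0 < a * b → 0 < a × 0 < b
*-pos (suc a) (suc b) p = s≤s z≤n , s≤s z≤n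
*-pos (suc a) zero p = ⊥-elim (<-irrefl refl (<-≤-trans p (≤-reflexive (*-zeroʳ a))))

𝟙-pos : ∀ {a} → 0 < 𝟙 a → a ≡ true
𝟙-pos {true} p = refl

clique-const : ℕ → ℕ → ℕ → ℕ
clique-const D zero c = c
clique-const D (suc t) c = clique-const D t (2 * (c * c * D))

clique-bound : ℕ → ℕ → ℕ → ℕ
clique-bound D zero c = c
clique-bound D (suc t) c = c + clique-bound D t (2 * (c * c * D))

module _ {n : ℕ} (G : Graph n) (D C : ℕ) (lin : Lin G D C) (n>0 : 0 < n) where

  private vs = allFin n

  weighted-neighbour : ∀ {J : Set} (js : List J) (ω : J → ℕ) (S : J → VSet n) (Ω c : ℕ) → c ≤ C →
    ∑ js ω ≤ Ω → n * Ω ≤ c * ∑ js (λ j → ω j * ∣ S j ∣) →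
    ∃ λ q → n * Ω ≤ 2 * (c * c * D) * ∑ js (λ j → ω j * 𝟙 (S j q) * ∣ adj G q ∩ S j ∣)
  weighted-neighbour js ω S Ω c c≤C ωΩ h = ∑V-∃≤ n>0
    (≤-trans (≤-reflexive (trans (∑V-const {n} (n * Ω)) (sym (*-assoc n n Ω)))) (≤-trans main (≤-reflexive swap)))
    where
    e = 2 * (c * c * D)
    W = ∑ js (λ j → ω j * E G (S j))
    X = ∑ js (λ j → ω j * ∣ S j ∣)
    swap : e * W ≡ ∑V (λ q → e * ∑ js (λ j → ω j * 𝟙 (S j q) * ∣ adj G q ∩ S j ∣))
    swap = sym (trans (∑-*ˡ vs e _) (cong (e *_) (trans (∑-swap vs js _)
      (∑-cong js (λ j → trans (∑-cong vs (λ q → *-assoc (ω j) _ _)) (∑-*ˡ vs (ω j) _))))))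
    sum4 : 4 * c * n * X ≤ e * W + 3 * (n * n) * Ω
    sum4 = begin
      4 * c * n * X ≡⟨ ∑-*ˡ js (4 * c * n) _ ⟨
      ∑ js (λ j → 4 * c * n * (ω j * ∣ S j ∣)) ≤⟨ ∑-mono js (λ j → ≤-trans (≤-reflexive (l1 (4 * c * n) (ω j) _))
           (≤-trans (*-monoʳ-≤ (ω j) (lin c c≤C (S j))) (≤-reflexive (l2 (ω j) e (E G (S j)) (3 * (n * n)))))) ⟩
      ∑ js (λ j → e * (ω j * E G (S j)) + 3 * (n * n) * ω j) ≡⟨ ∑-+ js _ _ ⟩
      _ ≡⟨ cong₂ _+_ (∑-*ˡ js e _) (∑-*ˡ js (3 * (n * n)) ω) ⟩
      e * W + 3 * (n * n) * ∑ js ω ≤⟨ +-monoʳ-≤ (e * W) (*-monoʳ-≤ (3 * (n * n)) ωΩ) ⟩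
      e * W + 3 * (n * n) * Ω ∎
      where
      open ≤-Reasoning
      l1 : ∀ a b d → a * (b * d) ≡ b * (a * d)
      l1 = solve-∀
      l2 : ∀ w e x y → w * (e * x + y) ≡ e * (w * x) + y * w
      l2 = solve-∀
    main : n * n * Ω ≤ e * W
    main = cancel-cert (n * n * Ω) (e * W) 0
      (≤-trans (*-monoʳ-≤ (4 * n) h) (≤-trans (≤-reflexive (l4 n c X)) sum4)) (l5 n Ω (e * W))
      where
      l4 : ∀ n c X → 4 * n * (c * X) ≡ 4 * c * n * X
      l4 = solve-∀
      l5 : ∀ n Ω Y → n * n * Ω + (Y + 3 * (n * n) * Ω) + 0 ≡ Y + 4 * n * (n * Ω)
      l5 = solve-∀

  extend-clique : ∀ {J : Set} (js : List J) (ω : J → ℕ) (S : J → VSet n) {Ω t : ℕ} → 0 < Ω → (κ : ℕ) (q : Fin n) (Q : Vec (Fin n) t) →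
    Ω ≤ κ * ∑ js (λ j → ω j * 𝟙 (S j q) * 𝟙 (allIn Q (adj G q ∩ S j))) →
    allIn Q (adj G q) ≡ true × Ω ≤ κ * ∑ js (λ j → ω j * 𝟙 (allIn (q ∷ Q) (S j)))
  extend-clique js ω S Ω>0 κ q Q h = adjq , ≤-trans h (*-monoʳ-≤ κ (∑-mono js pt))
    where
    both : ∀ j → allIn Q (adj G q ∩ S j) ≡ true → allIn Q (adj G q) ≡ true × allIn Q (S j) ≡ true
    both j p = allIn-mono Q {adj G q ∩ S j} {adj G q} (λ x → ∧-∈ˡ) p , allIn-mono Q {adj G q ∩ S j} {S j} (λ x → ∧-∈ʳ {adj G q x}) p
    adjq : allIn Q (adj G q) ≡ true
    adjq with positive-term js (λ j → ω j * 𝟙 (S j q) * 𝟙 (allIn Q (adj G q ∩ S j)))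
                (proj₂ (*-pos κ (∑ js (λ j → ω j * 𝟙 (S j q) * 𝟙 (allIn Q (adj G q ∩ S j)))) (<-≤-trans Ω>0 h)))
    ... | j , pj = proj₁ (both j (𝟙-pos (proj₂ (*-pos (ω j * 𝟙 (S j q)) (𝟙 (allIn Q (adj G q ∩ S j))) pj))))
    pt : ∀ j → ω j * 𝟙 (S j q) * 𝟙 (allIn Q (adj G q ∩ S j)) ≤ ω j * 𝟙 (S j q ∧ allIn Q (S j))
    pt j = ≤-trans (≤-reflexive (*-assoc (ω j) (𝟙 (S j q)) _)) (*-monoʳ-≤ (ω j)
      (≤-trans (*-monoʳ-≤ (𝟙 (S j q)) (𝟙-mono (λ p → proj₂ (both j p)))) (≤-reflexive (sym (𝟙-∧ (S j q) (allIn Q (S j)))))))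

  weighted-clique : ∀ {J : Set} (t : ℕ) (js : List J) (ω : J → ℕ) (S : J → VSet n) (Ω c : ℕ) → clique-bound D t c ≤ C →
    0 < Ω → ∑ js ω ≤ Ω → n * Ω ≤ c * ∑ js (λ j → ω j * ∣ S j ∣) →
    ∃ λ (Q : Vec (Fin n) t) → IsClique G Q × Ω ≤ clique-const D t c * ∑ js (λ j → ω j * 𝟙 (allIn Q (S j)))
  weighted-clique zero js ω S Ω c _ Ω>0 ωΩ h = [] , tt , *-cancelˡ-≤ n ⦃ >-nonZero n>0 ⦄ (begin
      n * Ω ≤⟨ h ⟩
      c * ∑ js (λ j → ω j * ∣ S j ∣) ≤⟨ *-monoʳ-≤ c (∑-mono js (λ j → *-monoʳ-≤ (ω j) (∣∣≤n (S j)))) ⟩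
      c * ∑ js (λ j → ω j * n) ≡⟨ cong (c *_) (∑-*ʳ js ω n) ⟩
      c * (∑ js ω * n) ≡⟨ l1 c (∑ js ω) n ⟩
      n * (c * ∑ js ω) ≡⟨ cong (λ z → n * (c * z)) (∑-cong js (λ j → sym (*-identityʳ (ω j)))) ⟩
      n * (c * ∑ js (λ j → ω j * 1)) ∎)
    where
    open ≤-Reasoning
    l1 : ∀ a b d → a * (b * d) ≡ d * (a * b)
    l1 = solve-∀
  weighted-clique (suc t) js ω S Ω c bd Ω>0 ωΩ h =
    step (weighted-neighbour js ω S Ω c (≤-trans (m≤m+n c (clique-bound D t c′)) bd) ωΩ h)
    where
    c′ = 2 * (c * c * D)
    step : (∃ λ q → n * Ω ≤ c′ * ∑ js (λ j → ω j * 𝟙 (S j q) * ∣ adj G q ∩ S j ∣)) →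
      ∃ λ (Q : Vec (Fin n) (suc t)) → IsClique G Q × Ω ≤ clique-const D t c′ * ∑ js (λ j → ω j * 𝟙 (allIn Q (S j)))
    step (q , hq) =
      let Q , cl , h′ = weighted-clique t js (λ j → ω j * 𝟙 (S j q)) (λ j → adj G q ∩ S j) Ω c′
            (≤-trans (m≤n+m (clique-bound D t c′) c) bd) Ω>0
            (≤-trans (∑-mono js (λ j → ≤-trans (*-monoʳ-≤ (ω j) (𝟙≤1 (S j q))) (≤-reflexive (*-identityʳ (ω j))))) ωΩ) hq
          adjq , Ω≤ = extend-clique js ω S Ω>0 (clique-const D t c′) q Q h′
      in q ∷ Q , (adjq , cl) , Ω≤

-- Dependent random choice

prepend-all : ∀ {n t} → List (Fin n) → List (Vec (Fin n) t) → List (Vec (Fin n) (suc t))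
prepend-all [] Ts = []
prepend-all (v ∷ xs) Ts = map (v ∷_) Ts ++ prepend-all xs Ts

tuples : ∀ n t → List (Vec (Fin n) t)
tuples n zero = [] ∷ []
tuples n (suc t) = prepend-all (allFin n) (tuples n t)

∑-++ : ∀ {A : Set} (xs ys : List A) (f : A → ℕ) → ∑ (xs ++ ys) f ≡ ∑ xs f + ∑ ys f
∑-++ [] ys f = refl
∑-++ (x ∷ xs) ys f rewrite ∑-++ xs ys f = sym (+-assoc (f x) _ _)

∑-map : ∀ {A B : Set} (g : A → B) (xs : List A) (f : B → ℕ) → ∑ (map g xs) f ≡ ∑ xs (f ∘ g)
∑-map g [] f = refl
∑-map g (x ∷ xs) f = cong (f (g x) +_) (∑-map g xs f)

∑-tuples-suc : ∀ {n} t (f : Vec (Fin n) (suc t) → ℕ) →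
  ∑ (tuples n (suc t)) f ≡ ∑V (λ v → ∑ (tuples n t) (λ T → f (v ∷ T)))
∑-tuples-suc {n} t f = go (allFin n)
  where
  go : ∀ xs → ∑ (prepend-all xs (tuples n t)) f ≡ ∑ xs (λ v → ∑ (tuples n t) (λ T → f (v ∷ T)))
  go [] = refl
  go (x ∷ xs) = trans (∑-++ (map (x ∷_) (tuples n t)) _ f) (cong₂ _+_ (∑-map (x ∷_) (tuples n t) f) (go xs))

∑-tuples-const : ∀ n t c → ∑ (tuples n t) (λ _ → c) ≡ n ^ t * c
∑-tuples-const n zero c = refl
∑-tuples-const n (suc t) c = trans (∑-tuples-suc {n} t (λ _ → c)) (trans (∑V-const {n} (∑ (tuples n t) (λ _ → c)))
  (trans (cong (n *_) (∑-tuples-const n t c)) (sym (*-assoc n _ c))))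

∑-tuples-in : ∀ {n} t (A : VSet n) → ∑ (tuples n t) (λ T → 𝟙 (allIn T A)) ≡ ∣ A ∣ ^ t
∑-tuples-in zero A = refl
∑-tuples-in {n} (suc t) A = trans (∑-tuples-suc {n} t (λ T → 𝟙 (allIn T A))) (trans
  (∑-cong (allFin n) (λ v → trans (∑-cong (tuples n t) (λ T → 𝟙-∧ (A v) (allIn T A)))
    (trans (∑-*ˡ (tuples n t) (𝟙 (A v)) _) (cong (𝟙 (A v) *_) (∑-tuples-in t A)))))
  (∑-*ʳ (allFin n) (λ v → 𝟙 (A v)) (∣ A ∣ ^ t)))

∑-tuples-single : ∀ {n} t (T : Vec (Fin n) t) (f : Vec (Fin n) t → ℕ) → f T ≤ ∑ (tuples n t) f
∑-tuples-single zero [] f = m≤m+n _ _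
∑-tuples-single (suc t) (v ∷ T) f = ≤-trans (∑-tuples-single t T (λ T → f (v ∷ T)))
  (≤-trans (∑V-single v (λ v → ∑ (tuples _ t) (λ T → f (v ∷ T)))) (≤-reflexive (sym (∑-tuples-suc t f))))

exchange-≤ : ∀ {p q u v} → p ≤ q → u ≤ v → q * u + p * v ≤ q * v + p * u
exchange-≤ {p} {q} {u} {v} pq uv with m≤n⇒∃[o]m+o≡n pq | m≤n⇒∃[o]m+o≡n uv
... | a , refl | b , refl = ≤-trans (m≤m+n _ (a * b)) (≤-reflexive (l p u a b))
  where l : ∀ p u a b → (p + a) * u + p * (u + b) + a * b ≡ (p + a) * (u + b) + p * u
        l = solve-∀

tangent : ∀ y a t → a * y ^ t + y * a ^ t ≤ y ^ suc t + a ^ suc t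
tangent y a t with ≤-total a y
... | inj₁ p = ≤-trans (≤-reflexive (l a (y ^ t) y (a ^ t)))
      (≤-trans (exchange-≤ {a} {y} {a ^ t} {y ^ t} p (^-monoˡ-≤ t p)) ≤-refl)
  where l : ∀ a b c d → a * b + c * d ≡ c * d + a * b
        l = solve-∀
... | inj₂ p = ≤-trans (exchange-≤ {y} {a} {y ^ t} {a ^ t} p (^-monoˡ-≤ t p)) (≤-reflexive (+-comm (a * a ^ t) _))

0^ : ∀ {t} → 0 < t → 0 ^ t ≡ 0
0^ {suc t} _ = refl

power-mean : ∀ {n} (y : Fin n → ℕ) → n * n ≤ ∑V y → ∀ t → n * n ^ t ≤ ∑V (λ v → y v ^ t)
power-mean {n} y h zero = ≤-reflexive (sym (∑V-const {n} 1))
power-mean {n} y h (suc t) = cancel-cert (n * (n * n ^ t)) (∑V (λ v → y v ^ suc t)) 0 step (l n (n ^ t) (∑V (λ v → y v ^ suc t)))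
  where
  open ≤-Reasoning
  l : ∀ n p Y → n * (n * p) + (Y + n * (n * p)) + 0 ≡ Y + (n * (n * p) + n * n * p)
  l = solve-∀
  step : n * (n * n ^ t) + n * n * n ^ t ≤ ∑V (λ v → y v ^ suc t) + n * n ^ suc t
  step = begin
    n * (n * n ^ t) + n * n * n ^ t ≤⟨ +-mono-≤ (*-monoʳ-≤ n (power-mean y h t)) (*-monoˡ-≤ (n ^ t) h) ⟩
    n * ∑V (λ v → y v ^ t) + ∑V y * n ^ t ≡⟨ cong₂ _+_ (∑-*ˡ (allFin n) n _) (∑-*ʳ (allFin n) y _) ⟨
    ∑V (λ v → n * y v ^ t) + ∑V (λ v → y v * n ^ t) ≡⟨ ∑-+ (allFin n) _ _ ⟨
    ∑V (λ v → n * y v ^ t + y v * n ^ t) ≤⟨ ∑-mono (allFin n) (λ v → tangent (y v) n t) ⟩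
    ∑V (λ v → y v ^ suc t + n ^ suc t) ≡⟨ ∑-+ (allFin n) _ _ ⟩
    ∑V (λ v → y v ^ suc t) + ∑V {n} (λ v → n ^ suc t) ≡⟨ cong (∑V (λ v → y v ^ suc t) +_) (∑V-const {n} (n ^ suc t)) ⟩
    ∑V (λ v → y v ^ suc t) + n * n ^ suc t ∎

common : ∀ {n t} → Graph n → VSet n → Vec (Fin n) t → VSet n
common G B S v = B v ∧ allIn S (adj G v)

*-^ : ∀ a b t → (a * b) ^ t ≡ a ^ t * b ^ t
*-^ a b zero = refl
*-^ a b (suc t) rewrite *-^ a b t = l a b (a ^ t) (b ^ t)
  where l : ∀ a b c d → a * b * (c * d) ≡ a * c * (b * d)
        l = solve-∀

opaque
  drc-const : ℕ → ℕ → ℕ → ℕ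
  drc-const D Δ c = 2 * (2 * (c * c * D)) ^ (suc Δ * 2)

drc-chain-const : ℕ → ℕ → ℕ → ℕ → ℕ
drc-chain-const D Δ zero c = c
drc-chain-const D Δ (suc k) c = drc-chain-const D Δ k (drc-const D Δ c)

drc-chain-bound : ℕ → ℕ → ℕ → ℕ → ℕ
drc-chain-bound D Δ zero c = 0
drc-chain-bound D Δ (suc k) c = c + drc-chain-bound D Δ k (drc-const D Δ c)

drc-chain-threshold : ℕ → ℕ → ℕ → ℕ → ℕ → ℕ
drc-chain-threshold D Δ K zero c = 0
drc-chain-threshold D Δ K (suc k) c = drc-const D Δ c * K ^ suc Δ + drc-chain-threshold D Δ K k (drc-const D Δ c)

drc-numeric : ∀ n Δ K s κ → s * s ≤ K * n → κ * K ^ suc Δ < n → κ * n * (n ^ Δ * s ^ (suc Δ * 2)) < n * n ^ (suc Δ * 2)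
drc-numeric n Δ K s κ sK large = begin-strict
  κ * n * (n ^ Δ * s ^ (r * 2)) ≤⟨ *-monoʳ-≤ (κ * n) (*-monoʳ-≤ (n ^ Δ) sK') ⟩
  κ * n * (n ^ Δ * (K ^ r * n ^ r)) ≡⟨ l1 κ n (n ^ Δ) (K ^ r) (n ^ r) ⟩
  κ * K ^ r * (n * n ^ Δ * n ^ r) ≡⟨ cong (κ * K ^ r *_) nt ⟩
  κ * K ^ r * n ^ (r * 2) <⟨ *-monoˡ-< (n ^ (r * 2)) ⦃ m^n≢0 n (r * 2) ⦃ >-nonZero (≤-<-trans z≤n large) ⦄ ⦄ large ⟩
  n * n ^ (r * 2) ∎
  where
  open ≤-Reasoning
  r = suc Δ
  l1 : ∀ a n b k m → a * n * (b * (k * m)) ≡ a * k * (n * b * m)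
  l1 = solve-∀
  l3 : ∀ r → r + r ≡ r * 2
  l3 = solve-∀
  nt : n ^ r * n ^ r ≡ n ^ (r * 2)
  nt = trans (sym (^-distribˡ-+-* n r r)) (cong (n ^_) (l3 r))
  sK' : s ^ (r * 2) ≤ K ^ r * n ^ r
  sK' = begin
    s ^ (r * 2) ≡⟨ cong (s ^_) (*-comm r 2) ⟩
    s ^ (2 * r) ≡⟨ ^-*-assoc s 2 r ⟨
    (s ^ 2) ^ r ≡⟨ cong (λ z → (s * z) ^ r) (*-identityʳ s) ⟩
    (s * s) ^ r ≤⟨ ^-monoˡ-≤ r sK ⟩
    (K * n) ^ r ≡⟨ *-^ K n r ⟩
    K ^ r * n ^ r ∎

module _ {n : ℕ} (G : Graph n) (D C : ℕ) (lin : Lin G D C) where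

  dense-E : ∀ c B → c ≤ C → n ≤ c * ∣ B ∣ → n * n ≤ 2 * (c * c * D) * E G B
  dense-E c B c≤C h = cancel-cert (n * n) (e * E G B) 0
    (≤-trans (*-monoʳ-≤ (4 * n) h) (≤-trans (≤-reflexive (l1 n c ∣ B ∣)) (lin c c≤C B))) (l2 n (e * E G B))
    where
    e = 2 * (c * c * D)
    l1 : ∀ n c b → 4 * n * (c * b) ≡ 4 * c * n * b
    l1 = solve-∀
    l2 : ∀ n Y → n * n + (Y + 3 * (n * n)) + 0 ≡ Y + 4 * n * n
    l2 = solve-∀

  -- B′ is the common neighbourhood in B of t vertices of B.
  dependent-choice-core : ∀ Δ s e t B → 0 < Δ → 0 < t → n * n ≤ e * E G B → 2 * e ^ t * n * (n ^ Δ * s ^ t) < n * n ^ t →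
    ∃ λ B′ → B′ ⊆ B × n ≤ 2 * e ^ t * ∣ B′ ∣ ×
      (∀ (S : Vec (Fin n) Δ) → allIn S B′ ≡ true → s ≤ ∣ common G B S ∣)
  dependent-choice-core Δ s e t B Δ>0 t>0 hE large = pick (∑-∃ Ts {f} {g} total)
    where
    open ≤-Reasoning
    Ts = tuples n t
    Ss = tuples n Δ
    vs = allFin n
    cm : Vec (Fin n) t → VSet n
    cm T b = B b ∧ allIn T (adj G b ∩ B)
    badS : Vec (Fin n) Δ → Bool
    badS S = ∣ common G B S ∣ <ᵇ s
    bad : Vec (Fin n) t → ℕ
    bad T = ∑ Ss (λ S → 𝟙 (badS S) * 𝟙 (allIn S (cm T)))
    f g : Vec (Fin n) t → ℕ
    f T = n + 2 * e ^ t * n * bad T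
    g T = 2 * e ^ t * ∣ cm T ∣
    sumF : n * n ^ t ≤ e ^ t * ∑ Ts (λ T → ∣ cm T ∣)
    sumF = begin
      n * n ^ t ≤⟨ power-mean y (≤-trans hE (≤-reflexive (sym (∑-*ˡ vs e _)))) t ⟩
      ∑V (λ v → y v ^ t) ≡⟨ ∑-cong vs (λ v → *-^ e (x v) t) ⟩
      ∑V (λ v → e ^ t * x v ^ t) ≡⟨ ∑-*ˡ vs (e ^ t) _ ⟩
      e ^ t * ∑V (λ v → x v ^ t) ≡⟨ cong (e ^ t *_) (∑-cong vs pt) ⟩
      e ^ t * ∑V (λ v → ∑ Ts (λ T → 𝟙 (cm T v))) ≡⟨ cong (e ^ t *_) (∑-swap vs Ts _) ⟩
      e ^ t * ∑ Ts (λ T → ∣ cm T ∣) ∎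
      where
      x y : Fin n → ℕ
      x b = 𝟙 (B b) * Nb G b B
      y b = e * x b
      pt : ∀ v → x v ^ t ≡ ∑ Ts (λ T → 𝟙 (cm T v))
      pt v with B v
      ... | true = trans (cong (_^ t) (+-identityʳ (Nb G v B))) (sym (∑-tuples-in t (adj G v ∩ B)))
      ... | false = trans (0^ t>0) (sym (∑-0 Ts))
    sumBad : ∑ Ts bad ≤ n ^ Δ * s ^ t
    sumBad = begin
      ∑ Ts bad ≡⟨ ∑-swap Ts Ss _ ⟩
      ∑ Ss (λ S → ∑ Ts (λ T → 𝟙 (badS S) * 𝟙 (allIn S (cm T)))) ≤⟨ ∑-mono Ss pt ⟩
      ∑ Ss (λ S → s ^ t) ≡⟨ ∑-tuples-const n Δ (s ^ t) ⟩
      n ^ Δ * s ^ t ∎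
      where
      flip : ∀ S T → allIn S (cm T) ≡ true → allIn T (common G B S) ≡ true
      flip S T p = lookup-allIn T (λ j → ∧-∈ (fromT j)
          (lookup-allIn S (λ i → trans (adj-sym G _ _) (∧-∈ˡ {adj G (lookup S i) (lookup T j)} (bit i j)))))
        where
        bit : ∀ i j → adj G (lookup S i) (lookup T j) ∧ B (lookup T j) ≡ true
        bit i j = allIn-lookup T {adj G (lookup S i) ∩ B} (∧-∈ʳ {B (lookup S i)} (allIn-lookup S {cm T} p i)) j
        fromT : ∀ j → B (lookup T j) ≡ true
        fromT j = ∧-∈ʳ {adj G (lookup S (fromℕ< Δ>0)) (lookup T j)} (bit (fromℕ< Δ>0) j)
      pt : ∀ S → ∑ Ts (λ T → 𝟙 (badS S) * 𝟙 (allIn S (cm T))) ≤ s ^ t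
      pt S with ∣ common G B S ∣ <ᵇ s in eq
      ... | false = ≤-trans (≤-reflexive (∑-0 Ts)) z≤n
      ... | true = begin
        ∑ Ts (λ T → 1 * 𝟙 (allIn S (cm T))) ≡⟨ ∑-*ˡ Ts 1 _ ⟩
        1 * ∑ Ts (λ T → 𝟙 (allIn S (cm T))) ≡⟨ +-identityʳ _ ⟩
        ∑ Ts (λ T → 𝟙 (allIn S (cm T))) ≤⟨ ∑-mono Ts (λ T → 𝟙-mono (flip S T)) ⟩
        ∑ Ts (λ T → 𝟙 (allIn T (common G B S))) ≡⟨ ∑-tuples-in t (common G B S) ⟩
        ∣ common G B S ∣ ^ t ≤⟨ ^-monoˡ-≤ t (<⇒≤ (<ᵇ⇒< _ s (subst True (sym eq) tt))) ⟩
        s ^ t ∎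
    total : ∑ Ts f < ∑ Ts g
    total = begin-strict
      ∑ Ts f ≡⟨ trans (∑-+ Ts _ _) (cong₂ _+_ (∑-tuples-const n t n) (∑-*ˡ Ts (2 * e ^ t * n) bad)) ⟩
      n ^ t * n + 2 * e ^ t * n * ∑ Ts bad ≤⟨ +-monoʳ-≤ (n ^ t * n) (*-monoʳ-≤ (2 * e ^ t * n) sumBad) ⟩
      n ^ t * n + 2 * e ^ t * n * (n ^ Δ * s ^ t) <⟨ +-monoʳ-< (n ^ t * n) large ⟩
      n ^ t * n + n * n ^ t ≡⟨ l2 n (n ^ t) ⟩
      2 * (n * n ^ t) ≤⟨ *-monoʳ-≤ 2 sumF ⟩
      2 * (e ^ t * ∑ Ts (λ T → ∣ cm T ∣)) ≡⟨ trans (sym (*-assoc 2 (e ^ t) _)) (sym (∑-*ˡ Ts (2 * e ^ t) _)) ⟩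
      ∑ Ts g ∎
      where
      l2 : ∀ n p → p * n + n * p ≡ 2 * (n * p)
      l2 = solve-∀
    pick : (∃ λ T → f T < g T) → ∃ λ B′ → B′ ⊆ B × n ≤ 2 * e ^ t * ∣ B′ ∣ ×
      (∀ (S : Vec (Fin n) Δ) → allIn S B′ ≡ true → s ≤ ∣ common G B S ∣)
    pick (T₀ , lt) = cm T₀ , (λ x → ∧-∈ˡ) , <⇒≤ (≤-<-trans (m≤m+n n _) lt) , good
      where
      bad0 : bad T₀ < 1
      bad0 = *-cancelˡ-< (2 * e ^ t * n) (bad T₀) 1 (begin-strict
        2 * e ^ t * n * bad T₀ ≤⟨ m≤n+m _ n ⟩
        f T₀ <⟨ lt ⟩
        2 * e ^ t * ∣ cm T₀ ∣ ≤⟨ *-monoʳ-≤ (2 * e ^ t) (∣∣≤n (cm T₀)) ⟩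
        2 * e ^ t * n ≡⟨ *-identityʳ _ ⟨
        2 * e ^ t * n * 1 ∎)
      good : ∀ S → allIn S (cm T₀) ≡ true → s ≤ ∣ common G B S ∣
      good S p with s ≤? ∣ common G B S ∣
      ... | yes q = q
      ... | no ¬q = ⊥-elim (<-irrefl refl (<-≤-trans bad0 (≤-trans
          (≤-reflexive (sym (cong₂ _*_ (𝟙-true {badS S} (Tb (<⇒<ᵇ (≰⇒> ¬q)))) (𝟙-true p))))
          (∑-tuples-single Δ S (λ S → 𝟙 (badS S) * 𝟙 (allIn S (cm T₀)))))))
        where Tb : ∀ {b} → True b → b ≡ true
              Tb {true} _ = refl

  opaque
    unfolding drc-const

    dependent-choice : ∀ Δ K s c B → 0 < Δ → c ≤ C → n ≤ c * ∣ B ∣ → s * s ≤ K * n → drc-const D Δ c * K ^ suc Δ < n →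
      ∃ λ B′ → B′ ⊆ B × n ≤ drc-const D Δ c * ∣ B′ ∣ ×
        (∀ (S : Vec (Fin n) Δ) → allIn S B′ ≡ true → s ≤ ∣ common G B S ∣)
    dependent-choice Δ K s c B Δ>0 c≤C hB sK large =
      dependent-choice-core Δ s (2 * (c * c * D)) (suc Δ * 2) B Δ>0 (s≤s z≤n) (dense-E c B c≤C hB)
        (drc-numeric n Δ K s (2 * (2 * (c * c * D)) ^ (suc Δ * 2)) sK large)

  record Chain (Δ k s c : ℕ) (A : VSet n) : Set where
    field
      level : ℕ → VSet n
      top : level 0 ⊆ A
      decreasing : ∀ j → j < k → level (suc j) ⊆ level j
      large : n ≤ c * ∣ level k ∣
      rich : ∀ j → j < k → (S : Vec (Fin n) Δ) → allIn S (level (suc j)) ≡ true → s ≤ ∣ common G (level j) S ∣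

  chain : ∀ Δ K s k c A → 0 < Δ → drc-chain-bound D Δ k c ≤ C → n ≤ c * ∣ A ∣ → s * s ≤ K * n →
    drc-chain-threshold D Δ K k c < n → Chain Δ k s (drc-chain-const D Δ k c) A
  chain Δ K s zero c A Δ>0 bd hA sK th = record
    { level = λ _ → A ; top = λ _ p → p ; decreasing = λ _ () ; large = hA ; rich = λ _ () }
  chain Δ K s (suc k) c A Δ>0 bd hA sK th = extend
    (dependent-choice Δ K s c A Δ>0 (≤-trans (m≤m+n c _) bd) hA sK (≤-<-trans (m≤m+n (κ * K ^ suc Δ) _) th))
    where
    κ = drc-const D Δ c
    extend : (∃ λ B → B ⊆ A × n ≤ κ * ∣ B ∣ × (∀ (S : Vec (Fin n) Δ) → allIn S B ≡ true → s ≤ ∣ common G A S ∣)) →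
      Chain Δ (suc k) s (drc-chain-const D Δ k κ) A
    extend (B , B⊆A , hB , rich) = record
      { level = L
      ; top = λ _ p → p
      ; decreasing = dec
      ; large = Chain.large ch
      ; rich = rch
      }
      where
      ch : Chain Δ k s (drc-chain-const D Δ k κ) B
      ch = chain Δ K s k κ B Δ>0 (≤-trans (m≤n+m _ c) bd) hB sK
             (≤-<-trans (m≤n+m (drc-chain-threshold D Δ K k κ) (κ * K ^ suc Δ)) th)
      L : ℕ → VSet n
      L zero = A
      L (suc j) = Chain.level ch j
      dec : ∀ j → j < suc k → L (suc j) ⊆ L j
      dec zero _ x p = B⊆A x (Chain.top ch x p)
      dec (suc j) (s≤s q) = Chain.decreasing ch j q
      rch : ∀ j → j < suc k → (S : Vec (Fin n) Δ) → allIn S (L (suc j)) ≡ true → s ≤ ∣ common G (L j) S ∣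
      rch zero _ S p = rich S (allIn-mono S (Chain.top ch) p)
      rch (suc j) (s≤s q) = Chain.rich ch j q

-- Partial embeddings

T⇒≡ : ∀ {b} → True b → b ≡ true
T⇒≡ {true} _ = refl

≡⇒T : ∀ {b} → b ≡ true → True b
≡⇒T refl = tt

∃ᵇ : ∀ {n} → VSet n → Bool
∃ᵇ A = 0 <ᵇ ∣ A ∣

∃ᵇ-intro : ∀ {n} {A : VSet n} x → x ∈ A → ∃ᵇ A ≡ true
∃ᵇ-intro {A = A} x p = T⇒≡ (<⇒<ᵇ (∈⇒∣∣>0 A p))

∃ᵇ-elim : ∀ {n} {A : VSet n} → ∃ᵇ A ≡ true → ∃ λ x → x ∈ A
∃ᵇ-elim {A = A} p = ∣∣-∃ A (<ᵇ⇒< 0 _ (≡⇒T p))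

∀ᵇ : ∀ {n} → VSet n → Bool
∀ᵇ A = not (∃ᵇ (λ x → not (A x)))

∀ᵇ-intro : ∀ {n} {A : VSet n} → (∀ x → x ∈ A) → ∀ᵇ A ≡ true
∀ᵇ-intro {A = A} f = not-∈ (≢true (λ p → let (x , q) = ∃ᵇ-elim {A = λ x → not (A x)} p in true≢false (f x) (not-∉ q)))

∀ᵇ-elim : ∀ {n} {A : VSet n} → ∀ᵇ A ≡ true → ∀ x → x ∈ A
∀ᵇ-elim {A = A} p x with A x in e
... | true = refl
... | false = true≢false (∃ᵇ-intro {A = λ x → not (A x)} x (not-∈ e)) (not-∉ p)

∈-∖ : ∀ {n} {A B : VSet n} {x} → x ∈ A → x ∉ B → x ∈ A ∖ B
∈-∖ p q = ∧-∈ p (not-∈ q)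

∖-∉ : ∀ {n} {A B : VSet n} {x} → x ∈ A ∖ B → x ∉ B
∖-∉ {A = A} {B} {x} p = not-∉ (∧-∈ʳ {A x} p)

∉-∖ : ∀ {n} {A B : VSet n} {x} → x ∈ A → x ∉ A ∖ B → x ∈ B
∉-∖ {A = A} {B} {x} p q with A x | B x
∉-∖ refl q | true | true = refl
∉-∖ refl () | true | false

im : ∀ {n} → VSet n → (Fin n → Fin n) → VSet n
im dom φ v = ∃ᵇ (λ x → dom x ∧ ⁅ φ x ⁆ v)

im-intro : ∀ {n} {dom : VSet n} (φ : Fin n → Fin n) x → x ∈ dom → φ x ∈ im dom φ
im-intro {dom = dom} φ x p = ∃ᵇ-intro {A = λ y → dom y ∧ ⁅ φ y ⁆ (φ x)} x (∧-∈ p (⁅⁆-∈ (φ x)))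

im-elim : ∀ {n} {dom : VSet n} (φ : Fin n → Fin n) v → v ∈ im dom φ → ∃ λ x → x ∈ dom × φ x ≡ v
im-elim {dom = dom} φ v p with ∃ᵇ-elim {A = λ y → dom y ∧ ⁅ φ y ⁆ v} p
... | x , q = x , ∧-∈ˡ q , ∈-⁅⁆ (∧-∈ʳ {dom x} q)

𝟙-∃ᵇ : ∀ {n} (A : VSet n) → 𝟙 (∃ᵇ A) ≤ ∣ A ∣
𝟙-∃ᵇ A with ∣ A ∣
... | zero = z≤n
... | suc m = s≤s z≤n

∣im∣≤ : ∀ {n} (dom : VSet n) (φ : Fin n → Fin n) → ∣ im dom φ ∣ ≤ ∣ dom ∣
∣im∣≤ {n} dom φ = begin
  ∑V (λ v → 𝟙 (im dom φ v)) ≤⟨ ∑-mono vs (λ v → 𝟙-∃ᵇ (λ x → dom x ∧ ⁅ φ x ⁆ v)) ⟩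
  ∑V (λ v → ∑V (λ x → 𝟙 (dom x ∧ ⁅ φ x ⁆ v))) ≡⟨ ∑-swap vs vs _ ⟩
  ∑V (λ x → ∑V (λ v → 𝟙 (dom x ∧ ⁅ φ x ⁆ v))) ≡⟨ ∑-cong vs (λ x → trans (∑-cong vs (λ v → 𝟙-∧ (dom x) _)) (trans (∑-*ˡ vs (𝟙 (dom x)) _) (trans (cong (𝟙 (dom x) *_) (∣⁅⁆∣ (φ x))) (*-identityʳ _)))) ⟩
  ∑V (λ x → 𝟙 (dom x)) ∎
  where open ≤-Reasoning
        vs = allFin n

-- D₀ ⊆ D only up to pointwise equality, hence the two inclusions with the target.
grow : ∀ {n} (T : VSet n) (Inv : VSet n → Set) → Inv ∅ →
  (∀ D x → D ⊆ T → x ∈ T → x ∉ D → Inv D → Inv (D ∪ ⁅ x ⁆)) →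
  ∃ λ D → D ⊆ T × T ⊆ D × Inv D
grow {n} T Inv i₀ step = go ∣ T ∣ ∅ (λ _ ()) (∣∣-mono {A = T ∖ ∅} {T} (λ x p → ∧-∈ˡ p)) i₀
  where
  go : ∀ fuel D → D ⊆ T → ∣ T ∖ D ∣ ≤ fuel → Inv D → ∃ λ D → D ⊆ T × T ⊆ D × Inv D
  go fuel D D⊆T f iv with Bool-dec (∃ᵇ (T ∖ D))
  ... | inj₂ e = D , D⊆T , (λ x p → ∉-∖ {A = T} {D} p (≢true (λ q → true≢false (∃ᵇ-intro {A = T ∖ D} x q) e))) , iv
  ... | inj₁ e with ∃ᵇ-elim {A = T ∖ D} e
  go zero D D⊆T f iv | inj₁ e | x , q = ⊥-elim (<-irrefl refl (<-≤-trans (∈⇒∣∣>0 (T ∖ D) q) f))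
  go (suc fuel) D D⊆T f iv | inj₁ e | x , q = go fuel (D ∪ ⁅ x ⁆) sub smaller
      (step D x D⊆T (∧-∈ˡ q) (∖-∉ {A = T} {D} q) iv)
    where
    sub : (D ∪ ⁅ x ⁆) ⊆ T
    sub y p with ∨-split {D y} p
    ... | inj₁ r = D⊆T y r
    ... | inj₂ r = subst (_∈ T) (∈-⁅⁆ r) (∧-∈ˡ q)
    smaller : ∣ T ∖ (D ∪ ⁅ x ⁆) ∣ ≤ fuel
    smaller = s≤s⁻¹ (≤-trans (≤-trans (s≤s (∣∣-mono {A = T ∖ (D ∪ ⁅ x ⁆)} {(T ∖ D) ∖ ⁅ x ⁆} le))
        (≤-reflexive (sym (trans (∣∖∣-⊆ {A = T ∖ D} {⁅ x ⁆} (λ y p → subst (_∈ T ∖ D) (∈-⁅⁆ p) q)) (cong (_+ ∣ (T ∖ D) ∖ ⁅ x ⁆ ∣) (∣⁅⁆∣ x)))))) f)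
      where
      le : (T ∖ (D ∪ ⁅ x ⁆)) ⊆ ((T ∖ D) ∖ ⁅ x ⁆)
      le y p with T y | D y | ⁅ x ⁆ y
      le y refl | true | false | false = refl

find : ∀ {n t} → 0 < t → Vec (Fin n) t → Fin n → Fin t
find {t = suc zero} _ S x = zero
find {t = suc (suc t)} _ (v ∷ S) x = if ⁅ v ⁆ x then zero else suc (find (s≤s z≤n) S x)

find-correct : ∀ {n t} (p : 0 < t) (S : Vec (Fin n) t) x → (∃ λ i → lookup S i ≡ x) → lookup S (find p S x) ≡ x
find-correct {t = suc zero} _ (v ∷ S) x (zero , e) = e
find-correct {t = suc (suc t)} _ (v ∷ S) x (i , e) with v ≟F x
... | yes q = q
find-correct {t = suc (suc t)} _ (v ∷ S) x (zero , e) | no q = ⊥-elim (q e)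
find-correct {t = suc (suc t)} _ (v ∷ S) x (suc i , e) | no q = find-correct (s≤s z≤n) S x (i , e)

∣∖⁅⁆∣ : ∀ {n} {A : VSet n} {x} → x ∈ A → ∣ A ∣ ≡ suc ∣ A ∖ ⁅ x ⁆ ∣
∣∖⁅⁆∣ {A = A} {x} p = trans (∣∖∣-⊆ {A = A} {⁅ x ⁆} (λ y q → subst (_∈ A) (∈-⁅⁆ q) p)) (cong (_+ ∣ A ∖ ⁅ x ⁆ ∣) (∣⁅⁆∣ x))

enumerate : ∀ {n} t (A : VSet n) (d : Fin n) → ∣ A ∣ ≤ t →
  ∃ λ (S : Vec (Fin n) t) → ∀ x → x ∈ A → ∃ λ i → lookup S i ≡ x
enumerate zero A d h = [] , λ x p → ⊥-elim (<-irrefl refl (<-≤-trans (∈⇒∣∣>0 A p) h))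
enumerate (suc t) A d h with Bool-dec (∃ᵇ A)
... | inj₂ e = replicateV (suc t) d , λ x p → true≢false (∃ᵇ-intro {A = A} x p) e
enumerate (suc t) A d h | inj₁ e with ∃ᵇ-elim {A = A} e
... | x , p with enumerate t (A ∖ ⁅ x ⁆) d (s≤s⁻¹ (≤-trans (≤-reflexive (sym (∣∖⁅⁆∣ {A = A} p))) h))
... | S , a = x ∷ S , cover
  where
  cover : ∀ y → y ∈ A → ∃ λ i → lookup (x ∷ S) i ≡ y
  cover y q with x ≟F y
  ... | yes r = zero , r
  ... | no r with a y (∈-∖ {A = A} {⁅ x ⁆} q (∉-⁅⁆ r))
  ... | i , e = suc i , e

record Emb {n} (G H : Graph n) (P dom : VSet n) (φ : Fin n → Fin n) : Set where
  field
    inP : ∀ x → x ∈ dom → φ x ∈ P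
    inj : ∀ x y → x ∈ dom → y ∈ dom → φ x ≡ φ y → x ≡ y
    hom : ∀ x y → x ∈ dom → y ∈ dom → adj H x y ≡ true → adj G (φ x) (φ y) ≡ true
open Emb public

module _ {n : ℕ} (G H : Graph n) where

  Emb-∅ : ∀ {P} φ → Emb G H P ∅ φ
  Emb-∅ φ = record { inP = λ _ () ; inj = λ _ _ () ; hom = λ _ _ () }

  Emb-mono : ∀ {P P′ dom dom′ φ} → P ⊆ P′ → dom′ ⊆ dom → Emb G H P dom φ → Emb G H P′ dom′ φ
  Emb-mono a b e = record
    { inP = λ x p → a _ (inP e x (b x p)) ; inj = λ x y p q → inj e x y (b x p) (b y q) ; hom = λ x y p q → hom e x y (b x p) (b y q) }

  override : VSet n → (Fin n → Fin n) → (Fin n → Fin n) → Fin n → Fin n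
  override B β φ x = if B x then β x else φ x

  override-∈ : ∀ {B} β φ {x} → x ∈ B → override B β φ x ≡ β x
  override-∈ β φ p rewrite p = refl

  override-∉ : ∀ {B} β φ {x} → x ∉ B → override B β φ x ≡ φ x
  override-∉ β φ p rewrite p = refl

  merge : ∀ {P A B φ β} → Emb G H P A φ → Emb G H P B β →
    (∀ x y → x ∈ A → x ∉ B → y ∈ B → φ x ≡ β y → ⊥) →
    (∀ x y → x ∈ A → x ∉ B → y ∈ B → adj H x y ≡ true → adj G (φ x) (β y) ≡ true) →
    Emb G H P (A ∪ B) (override B β φ)
  merge {P} {A} {B} {φ} {β} ea eb sep cross = record { inP = ip ; inj = ij ; hom = hm }
    where
    inA : ∀ {a} → a ∨ false ≡ true → a ≡ true
    inA {true} p = refl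
    ip : ∀ x → x ∈ A ∪ B → override B β φ x ∈ P
    ip x p with B x in e
    ... | true = inP eb x e
    ... | false = inP ea x (inA p)
    ij : ∀ x y → x ∈ A ∪ B → y ∈ A ∪ B → override B β φ x ≡ override B β φ y → x ≡ y
    ij x y p q with B x in e | B y in f
    ... | true | true = inj eb x y e f
    ... | true | false = λ r → ⊥-elim (sep y x (inA q) f e (sym r))
    ... | false | true = λ r → ⊥-elim (sep x y (inA p) e f r)
    ... | false | false = inj ea x y (inA p) (inA q)
    hm : ∀ x y → x ∈ A ∪ B → y ∈ A ∪ B → adj H x y ≡ true → adj G (override B β φ x) (override B β φ y) ≡ true
    hm x y p q r with B x in e | B y in f
    ... | true | true = hom eb x y e f r
    ... | true | false = trans (adj-sym G _ _) (cross y x (inA q) f e (trans (adj-sym H y x) r))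
    ... | false | true = cross x y (inA p) e f r
    ... | false | false = hom ea x y (inA p) (inA q) r

  Emb-single : ∀ {P} y v → v ∈ P → Emb G H P ⁅ y ⁆ (λ _ → v)
  Emb-single y v p = record
    { inP = λ _ _ → p ; inj = λ x x′ q q′ _ → trans (sym (∈-⁅⁆ q)) (∈-⁅⁆ q′)
    ; hom = λ x x′ q q′ r → true≢false (subst₂ (λ a b → adj H a b ≡ true) (sym (∈-⁅⁆ q)) (sym (∈-⁅⁆ q′)) r) (irrefl H y) }

  place : ∀ {P dom φ} y v → Emb G H P dom φ → v ∈ P → v ∉ im dom φ →
    (∀ z → z ∈ dom → adj H y z ≡ true → adj G v (φ z) ≡ true) → Emb G H P (dom ∪ ⁅ y ⁆) (override ⁅ y ⁆ (λ _ → v) φ)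
  place {P} {dom} {φ} y v e vP vim cross = merge e (Emb-single y v vP)
    (λ x y′ p _ q r → true≢false (subst (_∈ im dom φ) r (im-intro φ x p)) vim)
    (λ x y′ p _ q r → trans (adj-sym G _ _) (cross x p (trans (adj-sym H y x) (subst (λ z → adj H x z ≡ true) (sym (∈-⁅⁆ q)) r))))

-- Embedding one block

opaque
  level-const : (D Δ k c : ℕ) → ℕ
  level-const D Δ k c = 2 * drc-chain-const D Δ k c

  gain-const : (D Δ k c W : ℕ) → ℕ
  gain-const D Δ k c W = clique-const D Δ (level-const D Δ k c * W)

-- The requirements on the density range C and on n under which blocks of order at most s embed
-- into sets of size at least n / c.
record BlockOK (n D C Δ k s c W : ℕ) : Set where
  field
    K : ℕ
    s² : s * s ≤ K * n
    chain-bound : drc-chain-bound D Δ k c ≤ C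
    threshold : drc-chain-threshold D Δ K k c < n
    small : level-const D Δ k c * s ≤ n
    gain-bound : clique-bound D Δ (level-const D Δ k c * W) ≤ C

module Blocks {n : ℕ} (G H : Graph n) (D C : ℕ) (lin : Lin G D C) (n>0 : 0 < n)
  (Δ : ℕ) (Δ>0 : 0 < Δ) (maxdeg : ∀ v → ∣ adj H v ∣ ≤ Δ)
  (k : ℕ) (col : Fin n → Fin k) (proper : ∀ x y → adj H x y ≡ true → ¬ (col x ≡ col y)) where

  private vs = allFin n

  nbs : VSet n → VSet n
  nbs X z = ∃ᵇ (λ x → X x ∧ adj H x z)

  nbs-intro : ∀ {X} x z → x ∈ X → adj H x z ≡ true → z ∈ nbs X
  nbs-intro {X} x z p q = ∃ᵇ-intro {A = λ y → X y ∧ adj H y z} x (∧-∈ p q)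

  nbs-elim : ∀ {X} z → z ∈ nbs X → ∃ λ x → x ∈ X × adj H x z ≡ true
  nbs-elim {X} z p with ∃ᵇ-elim {A = λ y → X y ∧ adj H y z} p
  ... | x , q = x , ∧-∈ˡ q , ∧-∈ʳ {X x} q

  -- Distinct members are at distance at least 4 in H.
  record Separated (X : VSet n) : Set where
    field
      far₁ : ∀ x y → x ∈ X → y ∈ X → ¬ (x ≡ y) → adj H x y ≡ false
      far₂ : ∀ x y z → x ∈ X → y ∈ X → ¬ (x ≡ y) → adj H x z ≡ true → adj H y z ≡ false
      far₃ : ∀ x y z z′ → x ∈ X → y ∈ X → ¬ (x ≡ y) → adj H x z ≡ true → adj H y z′ ≡ true → adj H z z′ ≡ false

  nbIn : Fin n → (Fin n → Fin n) → VSet n → Bool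
  nbIn x ψ S = ∀ᵇ (λ z → not (adj H x z) ∨ S (ψ z))

  nbIn-intro : ∀ {x ψ S} → (∀ z → adj H x z ≡ true → ψ z ∈ S) → nbIn x ψ S ≡ true
  nbIn-intro {x} {ψ} {S} f = ∀ᵇ-intro {A = λ z → not (adj H x z) ∨ S (ψ z)} pt
    where
    pt : ∀ z → not (adj H x z) ∨ S (ψ z) ≡ true
    pt z with adj H x z in e
    ... | true = f z e
    ... | false = refl

  nbIn-elim : ∀ {x ψ S} → nbIn x ψ S ≡ true → ∀ z → adj H x z ≡ true → ψ z ∈ S
  nbIn-elim {x} {ψ} {S} p z q with ∀ᵇ-elim {A = λ z → not (adj H x z) ∨ S (ψ z)} p z
  ... | r rewrite q = r

  module Block (A : VSet n) (s c : ℕ) (ch : Chain G D C lin Δ k s c A)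
    (c′ : ℕ) (J X : VSet n) (J≤s : ∣ J ∣ ≤ s) (X⊆J : X ⊆ J) (closed : ∀ x z → x ∈ X → adj H x z ≡ true → z ∈ J)
    (sepX : Separated X) {I : Set} (js : List I) (ω : I → ℕ) (S : I → VSet n) (Ω w : ℕ)
    (Ω>0 : 0 < Ω) (ωΩ : ∑ js ω ≤ Ω) (rich-A : ∀ a → a ∈ A → Ω ≤ w * ∑ js (λ j → ω j * 𝟙 (S j a)))
    (small : ∀ b → n ≤ c * (b + s) → n ≤ c′ * b) (bound : clique-bound D Δ (c′ * w) ≤ C) where

    open Chain ch
    open Separated sepX

    Gain : Fin n → (Fin n → Fin n) → Set
    Gain x ψ = Ω ≤ clique-const D Δ (c′ * w) * ∑ js (λ j → ω j * 𝟙 (nbIn x ψ (S j)))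

    Gain-mono : ∀ {x ψ ψ′} → (∀ z → adj H x z ≡ true → ψ′ z ≡ ψ z) → Gain x ψ → Gain x ψ′
    Gain-mono {x} {ψ} {ψ′} e g = ≤-trans g (*-monoʳ-≤ (clique-const D Δ (c′ * w)) (∑-mono js (λ j → *-monoʳ-≤ (ω j)
      (𝟙-mono (λ p → nbIn-intro {x} {ψ′} {S j} (λ z q → trans (cong (S j) (e z q)) (nbIn-elim {x} {ψ} {S j} p z q)))))))

    level-⊆ : ∀ i j → i ≤ j → j ≤ k → level j ⊆ level i
    level-⊆ i j i≤j j≤k with m≤n⇒∃[o]m+o≡n i≤j
    ... | o , refl = go o j≤k
      where
      go : ∀ o → i + o ≤ k → level (i + o) ⊆ level i
      go zero _ x p = subst (λ z → x ∈ level z) (+-identityʳ i) p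
      go (suc o) le x p = go o (<⇒≤ le′) x (decreasing (i + o) le′ x (subst (λ z → x ∈ level z) (+-suc i o) p))
        where le′ : i + o < k
              le′ = subst (_≤ k) (+-suc i o) le

    CliqueState : VSet n → Set
    CliqueState Y = ∃ λ ψ → Emb G H (level k) (nbs Y) ψ × (∀ x → x ∈ Y → Gain x ψ)

    nbs-⊆J : ∀ {Y} → Y ⊆ X → nbs Y ⊆ J
    nbs-⊆J {Y} Y⊆X z p with nbs-elim {Y} z p
    ... | x , q , r = closed x z (Y⊆X x q) r

    clique-step : ∀ Y x → Y ⊆ X → x ∈ X → x ∉ Y → CliqueState Y → CliqueState (Y ∪ ⁅ x ⁆)
    clique-step Y x Y⊆X x∈X x∉Y (ψ , e , g) =
      pick (weighted-clique G D C lin n>0 Δ js ω (λ j → S j ∩ B) Ω (c′ * w) bound Ω>0 ωΩ weight)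
        (enumerate Δ (adj H x) x (maxdeg x))
      where
      open ≤-Reasoning
      used = im (nbs Y) ψ
      B = level k ∖ used
      B-large : n ≤ c′ * ∣ B ∣
      B-large = small ∣ B ∣ (≤-trans large (*-monoʳ-≤ c (≤-trans (∣∣≤∖+ (level k) used)
             (+-monoʳ-≤ ∣ B ∣ (≤-trans (∣im∣≤ (nbs Y) ψ) (≤-trans (∣∣-mono {A = nbs Y} {J} (nbs-⊆J Y⊆X)) J≤s))))))
      weight : n * Ω ≤ c′ * w * ∑ js (λ j → ω j * ∣ S j ∩ B ∣)
      weight = begin
        n * Ω ≤⟨ *-monoˡ-≤ Ω B-large ⟩
        c′ * ∣ B ∣ * Ω ≡⟨ *-assoc c′ ∣ B ∣ Ω ⟩
        c′ * (∣ B ∣ * Ω) ≡⟨ cong (c′ *_) (∑-*ʳ vs (λ a → 𝟙 (B a)) Ω) ⟨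
        c′ * ∑V (λ a → 𝟙 (B a) * Ω) ≤⟨ *-monoʳ-≤ c′ (∑-mono vs pt) ⟩
        c′ * ∑V (λ a → w * ∑ js (λ j → ω j * 𝟙 (S j a ∧ B a))) ≡⟨ cong (c′ *_) (trans (∑-*ˡ vs w _) (cong (w *_)
             (trans (∑-swap vs js _) (∑-cong js (λ j → ∑-*ˡ vs (ω j) _))))) ⟩
        c′ * (w * ∑ js (λ j → ω j * ∣ S j ∩ B ∣)) ≡⟨ *-assoc c′ w _ ⟨
        c′ * w * ∑ js (λ j → ω j * ∣ S j ∩ B ∣) ∎
        where
        pt : ∀ a → 𝟙 (B a) * Ω ≤ w * ∑ js (λ j → ω j * 𝟙 (S j a ∧ B a))
        pt a with B a in eq
        ... | false = z≤n
        ... | true = ≤-trans (≤-reflexive (+-identityʳ Ω)) (≤-trans (rich-A a (top a (level-⊆ 0 k z≤n ≤-refl a (∧-∈ˡ eq))))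
              (≤-reflexive (cong (w *_) (∑-cong js (λ j → cong (λ b → ω j * 𝟙 b) (sym (∧-identityʳ (S j a))))))))
      pick : (∃ λ (Q : Vec (Fin n) Δ) → IsClique G Q × Ω ≤ clique-const D Δ (c′ * w) * ∑ js (λ j → ω j * 𝟙 (allIn Q (S j ∩ B)))) →
        (∃ λ (Z : Vec (Fin n) Δ) → ∀ z → z ∈ adj H x → ∃ λ i → lookup Z i ≡ z) →
        CliqueState (Y ∪ ⁅ x ⁆)
      pick (Q , isC , gain) (Z , covers) = ψ′ , e′ , g′
        where
        Q⊆B : ∀ i → lookup Q i ∈ B
        Q⊆B i with positive-term js (λ j → ω j * 𝟙 (allIn Q (S j ∩ B))) (proj₂ (*-pos (clique-const D Δ (c′ * w)) _ (<-≤-trans Ω>0 gain)))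
        ... | j , pj = ∧-∈ʳ {S j (lookup Q i)} (allIn-lookup Q {S j ∩ B} (𝟙-pos (proj₂ (*-pos (ω j) _ pj))) i)
        idx : Fin n → Fin Δ
        idx = find Δ>0 Z
        idx-ok : ∀ z → adj H x z ≡ true → lookup Z (idx z) ≡ z
        idx-ok z p = find-correct Δ>0 Z z (covers z p)
        idx-inj : ∀ z z′ → adj H x z ≡ true → adj H x z′ ≡ true → idx z ≡ idx z′ → z ≡ z′
        idx-inj z z′ p p′ q = trans (sym (idx-ok z p)) (trans (cong (lookup Z) q) (idx-ok z′ p′))
        β : Fin n → Fin n
        β z = lookup Q (idx z)
        eβ : Emb G H (level k) (adj H x) β
        eβ = record
          { inP = λ z p → ∧-∈ˡ (Q⊆B (idx z))
          ; inj = λ z z′ p p′ q → idx-inj z z′ p p′ (same z z′ q)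
          ; hom = λ z z′ p p′ r → clique-adj G Q isC (idx z) (idx z′) (λ q →
              true≢false (subst (λ y → adj H z y ≡ true) (sym (idx-inj z z′ p p′ q)) r) (irrefl H z)) }
          where
          same : ∀ z z′ → β z ≡ β z′ → idx z ≡ idx z′
          same z z′ q with idx z ≟F idx z′
          ... | yes r = r
          ... | no ne = true≢false (clique-adj G Q isC (idx z) (idx z′) ne) (subst (λ y → adj G (β z) y ≡ false) q (irrefl G (β z)))
        ne-x : ∀ {x′} → x′ ∈ Y → ¬ (x′ ≡ x)
        ne-x p refl = true≢false p x∉Y
        ψ′ = override G H (adj H x) β ψ
        em : Emb G H (level k) (nbs Y ∪ adj H x) ψ′
        em = merge G H e eβ
          (λ a y p _ q r → true≢false (subst (_∈ used) r (im-intro ψ a p)) (∖-∉ {A = level k} {used} (Q⊆B (idx y))))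
          (λ a y p _ q r → let (x′ , p′ , q′) = nbs-elim {Y} a p in
            true≢false r (far₃ x′ x a y (Y⊆X x′ p′) x∈X (ne-x p′) q′ q))
        e′ : Emb G H (level k) (nbs (Y ∪ ⁅ x ⁆)) ψ′
        e′ = Emb-mono G H (λ _ p → p) sub em
          where
          sub : nbs (Y ∪ ⁅ x ⁆) ⊆ (nbs Y ∪ adj H x)
          sub z p with nbs-elim {Y ∪ ⁅ x ⁆} z p
          ... | y , q , r with ∨-split {Y y} q
          ... | inj₁ q′ = ∨-∈ˡ (nbs-intro {Y} y z q′ r)
          ... | inj₂ q′ = ∨-∈ʳ {nbs Y z} (subst (λ t → adj H t z ≡ true) (sym (∈-⁅⁆ q′)) r)
        gx : Gain x ψ′
        gx = ≤-trans gain (*-monoʳ-≤ (clique-const D Δ (c′ * w)) (∑-mono js (λ j → *-monoʳ-≤ (ω j)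
          (𝟙-mono (λ p → nbIn-intro {x} {ψ′} {S j} (λ z q → trans (cong (S j) (override-∈ G H {adj H x} β ψ q))
            (∧-∈ˡ (allIn-lookup Q {S j ∩ B} p (idx z)))))))))
        g′ : ∀ y → y ∈ Y ∪ ⁅ x ⁆ → Gain y ψ′
        g′ y p with ∨-split {Y y} p
        ... | inj₂ q = subst (λ t → Gain t ψ′) (∈-⁅⁆ q) gx
        ... | inj₁ q = Gain-mono {y} {ψ} {ψ′} (λ z r → override-∉ G H {adj H x} β ψ (far₂ y x z (Y⊆X y q) x∈X (ne-x q) r)) (g y q)

    cliques : CliqueState X
    cliques = finish (grow X CliqueState ((λ x → x) , Emb-mono G H (λ _ p → p) none (Emb-∅ G H (λ x → x)) , λ _ ()) clique-step)
      where
      none : nbs ∅ ⊆ ∅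
      none z p with nbs-elim {∅} z p
      ... | _ , () , _
      finish : (∃ λ Y → Y ⊆ X × X ⊆ Y × CliqueState Y) → CliqueState X
      finish (Y , Y⊆X , X⊆Y , ψ , e , g) = ψ , Emb-mono G H (λ _ p → p) sub e , λ x p → g x (X⊆Y x p)
        where
        sub : nbs X ⊆ nbs Y
        sub z p with nbs-elim {X} z p
        ... | x , q , r = nbs-intro {Y} x z (X⊆Y x q) r

    lev : Fin n → ℕ
    lev z = if nbs X z then k else toℕ (col z)

    lev≤k : ∀ z → lev z ≤ k
    lev≤k z with nbs X z
    ... | true = ≤-refl
    ... | false = <⇒≤ (toℕ<n (col z))

    lev-nbs : ∀ {z} → z ∈ nbs X → lev z ≡ k
    lev-nbs p rewrite p = refl

    lev-other : ∀ {z} → z ∉ nbs X → lev z ≡ toℕ (col z)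
    lev-other p rewrite p = refl

    rest : VSet n
    rest = (J ∖ X) ∖ nbs X

    State : VSet n → Set
    State dom = ∃ λ ψ → Emb G H A dom ψ × (∀ z → z ∈ dom → ψ z ∈ level (lev z)) × (∀ x → x ∈ X → Gain x ψ)

    L-⊆A : ∀ j → j ≤ k → level j ⊆ A
    L-⊆A j j≤k x p = top x (level-⊆ 0 j z≤n j≤k x p)

    colour-step : ∀ dom y → y ∈ rest → dom ⊆ J → y ∉ dom → (∀ z → z ∈ dom → adj H y z ≡ true → lev y < lev z) →
      State dom → State (dom ∪ ⁅ y ⁆)
    colour-step dom y yr dom⊆J y∉dom later (ψ , e , lv , g) =
      pick-d (∣∣-∃ (level k) (proj₂ (*-pos c _ (<-≤-trans n>0 large))))
        (enumerate Δ (dom ∩ adj H y) y (≤-trans (∣∣-mono {A = dom ∩ adj H y} {adj H y} (λ x → ∧-∈ʳ {dom x})) (maxdeg y)))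
      where
      y∉N : y ∉ nbs X
      y∉N = ∖-∉ {A = J ∖ X} {nbs X} yr
      ly : lev y < k
      ly = subst (_< k) (sym (lev-other y∉N)) (toℕ<n (col y))
      dom<s : ∣ dom ∣ < s
      dom<s = <-≤-trans (≤-trans (s≤s (∣∣-mono {A = dom} {J ∖ ⁅ y ⁆} (λ z p → ∈-∖ {A = J} {⁅ y ⁆} (dom⊆J z p)
          (∉-⁅⁆ (λ q → true≢false (subst (_∈ dom) (sym q) p) y∉dom)))))
          (≤-reflexive (sym (∣∖⁅⁆∣ {A = J} (∧-∈ˡ (∧-∈ˡ yr)))))) J≤s
      finish : ∀ v → v ∈ level (lev y) → v ∉ im dom ψ → (∀ z → z ∈ dom → adj H y z ≡ true → adj G v (ψ z) ≡ true) → State (dom ∪ ⁅ y ⁆)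
      finish v v∈L v∉im nbrs = override G H ⁅ y ⁆ (λ _ → v) ψ , place G H y v e (L-⊆A (lev y) (lev≤k y) v v∈L) v∉im nbrs , lv′ , g′
        where
        lv′ : ∀ z → z ∈ dom ∪ ⁅ y ⁆ → override G H ⁅ y ⁆ (λ _ → v) ψ z ∈ level (lev z)
        lv′ z p with Bool-dec (⁅ y ⁆ z)
        ... | inj₁ q = subst₂ (λ a b → a ∈ level (lev b)) (sym (override-∈ G H {⁅ y ⁆} (λ _ → v) ψ q)) (∈-⁅⁆ q) v∈L
        ... | inj₂ q with ∨-split {dom z} p
        ...   | inj₁ r = subst (_∈ level (lev z)) (sym (override-∉ G H {⁅ y ⁆} (λ _ → v) ψ q)) (lv z r)
        ...   | inj₂ r = true≢false r q
        g′ : ∀ x → x ∈ X → Gain x (override G H ⁅ y ⁆ (λ _ → v) ψ)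
        g′ x p = Gain-mono {x} {ψ} (λ z q → override-∉ G H {⁅ y ⁆} (λ _ → v) ψ (∉-⁅⁆ (λ r →
          true≢false (nbs-intro {X} x y p (subst (λ t → adj H x t ≡ true) (sym r) q)) y∉N))) (g x p)
      pick-d : (∃ λ d → d ∈ level k) → (∃ λ (Z : Vec (Fin n) Δ) → ∀ x → x ∈ dom ∩ adj H y → ∃ λ i → lookup Z i ≡ x) → State (dom ∪ ⁅ y ⁆)
      pick-d (d , d∈) (Z , covers) = pick-v (∣∣-∃< (im dom ψ) (common G (level (lev y)) Sv)
          (≤-<-trans (∣im∣≤ dom ψ) (<-≤-trans dom<s (rich (lev y) ly Sv S-in))))
        where
        val : Fin n → Fin n
        val z = if dom z ∧ adj H y z then ψ z else d
        Sv : Vec (Fin n) Δ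
        Sv = mapV val Z
        val-in : ∀ z → val z ∈ level (suc (lev y))
        val-in z with dom z in e₁ | adj H y z in e₂
        ... | true | true = level-⊆ (suc (lev y)) (lev z) (later z e₁ e₂) (lev≤k z) _ (lv z e₁)
        ... | true | false = level-⊆ (suc (lev y)) k ly ≤-refl _ d∈
        ... | false | _ = level-⊆ (suc (lev y)) k ly ≤-refl _ d∈
        S-in : allIn Sv (level (suc (lev y))) ≡ true
        S-in = lookup-allIn Sv (λ i → subst (_∈ level (suc (lev y))) (sym (lookup-map i val Z)) (val-in (lookup Z i)))
        pick-v : (∃ λ v → v ∈ common G (level (lev y)) Sv × v ∉ im dom ψ) → State (dom ∪ ⁅ y ⁆)
        pick-v (v , v∈ , v∉im) = finish v (∧-∈ˡ v∈) v∉im nbrs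
          where
          nbrs : ∀ z → z ∈ dom → adj H y z ≡ true → adj G v (ψ z) ≡ true
          nbrs z p q with covers z (∧-∈ p q)
          ... | i , r = trans (cong (adj G v) (sym eq)) (allIn-lookup Sv {adj G v} (∧-∈ʳ {level (lev y) v} v∈) i)
            where
            eq : lookup Sv i ≡ ψ z
            eq = trans (lookup-map i val Z) (trans (cong val r) (cong (λ b → if b then ψ z else d) (∧-∈ p q)))

    Reached : ℕ → Set
    Reached m = ∃ λ dom → State dom × dom ⊆ (J ∖ X) × nbs X ⊆ dom × (∀ z → z ∈ dom → m ≤ lev z) ×
      (∀ y → y ∈ rest → m ≤ lev y → y ∈ dom)

    N∩X : ∀ z → z ∈ nbs X → z ∉ X
    N∩X z p with nbs-elim {X} z p | Bool-dec (X z)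
    ... | _ | inj₂ q = q
    ... | x , a , b | inj₁ q with x ≟F z
    ... | yes refl = true≢false b (irrefl H x)
    ... | no ne = true≢false b (far₁ x z a q ne)

    start : Reached k
    start = from-cliques cliques
      where
      from-cliques : CliqueState X → Reached k
      from-cliques (ψ , e , g) = nbs X , (ψ , Emb-mono G H (L-⊆A k ≤-refl) (λ _ p → p) e
          , (λ z p → subst (λ t → ψ z ∈ level t) (sym (lev-nbs p)) (inP e z p)) , g)
        , (λ z p → ∈-∖ {A = J} {X} (nbs-⊆J (λ _ q → q) z p) (N∩X z p))
        , (λ _ p → p) , (λ z p → ≤-reflexive (sym (lev-nbs p)))
        , (λ y p le → ⊥-elim (<-irrefl refl (≤-<-trans le (subst (_< k) (sym (lev-other (∖-∉ {A = J ∖ X} {nbs X} p))) (toℕ<n (col y))))))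

    descend : ∀ m → m < k → Reached (suc m) → Reached m
    descend m m<k (dom , st , dJ , nd , lo , all) = finish (grow U Inv start-Inv step)
      where
      U : VSet n
      U y = rest y ∧ (toℕ (col y) ≡ᵇ m)
      Inv : VSet n → Set
      Inv Y = State (dom ∪ Y)
      restrict : ∀ {A B : VSet n} → B ⊆ A → State A → State B
      restrict sub (ψ , e , lv , g) = ψ , Emb-mono G H (λ _ p → p) sub e , (λ z p → lv z (sub z p)) , g
      start-Inv : Inv ∅
      start-Inv = restrict sub st
        where sub : (dom ∪ ∅) ⊆ dom
              sub z p with ∨-split {dom z} p
              ... | inj₁ q = q
      col-U : ∀ y → y ∈ U → toℕ (col y) ≡ m
      col-U y p = ≡ᵇ⇒≡ (toℕ (col y)) m (≡⇒T (∧-∈ʳ {rest y} p))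
      lev-U : ∀ y → y ∈ U → lev y ≡ m
      lev-U y p = trans (lev-other (∖-∉ {A = J ∖ X} {nbs X} (∧-∈ˡ p))) (col-U y p)
      step : ∀ Y y → Y ⊆ U → y ∈ U → y ∉ Y → Inv Y → Inv (Y ∪ ⁅ y ⁆)
      step Y y Y⊆U yU y∉Y st = restrict sub′ (colour-step (dom ∪ Y) y (∧-∈ˡ yU) sub ny later st)
        where
        sub : (dom ∪ Y) ⊆ J
        sub z p with ∨-split {dom z} p
        ... | inj₁ q = ∧-∈ˡ (dJ z q)
        ... | inj₂ q = ∧-∈ˡ (∧-∈ˡ (∧-∈ˡ {rest z} (Y⊆U z q)))
        ny : y ∉ dom ∪ Y
        ny = ≢true (λ p → case ∨-split {dom y} p of λ
          { (inj₁ q) → <-irrefl refl (≤-trans (lo y q) (≤-reflexive (lev-U y yU))) ; (inj₂ q) → true≢false q y∉Y })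
        later : ∀ z → z ∈ dom ∪ Y → adj H y z ≡ true → lev y < lev z
        later z p q with ∨-split {dom z} p
        ... | inj₁ r = subst (_< lev z) (sym (lev-U y yU)) (lo z r)
        ... | inj₂ r = ⊥-elim (proper y z q (toℕ-injective (trans (col-U y yU) (sym (col-U z (Y⊆U z r))))))
        sub′ : (dom ∪ (Y ∪ ⁅ y ⁆)) ⊆ ((dom ∪ Y) ∪ ⁅ y ⁆)
        sub′ z p with dom z | Y z
        ... | true | _ = refl
        ... | false | true = refl
        ... | false | false = p
      finish : (∃ λ Y → Y ⊆ U × U ⊆ Y × Inv Y) → Reached m
      finish (Y , Y⊆U , U⊆Y , st′) = dom ∪ Y , st′ , sub , (λ z p → ∨-∈ˡ (nd z p)) , lo′ , all′
        where
        sub : (dom ∪ Y) ⊆ (J ∖ X)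
        sub z p with ∨-split {dom z} p
        ... | inj₁ q = dJ z q
        ... | inj₂ q = ∧-∈ˡ (∧-∈ˡ {rest z} (Y⊆U z q))
        lo′ : ∀ z → z ∈ dom ∪ Y → m ≤ lev z
        lo′ z p with ∨-split {dom z} p
        ... | inj₁ q = <⇒≤ (lo z q)
        ... | inj₂ q = ≤-reflexive (sym (lev-U z (Y⊆U z q)))
        all′ : ∀ y → y ∈ rest → m ≤ lev y → y ∈ dom ∪ Y
        all′ y p le with m≤n⇒m<n∨m≡n le
        ... | inj₁ lt = ∨-∈ˡ (all y p lt)
        ... | inj₂ eq = ∨-∈ʳ {dom y} (U⊆Y y (∧-∈ p (T⇒≡ (≡⇒≡ᵇ (toℕ (col y)) m (trans (sym (lev-other (∖-∉ {A = J ∖ X} {nbs X} p))) (sym eq))))))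

    reach-all : ∀ m → m ≤ k → Reached (k ∸ m)
    reach-all zero _ = start
    reach-all (suc m) lt = descend (k ∸ suc m) (∸-monoʳ-< {k} (s≤s z≤n) lt) (subst Reached (+-∸-assoc 1 lt) (reach-all m (<⇒≤ lt)))

    block-embed : ∃ λ ψ → Emb G H A (J ∖ X) ψ × (∀ x → x ∈ X → Gain x ψ)
    block-embed with subst Reached (n∸n≡0 k) (reach-all k ≤-refl)
    ... | dom , (ψ , e , _ , g) , _ , nd , _ , all = ψ , Emb-mono G H (λ _ p → p) sub e , g
      where
      sub : (J ∖ X) ⊆ dom
      sub z p with Bool-dec (nbs X z)
      ... | inj₁ q = nd z q
      ... | inj₂ q = all z (∈-∖ {A = J ∖ X} {nbs X} p q) z≤n

  opaque
    unfolding level-const gain-const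

    embed-block : ∀ {s c W} → BlockOK n D C Δ k s c W → (A : VSet n) → n ≤ c * ∣ A ∣ →
      (J X : VSet n) → ∣ J ∣ ≤ s → X ⊆ J → (∀ x z → x ∈ X → adj H x z ≡ true → z ∈ J) → Separated X →
      {I : Set} (js : List I) (ω : I → ℕ) (S : I → VSet n) (Ω : ℕ) → 0 < Ω → ∑ js ω ≤ Ω →
      (∀ a → a ∈ A → Ω ≤ W * ∑ js (λ j → ω j * 𝟙 (S j a))) →
      ∃ λ ψ → Emb G H A (J ∖ X) ψ ×
        (∀ x → x ∈ X → Ω ≤ gain-const D Δ k c W * ∑ js (λ j → ω j * 𝟙 (nbIn x ψ (S j))))
    embed-block {s} {c} {W} ok A hA J X J≤s X⊆J cl sep js ω S Ω Ω>0 ωΩ rich =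
      Block.block-embed A s cₖ (chain G D C lin Δ K s k c A Δ>0 chain-bound hA s² threshold) (2 * cₖ) J X J≤s X⊆J cl sep
        js ω S Ω W Ω>0 ωΩ rich halve gain-bound
      where
      open BlockOK ok
      cₖ : ℕ
      cₖ = drc-chain-const D Δ k c
      halve : ∀ b → n ≤ cₖ * (b + s) → n ≤ 2 * cₖ * b
      halve b h = half cₖ b s n h small
        where
        half : ∀ a b s n → n ≤ a * (b + s) → 2 * a * s ≤ n → n ≤ 2 * a * b
        half a b s n h h′ = cancel-cert n (2 * a * b) 0 (≤-trans (*-monoʳ-≤ 2 h) (≤-trans (≤-reflexive (l1 a b s)) (+-monoʳ-≤ (2 * a * b) h′))) (l2 n (2 * a * b))
          where
          l1 : ∀ c b s → 2 * (c * (b + s)) ≡ 2 * c * b + 2 * c * s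
          l1 = solve-∀
          l2 : ∀ n b → n + (b + n) + 0 ≡ b + 2 * n
          l2 = solve-∀

-- Separated vertices and blocks of components

module Sparse {n : ℕ} (H : Graph n) (Δ : ℕ) (maxdeg : ∀ v → ∣ adj H v ∣ ≤ Δ) where

  private vs = allFin n

  nhd : VSet n → VSet n
  nhd A z = A z ∨ ∃ᵇ (λ x → A x ∧ adj H x z)

  ∣nhd∣≤ : ∀ A → ∣ nhd A ∣ ≤ suc Δ * ∣ A ∣
  ∣nhd∣≤ A = begin
    ∣ nhd A ∣ ≤⟨ ∣∪∣≤ A (λ z → ∃ᵇ (λ x → A x ∧ adj H x z)) ⟩
    ∣ A ∣ + ∑V (λ z → 𝟙 (∃ᵇ (λ x → A x ∧ adj H x z))) ≤⟨ +-monoʳ-≤ ∣ A ∣ (∑-mono vs (λ z → 𝟙-∃ᵇ (λ x → A x ∧ adj H x z))) ⟩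
    ∣ A ∣ + ∑V (λ z → ∑V (λ x → 𝟙 (A x ∧ adj H x z))) ≡⟨ cong (∣ A ∣ +_) (∑-swap vs vs _) ⟩
    ∣ A ∣ + ∑V (λ x → ∑V (λ z → 𝟙 (A x ∧ adj H x z))) ≤⟨ +-monoʳ-≤ ∣ A ∣ (∑-mono vs pt) ⟩
    ∣ A ∣ + ∑V (λ x → Δ * 𝟙 (A x)) ≡⟨ cong (∣ A ∣ +_) (∑-*ˡ vs Δ (λ x → 𝟙 (A x))) ⟩
    suc Δ * ∣ A ∣ ∎
    where
    open ≤-Reasoning
    pt : ∀ x → ∑V (λ z → 𝟙 (A x ∧ adj H x z)) ≤ Δ * 𝟙 (A x)
    pt x with A x
    ... | true = ≤-trans (maxdeg x) (≤-reflexive (sym (*-identityʳ Δ)))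
    ... | false = ≤-trans (≤-reflexive (∑-0 vs)) z≤n

  nhd-self : ∀ {A x} → x ∈ A → x ∈ nhd A
  nhd-self p = ∨-∈ˡ p

  nhd-adj : ∀ {A} x z → x ∈ A → adj H x z ≡ true → z ∈ nhd A
  nhd-adj {A} x z p q = ∨-∈ʳ {A z} (∃ᵇ-intro {A = λ y → A y ∧ adj H y z} x (∧-∈ p q))

  ball : Fin n → VSet n
  ball x = nhd (nhd (nhd ⁅ x ⁆))

  ball-size : ℕ
  ball-size = suc Δ * (suc Δ * suc Δ)

  ∣ball∣≤ : ∀ x → ∣ ball x ∣ ≤ ball-size
  ∣ball∣≤ x = ≤-trans (∣nhd∣≤ (nhd (nhd ⁅ x ⁆))) (*-monoʳ-≤ (suc Δ) (≤-trans (∣nhd∣≤ (nhd ⁅ x ⁆)) (*-monoʳ-≤ (suc Δ)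
    (≤-trans (∣nhd∣≤ ⁅ x ⁆) (≤-reflexive (trans (cong (suc Δ *_) (∣⁅⁆∣ x)) (*-identityʳ (suc Δ))))))))

  record Apart (x y : Fin n) : Set where
    field
      apart₁ : adj H x y ≡ false
      apart₂ : ∀ z → adj H x z ≡ true → adj H y z ≡ false
      apart₃ : ∀ z z′ → adj H x z ≡ true → adj H y z′ ≡ true → adj H z z′ ≡ false
  open Apart

  Apart-sym : ∀ {x y} → Apart x y → Apart y x
  Apart-sym {x} {y} a = record
    { apart₁ = trans (adj-sym H y x) (apart₁ a)
    ; apart₂ = λ z p → ≢true (λ q → true≢false p (apart₂ a z q))
    ; apart₃ = λ z z′ p q → trans (adj-sym H z z′) (apart₃ a z′ z q p) }

  ∉ball⇒Apart : ∀ x y → y ∉ ball x → Apart x y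
  ∉ball⇒Apart x y ny = record
    { apart₁ = ≢true (λ p → true≢false (nhd-self (nhd-self (nhd-adj x y (⁅⁆-∈ x) p))) ny)
    ; apart₂ = λ z p → ≢true (λ q → true≢false (nhd-self (nhd-adj z y (nhd-adj x z (⁅⁆-∈ x) p) (flip q))) ny)
    ; apart₃ = λ z z′ p q → ≢true (λ r → true≢false (nhd-adj z′ y (nhd-adj z z′ (nhd-adj x z (⁅⁆-∈ x) p) r) (flip q)) ny) }
    where
    flip : ∀ {a b} → adj H a b ≡ true → adj H b a ≡ true
    flip {a} {b} p = trans (adj-sym H b a) p

  apart-set : ∀ p J → p * ball-size ≤ ∣ J ∣ →
    ∃ λ X → X ⊆ J × ∣ X ∣ ≡ p × (∀ x y → x ∈ X → y ∈ X → ¬ (x ≡ y) → Apart x y)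
  apart-set zero J h = ∅ , (λ _ ()) , ∣∅∣ {n} , (λ _ _ ())
  apart-set (suc p) J h = pick (∣∣-∃ J (≤-trans (s≤s z≤n) h))
    where
    pick : (∃ λ x → x ∈ J) → _
    pick (x , x∈J) = finish (apart-set p (J ∖ ball x) (+-cancelˡ-≤ ball-size _ _ (≤-trans h
        (≤-trans (∣∣≤∖+ J (ball x)) (≤-trans (+-monoʳ-≤ ∣ J ∖ ball x ∣ (∣ball∣≤ x)) (≤-reflexive (+-comm ∣ J ∖ ball x ∣ ball-size)))))))
      where
      finish : (∃ λ X → X ⊆ (J ∖ ball x) × ∣ X ∣ ≡ p × (∀ x y → x ∈ X → y ∈ X → ¬ (x ≡ y) → Apart x y)) →
        ∃ λ X → X ⊆ J × ∣ X ∣ ≡ suc p × (∀ x y → x ∈ X → y ∈ X → ¬ (x ≡ y) → Apart x y)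
      finish (X , X⊆ , ∣X∣ , ap) = X ∪ ⁅ x ⁆ , sub , trans (∣∪∣-disjoint X ⁅ x ⁆ disj) (trans (cong₂ _+_ ∣X∣ (∣⁅⁆∣ x)) (+-comm p 1)) , ap′
        where
        sub : (X ∪ ⁅ x ⁆) ⊆ J
        sub y q with ∨-split {X y} q
        ... | inj₁ r = ∧-∈ˡ (X⊆ y r)
        ... | inj₂ r = subst (_∈ J) (∈-⁅⁆ r) x∈J
        off : ∀ y → y ∈ X → Apart x y
        off y q = ∉ball⇒Apart x y (∖-∉ {A = J} {ball x} (X⊆ y q))
        disj : ∀ y → y ∈ X → y ∈ ⁅ x ⁆ → ⊥
        disj y q r = true≢false (nhd-self (nhd-self (nhd-self r))) (∖-∉ {A = J} {ball x} (X⊆ y q))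
        ap′ : ∀ y z → y ∈ X ∪ ⁅ x ⁆ → z ∈ X ∪ ⁅ x ⁆ → ¬ (y ≡ z) → Apart y z
        ap′ y z q r ne with ∨-split {X y} q | ∨-split {X z} r
        ... | inj₁ a | inj₁ b = ap y z a b ne
        ... | inj₁ a | inj₂ b = subst (Apart y) (∈-⁅⁆ b) (Apart-sym (off y a))
        ... | inj₂ a | inj₁ b = subst (λ t → Apart t z) (∈-⁅⁆ a) (off z b)
        ... | inj₂ a | inj₂ b = ⊥-elim (ne (trans (sym (∈-⁅⁆ a)) (∈-⁅⁆ b)))

Closed : ∀ {n} → (Fin n → Fin n) → VSet n → Set
Closed rep R = ∀ x y → x ∈ R → rep x ≡ rep y → y ∈ R

class : ∀ {n} → (Fin n → Fin n) → Fin n → VSet n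
class rep i v = ⁅ i ⁆ (rep v)

module _ {n : ℕ} (rep : Fin n → Fin n) where

  Closed-∪ : ∀ {A B} → Closed rep A → Closed rep B → Closed rep (A ∪ B)
  Closed-∪ {A} {B} a b x y p q with ∨-split {A x} p
  ... | inj₁ r = ∨-∈ˡ (a x y r q)
  ... | inj₂ r = ∨-∈ʳ {A y} (b x y r q)

  Closed-∖ : ∀ {A B} → Closed rep A → Closed rep B → Closed rep (A ∖ B)
  Closed-∖ {A} {B} a b x y p q = ∈-∖ {A = A} {B} (a x y (∧-∈ˡ p) q)
    (≢true (λ r → true≢false (b y x r (sym q)) (∖-∉ {A = A} {B} p)))

  Closed-class : ∀ i → Closed rep (class rep i)
  Closed-class i x y p q = subst (λ t → ⁅ i ⁆ t ≡ true) q p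

  next-block : ∀ w b R → Closed rep R → (∀ i → ∣ class rep i ∣ ≤ w) →
    ∃ λ J → J ⊆ R × Closed rep J × ∣ J ∣ ≤ b + w × (b ≤ ∣ J ∣ ⊎ R ⊆ J)
  next-block w b R cR hw = go b ∅ (λ _ ()) (λ _ _ ()) (≤-trans (≤-reflexive (∣∅∣ {n})) z≤n) (m≤n+m b _)
    where
    go : ∀ fuel J → J ⊆ R → Closed rep J → ∣ J ∣ ≤ b + w → b ≤ ∣ J ∣ + fuel →
      ∃ λ J → J ⊆ R × Closed rep J × ∣ J ∣ ≤ b + w × (b ≤ ∣ J ∣ ⊎ R ⊆ J)
    go fuel J J⊆R cJ up lo with b ≤? ∣ J ∣
    ... | yes q = J , J⊆R , cJ , up , inj₁ q
    go zero J J⊆R cJ up lo | no ¬q = ⊥-elim (¬q (≤-trans lo (≤-reflexive (+-identityʳ ∣ J ∣))))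
    go (suc fuel) J J⊆R cJ up lo | no ¬q with Bool-dec (∃ᵇ (R ∖ J))
    ... | inj₂ e = J , J⊆R , cJ , up , inj₂ (λ x p → ∉-∖ {A = R} {J} p (≢true (λ q → true≢false (∃ᵇ-intro {A = R ∖ J} x q) e)))
    ... | inj₁ e with ∃ᵇ-elim {A = R ∖ J} e
    ... | x , q = go fuel (J ∪ class rep (rep x)) sub (Closed-∪ {J} {class rep (rep x)} cJ (Closed-class (rep x)))
        (≤-trans (∣∪∣≤ J (class rep (rep x))) (+-mono-≤ (<⇒≤ (≰⇒> ¬q)) (hw (rep x))))
        (≤-trans lo (≤-trans (≤-reflexive (+-suc ∣ J ∣ fuel)) (+-monoˡ-≤ fuel bigger)))
      where
      sub : (J ∪ class rep (rep x)) ⊆ R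
      sub y p with ∨-split {J y} p
      ... | inj₁ r = J⊆R y r
      ... | inj₂ r = cR x y (∧-∈ˡ q) (∈-⁅⁆ r)
      bigger : suc ∣ J ∣ ≤ ∣ J ∪ class rep (rep x) ∣
      bigger = ≤-trans (≤-reflexive (trans (+-comm 1 ∣ J ∣) (sym (trans (∣∪∣-disjoint J ⁅ x ⁆
        (λ y a b → true≢false (subst (_∈ J) (sym (∈-⁅⁆ b)) a) (∖-∉ {A = R} {J} q))) (cong (∣ J ∣ +_) (∣⁅⁆∣ x))))))
        (∣∣-mono {A = J ∪ ⁅ x ⁆} {J ∪ class rep (rep x)} inc)
        where
        inc : (J ∪ ⁅ x ⁆) ⊆ (J ∪ class rep (rep x))
        inc y p with ∨-split {J y} p
        ... | inj₁ r = ∨-∈ˡ r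
        ... | inj₂ r = ∨-∈ʳ {J y} (subst (λ t → ⁅ rep x ⁆ (rep t) ≡ true) (∈-⁅⁆ r) (⁅⁆-∈ (rep x)))

-- Growth of two-step walks

cut : ∀ {n} → Graph n → VSet n → VSet n → ℕ
cut G A B = ∑V (λ u → 𝟙 (A u) * Nb G u B)

∑-pull : ∀ {A : Set} (xs : List A) (b : ℕ) (f : A → ℕ) → b * ∑ xs f ≡ ∑ xs (λ x → b * f x)
∑-pull xs b f = sym (∑-*ˡ xs b f)

cut-sym : ∀ {n} (G : Graph n) (A B : VSet n) → cut G A B ≡ cut G B A
cut-sym {n} G A B = begin
  ∑V (λ u → 𝟙 (A u) * Nb G u B) ≡⟨ ∑-cong vs (λ u → ∑-pull vs (𝟙 (A u)) _) ⟩
  ∑V (λ u → ∑V (λ v → 𝟙 (A u) * 𝟙 (adj G u v ∧ B v))) ≡⟨ ∑-swap vs vs _ ⟩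
  ∑V (λ v → ∑V (λ u → 𝟙 (A u) * 𝟙 (adj G u v ∧ B v))) ≡⟨ ∑-cong vs (λ v → trans (∑-cong vs (λ u → pt u v)) (∑-*ˡ vs (𝟙 (B v)) _)) ⟩
  ∑V (λ v → 𝟙 (B v) * Nb G v A) ∎
  where
  open ≡-Reasoning
  vs = allFin n
  pt : ∀ u v → 𝟙 (A u) * 𝟙 (adj G u v ∧ B v) ≡ 𝟙 (B v) * 𝟙 (adj G v u ∧ A u)
  pt u v rewrite adj-sym G v u with A u | adj G u v | B v
  ... | true | true | true = refl
  ... | true | true | false = refl
  ... | true | false | true = refl
  ... | true | false | false = refl
  ... | false | true | true = refl
  ... | false | true | false = refl
  ... | false | false | true = refl
  ... | false | false | false = refl

codeg : ∀ {n} → Graph n → VSet n → Fin n → Fin n → ℕ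
codeg G P u m = ∣ (adj G u ∩ adj G m) ∩ P ∣

walk2 : ∀ {n} → Graph n → VSet n → Fin n → VSet n → ℕ
walk2 G P u B = ∑V (λ m → 𝟙 (B m) * codeg G P u m)

walk2-mid : ∀ {n} (G : Graph n) P u B → walk2 G P u B ≡ ∑V (λ z → 𝟙 (adj G u z ∧ P z) * Nb G z B)
walk2-mid {n} G P u B = begin
  ∑V (λ m → 𝟙 (B m) * codeg G P u m) ≡⟨ ∑-cong vs (λ m → ∑-pull vs (𝟙 (B m)) _) ⟩
  ∑V (λ m → ∑V (λ z → 𝟙 (B m) * 𝟙 ((adj G u z ∧ adj G m z) ∧ P z))) ≡⟨ ∑-swap vs vs _ ⟩
  ∑V (λ z → ∑V (λ m → 𝟙 (B m) * 𝟙 ((adj G u z ∧ adj G m z) ∧ P z))) ≡⟨ ∑-cong vs (λ z → trans (∑-cong vs (λ m → pt z m)) (∑-*ˡ vs (𝟙 (adj G u z ∧ P z)) _)) ⟩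
  ∑V (λ z → 𝟙 (adj G u z ∧ P z) * Nb G z B) ∎
  where
  open ≡-Reasoning
  vs = allFin n
  pt : ∀ z m → 𝟙 (B m) * 𝟙 ((adj G u z ∧ adj G m z) ∧ P z) ≡ 𝟙 (adj G u z ∧ P z) * 𝟙 (adj G z m ∧ B m)
  pt z m rewrite adj-sym G z m with B m | adj G u z | adj G m z | P z
  ... | true | true | true | true = refl
  ... | true | true | true | false = refl
  ... | true | true | false | true = refl
  ... | true | true | false | false = refl
  ... | true | false | true | true = refl
  ... | true | false | true | false = refl
  ... | true | false | false | true = refl
  ... | true | false | false | false = refl
  ... | false | true | true | true = refl
  ... | false | true | true | false = refl
  ... | false | true | false | true = refl
  ... | false | true | false | false = refl
  ... | false | false | _ | true = refl
  ... | false | false | _ | false = refl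

walk2≤ : ∀ {n} (G : Graph n) P u B → walk2 G P u B ≤ n * n
walk2≤ {n} G P u B = ≤-trans (∑-mono (allFin n) pt) (≤-reflexive (∑V-const {n} n))
  where
  pt : ∀ m → 𝟙 (B m) * codeg G P u m ≤ n
  pt m = ≤-trans (*-monoˡ-≤ (codeg G P u m) (𝟙≤1 (B m))) (≤-trans (≤-reflexive (+-identityʳ _)) (∣∣≤n _))

many-large : ∀ {n} (f : Fin n → ℕ) (b c : ℕ) → (∀ x → f x ≤ b) → 2 * n * b ≤ c * ∑V f →
  n * b ≤ c * b * ∣ (λ x → b ≤ᵇ c * f x) ∣
many-large {n} f b c hb h = cancel-cert (n * b) (c * b * ∣ F ∣) 0 main (l1 (n * b) (c * b * ∣ F ∣))
  where
  open ≤-Reasoning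
  F : VSet n
  F x = b ≤ᵇ c * f x
  l1 : ∀ a y → a + (y + a) + 0 ≡ y + 2 * a
  l1 = solve-∀
  pt : ∀ x → c * f x ≤ c * b * 𝟙 (F x) + b
  pt x with b ≤ᵇ c * f x in e
  ... | true = ≤-trans (*-monoʳ-≤ c (hb x)) (≤-trans (≤-reflexive (sym (*-identityʳ (c * b)))) (m≤m+n _ b))
  ... | false = ≤-trans (<⇒≤ (≰⇒> (λ q → true≢false (T⇒≡ (≤⇒≤ᵇ q)) e))) (m≤n+m b _)
  main : 2 * (n * b) ≤ c * b * ∣ F ∣ + n * b
  main = begin
    2 * (n * b) ≡⟨ *-assoc 2 n b ⟨
    2 * n * b ≤⟨ h ⟩
    c * ∑V f ≡⟨ ∑-pull (allFin n) c f ⟩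
    ∑V (λ x → c * f x) ≤⟨ ∑-mono (allFin n) pt ⟩
    ∑V (λ x → c * b * 𝟙 (F x) + b) ≡⟨ ∑-+ (allFin n) _ _ ⟩
    ∑V (λ x → c * b * 𝟙 (F x)) + ∑V {n} (λ _ → b) ≡⟨ cong₂ _+_ (∑-*ˡ (allFin n) (c * b) _) (∑V-const {n} b) ⟩
    c * b * ∣ F ∣ + n * b ∎

record Piece {n} (G : Graph n) (P : VSet n) (M c η : ℕ) : Set where
  field
    min-degree : ∀ u → u ∈ P → n ≤ M * Nb G u P
    no-cut : ∀ A → A ⊆ P → n ≤ c * ∣ A ∣ → n ≤ c * ∣ P ∖ A ∣ → n * n ≤ η * cut G A (P ∖ A)

module Closure {n : ℕ} (G : Graph n) (n>0 : 0 < n) (P : VSet n) (M c η : ℕ) (piece : Piece G P M c η)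
  (2M≤c : 2 * M ≤ c) (e₁ e₂ κ : ℕ)
  (dense₁ : ∀ Z → n ≤ 2 * η * ∣ Z ∣ → n * n ≤ e₁ * E G Z)
  (dense₂ : ∀ Z → n ≤ 2 * M * ∣ Z ∣ → n * n ≤ e₂ * E G Z)
  (κ₁ : 2 * (e₁ * (2 * η)) ≤ κ) (κ₂ : e₂ ≤ κ) where

  open Piece piece
  private vs = allFin n

  next : VSet n → VSet n
  next B u = P u ∧ (B u ∨ (n * n ≤ᵇ κ * walk2 G P u B))

  next-⊇ : ∀ B → B ⊆ P → B ⊆ next B
  next-⊇ B s x p = ∧-∈ (s x p) (∨-∈ˡ p)

  next-⊆ : ∀ B → next B ⊆ P
  next-⊆ B x p = ∧-∈ˡ p

  next-walk : ∀ B u → u ∈ next B → u ∈ B ⊎ n * n ≤ κ * walk2 G P u B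
  next-walk B u p with ∨-split {B u} (∧-∈ʳ {P u} p)
  ... | inj₁ q = inj₁ q
  ... | inj₂ q = inj₂ (≤ᵇ⇒≤ _ _ (≡⇒T q))

  grows : ∀ B → B ⊆ P → n ≤ c * ∣ B ∣ → n ≤ κ * ∣ next B ∖ B ∣ ⊎ P ⊆ next B
  grows B B⊆P hB with n ≤? c * ∣ P ∖ B ∣
  ... | yes hc = inj₁ (*-cancelʳ-≤ n (κ * ∣ next B ∖ B ∣) (n * n) ⦃ >-nonZero (*-mono-≤ n>0 n>0) ⦄ (begin
      n * (n * n) ≤⟨ many-large f (n * n) κ f≤ big ⟩
      κ * (n * n) * ∣ (λ x → n * n ≤ᵇ κ * f x) ∣ ≤⟨ *-monoʳ-≤ (κ * (n * n)) (∣∣-mono {A = λ x → n * n ≤ᵇ κ * f x} {next B ∖ B} sub) ⟩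
      κ * (n * n) * ∣ next B ∖ B ∣ ≡⟨ l2 κ (n * n) ∣ next B ∖ B ∣ ⟩
      κ * ∣ next B ∖ B ∣ * (n * n) ∎))
    where
    open ≤-Reasoning
    R = P ∖ B
    Z : VSet n
    Z z = R z ∧ (n ≤ᵇ 2 * η * Nb G z B)
    l2 : ∀ a b d → a * b * d ≡ a * d * b
    l2 = solve-∀
    Z-large : n ≤ 2 * η * ∣ Z ∣
    Z-large = *-cancelʳ-≤ n (2 * η * ∣ Z ∣) n ⦃ >-nonZero n>0 ⦄ (≤-trans (many-large (λ z → 𝟙 (R z) * Nb G z B) n (2 * η) bnd hyp)
       (≤-trans (*-monoʳ-≤ (2 * η * n) (∣∣-mono {A = λ z → n ≤ᵇ 2 * η * (𝟙 (R z) * Nb G z B)} {Z} inZ)) (≤-reflexive (l2 (2 * η) n ∣ Z ∣))))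
      where
      bnd : ∀ z → 𝟙 (R z) * Nb G z B ≤ n
      bnd z = ≤-trans (*-monoˡ-≤ (Nb G z B) (𝟙≤1 (R z))) (≤-trans (≤-reflexive (+-identityʳ _)) (∣∣≤n _))
      hyp : 2 * n * n ≤ 2 * η * ∑V (λ z → 𝟙 (R z) * Nb G z B)
      hyp = ≤-trans (≤-reflexive (*-assoc 2 n n)) (≤-trans (*-monoʳ-≤ 2 (≤-trans (no-cut B B⊆P hB hc) (≤-reflexive (cong (η *_) (cut-sym G B R)))))
        (≤-reflexive (sym (*-assoc 2 η _))))
      inZ : (λ z → n ≤ᵇ 2 * η * (𝟙 (R z) * Nb G z B)) ⊆ Z
      inZ z p with R z
      ... | true = trans (cong (λ t → n ≤ᵇ 2 * η * t) (sym (+-identityʳ (Nb G z B)))) p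
      ... | false = ⊥-elim (<-irrefl refl (<-≤-trans n>0 (≤-trans (≤ᵇ⇒≤ n _ (≡⇒T p)) (≤-reflexive (*-zeroʳ (2 * η))))))
    f : Fin n → ℕ
    f u = 𝟙 (Z u) * walk2 G P u B
    f≤ : ∀ u → f u ≤ n * n
    f≤ u = ≤-trans (*-monoˡ-≤ _ (𝟙≤1 (Z u))) (≤-trans (≤-reflexive (+-identityʳ _)) (walk2≤ G P u B))
    through : ∀ u → n * Nb G u Z ≤ 2 * η * walk2 G P u B
    through u = begin
      n * Nb G u Z ≡⟨ ∑-pull vs n _ ⟩
      ∑V (λ z → n * 𝟙 (adj G u z ∧ Z z)) ≤⟨ ∑-mono vs pt ⟩
      ∑V (λ z → 2 * η * (𝟙 (adj G u z ∧ P z) * Nb G z B)) ≡⟨ ∑-*ˡ vs (2 * η) _ ⟩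
      2 * η * ∑V (λ z → 𝟙 (adj G u z ∧ P z) * Nb G z B) ≡⟨ cong (2 * η *_) (walk2-mid G P u B) ⟨
      2 * η * walk2 G P u B ∎
      where
      pt : ∀ z → n * 𝟙 (adj G u z ∧ Z z) ≤ 2 * η * (𝟙 (adj G u z ∧ P z) * Nb G z B)
      pt z with adj G u z | Bool-dec (Z z)
      ... | false | _ = ≤-trans (≤-reflexive (*-zeroʳ n)) z≤n
      ... | true | inj₂ q = ≤-trans (≤-reflexive (trans (cong (λ b → n * 𝟙 b) q) (*-zeroʳ n))) z≤n
      ... | true | inj₁ q = ≤-trans (≤-reflexive (trans (cong (λ b → n * 𝟙 b) q) (*-identityʳ n)))
            (≤-trans (≤ᵇ⇒≤ n _ (≡⇒T (∧-∈ʳ {R z} q))) (≤-reflexive (cong (2 * η *_)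
              (sym (trans (cong (λ b → 𝟙 b * Nb G z B) (∧-∈ˡ {P z} (∧-∈ˡ {R z} q))) (+-identityʳ _))))))
    big : 2 * n * (n * n) ≤ κ * ∑V f
    big = begin
      2 * n * (n * n) ≤⟨ *-monoʳ-≤ (2 * n) (dense₁ Z Z-large) ⟩
      2 * n * (e₁ * E G Z) ≡⟨ l3 n e₁ (E G Z) ⟩
      2 * e₁ * (n * E G Z) ≡⟨ cong (2 * e₁ *_) (∑-pull vs n _) ⟩
      2 * e₁ * ∑V (λ u → n * (𝟙 (Z u) * Nb G u Z)) ≤⟨ *-monoʳ-≤ (2 * e₁) (∑-mono vs (λ u →
           ≤-trans (≤-reflexive (l4 n (𝟙 (Z u)) (Nb G u Z))) (≤-trans (*-monoʳ-≤ (𝟙 (Z u)) (through u)) (≤-reflexive (l4 (𝟙 (Z u)) (2 * η) (walk2 G P u B)))))) ⟩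
      2 * e₁ * ∑V (λ u → 2 * η * f u) ≡⟨ cong (2 * e₁ *_) (∑-*ˡ vs (2 * η) f) ⟩
      2 * e₁ * (2 * η * ∑V f) ≡⟨ l5 e₁ (2 * η) (∑V f) ⟩
      2 * (e₁ * (2 * η)) * ∑V f ≤⟨ *-monoˡ-≤ (∑V f) κ₁ ⟩
      κ * ∑V f ∎
      where
      l3 : ∀ n e x → 2 * n * (e * x) ≡ 2 * e * (n * x)
      l3 = solve-∀
      l4 : ∀ a b d → a * (b * d) ≡ b * (a * d)
      l4 = solve-∀
      l5 : ∀ e h x → 2 * e * (h * x) ≡ 2 * (e * h) * x
      l5 = solve-∀
    sub : (λ x → n * n ≤ᵇ κ * f x) ⊆ (next B ∖ B)
    sub u p with Bool-dec (Z u)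
    ... | inj₂ q = ⊥-elim (<-irrefl refl (<-≤-trans (*-mono-≤ n>0 n>0) (≤-trans (≤ᵇ⇒≤ (n * n) _ (≡⇒T p))
           (≤-reflexive (trans (cong (λ b → κ * (𝟙 b * walk2 G P u B)) q) (*-zeroʳ κ))))))
    ... | inj₁ q = ∈-∖ {A = next B} {B} (∧-∈ (∧-∈ˡ uR) (∨-∈ʳ {B u} (trans (cong (λ t → n * n ≤ᵇ κ * t)
           (sym (trans (cong (λ b → 𝟙 b * walk2 G P u B) q) (+-identityʳ _)))) p))) (∖-∉ {A = P} {B} uR)
      where uR : u ∈ P ∖ B
            uR = ∧-∈ˡ {R u} q
  ... | no ¬hc = inj₂ all
    where
    open ≤-Reasoning
    all : P ⊆ next B
    all u uP = ∧-∈ uP (∨-∈ʳ {B u} (T⇒≡ (≤⇒≤ᵇ (begin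
        n * n ≤⟨ dense₂ Z Z-large ⟩
        e₂ * E G Z ≤⟨ *-mono-≤ κ₂ (∑-mono vs pt) ⟩
        κ * ∑V (λ z → 𝟙 (adj G u z ∧ P z) * Nb G z B) ≡⟨ cong (κ *_) (walk2-mid G P u B) ⟨
        κ * walk2 G P u B ∎))))
      where
      Z = adj G u ∩ B
      pt : ∀ z → 𝟙 (Z z) * Nb G z Z ≤ 𝟙 (adj G u z ∧ P z) * Nb G z B
      pt z = *-mono-≤ (𝟙-mono {Z z} {adj G u z ∧ P z} (λ q → ∧-∈ (∧-∈ˡ q) (B⊆P z (∧-∈ʳ {adj G u z} q))))
        (∣∣-mono {A = adj G z ∩ Z} {adj G z ∩ B} (λ t q → ∧-∈ (∧-∈ˡ q) (∧-∈ʳ {adj G u t} (∧-∈ʳ {adj G z t} q))))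
      split : Nb G u P ≤ ∣ Z ∣ + ∣ P ∖ B ∣
      split = ≤-trans (∣∣-mono {A = adj G u ∩ P} {Z ∪ (P ∖ B)} inc) (∣∪∣≤ Z (P ∖ B))
        where
        inc : (adj G u ∩ P) ⊆ (Z ∪ (P ∖ B))
        inc t p with adj G u t | P t | B t
        ... | true | true | true = refl
        ... | true | true | false = refl
      Z-large : n ≤ 2 * M * ∣ Z ∣
      Z-large = cancel-cert n (2 * M * ∣ Z ∣) 0 (begin
          2 * n ≤⟨ *-monoʳ-≤ 2 (min-degree u uP) ⟩
          2 * (M * Nb G u P) ≤⟨ *-monoʳ-≤ 2 (*-monoʳ-≤ M split) ⟩
          2 * (M * (∣ Z ∣ + ∣ P ∖ B ∣)) ≡⟨ l1 M ∣ Z ∣ ∣ P ∖ B ∣ ⟩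
          2 * M * ∣ Z ∣ + 2 * M * ∣ P ∖ B ∣ ≤⟨ +-monoʳ-≤ (2 * M * ∣ Z ∣) (≤-trans (*-monoˡ-≤ _ 2M≤c) (<⇒≤ (≰⇒> ¬hc))) ⟩
          2 * M * ∣ Z ∣ + n ∎) (l2 n (2 * M * ∣ Z ∣))
        where
        l1 : ∀ m a b → 2 * (m * (a + b)) ≡ 2 * m * a + 2 * m * b
        l1 = solve-∀
        l2 : ∀ n b → n + (b + n) + 0 ≡ b + 2 * n
        l2 = solve-∀

  closure : VSet n → ℕ → VSet n
  closure B zero = B
  closure B (suc l) = next (closure B l)

  closure-⊆ : ∀ B → B ⊆ P → ∀ l → closure B l ⊆ P
  closure-⊆ B s zero = s
  closure-⊆ B s (suc l) = next-⊆ (closure B l)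

  closure-full : ∀ B → B ⊆ P → n ≤ c * ∣ B ∣ → P ⊆ closure B (suc κ)
  closure-full B B⊆P hB with size (suc κ)
    where
    size : ∀ l → (n ≤ c * ∣ closure B l ∣ × l * n ≤ κ * ∣ closure B l ∣) ⊎ P ⊆ closure B l
    size zero = inj₁ (hB , z≤n)
    size (suc l) with size l
    ... | inj₂ q = inj₂ (λ x p → next-⊇ (closure B l) (closure-⊆ B B⊆P l) x (q x p))
    ... | inj₁ (h₁ , h₂) with grows (closure B l) (closure-⊆ B B⊆P l) h₁
    ...   | inj₂ q = inj₂ q
    ...   | inj₁ q = inj₁ (≤-trans h₁ (*-monoʳ-≤ c (∣∣-mono {A = closure B l} {next (closure B l)} inc)) ,
              ≤-trans (+-mono-≤ q h₂) (≤-reflexive (trans (sym (*-distribˡ-+ κ ∣ next (closure B l) ∖ closure B l ∣ ∣ closure B l ∣)) (cong (κ *_)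
                (trans (+-comm ∣ next (closure B l) ∖ closure B l ∣ _) (sym (∣∖∣-⊆ {A = next (closure B l)} {closure B l} inc)))))))
      where inc : closure B l ⊆ next (closure B l)
            inc = next-⊇ (closure B l) (closure-⊆ B B⊆P l)
  ... | inj₂ q = q
  ... | inj₁ (_ , h) = ⊥-elim (<-irrefl refl (<-≤-trans (m<m+n (κ * n) n>0) (≤-trans (≤-reflexive (+-comm (κ * n) n))
          (≤-trans h (*-monoʳ-≤ κ (∣∣≤n (closure B (suc κ))))))))

-- Multiplicative weights and absorption

pairs : ∀ {A B : Set} → List A → List B → List (A × B)
pairs [] ys = []
pairs (x ∷ xs) ys = map (x ,_) ys ++ pairs xs ys

∑-pairs : ∀ {A B : Set} (xs : List A) (ys : List B) (f : A × B → ℕ) → ∑ (pairs xs ys) f ≡ ∑ xs (λ x → ∑ ys (λ y → f (x , y)))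
∑-pairs [] ys f = refl
∑-pairs (x ∷ xs) ys f = trans (∑-++ (map (x ,_) ys) (pairs xs ys) f) (cong₂ _+_ (∑-map (x ,_) ys f) (∑-pairs xs ys f))

weight : ℕ → ℕ → ℕ
weight m s = if s <ᵇ m then 2 ^ (m ∸ s) else 0

weight-suc : ∀ m s → 2 * weight m (suc s) ≤ weight m s
weight-suc m s with suc s <ᵇ m in e
... | false = z≤n
... | true with s <ᵇ m in e′
...   | true = ≤-reflexive (cong (2 ^_) (sym (+-∸-assoc 1 (<⇒≤ (<ᵇ⇒< (suc s) m (≡⇒T e))))))
...   | false = true≢false (T⇒≡ (<⇒<ᵇ (<-trans (n<1+n s) (<ᵇ⇒< (suc s) m (≡⇒T e))))) e′

weight≤ : ∀ m s → weight m s ≤ 2 ^ m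
weight≤ m s with s <ᵇ m
... | true = ^-monoʳ-≤ 2 (m∸n≤m m s)
... | false = z≤n

weight-0 : ∀ m s → weight m s ≡ 0 → m ≤ s
weight-0 m s h with s <ᵇ m in e
... | true = ⊥-elim (m^n≢0-lemma (m ∸ s) h)
  where m^n≢0-lemma : ∀ t → ¬ (2 ^ t ≡ 0)
        m^n≢0-lemma t q = <-irrefl (sym q) (m^n>0 2 t)
... | false = ≮⇒≥ (λ p → true≢false (T⇒≡ (<⇒<ᵇ p)) e)

∑-zero : ∀ {A : Set} (xs : List A) (f : A → ℕ) → ∑ xs f ≡ 0 → ∀ i → f i ≤ ∑ xs f → f i ≡ 0
∑-zero xs f h i le = n≤0⇒n≡0 (≤-trans le (≤-reflexive h))

∑-pairs-single : ∀ {A B : Set} (xs : List A) (ys : List B) → (∀ (f : A → ℕ) i → f i ≤ ∑ xs f) → (∀ (f : B → ℕ) i → f i ≤ ∑ ys f) →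
  ∀ (f : A × B → ℕ) i → f i ≤ ∑ (pairs xs ys) f
∑-pairs-single xs ys cx cy f (a , b) = ≤-trans (cy (λ y → f (a , y)) b) (≤-trans (cx (λ x → ∑ ys (λ y → f (x , y))) a) (≤-reflexive (sym (∑-pairs xs ys f))))

length-pairs : ∀ {A B : Set} (xs : List A) (ys : List B) → length (pairs xs ys) ≡ length xs * length ys
length-pairs xs ys = trans (sym (trans (∑-const (pairs xs ys) 1) (*-identityʳ _))) (trans (∑-pairs xs ys (λ _ → 1))
  (trans (∑-const xs _) (cong (length xs *_) (trans (∑-const ys 1) (*-identityʳ _)))))

module Absorption {n : ℕ} (G H : Graph n) (P Q : VSet n) (∣Q∣≡∣P∣ : ∣ Q ∣ ≡ ∣ P ∣) (X₁ X₀ : VSet n) (φ′ : Fin n → Fin n)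
  (target : Fin n → ℕ → VSet n) (moves : Fin n → VSet n) (L N : ℕ)
  (emb′ : Emb G H P (Q ∖ X₁) φ′) (X₁⊆Q : X₁ ⊆ Q) (X₀⊆Q : X₀ ⊆ Q) (X₀∉X₁ : ∀ x → x ∈ X₀ → x ∉ X₁)
  (indep₀ : ∀ x y → x ∈ X₁ ∪ X₀ → y ∈ X₁ ∪ X₀ → adj H x y ≡ false)
  (target⊆P : ∀ y l → target y l ⊆ P)
  (base : ∀ y v → y ∈ X₁ → v ∈ target y 0 → ∀ z → adj H y z ≡ true → adj G v (φ′ z) ≡ true)
  (moves-adj : ∀ v x → x ∈ X₀ → x ∈ moves v → ∀ z → adj H x z ≡ true → adj G v (φ′ z) ≡ true)
  (plenty : ∀ v y l → v ∈ target y (suc l) → l < L → v ∉ target y l → N < ∣ (λ x → X₀ x ∧ (target y l (φ′ x) ∧ moves v x)) ∣)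
  (full : ∀ y v → y ∈ X₁ → v ∈ P → v ∈ target y L) (budget : ∣ X₁ ∣ * L ≤ N) where

  flexible : VSet n
  flexible = X₁ ∪ X₀

  nb-rigid : ∀ {x z} → x ∈ flexible → adj H x z ≡ true → z ∉ flexible
  nb-rigid {x} {z} p q = ≢true (λ r → true≢false q (indep₀ x z p r))

  -- Y: remaining holes; Z: vertices of X₀ that have been moved.
  record Partial (Y Z : VSet n) (θ : Fin n → Fin n) : Set where
    field
      embθ : Emb G H P (Q ∖ Y) θ
      Y⊆X₁ : Y ⊆ X₁
      rigid : ∀ x → x ∉ flexible → θ x ≡ φ′ x
      unmoved : ∀ x → x ∈ X₀ → x ∉ Z → θ x ≡ φ′ x
  open Partial

  chain-switch : ∀ l → l ≤ L → ∀ Y Z θ → Partial Y Z θ → ∀ y → y ∈ Y → ∀ v → v ∈ target y l → v ∉ im (Q ∖ Y) θ →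
    ∣ Z ∣ + l ≤ N → ∃ λ Z′ → ∃ λ θ′ → Partial (Y ∖ ⁅ y ⁆) Z′ θ′ × ∣ Z′ ∣ ≤ ∣ Z ∣ + l
  chain-switch zero _ Y Z θ pt y y∈ v v∈ v∉ _ = Z , θ′ , record
      { embθ = Emb-mono G H (λ _ p → p) sub (place G H y v (embθ pt) (target⊆P y 0 v v∈) v∉ nbrs)
      ; Y⊆X₁ = λ x p → Y⊆X₁ pt x (∧-∈ˡ p)
      ; rigid = λ x p → trans (same x (λ r → true≢false (∨-∈ˡ (Y⊆X₁ pt y y∈)) (subst (_∉ flexible) (sym r) p))) (rigid pt x p)
      ; unmoved = λ x p q → trans (same x (λ r → true≢false (Y⊆X₁ pt y y∈) (subst (_∉ X₁) (sym r) (X₀∉X₁ x p)))) (unmoved pt x p q)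
      } , ≤-reflexive (sym (+-identityʳ ∣ Z ∣))
    where
    θ′ = override G H ⁅ y ⁆ (λ _ → v) θ
    same : ∀ x → ¬ (y ≡ x) → θ′ x ≡ θ x
    same x ne = override-∉ G H {⁅ y ⁆} (λ _ → v) θ (∉-⁅⁆ ne)
    sub : (Q ∖ (Y ∖ ⁅ y ⁆)) ⊆ ((Q ∖ Y) ∪ ⁅ y ⁆)
    sub x p with Q x | Y x | ⁅ y ⁆ x
    ... | true | true | true = refl
    ... | true | false | _ = refl
    nbrs : ∀ z → z ∈ Q ∖ Y → adj H y z ≡ true → adj G v (θ z) ≡ true
    nbrs z p q = trans (cong (adj G v) (rigid pt z (nb-rigid (∨-∈ˡ (Y⊆X₁ pt y y∈)) q))) (base y v (Y⊆X₁ pt y y∈) v∈ z q)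
  chain-switch (suc l) l≤ Y Z θ pt y y∈ v v∈ v∉ bd with Bool-dec (target y l v)
  ... | inj₁ q = let (Z′ , θ′ , pt′ , h) = chain-switch l (<⇒≤ l≤) Y Z θ pt y y∈ v q v∉ (≤-trans (+-monoʳ-≤ ∣ Z ∣ (n≤1+n l)) bd)
                 in Z′ , θ′ , pt′ , ≤-trans h (+-monoʳ-≤ ∣ Z ∣ (n≤1+n l))
  ... | inj₂ q = pick (∣∣-∃< Z (λ x → X₀ x ∧ (target y l (φ′ x) ∧ moves v x))
        (≤-<-trans (≤-trans (m≤m+n ∣ Z ∣ (suc l)) bd) (plenty v y l v∈ l≤ q)))
    where
    pick : (∃ λ x → (X₀ x ∧ (target y l (φ′ x) ∧ moves v x) ≡ true) × x ∉ Z) →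
      ∃ λ Z′ → ∃ λ θ′ → Partial (Y ∖ ⁅ y ⁆) Z′ θ′ × ∣ Z′ ∣ ≤ ∣ Z ∣ + suc l
    pick (x , h , x∉Z) = finish (chain-switch l (<⇒≤ l≤) Y (Z ∪ ⁅ x ⁆) θ′ pt′ y y∈ (θ x) (subst (_∈ target y l) (sym θx) (∧-∈ˡ {target y l (φ′ x)} hh)) new∉
        (≤-trans (+-monoˡ-≤ l Z+1) (≤-trans (≤-reflexive (sym (+-suc ∣ Z ∣ l))) bd)))
      where
      x∈X₀ : x ∈ X₀
      x∈X₀ = ∧-∈ˡ {X₀ x} h
      hh : target y l (φ′ x) ∧ moves v x ≡ true
      hh = ∧-∈ʳ {X₀ x} h
      θx : θ x ≡ φ′ x
      θx = unmoved pt x x∈X₀ x∉Z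
      x∉Y : x ∉ Y
      x∉Y = ≢true (λ r → true≢false (Y⊆X₁ pt x r) (X₀∉X₁ x x∈X₀))
      x∈dom : x ∈ Q ∖ Y
      x∈dom = ∈-∖ {A = Q} {Y} (X₀⊆Q x x∈X₀) x∉Y
      θ′ = override G H ⁅ x ⁆ (λ _ → v) θ
      same : ∀ z → ¬ (x ≡ z) → θ′ z ≡ θ z
      same z ne = override-∉ G H {⁅ x ⁆} (λ _ → v) θ (∉-⁅⁆ ne)
      at-x : θ′ x ≡ v
      at-x = override-∈ G H {⁅ x ⁆} (λ _ → v) θ (⁅⁆-∈ x)
      Z+1 : ∣ Z ∪ ⁅ x ⁆ ∣ ≤ suc ∣ Z ∣
      Z+1 = ≤-trans (∣∪∣≤ Z ⁅ x ⁆) (≤-reflexive (trans (cong (∣ Z ∣ +_) (∣⁅⁆∣ x)) (+-comm ∣ Z ∣ 1)))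
      v∉′ : v ∉ im ((Q ∖ Y) ∖ ⁅ x ⁆) θ
      v∉′ = ≢true (λ r → let (z , a , e) = im-elim {dom = (Q ∖ Y) ∖ ⁅ x ⁆} θ v r in
        true≢false (subst (_∈ im (Q ∖ Y) θ) e (im-intro {dom = Q ∖ Y} θ z (∧-∈ˡ a))) v∉)
      nbrs : ∀ z → z ∈ (Q ∖ Y) ∖ ⁅ x ⁆ → adj H x z ≡ true → adj G v (θ z) ≡ true
      nbrs z _ r = trans (cong (adj G v) (rigid pt z (nb-rigid (∨-∈ʳ {X₁ x} x∈X₀) r)))
        (moves-adj v x x∈X₀ (∧-∈ʳ {target y l (φ′ x)} hh) z r)
      sub : (Q ∖ Y) ⊆ (((Q ∖ Y) ∖ ⁅ x ⁆) ∪ ⁅ x ⁆)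
      sub z r with Q z ∧ not (Y z) | ⁅ x ⁆ z
      ... | true | true = refl
      ... | true | false = refl
      pt′ : Partial Y (Z ∪ ⁅ x ⁆) θ′
      pt′ = record
        { embθ = Emb-mono G H (λ _ p → p) sub (place G H x v (Emb-mono G H (λ _ p → p) (λ _ p → ∧-∈ˡ p) (embθ pt)) (target⊆P y (suc l) v v∈) v∉′ nbrs)
        ; Y⊆X₁ = Y⊆X₁ pt
        ; rigid = λ z r → trans (same z (λ e → true≢false (∨-∈ʳ {X₁ x} x∈X₀) (subst (_∉ flexible) (sym e) r))) (rigid pt z r)
        ; unmoved = λ z r r′ → trans (same z (λ e → true≢false (∨-∈ʳ {Z z} (subst (λ t → ⁅ x ⁆ t ≡ true) e (⁅⁆-∈ x))) r′))
            (unmoved pt z r (≢true (λ e → true≢false (∨-∈ˡ e) r′))) }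
      new∉ : θ x ∉ im (Q ∖ Y) θ′
      new∉ = ≢true (λ r → let (z , a , e) = im-elim {dom = Q ∖ Y} θ′ (θ x) r in clash z a e)
        where
        clash : ∀ z → z ∈ Q ∖ Y → θ′ z ≡ θ x → ⊥
        clash z a e = decide (x ≟F z)
          where
          decide : Dec (x ≡ z) → ⊥
          decide (yes q) = true≢false (subst (_∈ im (Q ∖ Y) θ) (trans (sym e) (trans (cong θ′ (sym q)) at-x)) (im-intro {dom = Q ∖ Y} θ x x∈dom)) v∉
          decide (no ne) = ne (sym (inj (embθ pt) z x a x∈dom (trans (sym (same z ne)) e)))
      finish : (∃ λ Z′ → ∃ λ θ″ → Partial (Y ∖ ⁅ y ⁆) Z′ θ″ × ∣ Z′ ∣ ≤ ∣ Z ∪ ⁅ x ⁆ ∣ + l) →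
        ∃ λ Z′ → ∃ λ θ″ → Partial (Y ∖ ⁅ y ⁆) Z′ θ″ × ∣ Z′ ∣ ≤ ∣ Z ∣ + suc l
      finish (Z′ , θ″ , pt″ , hz) = Z′ , θ″ , pt″ , ≤-trans hz (≤-trans (+-monoˡ-≤ l Z+1) (≤-reflexive (sym (+-suc ∣ Z ∣ l))))

  absorb-all : ∀ fuel Y Z θ → Partial Y Z θ → ∣ Y ∣ ≡ fuel → ∣ Z ∣ + fuel * L ≤ N → ∃ λ θ → Emb G H P Q θ
  absorb-all zero Y Z θ pt e _ = θ , Emb-mono G H (λ _ p → p) (λ x p → ∈-∖ {A = Q} {Y} p
    (≢true (λ q → <-irrefl refl (<-≤-trans (∈⇒∣∣>0 Y q) (≤-reflexive e))))) (embθ pt)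
  absorb-all (suc f) Y Z θ pt e bd = pick-y (∣∣-∃ Y (subst (0 <_) (sym e) (s≤s z≤n)))
    where
    open ≤-Reasoning
    Y⊆Q : Y ⊆ Q
    Y⊆Q x p = X₁⊆Q x (Y⊆X₁ pt x p)
    deficient : ∣ im (Q ∖ Y) θ ∣ < ∣ P ∣
    deficient = begin-strict
      ∣ im (Q ∖ Y) θ ∣ ≤⟨ ∣im∣≤ (Q ∖ Y) θ ⟩
      ∣ Q ∖ Y ∣ <⟨ m<n+m (count (Q ∖ Y)) (subst (0 <_) (sym e) (s≤s z≤n)) ⟩
      ∣ Y ∣ + ∣ Q ∖ Y ∣ ≡⟨ ∣∖∣-⊆ {A = Q} {Y} Y⊆Q ⟨
      ∣ Q ∣ ≡⟨ ∣Q∣≡∣P∣ ⟩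
      ∣ P ∣ ∎
    pick-y : (∃ λ y → y ∈ Y) → ∃ λ θ → Emb G H P Q θ
    pick-y (y , y∈) = pick-v (∣∣-∃< (im (Q ∖ Y) θ) P deficient)
      where
      pick-v : (∃ λ v → v ∈ P × v ∉ im (Q ∖ Y) θ) → ∃ λ θ → Emb G H P Q θ
      pick-v (v , v∈P , v∉) = continue (chain-switch L ≤-refl Y Z θ pt y y∈ v
          (full y v (Y⊆X₁ pt y y∈) v∈P) v∉
          (≤-trans (+-monoʳ-≤ ∣ Z ∣ (m≤m+n L (f * L))) bd))
        where
        continue : (∃ λ Z′ → ∃ λ θ′ → Partial (Y ∖ ⁅ y ⁆) Z′ θ′ × ∣ Z′ ∣ ≤ ∣ Z ∣ + L) → ∃ λ θ → Emb G H P Q θ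
        continue (Z′ , θ′ , pt′ , h) = absorb-all f (Y ∖ ⁅ y ⁆) Z′ θ′ pt′ (suc-injective (trans (sym (∣∖⁅⁆∣ {A = Y} y∈)) e))
          (≤-trans (+-monoˡ-≤ (f * L) h) (≤-trans (≤-reflexive (+-assoc ∣ Z ∣ L (f * L))) bd))

  result : ∃ λ θ → Emb G H P Q θ
  result = absorb-all ∣ X₁ ∣ X₁ ∅ φ′ (record
      { embθ = emb′ ; Y⊆X₁ = λ _ p → p ; rigid = λ _ _ → refl ; unmoved = λ _ _ _ → refl }) refl
      (≤-trans (≤-reflexive (cong (_+ ∣ X₁ ∣ * L) (∣∅∣ {n}))) budget)

record PieceNumbers (n D C Δ k M c η w ball : ℕ) : Set where
  field
    κ W q₀ b U p m t₁ rounds cF : ℕ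
    κ₁ : 2 * (2 * (2 * η * (2 * η) * D) * (2 * η)) ≤ κ
    κ₂ : 2 * (2 * M * (2 * M) * D) ≤ κ
    η≤C : 2 * η ≤ C
    M≤C : 2 * M ≤ C
    M≤c : 2 * M ≤ c
    ok₁ : BlockOK n D C Δ k (w + w) (2 * M) M
    λ₁≤c : gain-const D Δ k (2 * M) M ≤ c
    W≥ : 2 * (2 * κ) ≤ W
    ok₂ : BlockOK n D C Δ k (w + w) W W
    q₀≥ : 2 * gain-const D Δ k W W ≤ q₀
    b≡ : suc b ≡ 4 * q₀
    p-small : p * ball ≤ w
    p>0 : 0 < p
    loss : 4 * κ * U ≤ n
    few : q₀ * (w + w) < n
    fits : (rounds + t₁) * (w + w) ≤ U
    enough : b ^ rounds * (n * (n * suc κ) * 2 ^ m) < suc b ^ rounds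
    ok₃ : BlockOK n D C Δ k (w + w) cF 1
    holes-many : n ≤ cF * (t₁ * p)
    absorbable : 2 * q₀ * (t₁ * p * suc κ) < m * p
    roomy : 2 * M * (U + w) ≤ n

module Phases {n : ℕ} (G H : Graph n) (D C : ℕ) (lin : Lin G D C) (n>0 : 0 < n)
  (Δ : ℕ) (Δ>0 : 0 < Δ) (maxdeg : ∀ v → ∣ adj H v ∣ ≤ Δ)
  (k : ℕ) (col : Fin n → Fin k) (proper : ∀ x y → adj H x y ≡ true → ¬ (col x ≡ col y))
  (rep : Fin n → Fin n) (rep-adj : ∀ x y → adj H x y ≡ true → rep x ≡ rep y)
  (w : ℕ) (w>0 : 0 < w) (class≤w : ∀ i → ∣ class rep i ∣ ≤ w)
  (P Q : VSet n) (Q-closed : Closed rep Q) (∣Q∣≡∣P∣ : ∣ Q ∣ ≡ ∣ P ∣) where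

  open Blocks G H D C lin n>0 Δ Δ>0 maxdeg k col proper public
  open Sparse H Δ maxdeg public

  private vs = allFin n

  s : ℕ
  s = w + w

  Emb-cong : ∀ {P dom φ φ′} → (∀ x → x ∈ dom → φ′ x ≡ φ x) → Emb G H P dom φ → Emb G H P dom φ′
  Emb-cong {P} {dom} {φ} {φ′} c e = record
    { inP = λ x p → subst (_∈ P) (sym (c x p)) (inP e x p)
    ; inj = λ x y p q r → inj e x y p q (trans (sym (c x p)) (trans r (c y q)))
    ; hom = λ x y p q r → subst₂ (λ a b → adj G a b ≡ true) (sym (c x p)) (sym (c y q)) (hom e x y p q r) }

  apart⇒sep : ∀ {X} → (∀ x y → x ∈ X → y ∈ X → ¬ (x ≡ y) → Apart x y) → Separated X
  apart⇒sep f = record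
    { far₁ = λ x y p q ne → Apart.apart₁ (f x y p q ne)
    ; far₂ = λ x y z p q ne → Apart.apart₂ (f x y p q ne) z
    ; far₃ = λ x y z z′ p q ne → Apart.apart₃ (f x y p q ne) z z′ }

  closed-adj : ∀ {J} → Closed rep J → ∀ x z → x ∈ J → adj H x z ≡ true → z ∈ J
  closed-adj c x z p q = c x z p (rep-adj x z q)

  Indep : VSet n → Set
  Indep X = ∀ x y → x ∈ X → y ∈ X → adj H x y ≡ false

  apart⇒indep : ∀ {X} → (∀ x y → x ∈ X → y ∈ X → ¬ (x ≡ y) → Apart x y) → Indep X
  apart⇒indep f x y p q with x ≟F y
  ... | yes refl = irrefl H x
  ... | no ne = Apart.apart₁ (f x y p q ne)

  Indep-∪ : ∀ {X T J Y} → Indep X → X ⊆ T → Closed rep T → Indep Y → Y ⊆ J → (∀ x → x ∈ J → x ∉ T) → Indep (X ∪ Y)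
  Indep-∪ {X} {T} {J} {Y} iX X⊆T cT iY Y⊆J off x y p q with ∨-split {X x} p | ∨-split {X y} q
  ... | inj₁ a | inj₁ b = iX x y a b
  ... | inj₂ a | inj₂ b = iY x y a b
  ... | inj₁ a | inj₂ b = ≢true (λ r → true≢false (closed-adj {T} cT x y (X⊆T x a) r) (off y (Y⊆J y b)))
  ... | inj₂ a | inj₁ b = ≢true (λ r → true≢false (closed-adj {T} cT y x (X⊆T y b) (trans (adj-sym H y x) r)) (off x (Y⊆J x a)))

  -- T consists of whole components, and φ embeds T except for the holes X.
  record State (T X : VSet n) (φ : Fin n → Fin n) : Set where
    field
      emb : Emb G H P (T ∖ X) φ
      closed : Closed rep T
      inQ : T ⊆ Q
      holes : X ⊆ T
      indep : Indep X
  open State public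

  free : VSet n → VSet n → (Fin n → Fin n) → VSet n
  free T X φ = P ∖ im (T ∖ X) φ

  free-large : ∀ {T X φ} → X ⊆ T → ∣ P ∣ + ∣ X ∣ ≤ ∣ free T X φ ∣ + ∣ T ∣
  free-large {T} {X} {φ} X⊆T = begin
    ∣ P ∣ + ∣ X ∣ ≤⟨ +-monoˡ-≤ ∣ X ∣ (≤-trans (∣∣≤∖+ P (im (T ∖ X) φ)) (+-monoʳ-≤ ∣ free T X φ ∣ (∣im∣≤ (T ∖ X) φ))) ⟩
    ∣ free T X φ ∣ + ∣ T ∖ X ∣ + ∣ X ∣ ≡⟨ l (count (free T X φ)) (count (T ∖ X)) (count X) ⟩
    ∣ free T X φ ∣ + (∣ X ∣ + ∣ T ∖ X ∣) ≡⟨ cong (∣ free T X φ ∣ +_) (∣∖∣-⊆ {A = T} {X} X⊆T) ⟨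
    ∣ free T X φ ∣ + ∣ T ∣ ∎
    where
    open ≤-Reasoning
    l : ∀ a b c → a + b + c ≡ a + (c + b)
    l = solve-∀

  add-block : ∀ {T X φ J Y ψ} → State T X φ → Closed rep J → J ⊆ (Q ∖ T) → Y ⊆ J → Indep Y →
    Emb G H (free T X φ) (J ∖ Y) ψ → State (T ∪ J) (X ∪ Y) (override G H J ψ φ)
  add-block {T} {X} {φ} {J} {Y} {ψ} st cJ J⊆ Y⊆J iY e = record
    { emb = Emb-mono G H (λ _ p → p) sub (Emb-cong agree (merge G H (emb st) (Emb-mono G H (λ _ p → ∧-∈ˡ p) (λ _ p → p) e) sep cross))
    ; closed = Closed-∪ rep {T} {J} (closed st) cJ
    ; inQ = inq
    ; holes = hl
    ; indep = Indep-∪ {X} {T} {J} {Y} (indep st) (holes st) (closed st) iY Y⊆J off }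
    where
    off : ∀ x → x ∈ J → x ∉ T
    off x p = ∖-∉ {A = Q} {T} (J⊆ x p)
    inq : (T ∪ J) ⊆ Q
    inq x p with ∨-split {T x} p
    ... | inj₁ q = inQ st x q
    ... | inj₂ q = ∧-∈ˡ (J⊆ x q)
    hl : (X ∪ Y) ⊆ (T ∪ J)
    hl x p with ∨-split {X x} p
    ... | inj₁ q = ∨-∈ˡ (holes st x q)
    ... | inj₂ q = ∨-∈ʳ {T x} (Y⊆J x q)
    sep : ∀ x y → x ∈ T ∖ X → x ∉ J ∖ Y → y ∈ J ∖ Y → φ x ≡ ψ y → ⊥
    sep x y p _ q r = true≢false (subst (_∈ im (T ∖ X) φ) r (im-intro φ x p)) (∖-∉ {A = P} {im (T ∖ X) φ} (inP e y q))
    cross : ∀ x y → x ∈ T ∖ X → x ∉ J ∖ Y → y ∈ J ∖ Y → adj H x y ≡ true → adj G (φ x) (ψ y) ≡ true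
    cross x y p _ q r = true≢false (closed-adj {T} (closed st) x y (∧-∈ˡ p) r) (off y (∧-∈ˡ q))
    sub : ((T ∪ J) ∖ (X ∪ Y)) ⊆ ((T ∖ X) ∪ (J ∖ Y))
    sub x p with T x | J x | X x | Y x
    ... | true | _ | false | false = refl
    ... | false | true | false | false = refl
    agree : ∀ x → x ∈ (T ∖ X) ∪ (J ∖ Y) → override G H J ψ φ x ≡ override G H (J ∖ Y) ψ φ x
    agree x p with Bool-dec (J x)
    ... | inj₂ q = trans (override-∉ G H {J} ψ φ q) (sym (override-∉ G H {J ∖ Y} ψ φ (cong (_∧ not (Y x)) q)))
    ... | inj₁ q with ∨-split {T x ∧ not (X x)} p
    ...   | inj₁ r = true≢false (∧-∈ˡ r) (off x q)
    ...   | inj₂ r = trans (override-∈ G H {J} ψ φ q) (sym (override-∈ G H {J ∖ Y} ψ φ r))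

  empty-state : State ∅ ∅ id
  empty-state = record { emb = Emb-∅ G H id ; closed = λ _ _ () ; inQ = λ _ () ; holes = λ _ () ; indep = λ _ _ () }

  keep : ∀ {T J ψ φ} → J ⊆ (Q ∖ T) → ∀ x → x ∈ T → override G H J ψ φ x ≡ φ x
  keep {T} {J} {ψ} {φ} J⊆ x p = override-∉ G H {J} ψ φ (≢true (λ q → true≢false p (∖-∉ {A = Q} {T} (J⊆ x q))))

  candidates : (Fin n → Fin n) → Fin n → VSet n
  candidates φ y v = P v ∧ nbIn y φ (adj G v)

  nbIn-cong : ∀ {x φ φ′ S} → (∀ z → adj H x z ≡ true → φ′ z ≡ φ z) → nbIn x φ S ≡ true → nbIn x φ′ S ≡ true
  nbIn-cong {x} {φ} {φ′} {S} e p = nbIn-intro {x} {φ′} {S} (λ z q → trans (cong S (e z q)) (nbIn-elim {x} {φ} {S} p z q))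

  fill : ∀ {c} → BlockOK n D C Δ k s c 1 → ∀ fuel T X φ → State T X φ → n ≤ c * ∣ X ∣ → ∣ Q ∖ T ∣ ≤ fuel →
    ∃ λ T′ → ∃ λ φ′ → State T′ X φ′ × Q ⊆ T′ × (∀ x → x ∈ T → φ′ x ≡ φ x)
  fill {c} ok fuel T X φ st hX hf with Bool-dec (∃ᵇ (Q ∖ T))
  ... | inj₂ e = T , φ , st , (λ x p → ∉-∖ {A = Q} {T} p (≢true (λ q → true≢false (∃ᵇ-intro {A = Q ∖ T} x q) e))) , λ _ _ → refl
  fill {c} ok zero T X φ st hX hf | inj₁ e = ⊥-elim (<-irrefl refl (<-≤-trans (<ᵇ⇒< 0 _ (≡⇒T e)) hf))
  fill {c} ok (suc fuel) T X φ st hX hf | inj₁ e =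
    with-block (next-block rep w w (Q ∖ T) (Closed-∖ rep {Q} {T} Q-closed (closed st)) class≤w)
    where
    open ≤-Reasoning
    A = free T X φ
    A-large : n ≤ c * ∣ A ∣
    A-large = ≤-trans hX (*-monoʳ-≤ c (+-cancelˡ-≤ (count T) (count X) (count A) (begin
      ∣ T ∣ + ∣ X ∣ ≤⟨ +-monoˡ-≤ ∣ X ∣ (≤-trans (∣∣-mono {A = T} {Q} (inQ st)) (≤-reflexive ∣Q∣≡∣P∣)) ⟩
      ∣ P ∣ + ∣ X ∣ ≤⟨ free-large {T} {X} {φ} (holes st) ⟩
      ∣ A ∣ + ∣ T ∣ ≡⟨ +-comm (count A) (count T) ⟩
      ∣ T ∣ + ∣ A ∣ ∎)))
    with-block : (∃ λ J → J ⊆ (Q ∖ T) × Closed rep J × ∣ J ∣ ≤ s × (w ≤ ∣ J ∣ ⊎ (Q ∖ T) ⊆ J)) →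
      ∃ λ T′ → ∃ λ φ′ → State T′ X φ′ × Q ⊆ T′ × (∀ x → x ∈ T → φ′ x ≡ φ x)
    with-block (J , J⊆ , cJ , J≤s , big) = finish (embed-block ok A A-large J ∅ J≤s
        (λ _ ()) (λ _ _ ()) (record { far₁ = λ _ _ () ; far₂ = λ _ _ _ () ; far₃ = λ _ _ _ _ () })
        (tt ∷ []) (λ _ → 1) (λ _ _ → true) 1 (s≤s z≤n) ≤-refl (λ _ _ → ≤-refl))
      where
      positive : w ≤ ∣ J ∣ ⊎ (Q ∖ T) ⊆ J → 0 < ∣ J ∣
      positive (inj₁ q) = ≤-trans w>0 q
      positive (inj₂ q) = ≤-trans (<ᵇ⇒< 0 _ (≡⇒T e)) (∣∣-mono {A = Q ∖ T} {J} q)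
      smaller : ∣ Q ∖ (T ∪ J) ∣ ≤ fuel
      smaller = s≤s⁻¹ (begin
        suc ∣ Q ∖ (T ∪ J) ∣ ≤⟨ +-mono-≤ (positive big) (∣∣-mono {A = Q ∖ (T ∪ J)} {(Q ∖ T) ∖ J} inc) ⟩
        ∣ J ∣ + ∣ (Q ∖ T) ∖ J ∣ ≡⟨ ∣∖∣-⊆ {A = Q ∖ T} {J} J⊆ ⟨
        ∣ Q ∖ T ∣ ≤⟨ hf ⟩
        suc fuel ∎)
        where
        inc : (Q ∖ (T ∪ J)) ⊆ ((Q ∖ T) ∖ J)
        inc x p with Q x | T x | J x
        ... | true | false | false = refl
      finish : (∃ λ ψ → Emb G H A (J ∖ ∅) ψ × _) → ∃ λ T′ → ∃ λ φ′ → State T′ X φ′ × Q ⊆ T′ × (∀ x → x ∈ T → φ′ x ≡ φ x)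
      finish (ψ , e′ , _) = again (fill ok fuel (T ∪ J) X (override G H J ψ φ) st′ hX smaller)
        where
        st₁ : State (T ∪ J) (X ∪ ∅) (override G H J ψ φ)
        st₁ = add-block {T} {X} {φ} {J} {∅} {ψ} st cJ J⊆ (λ _ ()) (λ _ _ ()) e′
        st′ : State (T ∪ J) X (override G H J ψ φ)
        st′ = record
          { emb = Emb-mono G H (λ _ p → p) (λ x p → trans (cong (λ b → (T x ∨ J x) ∧ not b) (∨-identityʳ (X x))) p) (emb st₁)
          ; closed = closed st₁ ; inQ = inQ st₁ ; holes = λ x p → ∨-∈ˡ (holes st x p) ; indep = indep st }
        again : (∃ λ T′ → ∃ λ φ′ → State T′ X φ′ × Q ⊆ T′ × (∀ x → x ∈ T ∪ J → φ′ x ≡ override G H J ψ φ x)) →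
          ∃ λ T′ → ∃ λ φ′ → State T′ X φ′ × Q ⊆ T′ × (∀ x → x ∈ T → φ′ x ≡ φ x)
        again (T′ , φ′ , st″ , full , ag) = T′ , φ′ , st″ , full , λ x p → trans (ag x (∨-∈ˡ p)) (keep {T} {J} {ψ} {φ} J⊆ x p)

  record Room (U cA : ℕ) : Set where
    field
      room-P : ∀ T X φ → State T X φ → ∣ T ∣ ≤ U → n ≤ cA * ∣ free T X φ ∣
      room-Q : ∀ T → ∣ T ∣ ≤ U → w ≤ ∣ Q ∖ T ∣

  -- A block of between w and 2w vertices disjoint from T together with p pairwise distant vertices in it.
  record FreshBlock (p : ℕ) (T : VSet n) : Set where
    field
      J X : VSet n
      J⊆ : J ⊆ (Q ∖ T)
      J-closed : Closed rep J
      J≤s : ∣ J ∣ ≤ s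
      X⊆J : X ⊆ J
      ∣X∣≡p : ∣ X ∣ ≡ p
      X-apart : ∀ x y → x ∈ X → y ∈ X → ¬ (x ≡ y) → Apart x y

  fresh-block : ∀ {U cA} → Room U cA → ∀ p → p * ball-size ≤ w → ∀ T → Closed rep T → ∣ T ∣ ≤ U → FreshBlock p T
  fresh-block room p hp T cT hT = go (next-block rep w w (Q ∖ T) (Closed-∖ rep {Q} {T} Q-closed cT) class≤w)
    where
    go : (∃ λ J → J ⊆ (Q ∖ T) × Closed rep J × ∣ J ∣ ≤ s × (w ≤ ∣ J ∣ ⊎ (Q ∖ T) ⊆ J)) → FreshBlock p T
    go (J , J⊆ , cJ , J≤s , big) = take (apart-set p J (≤-trans hp (at-least big)))
      where
      at-least : w ≤ ∣ J ∣ ⊎ (Q ∖ T) ⊆ J → w ≤ ∣ J ∣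
      at-least (inj₁ q) = q
      at-least (inj₂ q) = ≤-trans (Room.room-Q room T hT) (∣∣-mono {A = Q ∖ T} {J} q)
      take : (∃ λ X → X ⊆ J × ∣ X ∣ ≡ p × (∀ x y → x ∈ X → y ∈ X → ¬ (x ≡ y) → Apart x y)) → FreshBlock p T
      take (X , X⊆J , cX , ap) = record { J = J ; X = X ; J⊆ = J⊆ ; J-closed = cJ ; J≤s = J≤s ; X⊆J = X⊆J ; ∣X∣≡p = cX ; X-apart = ap }

  module Holes (M cA : ℕ) (ok : BlockOK n D C Δ k s cA M) (min-degree : ∀ u → u ∈ P → n ≤ M * Nb G u P)
    (U p : ℕ) (room : Room U cA) (hp : p * ball-size ≤ w) where

    λ₁ : ℕ
    λ₁ = gain-const D Δ k cA M

    record HoleState (t : ℕ) : Set where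
      field
        {T X} : VSet n
        {φ} : Fin n → Fin n
        state : State T X φ
        ∣T∣≤ : ∣ T ∣ ≤ t * s
        ∣X∣≡ : ∣ X ∣ ≡ t * p
        many : ∀ y → y ∈ X → n ≤ λ₁ * ∣ candidates φ y ∣

    holes-phase : ∀ t → t * s ≤ U → HoleState t
    holes-phase zero _ = record { state = empty-state ; ∣T∣≤ = ≤-reflexive (∣∅∣ {n}) ; ∣X∣≡ = ∣∅∣ {n} ; many = λ _ () }
    holes-phase (suc t) h = extend (holes-phase t (≤-trans (m≤n+m (t * s) s) h))
      where
      extend : HoleState t → HoleState (suc t)
      extend hs = finish (embed-block ok A (Room.room-P room T X φ state T≤U) J Y J≤s X⊆J
          (λ x z a b → closed-adj {J} J-closed x z (X⊆J x a) b) (apart⇒sep X-apart) vs (λ m → 𝟙 (P m)) (λ m → adj G m) n n>0 (∣∣≤n P) rich)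
        where
        open HoleState hs
        T≤U : ∣ T ∣ ≤ U
        T≤U = ≤-trans ∣T∣≤ (≤-trans (m≤n+m (t * s) s) h)
        A = free T X φ
        open FreshBlock (fresh-block room p hp T (closed state) T≤U) renaming (X to Y)
        rich : ∀ a → a ∈ A → n ≤ M * ∑ vs (λ m → 𝟙 (P m) * 𝟙 (adj G m a))
        rich a q = ≤-trans (min-degree a (∧-∈ˡ q)) (≤-reflexive (cong (M *_) (∑-cong vs (λ m →
          trans (𝟙-∧ (adj G a m) (P m)) (trans (*-comm (𝟙 (adj G a m)) _) (cong (λ b → 𝟙 (P m) * 𝟙 b) (adj-sym G a m)))))))
        finish : (∃ λ ψ → Emb G H A (J ∖ Y) ψ × (∀ x → x ∈ Y → n ≤ λ₁ * ∑ vs (λ m → 𝟙 (P m) * 𝟙 (nbIn x ψ (adj G m))))) → HoleState (suc t)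
        finish (ψ , e , g) = record
          { state = add-block {T} {X} {φ} {J} {Y} {ψ} state J-closed J⊆ X⊆J (apart⇒indep X-apart) e
          ; ∣T∣≤ = ≤-trans (∣∪∣≤ T J) (≤-trans (+-mono-≤ ∣T∣≤ J≤s) (≤-reflexive (+-comm (t * s) s)))
          ; ∣X∣≡ = trans (∣∪∣-disjoint X Y disj) (trans (cong₂ _+_ ∣X∣≡ ∣X∣≡p) (+-comm (t * p) p))
          ; many = many′ }
          where
          disj : ∀ x → x ∈ X → x ∈ Y → ⊥
          disj x a b = true≢false (holes state x a) (∖-∉ {A = Q} {T} (J⊆ x (X⊆J x b)))
          φ′ = override G H J ψ φ
          many′ : ∀ y → y ∈ X ∪ Y → n ≤ λ₁ * ∣ candidates φ′ y ∣
          many′ y q with ∨-split {X y} q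
          ... | inj₁ r = ≤-trans (many y r) (*-monoʳ-≤ λ₁ (∣∣-mono {A = candidates φ y} {candidates φ′ y} (λ v a → ∧-∈ (∧-∈ˡ a)
                (nbIn-cong {y} {φ} {φ′} {adj G v} (λ z b → keep {T} {J} {ψ} {φ} J⊆ z (closed-adj {T} (closed state) y z (holes state y r) b)) (∧-∈ʳ {P v} a)))))
          ... | inj₂ r = ≤-trans (g y r) (*-monoʳ-≤ λ₁ (∑-mono vs (λ m → ≤-trans (≤-reflexive (sym (𝟙-∧ (P m) _)))
                (𝟙-mono {P m ∧ nbIn y ψ (adj G m)} {candidates φ′ y m} (λ a → ∧-∈ (∧-∈ˡ a) (nbIn-intro {y} {φ′} {adj G m} (λ z b →
                  trans (cong (adj G m) (override-∈ G H {J} ψ φ (closed-adj {J} J-closed y z (X⊆J y r) b))) (nbIn-elim {y} {ψ} {adj G m} (∧-∈ʳ {P m} a) z b))))))))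

  module _ {I : Set} (is : List I) (u : I → Fin n) (B : I → VSet n) (valid : I → Bool)
    (κ W q₀ : ℕ) (W≡ : 2 * (2 * κ) ≤ W)
    (B⊆P : ∀ i → B i ⊆ P) (walks : ∀ i → valid i ≡ true → n * n ≤ κ * walk2 G P (u i) (B i))
    (ok : BlockOK n D C Δ k s W W)
    (q₀≥ : 2 * gain-const D Δ k W W ≤ q₀)
    (U : ℕ) (loss : 4 * κ * U ≤ n) (few : q₀ * s < n) where

    serve : I → (Fin n → Fin n) → Fin n → Bool
    serve i φ x = B i (φ x) ∧ nbIn x φ (adj G (u i))

    serve-cong : ∀ {i} {φ φ′ : Fin n → Fin n} {x} → φ′ x ≡ φ x → (∀ z → adj H x z ≡ true → φ′ z ≡ φ z) → serve i φ x ≡ true → serve i φ′ x ≡ true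
    serve-cong {i} {φ} {φ′} {x} e f h = ∧-∈ (trans (cong (B i) e) (∧-∈ˡ h)) (nbIn-cong {x} {φ} {φ′} {adj G (u i)} f (∧-∈ʳ {B i (φ x)} h))

    walk-loss : ∀ A (i : I) → A ⊆ P → walk2 G P (u i) (B i) ≤ ∑V (λ y → 𝟙 (B i y ∧ A y) * codeg G A (u i) y) + 2 * (n * ∣ P ∖ A ∣)
    walk-loss A i A⊆P = begin
      ∑V (λ y → 𝟙 (B i y) * codeg G P (u i) y) ≤⟨ ∑-mono vs pt ⟩
      ∑V (λ y → 𝟙 (B i y ∧ A y) * codeg G A (u i) y + (𝟙 ((P ∖ A) y) * n + ∣ P ∖ A ∣)) ≡⟨ trans (∑-+ vs _ _) (cong (main +_)
           (trans (∑-+ vs _ _) (cong₂ _+_ (∑-*ʳ vs (λ y → 𝟙 ((P ∖ A) y)) n) (∑V-const {n} ∣ P ∖ A ∣)))) ⟩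
      main + (∣ P ∖ A ∣ * n + n * ∣ P ∖ A ∣) ≡⟨ cong (main +_) (l ∣ P ∖ A ∣ n) ⟩
      main + 2 * (n * ∣ P ∖ A ∣) ∎
      where
      open ≤-Reasoning
      main = ∑V (λ y → 𝟙 (B i y ∧ A y) * codeg G A (u i) y)
      l : ∀ a n → a * n + n * a ≡ 2 * (n * a)
      l = solve-∀
      codeg≤ : ∀ y → codeg G P (u i) y ≤ codeg G A (u i) y + ∣ P ∖ A ∣
      codeg≤ y = ≤-trans (∣∣-mono {A = (adj G (u i) ∩ adj G y) ∩ P} {((adj G (u i) ∩ adj G y) ∩ A) ∪ (P ∖ A)} inc)
                   (∣∪∣≤ ((adj G (u i) ∩ adj G y) ∩ A) (P ∖ A))
        where
        inc : ((adj G (u i) ∩ adj G y) ∩ P) ⊆ (((adj G (u i) ∩ adj G y) ∩ A) ∪ (P ∖ A))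
        inc z q with adj G (u i) z ∧ adj G y z | P z | A z
        ... | true | true | true = refl
        ... | true | true | false = refl
      pt : ∀ y → 𝟙 (B i y) * codeg G P (u i) y ≤ 𝟙 (B i y ∧ A y) * codeg G A (u i) y + (𝟙 ((P ∖ A) y) * n + ∣ P ∖ A ∣)
      pt y with B i y in e₁ | A y in e₂
      ... | false | _ = z≤n
      ... | true | true = both (codeg G P (u i) y) (codeg G A (u i) y) (count (P ∖ A)) (𝟙 (P y ∧ not true) * n) (codeg≤ y)
        where
        both : ∀ c c′ e d → c ≤ c′ + e → 1 * c ≤ 1 * c′ + (d + e)
        both c c′ e d h = ≤-trans (≤-reflexive (*-identityˡ c)) (≤-trans h (+-mono-≤ (≤-reflexive (sym (*-identityˡ c′))) (m≤n+m e d)))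
      ... | true | false = outside (codeg G P (u i) y) (count (P ∖ A)) (P y) (B⊆P i y e₁) (∣∣≤n ((adj G (u i) ∩ adj G y) ∩ P))
        where
        outside : ∀ c e q → q ≡ true → c ≤ n → 1 * c ≤ 0 + (𝟙 (q ∧ true) * n + e)
        outside c e q refl h = ≤-trans (≤-reflexive (*-identityˡ c)) (≤-trans h (≤-trans (≤-reflexive (sym (*-identityˡ n))) (m≤m+n (1 * n) e)))

    module BlockStep (ω : I → ℕ) (Ω : ℕ) (Ω≡ : ∑ is ω ≡ Ω) (Ω>0 : 0 < Ω) (ω-valid : ∀ i → 0 < ω i → valid i ≡ true)
      (T X : VSet n) (φ : Fin n → Fin n) (st : State T X φ) (T≤U : ∣ T ∣ ≤ U) {p : ℕ} (fb : FreshBlock p T) (p>0 : 0 < p) where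

      A : VSet n
      A = free T X φ

      A⊆P : A ⊆ P
      A⊆P _ p = ∧-∈ˡ p

      P∖A≤ : ∣ P ∖ A ∣ ≤ U
      P∖A≤ = ≤-trans (≤-trans (∣∣-mono {A = P ∖ A} {im (T ∖ X) φ} (λ x p → ∉-∖ {A = P} {im (T ∖ X) φ} (∧-∈ˡ p) (∖-∉ {A = P} {A} p)))
               (≤-trans (∣im∣≤ (T ∖ X) φ) (∣∣-mono {A = T ∖ X} {T} (λ _ p → ∧-∈ˡ p)))) T≤U

      js : List (I × Fin n)
      js = pairs is vs

      ωj : I × Fin n → ℕ
      ωj (i , y) = ω i * 𝟙 (B i y ∧ A y)

      Sj : I × Fin n → VSet n
      Sj (i , y) = adj G (u i) ∩ adj G y

      F : Fin n → ℕ
      F a = ∑ js (λ j → ωj j * 𝟙 (Sj j a))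

      total : ∑ js ωj ≤ n * Ω
      total = begin
        ∑ js ωj ≡⟨ ∑-pairs is vs ωj ⟩
        ∑ is (λ i → ∑V (λ y → ω i * 𝟙 (B i y ∧ A y))) ≤⟨ ∑-mono is (λ i → ≤-trans (≤-reflexive (∑-*ˡ vs (ω i) _)) (*-monoʳ-≤ (ω i) (∣∣≤n (B i ∩ A)))) ⟩
        ∑ is (λ i → ω i * n) ≡⟨ ∑-*ʳ is ω n ⟩
        ∑ is ω * n ≡⟨ trans (cong (_* n) Ω≡) (*-comm Ω n) ⟩
        n * Ω ∎
        where open ≤-Reasoning

      F≤ : ∀ a → F a ≤ n * Ω
      F≤ a = ≤-trans (∑-mono js (λ j → ≤-trans (*-monoʳ-≤ (ωj j) (𝟙≤1 (Sj j a))) (≤-reflexive (*-identityʳ _)))) total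

      A′ : VSet n
      A′ a = A a ∧ (n * Ω ≤ᵇ W * F a)

      walkA : I → ℕ
      walkA i = ∑V (λ y → 𝟙 (B i y ∧ A y) * codeg G A (u i) y)

      walkA≥ : ∀ i → valid i ≡ true → n * n ≤ 2 * κ * walkA i
      walkA≥ i v = cancel-cert (n * n) (2 * κ * walkA i) 0 (begin
          2 * (n * n) ≤⟨ *-monoʳ-≤ 2 (walks i v) ⟩
          2 * (κ * walk2 G P (u i) (B i)) ≤⟨ *-monoʳ-≤ 2 (*-monoʳ-≤ κ (≤-trans (walk-loss A i A⊆P) (+-monoʳ-≤ (walkA i) (*-monoʳ-≤ 2 (*-monoʳ-≤ n P∖A≤))))) ⟩
          2 * (κ * (walkA i + 2 * (n * U))) ≡⟨ l1 κ (walkA i) n U ⟩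
          2 * κ * walkA i + n * (4 * κ * U) ≤⟨ +-monoʳ-≤ (2 * κ * walkA i) (*-monoʳ-≤ n loss) ⟩
          2 * κ * walkA i + n * n ∎) (l2 (n * n) (2 * κ * walkA i))
        where
        open ≤-Reasoning
        l1 : ∀ κ a n U → 2 * (κ * (a + 2 * (n * U))) ≡ 2 * κ * a + n * (4 * κ * U)
        l1 = solve-∀
        l2 : ∀ a y → a + (y + a) + 0 ≡ y + 2 * a
        l2 = solve-∀

      sumF : 2 * n * (n * Ω) ≤ W * ∑V (λ a → 𝟙 (A a) * F a)
      sumF = begin
        2 * n * (n * Ω) ≡⟨ trans (l1 n Ω) (cong (λ t → 2 * (n * n * t)) (sym Ω≡)) ⟩
        2 * (n * n * ∑ is ω) ≡⟨ cong (2 *_) (∑-pull is (n * n) ω) ⟩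
        2 * ∑ is (λ i → n * n * ω i) ≤⟨ *-monoʳ-≤ 2 (∑-mono is pt) ⟩
        2 * ∑ is (λ i → 2 * κ * (ω i * walkA i)) ≡⟨ trans (cong (2 *_) (∑-*ˡ is (2 * κ) _)) (sym (*-assoc 2 (2 * κ) _)) ⟩
        2 * (2 * κ) * ∑ is (λ i → ω i * walkA i) ≤⟨ *-monoˡ-≤ _ W≡ ⟩
        W * ∑ is (λ i → ω i * walkA i) ≡⟨ cong (W *_) (∑-cong is (λ i → l4 i)) ⟩
        W * ∑ is (λ i → ∑V (λ y → ∑V (λ a → 𝟙 (A a) * (ωj (i , y) * 𝟙 (Sj (i , y) a))))) ≡⟨ cong (W *_) (∑-pairs is vs _) ⟨
        W * ∑ js (λ j → ∑V (λ a → 𝟙 (A a) * (ωj j * 𝟙 (Sj j a)))) ≡⟨ cong (W *_) (∑-swap js vs _) ⟩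
        W * ∑V (λ a → ∑ js (λ j → 𝟙 (A a) * (ωj j * 𝟙 (Sj j a)))) ≡⟨ cong (W *_) (∑-cong vs (λ a → ∑-*ˡ js (𝟙 (A a)) _)) ⟩
        W * ∑V (λ a → 𝟙 (A a) * F a) ∎
        where
        open ≤-Reasoning
        l1 : ∀ n Ω → 2 * n * (n * Ω) ≡ 2 * (n * n * Ω)
        l1 = solve-∀
        l3 : ∀ κ a b → a * (2 * κ * b) ≡ 2 * κ * (a * b)
        l3 = solve-∀
        pt : ∀ i → n * n * ω i ≤ 2 * κ * (ω i * walkA i)
        pt i with ω i in e
        ... | zero = ≤-trans (≤-reflexive (*-zeroʳ (n * n))) z≤n
        ... | suc o = ≤-trans (≤-reflexive (*-comm (n * n) (suc o))) (≤-trans (*-monoʳ-≤ (suc o) (walkA≥ i (ω-valid i (subst (0 <_) (sym e) (s≤s z≤n)))))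
                (≤-reflexive (l3 κ (suc o) (walkA i))))
        l4 : ∀ i → ω i * walkA i ≡ ∑V (λ y → ∑V (λ a → 𝟙 (A a) * (ωj (i , y) * 𝟙 (Sj (i , y) a))))
        l4 i = trans (∑-pull vs (ω i) _) (∑-cong vs (λ y → trans (trans (sym (*-assoc (ω i) _ _)) (∑-pull vs (ω i * 𝟙 (B i y ∧ A y)) _))
          (∑-cong vs (λ a → trans (cong (ωj (i , y) *_) (𝟙-∧ (adj G (u i) a ∧ adj G y a) (A a))) (l5 (ωj (i , y)) (𝟙 (adj G (u i) a ∧ adj G y a)) (𝟙 (A a)))))))
          where l5 : ∀ a b c → a * (b * c) ≡ c * (a * b)
                l5 = solve-∀

      nΩ>0 : 0 < n * Ω
      nΩ>0 = *-mono-≤ n>0 Ω>0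

      A′-large : n ≤ W * ∣ A′ ∣
      A′-large = *-cancelʳ-≤ n (W * ∣ A′ ∣) (n * Ω) ⦃ >-nonZero nΩ>0 ⦄ (begin
          n * (n * Ω) ≤⟨ many-large f (n * Ω) W (λ a → ≤-trans (*-monoˡ-≤ (F a) (𝟙≤1 (A a))) (≤-trans (≤-reflexive (+-identityʳ _)) (F≤ a))) sumF ⟩
          W * (n * Ω) * ∣ (λ a → n * Ω ≤ᵇ W * f a) ∣ ≤⟨ *-monoʳ-≤ (W * (n * Ω)) (∣∣-mono {A = λ a → n * Ω ≤ᵇ W * f a} {A′} inc) ⟩
          W * (n * Ω) * ∣ A′ ∣ ≡⟨ l W (n * Ω) ∣ A′ ∣ ⟩
          W * ∣ A′ ∣ * (n * Ω) ∎)
        where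
        open ≤-Reasoning
        f : Fin n → ℕ
        f a = 𝟙 (A a) * F a
        l : ∀ a b c → a * b * c ≡ a * c * b
        l = solve-∀
        inc : (λ a → n * Ω ≤ᵇ W * f a) ⊆ A′
        inc a p with Bool-dec (A a)
        ... | inj₁ q = ∧-∈ q (trans (cong (λ t → n * Ω ≤ᵇ W * t) (sym (trans (cong (λ c → 𝟙 c * F a) q) (+-identityʳ (F a))))) p)
        ... | inj₂ q = ⊥-elim (<-irrefl refl (<-≤-trans nΩ>0 (≤-trans (≤ᵇ⇒≤ (n * Ω) _ (≡⇒T p))
              (≤-reflexive (trans (cong (λ c → W * (𝟙 c * F a)) q) (*-zeroʳ W))))))

      open FreshBlock fb renaming (X to Y) public

      λ₂ : ℕ
      λ₂ = gain-const D Δ k W W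

      Gain₂ : Fin n → (Fin n → Fin n) → Set
      Gain₂ x ψ = Ω ≤ q₀ * ∑ is (λ i → ω i * 𝟙 (serve i ψ x))

      Placed : Set
      Placed = ∃ λ ψ → Emb G H A J ψ × (∀ x → x ∈ Y → Gain₂ x ψ)

      block : ∃ λ ψ → Emb G H A′ (J ∖ Y) ψ × (∀ x → x ∈ Y → n * Ω ≤ λ₂ * ∑ js (λ j → ωj j * 𝟙 (nbIn x ψ (Sj j))))
      block = embed-block ok A′ A′-large J Y J≤s X⊆J
        (λ x z a b → closed-adj {J} J-closed x z (X⊆J x a) b) (apart⇒sep X-apart) js ωj Sj (n * Ω) nΩ>0 total
        (λ a p → ≤ᵇ⇒≤ (n * Ω) _ (≡⇒T (∧-∈ʳ {A a} p)))

      place-all : (∃ λ ψ → Emb G H A′ (J ∖ Y) ψ × (∀ x → x ∈ Y → n * Ω ≤ λ₂ * ∑ js (λ j → ωj j * 𝟙 (nbIn x ψ (Sj j))))) → Placed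
      place-all (ψ , e , g) = done (grow Y Inv start step)
        where
        Inv : VSet n → Set
        Inv Z = ∃ λ ψ′ → Emb G H A ((J ∖ Y) ∪ Z) ψ′ × (∀ z → z ∉ Y → ψ′ z ≡ ψ z) × (∀ x → x ∈ Z → Gain₂ x ψ′)
        start : Inv ∅
        start = ψ , Emb-mono G H (λ _ p → ∧-∈ˡ p) sub e , (λ _ _ → refl) , λ _ ()
          where sub : ((J ∖ Y) ∪ ∅) ⊆ (J ∖ Y)
                sub x p with ∨-split {J x ∧ not (Y x)} p
                ... | inj₁ q = q
        iY : Indep Y
        iY = apart⇒indep X-apart
        nbr∉Y : ∀ {x z} → x ∈ Y → adj H x z ≡ true → z ∉ Y
        nbr∉Y {x} {z} p q = ≢true (λ r → true≢false q (iY x z p r))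
        step : ∀ Z x → Z ⊆ Y → x ∈ Y → x ∉ Z → Inv Z → Inv (Z ∪ ⁅ x ⁆)
        step Z x Z⊆Y x∈Y x∉Z (ψ′ , e′ , ag , g′) = pick (∑-∃ vs {lhs} {λ y → q₀ * f y} averaged)
          where
          open ≤-Reasoning
          dom = (J ∖ Y) ∪ Z
          used = im dom ψ′
          used≤s : ∣ used ∣ ≤ s
          used≤s = ≤-trans (∣im∣≤ dom ψ′) (≤-trans (∣∣-mono {A = dom} {J} inJ) J≤s)
            where inJ : dom ⊆ J
                  inJ z p with ∨-split {J z ∧ not (Y z)} p
                  ... | inj₁ q = ∧-∈ˡ q
                  ... | inj₂ q = X⊆J z (Z⊆Y z q)
          f lhs : Fin n → ℕ
          f y = ∑ is (λ i → ω i * 𝟙 (B i y ∧ A y) * 𝟙 (nbIn x ψ (Sj (i , y))))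
          lhs y = Ω + q₀ * Ω * 𝟙 (used y)
          f≤Ω : ∀ y → f y ≤ Ω
          f≤Ω y = ≤-trans (∑-mono is (λ i → ≤-trans (*-mono-≤ (*-monoʳ-≤ (ω i) (𝟙≤1 (B i y ∧ A y))) (𝟙≤1 (nbIn x ψ (Sj (i , y)))))
                    (≤-reflexive (trans (*-identityʳ _) (*-identityʳ _))))) (≤-reflexive Ω≡)
          averaged : ∑V lhs < ∑V (λ y → q₀ * f y)
          averaged = begin-strict
            ∑V lhs ≡⟨ trans (∑-+ vs _ _) (cong₂ _+_ (∑V-const {n} Ω) (∑-*ˡ vs (q₀ * Ω) _)) ⟩
            n * Ω + q₀ * Ω * ∣ used ∣ ≤⟨ +-monoʳ-≤ (n * Ω) (*-monoʳ-≤ (q₀ * Ω) used≤s) ⟩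
            n * Ω + q₀ * Ω * s ≡⟨ cong (n * Ω +_) (l1 q₀ Ω s) ⟩
            n * Ω + q₀ * s * Ω <⟨ +-monoʳ-< (n * Ω) (*-monoˡ-< Ω ⦃ >-nonZero Ω>0 ⦄ few) ⟩
            n * Ω + n * Ω ≡⟨ l2 (n * Ω) ⟩
            2 * (n * Ω) ≤⟨ *-monoʳ-≤ 2 (g x x∈Y) ⟩
            2 * (λ₂ * ∑ js (λ j → ωj j * 𝟙 (nbIn x ψ (Sj j)))) ≡⟨ *-assoc 2 λ₂ _ ⟨
            2 * λ₂ * ∑ js (λ j → ωj j * 𝟙 (nbIn x ψ (Sj j))) ≤⟨ *-monoˡ-≤ _ q₀≥ ⟩
            q₀ * ∑ js (λ j → ωj j * 𝟙 (nbIn x ψ (Sj j))) ≡⟨ cong (q₀ *_) (trans (∑-pairs is vs _) (∑-swap is vs _)) ⟩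
            q₀ * ∑V f ≡⟨ ∑-pull vs q₀ f ⟩
            ∑V (λ y → q₀ * f y) ∎
            where
            l1 : ∀ a b c → a * b * c ≡ a * c * b
            l1 = solve-∀
            l2 : ∀ a → a + a ≡ 2 * a
            l2 = solve-∀
          pick : (∃ λ y → lhs y < q₀ * f y) → Inv (Z ∪ ⁅ x ⁆)
          pick (y , lt) = finish (positive-term is _ (proj₂ (*-pos q₀ (f y) (≤-<-trans z≤n lt))))
            where
            y∉used : y ∉ used
            y∉used = ≢true (λ h → <-irrefl refl (<-≤-trans lt (≤-trans (*-monoʳ-≤ q₀ (f≤Ω y)) (≤-trans (m≤n+m (q₀ * Ω) Ω)
              (≤-reflexive (cong (Ω +_) (sym (trans (cong (λ t → q₀ * Ω * 𝟙 t) h) (*-identityʳ (q₀ * Ω))))))))))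
            finish : (∃ λ i → 0 < ω i * 𝟙 (B i y ∧ A y) * 𝟙 (nbIn x ψ (Sj (i , y)))) → Inv (Z ∪ ⁅ x ⁆)
            finish (i , pos) = ψ″ , Emb-mono G H (λ _ p → p) sub (place G H x y e′ y∈A y∉used nbrs) , ag″ , g″
              where
              in1 = *-pos (ω i * 𝟙 (B i y ∧ A y)) _ pos
              y∈A : y ∈ A
              y∈A = ∧-∈ʳ {B i y} (𝟙-pos (proj₂ (*-pos (ω i) _ (proj₁ in1))))
              adjy : ∀ z → adj H x z ≡ true → adj G y (ψ z) ≡ true
              adjy z q = ∧-∈ʳ {adj G (u i) (ψ z)} (nbIn-elim {x} {ψ} {Sj (i , y)} (𝟙-pos (proj₂ in1)) z q)
              nbrs : ∀ z → z ∈ dom → adj H x z ≡ true → adj G y (ψ′ z) ≡ true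
              nbrs z _ q = trans (cong (adj G y) (ag z (nbr∉Y x∈Y q))) (adjy z q)
              ψ″ = override G H ⁅ x ⁆ (λ _ → y) ψ′
              same : ∀ z → ¬ (x ≡ z) → ψ″ z ≡ ψ′ z
              same z ne = override-∉ G H {⁅ x ⁆} (λ _ → y) ψ′ (∉-⁅⁆ ne)
              at-x : ψ″ x ≡ y
              at-x = override-∈ G H {⁅ x ⁆} (λ _ → y) ψ′ (⁅⁆-∈ x)
              sub : ((J ∖ Y) ∪ (Z ∪ ⁅ x ⁆)) ⊆ (((J ∖ Y) ∪ Z) ∪ ⁅ x ⁆)
              sub z p with J z ∧ not (Y z) | Z z
              ... | true | _ = refl
              ... | false | true = refl
              ... | false | false = p
              ag″ : ∀ z → z ∉ Y → ψ″ z ≡ ψ z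
              ag″ z p = trans (same z (λ r → true≢false x∈Y (subst (_∉ Y) (sym r) p))) (ag z p)
              nb-same : ∀ t → t ∈ Y → ∀ z → adj H t z ≡ true → ψ″ z ≡ ψ′ z
              nb-same t p z q = same z (λ r → true≢false (subst (_∈ Y) r x∈Y) (nbr∉Y p q))
              g″ : ∀ t → t ∈ Z ∪ ⁅ x ⁆ → Gain₂ t ψ″
              g″ t p with ∨-split {Z t} p
              ... | inj₁ q = ≤-trans (g′ t q) (*-monoʳ-≤ q₀ (∑-mono is (λ i → *-monoʳ-≤ (ω i) (𝟙-mono (serve-cong {i} {ψ′} {ψ″} {t}
                    (same t (λ r → true≢false (subst (_∈ Z) (sym r) q) x∉Z)) (nb-same t (Z⊆Y t q)))))))
              ... | inj₂ q = subst (λ r → Gain₂ r ψ″) (∈-⁅⁆ q) (≤-trans (<⇒≤ (≤-<-trans (m≤m+n Ω _) lt)) (*-monoʳ-≤ q₀ (∑-mono is (λ i →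
                    ≤-trans (≤-reflexive (*-assoc (ω i) _ _)) (*-monoʳ-≤ (ω i) (≤-trans (≤-reflexive (sym (𝟙-∧ (B i y ∧ A y) _))) (𝟙-mono (λ h →
                      ∧-∈ (trans (cong (B i) at-x) (∧-∈ˡ (∧-∈ˡ h))) (nbIn-intro {x} {ψ″} {adj G (u i)} (λ z q′ →
                        trans (cong (adj G (u i)) (trans (nb-same x x∈Y z q′) (ag z (nbr∉Y x∈Y q′))))
                          (∧-∈ˡ (nbIn-elim {x} {ψ} {Sj (i , y)} (∧-∈ʳ {B i y ∧ A y} h) z q′))))))))))))
        done : (∃ λ Z → Z ⊆ Y × Y ⊆ Z × Inv Z) → Placed
        done (Z , Z⊆Y , Y⊆Z , ψ′ , e′ , _ , g′) = ψ′ , Emb-mono G H (λ _ p → p) sub e′ , λ x p → g′ x (Y⊆Z x p)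
          where
          sub : J ⊆ ((J ∖ Y) ∪ Z)
          sub x p with Bool-dec (Y x)
          ... | inj₁ q = ∨-∈ʳ {J x ∧ not (Y x)} (Y⊆Z x q)
          ... | inj₂ q = ∨-∈ˡ (∈-∖ {A = J} {Y} p q)

      hits : (Fin n → Fin n) → I → ℕ
      hits ψ i = ∣ (λ x → Y x ∧ serve i ψ x) ∣

      heavy : (Fin n → Fin n) → I → Bool
      heavy ψ i = p ≤ᵇ 2 * q₀ * hits ψ i

      heavy-weight : ∀ ψ → (∀ x → x ∈ Y → Gain₂ x ψ) → Ω ≤ 2 * q₀ * ∑ is (λ i → ω i * 𝟙 (heavy ψ i))
      heavy-weight ψ g = *-cancelˡ-≤ p ⦃ >-nonZero p>0 ⦄ (cancel-cert (p * Ω) (p * (2 * q₀ * Hw)) 0 main (l5 (p * Ω) (p * (2 * q₀ * Hw))))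
        where
        open ≤-Reasoning
        Hw = ∑ is (λ i → ω i * 𝟙 (heavy ψ i))
        l5 : ∀ a y → a + (y + a) + 0 ≡ y + 2 * a
        l5 = solve-∀
        l6 : ∀ a q h → 2 * q * (a * h) ≡ a * (2 * q * h)
        l6 = solve-∀
        l7 : ∀ a q p → a * (2 * q * p) ≡ p * (2 * q * (a * 1)) + 0
        l7 = solve-∀
        ptY : ∀ x → 𝟙 (Y x) * Ω ≤ q₀ * ∑ is (λ i → ω i * 𝟙 (Y x ∧ serve i ψ x))
        ptY x with Y x in e
        ... | false = z≤n
        ... | true = ≤-trans (≤-reflexive (+-identityʳ Ω)) (g x e)
        pt : ∀ i → 2 * q₀ * (ω i * hits ψ i) ≤ p * (2 * q₀ * (ω i * 𝟙 (heavy ψ i))) + p * ω i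
        pt i with p ≤ᵇ 2 * q₀ * hits ψ i in e
        ... | true = ≤-trans (≤-reflexive (l6 (ω i) q₀ (hits ψ i))) (≤-trans (*-monoʳ-≤ (ω i) (*-monoʳ-≤ (2 * q₀)
               (≤-trans (∣∣-mono {A = λ x → Y x ∧ serve i ψ x} {Y} (λ _ p → ∧-∈ˡ p)) (≤-reflexive ∣X∣≡p))))
               (≤-trans (≤-reflexive (l7 (ω i) q₀ p)) (+-monoʳ-≤ _ z≤n)))
        ... | false = ≤-trans (≤-reflexive (l6 (ω i) q₀ (hits ψ i))) (≤-trans (*-monoʳ-≤ (ω i) (<⇒≤ (≰⇒> (λ h → true≢false (T⇒≡ (≤⇒≤ᵇ h)) e))))
               (≤-trans (≤-reflexive (*-comm (ω i) p)) (m≤n+m _ _)))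
        main : 2 * (p * Ω) ≤ p * (2 * q₀ * Hw) + p * Ω
        main = begin
          2 * (p * Ω) ≡⟨ cong (λ t → 2 * (t * Ω)) ∣X∣≡p ⟨
          2 * (∣ Y ∣ * Ω) ≡⟨ cong (2 *_) (∑-*ʳ vs (λ x → 𝟙 (Y x)) Ω) ⟨
          2 * ∑V (λ x → 𝟙 (Y x) * Ω) ≤⟨ *-monoʳ-≤ 2 (∑-mono vs ptY) ⟩
          2 * ∑V (λ x → q₀ * ∑ is (λ i → ω i * 𝟙 (Y x ∧ serve i ψ x))) ≡⟨ trans (cong (2 *_) (∑-*ˡ vs q₀ _)) (sym (*-assoc 2 q₀ _)) ⟩
          2 * q₀ * ∑V (λ x → ∑ is (λ i → ω i * 𝟙 (Y x ∧ serve i ψ x))) ≡⟨ cong (2 * q₀ *_) (trans (∑-swap vs is _) (∑-cong is (λ i → ∑-*ˡ vs (ω i) _))) ⟩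
          2 * q₀ * ∑ is (λ i → ω i * hits ψ i) ≡⟨ ∑-pull is (2 * q₀) _ ⟩
          ∑ is (λ i → 2 * q₀ * (ω i * hits ψ i)) ≤⟨ ∑-mono is pt ⟩
          ∑ is (λ i → p * (2 * q₀ * (ω i * 𝟙 (heavy ψ i))) + p * ω i) ≡⟨ trans (∑-+ is _ _) (cong₂ _+_ (trans (∑-*ˡ is p _) (cong (p *_) (∑-*ˡ is (2 * q₀) _)))
               (trans (∑-*ˡ is p ω) (cong (p *_) Ω≡))) ⟩
          p * (2 * q₀ * Hw) + p * Ω ∎

  record Supply {I : Set} (u : I → Fin n) (B : I → VSet n) (valid : I → Bool) (least factor : ℕ)
    (T₁ X₁ : VSet n) (φ₁ : Fin n → Fin n) : Set where
    field
      {T X₀} : VSet n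
      {φ} : Fin n → Fin n
      state : State T X₁ φ
      T₁⊆T : T₁ ⊆ T
      agree : ∀ x → x ∈ T₁ → φ x ≡ φ₁ x
      X₀⊆T : X₀ ⊆ T
      X₀∉X₁ : ∀ x → x ∈ X₀ → x ∉ X₁
      indep₀ : Indep (X₁ ∪ X₀)
      plenty : ∀ i → valid i ≡ true → least ≤ factor * ∣ (λ x → X₀ x ∧ (B i (φ x) ∧ nbIn x φ (adj G (u i)))) ∣

  module Loop {I : Set} (is : List I) (complete : ∀ (f : I → ℕ) i → f i ≤ ∑ is f) (u : I → Fin n) (B : I → VSet n) (valid : I → Bool)
    (κ W q₀ b : ℕ) (W≡ : 2 * (2 * κ) ≤ W)
    (B⊆P : ∀ i → B i ⊆ P) (walks : ∀ i → valid i ≡ true → n * n ≤ κ * walk2 G P (u i) (B i))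
    (ok : BlockOK n D C Δ k s W W)
    (q₀≥ : 2 * gain-const D Δ k W W ≤ q₀) (b≡ : suc b ≡ 4 * q₀)
    (U cA p : ℕ) (room : Room U cA) (hp : p * ball-size ≤ w) (p>0 : 0 < p)
    (loss : 4 * κ * U ≤ n) (few : q₀ * s < n) (m : ℕ)
    (T₁ X₁ : VSet n) (φ₁ : Fin n → Fin n) (st₁ : State T₁ X₁ φ₁) (rounds : ℕ) (fits : rounds * s + ∣ T₁ ∣ ≤ U)
    (enough : b ^ rounds * (length is * 2 ^ m) < suc b ^ rounds) where

    served : I → (Fin n → Fin n) → Fin n → Bool
    served i φ x = B i (φ x) ∧ nbIn x φ (adj G (u i))

    ω : (I → ℕ) → I → ℕ
    ω sv i = 𝟙 (valid i) * weight m (sv i)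

    Ω : (I → ℕ) → ℕ
    Ω sv = ∑ is (ω sv)

    record Served (t : ℕ) : Set where
      field
        {T X₀} : VSet n
        {φ} : Fin n → Fin n
        sv : I → ℕ
        state : State T X₁ φ
        T₁⊆T : T₁ ⊆ T
        agree : ∀ x → x ∈ T₁ → φ x ≡ φ₁ x
        ∣T∣≤ : ∣ T ∣ ≤ t * s + ∣ T₁ ∣
        X₀⊆T : X₀ ⊆ T
        X₀∉X₁ : ∀ x → x ∈ X₀ → x ∉ X₁
        indep₀ : Indep (X₁ ∪ X₀)
        counted : ∀ i → sv i * p ≤ 2 * q₀ * ∣ (λ x → X₀ x ∧ served i φ x) ∣
        potential : suc b ^ t * Ω sv ≤ b ^ t * Ω (λ _ → 0)

    Ω₀≤ : Ω (λ _ → 0) ≤ length is * 2 ^ m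
    Ω₀≤ = ≤-trans (∑-mono is (λ i → ≤-trans (*-monoˡ-≤ (weight m 0) (𝟙≤1 (valid i))) (≤-trans (≤-reflexive (*-identityˡ _)) (weight≤ m 0))))
            (≤-reflexive (∑-const is (2 ^ m)))

    initial : Served 0
    initial = record
      { T = T₁ ; X₀ = ∅ ; φ = φ₁ ; sv = λ _ → 0 ; state = st₁ ; T₁⊆T = λ _ p → p ; agree = λ _ _ → refl ; ∣T∣≤ = ≤-refl
      ; X₀⊆T = λ _ () ; X₀∉X₁ = λ _ () ; indep₀ = ind ; counted = λ _ → z≤n ; potential = ≤-refl }
      where
      ind : Indep (X₁ ∪ ∅)
      ind x y p q with ∨-split {X₁ x} p | ∨-split {X₁ y} q
      ... | inj₁ a | inj₁ b = indep st₁ x y a b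

    serve-block : ∀ t → suc t * s + ∣ T₁ ∣ ≤ U → (sd : Served t) → FreshBlock p (Served.T sd) → 0 < Ω (Served.sv sd) → Served (suc t)
    serve-block t fit sd fb Ω>0 = finish (BS.place-all BS.block)
      where
      open Served sd
      T≤U : ∣ T ∣ ≤ U
      T≤U = ≤-trans ∣T∣≤ (≤-trans (+-monoˡ-≤ ∣ T₁ ∣ (m≤n+m (t * s) s)) fit)
      module BS = BlockStep is u B valid κ W q₀ W≡ B⊆P walks ok q₀≥ U loss few
        (ω sv) (Ω sv) refl Ω>0 (λ i h → 𝟙-pos (proj₁ (*-pos (𝟙 (valid i)) _ h))) T X₁ φ state T≤U fb p>0
      open BS using (Y; J; J⊆; J-closed; J≤s; X⊆J; ∣X∣≡p; X-apart)
      finish : BS.Placed → Served (suc t)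
      finish (ψ , e , g) = record
        { T = T ∪ J ; X₀ = X₀ ∪ Y ; φ = φ′ ; sv = sv′ ; state = st′ ; T₁⊆T = λ x p → ∨-∈ˡ (T₁⊆T x p)
        ; agree = λ x p → trans (keep {T} {J} {ψ} {φ} J⊆ x (T₁⊆T x p)) (agree x p)
        ; ∣T∣≤ = ≤-trans (∣∪∣≤ T J) (≤-trans (+-mono-≤ ∣T∣≤ J≤s) (≤-reflexive (l1 (t * s) ∣ T₁ ∣ s)))
        ; X₀⊆T = sub
        ; X₀∉X₁ = avoid
        ; indep₀ = ind
        ; counted = cnt
        ; potential = pot }
        where
        l1 : ∀ a b c → a + b + c ≡ c + a + b
        l1 = solve-∀
        φ′ = override G H J ψ φ
        sv′ : I → ℕ
        sv′ i = if BS.heavy ψ i then suc (sv i) else sv i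
        off : ∀ x → x ∈ J → x ∉ T
        off x p = ∖-∉ {A = Q} {T} (J⊆ x p)
        st₂ : State (T ∪ J) (X₁ ∪ ∅) φ′
        st₂ = add-block {T} {X₁} {φ} {J} {∅} {ψ} state J-closed J⊆ (λ _ ()) (λ _ _ ())
          (Emb-mono G H (λ _ p → p) (λ _ p → ∧-∈ˡ p) e)
        st′ : State (T ∪ J) X₁ φ′
        st′ = record
          { emb = Emb-mono G H (λ _ p → p) (λ x p → trans (cong (λ b → (T x ∨ J x) ∧ not b) (∨-identityʳ (X₁ x))) p) (emb st₂)
          ; closed = closed st₂ ; inQ = inQ st₂ ; holes = λ x p → ∨-∈ˡ (holes state x p) ; indep = indep st₁ }
        sub : (X₀ ∪ Y) ⊆ (T ∪ J)
        sub x p with ∨-split {X₀ x} p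
        ... | inj₁ q = ∨-∈ˡ (X₀⊆T x q)
        ... | inj₂ q = ∨-∈ʳ {T x} (X⊆J x q)
        avoid : ∀ x → x ∈ X₀ ∪ Y → x ∉ X₁
        avoid x p with ∨-split {X₀ x} p
        ... | inj₁ q = X₀∉X₁ x q
        ... | inj₂ q = ≢true (λ r → true≢false (holes state x r) (off x (X⊆J x q)))
        XX⊆T : (X₁ ∪ X₀) ⊆ T
        XX⊆T x p with ∨-split {X₁ x} p
        ... | inj₁ q = holes state x q
        ... | inj₂ q = X₀⊆T x q
        ind : Indep (X₁ ∪ (X₀ ∪ Y))
        ind x y p q = Indep-∪ {X₁ ∪ X₀} {T} {J} {Y} indep₀ XX⊆T (closed state) (apart⇒indep X-apart) X⊆J off x y (assoc x p) (assoc y q)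
          where
          assoc : ∀ z → z ∈ X₁ ∪ (X₀ ∪ Y) → z ∈ (X₁ ∪ X₀) ∪ Y
          assoc z r with X₁ z | X₀ z
          ... | true | _ = refl
          ... | false | true = refl
          ... | false | false = r
        disj : ∀ x i → x ∈ (λ x → X₀ x ∧ served i φ′ x) → x ∈ (λ x → Y x ∧ served i φ′ x) → ⊥
        disj x i p q = true≢false (X₀⊆T x (∧-∈ˡ {X₀ x} p)) (off x (X⊆J x (∧-∈ˡ {Y x} q)))
        old-new : ∀ i → ∣ (λ x → X₀ x ∧ served i φ x) ∣ + BS.hits ψ i ≤ ∣ (λ x → (X₀ ∪ Y) x ∧ served i φ′ x) ∣
        old-new i = ≤-trans (+-mono-≤
            (∣∣-mono {A = λ x → X₀ x ∧ served i φ x} {λ x → X₀ x ∧ served i φ′ x} (λ x p → ∧-∈ {X₀ x} (∧-∈ˡ {X₀ x} p)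
              (serve-cong′ {φ = φ} {φ′} {x} (keep {T} {J} {ψ} {φ} J⊆ x (X₀⊆T x (∧-∈ˡ {X₀ x} p)))
                (λ z r → keep {T} {J} {ψ} {φ} J⊆ z (closed-adj {T} (closed state) x z (X₀⊆T x (∧-∈ˡ {X₀ x} p)) r)) (∧-∈ʳ {X₀ x} p))))
            (∣∣-mono {A = λ x → Y x ∧ served i ψ x} {λ x → Y x ∧ served i φ′ x} (λ x p → ∧-∈ {Y x} (∧-∈ˡ {Y x} p)
              (serve-cong′ {φ = ψ} {φ′} {x} (override-∈ G H {J} ψ φ (X⊆J x (∧-∈ˡ {Y x} p)))
                (λ z r → override-∈ G H {J} ψ φ (closed-adj {J} J-closed x z (X⊆J x (∧-∈ˡ {Y x} p)) r)) (∧-∈ʳ {Y x} p)))))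
            (≤-trans (≤-reflexive (sym (∣∪∣-disjoint (λ x → X₀ x ∧ served i φ′ x) (λ x → Y x ∧ served i φ′ x) (λ x → disj x i))))
              (∣∣-mono {A = (λ x → X₀ x ∧ served i φ′ x) ∪ (λ x → Y x ∧ served i φ′ x)} {λ x → (X₀ ∪ Y) x ∧ served i φ′ x} inc))
          where
          serve-cong′ : ∀ {φ φ′ : Fin n → Fin n} {x} → φ′ x ≡ φ x → (∀ z → adj H x z ≡ true → φ′ z ≡ φ z) → served i φ x ≡ true → served i φ′ x ≡ true
          serve-cong′ {φ} {φ′} {x} e f h = ∧-∈ (trans (cong (B i) e) (∧-∈ˡ h)) (nbIn-cong {x} {φ} {φ′} {adj G (u i)} f (∧-∈ʳ {B i (φ x)} h))
          inc : ((λ x → X₀ x ∧ served i φ′ x) ∪ (λ x → Y x ∧ served i φ′ x)) ⊆ (λ x → (X₀ ∪ Y) x ∧ served i φ′ x)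
          inc x p with ∨-split {X₀ x ∧ served i φ′ x} p
          ... | inj₁ q = ∧-∈ {(X₀ ∪ Y) x} (∨-∈ˡ (∧-∈ˡ {X₀ x} q)) (∧-∈ʳ {X₀ x} q)
          ... | inj₂ q = ∧-∈ {(X₀ ∪ Y) x} (∨-∈ʳ {X₀ x} (∧-∈ˡ {Y x} q)) (∧-∈ʳ {Y x} q)
        cnt : ∀ i → sv′ i * p ≤ 2 * q₀ * ∣ (λ x → (X₀ ∪ Y) x ∧ served i φ′ x) ∣
        cnt i with BS.heavy ψ i in e
        ... | true = ≤-trans (+-mono-≤ (≤ᵇ⇒≤ p _ (≡⇒T e)) (counted i)) (≤-trans (≤-reflexive (trans
               (sym (*-distribˡ-+ (2 * q₀) (BS.hits ψ i) _)) (cong (2 * q₀ *_) (+-comm (BS.hits ψ i) _)))) (*-monoʳ-≤ (2 * q₀) (old-new i)))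
        ... | false = ≤-trans (counted i) (*-monoʳ-≤ (2 * q₀) (≤-trans (m≤m+n _ (BS.hits ψ i)) (old-new i)))
        halves : ∀ i → 2 * ω sv′ i + ω sv i * 𝟙 (BS.heavy ψ i) ≤ 2 * ω sv i
        halves i with BS.heavy ψ i
        ... | true = ≤-trans (+-mono-≤ (≤-trans (≤-reflexive (l2 (𝟙 (valid i)) (weight m (suc (sv i))))) (*-monoʳ-≤ (𝟙 (valid i)) (weight-suc m (sv i))))
               (≤-reflexive (*-identityʳ (ω sv i)))) (≤-reflexive (l3 (ω sv i)))
          where
          l2 : ∀ a b → 2 * (a * b) ≡ a * (2 * b)
          l2 = solve-∀
          l3 : ∀ a → a + a ≡ 2 * a
          l3 = solve-∀
        ... | false = ≤-reflexive (trans (cong (2 * ω sv i +_) (*-zeroʳ (ω sv i))) (+-identityʳ _))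
        shrink : suc b * Ω sv′ ≤ b * Ω sv
        shrink = +-cancelʳ-≤ (Ω sv) (suc b * Ω sv′) (b * Ω sv) (begin
          suc b * Ω sv′ + Ω sv ≤⟨ +-monoʳ-≤ (suc b * Ω sv′) (BS.heavy-weight ψ g) ⟩
          suc b * Ω sv′ + 2 * q₀ * Hw ≡⟨ cong (λ t → t * Ω sv′ + 2 * q₀ * Hw) b≡ ⟩
          4 * q₀ * Ω sv′ + 2 * q₀ * Hw ≡⟨ l4 q₀ (Ω sv′) Hw ⟩
          2 * q₀ * (2 * Ω sv′ + Hw) ≤⟨ *-monoʳ-≤ (2 * q₀) summed ⟩
          2 * q₀ * (2 * Ω sv) ≡⟨ trans (l5 q₀ (Ω sv)) (cong (_* Ω sv) (sym b≡)) ⟩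
          suc b * Ω sv ≡⟨ +-comm (Ω sv) _ ⟩
          b * Ω sv + Ω sv ∎)
          where
          open ≤-Reasoning
          Hw = ∑ is (λ i → ω sv i * 𝟙 (BS.heavy ψ i))
          l4 : ∀ q a h → 4 * q * a + 2 * q * h ≡ 2 * q * (2 * a + h)
          l4 = solve-∀
          l5 : ∀ q a → 2 * q * (2 * a) ≡ 4 * q * a
          l5 = solve-∀
          summed : 2 * Ω sv′ + Hw ≤ 2 * Ω sv
          summed = begin
            2 * Ω sv′ + Hw ≡⟨ cong (_+ Hw) (∑-pull is 2 (ω sv′)) ⟩
            ∑ is (λ i → 2 * ω sv′ i) + Hw ≡⟨ ∑-+ is _ _ ⟨
            ∑ is (λ i → 2 * ω sv′ i + ω sv i * 𝟙 (BS.heavy ψ i)) ≤⟨ ∑-mono is halves ⟩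
            ∑ is (λ i → 2 * ω sv i) ≡⟨ ∑-*ˡ is 2 (ω sv) ⟩
            2 * Ω sv ∎
        pot : suc b ^ suc t * Ω sv′ ≤ b ^ suc t * Ω (λ _ → 0)
        pot = begin
          suc b * suc b ^ t * Ω sv′ ≡⟨ l6 (suc b) (suc b ^ t) (Ω sv′) ⟩
          suc b ^ t * (suc b * Ω sv′) ≤⟨ *-monoʳ-≤ (suc b ^ t) shrink ⟩
          suc b ^ t * (b * Ω sv) ≡⟨ l7 (suc b ^ t) b (Ω sv) ⟩
          b * (suc b ^ t * Ω sv) ≤⟨ *-monoʳ-≤ b potential ⟩
          b * (b ^ t * Ω (λ _ → 0)) ≡⟨ *-assoc b (b ^ t) _ ⟨
          b * b ^ t * Ω (λ _ → 0) ∎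
          where
          open ≤-Reasoning
          l6 : ∀ a x y → a * x * y ≡ x * (a * y)
          l6 = solve-∀
          l7 : ∀ x b y → x * (b * y) ≡ b * (x * y)
          l7 = solve-∀

    AllServed : Set
    AllServed = ∃ λ t → Σ (Served t) λ sd → Ω (Served.sv sd) ≡ 0

    serving-phase : AllServed
    serving-phase = go rounds 0 z≤n (+-identityʳ rounds) initial
      where
      go : ∀ fuel t → t ≤ rounds → fuel + t ≡ rounds → Served t → AllServed
      go fuel t t≤ eq sd with Ω (Served.sv sd) in e
      ... | zero = t , sd , e
      go zero t t≤ eq sd | suc o = ⊥-elim (<-irrefl refl (<-≤-trans (≤-<-trans (*-monoʳ-≤ (b ^ rounds) Ω₀≤) enough)
          (≤-trans (≤-reflexive (sym (*-identityʳ (suc b ^ rounds)))) (≤-trans (*-monoʳ-≤ (suc b ^ rounds) (subst (1 ≤_) (sym e) (s≤s z≤n)))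
            (subst (λ r → suc b ^ r * Ω (Served.sv sd) ≤ b ^ r * Ω (λ _ → 0)) eq (Served.potential sd))))))
      go (suc fuel) t t≤ eq sd | suc o = go fuel (suc t) t<r (trans (+-suc fuel t) eq)
          (serve-block t fit sd (fresh-block room p hp (Served.T sd) (closed (Served.state sd)) (≤-trans (Served.∣T∣≤ sd) (≤-trans (+-monoˡ-≤ ∣ T₁ ∣ (m≤n+m (t * s) s)) fit))) (subst (0 <_) (sym e) (s≤s z≤n)))
        where
        t<r : t < rounds
        t<r = ≤-trans (s≤s (m≤n+m t fuel)) (≤-reflexive eq)
        fit : suc t * s + ∣ T₁ ∣ ≤ U
        fit = ≤-trans (+-monoˡ-≤ ∣ T₁ ∣ (*-monoˡ-≤ s t<r)) fits

    supply : Supply u B valid (m * p) (2 * q₀) T₁ X₁ φ₁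
    supply = go serving-phase
      where
      go : AllServed → Supply u B valid (m * p) (2 * q₀) T₁ X₁ φ₁
      go (t , sd , Ω0) = record
        { state = state ; T₁⊆T = T₁⊆T ; agree = agree ; X₀⊆T = X₀⊆T ; X₀∉X₁ = X₀∉X₁ ; indep₀ = indep₀
        ; plenty = λ i v → ≤-trans (*-monoˡ-≤ p (weight-0 m (sv i) (m+n≡0⇒m≡0 _ (trans (sym (cong (λ t → 𝟙 t * weight m (sv i)) v))
            (∑-zero is (ω sv) Ω0 i (complete (ω sv) i)))))) (counted i) }
        where open Served sd

  module _ (M c η : ℕ) (piece : Piece G P M c η) (num : PieceNumbers n D C Δ k M c η w ball-size) where

    open PieceNumbers num
    open Piece piece
    open Closure G n>0 P M c η piece M≤c (2 * (2 * η * (2 * η) * D)) (2 * (2 * M * (2 * M) * D)) κ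
      (λ Z h → dense-E G D C lin (2 * η) Z η≤C h) (λ Z h → dense-E G D C lin (2 * M) Z M≤C h) κ₁ κ₂

    L : ℕ
    L = suc κ

    module _ (P>0 : 0 < ∣ P ∣) where

      n≤M∣P∣ : n ≤ M * ∣ P ∣
      n≤M∣P∣ with ∣∣-∃ P P>0
      ... | x , p = ≤-trans (min-degree x p) (*-monoʳ-≤ M (∣∣-mono {A = adj G x ∩ P} {P} (λ y → ∧-∈ʳ {adj G x y})))

      M>0 : 0 < M
      M>0 = proj₁ (*-pos M ∣ P ∣ (<-≤-trans n>0 n≤M∣P∣))

      room : Room U (2 * M)
      room = record { room-P = rP ; room-Q = rQ }
        where
        open ≤-Reasoning
        rP : ∀ T X φ → State T X φ → ∣ T ∣ ≤ U → n ≤ 2 * M * ∣ free T X φ ∣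
        rP T X φ st h = half M n (count (free T X φ)) U (begin
            n ≤⟨ n≤M∣P∣ ⟩
            M * ∣ P ∣ ≤⟨ *-monoʳ-≤ M (≤-trans (m≤m+n ∣ P ∣ ∣ X ∣) (≤-trans (free-large {T} {X} {φ} (holes st)) (+-monoʳ-≤ (count (free T X φ)) h))) ⟩
            M * (count (free T X φ) + U) ∎)
            (≤-trans (*-monoʳ-≤ (2 * M) (m≤m+n U w)) roomy)
          where
          half : ∀ a n f U → n ≤ a * (f + U) → 2 * a * U ≤ n → n ≤ 2 * a * f
          half a n f U h h′ = cancel-cert n (2 * a * f) 0 (≤-trans (*-monoʳ-≤ 2 h) (≤-trans (≤-reflexive (l1 a f U)) (+-monoʳ-≤ (2 * a * f) h′))) (l2 n (2 * a * f))
            where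
            l1 : ∀ c b s → 2 * (c * (b + s)) ≡ 2 * c * b + 2 * c * s
            l1 = solve-∀
            l2 : ∀ n b → n + (b + n) + 0 ≡ b + 2 * n
            l2 = solve-∀
        rQ : ∀ T → ∣ T ∣ ≤ U → w ≤ ∣ Q ∖ T ∣
        rQ T h = +-cancelˡ-≤ U w (count (Q ∖ T)) (*-cancelˡ-≤ M ⦃ >-nonZero M>0 ⦄ (begin
          M * (U + w) ≤⟨ *-monoˡ-≤ (U + w) (m≤n*m M 2) ⟩
          2 * M * (U + w) ≤⟨ roomy ⟩
          n ≤⟨ n≤M∣P∣ ⟩
          M * ∣ P ∣ ≡⟨ cong (M *_) ∣Q∣≡∣P∣ ⟨
          M * ∣ Q ∣ ≤⟨ *-monoʳ-≤ M (≤-trans (∣∣≤∖+ Q T) (≤-trans (+-monoʳ-≤ (count (Q ∖ T)) h) (≤-reflexive (+-comm (count (Q ∖ T)) U)))) ⟩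
          M * (U + count (Q ∖ T)) ∎))

      open Holes M (2 * M) ok₁ min-degree U p room p-small using (HoleState; holes-phase)

      module AfterHoles (hs : HoleState t₁) where
        open HoleState hs renaming (T to T₁; X to X₁; φ to φ₁; state to st₁)

        I : Set
        I = Fin n × (Fin n × Fin L)

        is : List I
        is = pairs vs (pairs vs (allFin L))

        target : Fin n → ℕ → VSet n
        target y l = closure (candidates φ₁ y) l

        B : I → VSet n
        B (_ , y , l) = target y (toℕ l)

        valid : I → Bool
        valid (v , y , l) = n * n ≤ᵇ κ * walk2 G P v (target y (toℕ l))

        target⊆P : ∀ y l → target y l ⊆ P
        target⊆P y l = closure-⊆ (candidates φ₁ y) (λ _ p → ∧-∈ˡ p) l

        length-is : length is ≡ n * (n * L)
        length-is = trans (length-pairs vs (pairs vs (allFin L))) (cong₂ _*_ (length-allFin n) (trans (length-pairs vs (allFin L)) (cong₂ _*_ (length-allFin n) (length-allFin L))))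

        fits′ : rounds * s + ∣ T₁ ∣ ≤ U
        fits′ = ≤-trans (+-monoʳ-≤ (rounds * s) ∣T∣≤) (≤-trans (≤-reflexive (sym (*-distribʳ-+ s rounds t₁))) fits)

        supplied : Supply proj₁ B valid (m * p) (2 * q₀) T₁ X₁ φ₁
        supplied = Loop.supply is (∑-pairs-single vs (pairs vs (allFin L)) (λ f i → ∑V-single i f) (∑-pairs-single vs (allFin L) (λ f i → ∑V-single i f) (λ f i → ∑V-single i f)))
          proj₁ B valid κ W q₀ b W≥ (λ { (_ , y , l) → target⊆P y (toℕ l) }) (λ { (v , y , l) h → ≤ᵇ⇒≤ (n * n) _ (≡⇒T h) })
          ok₂ q₀≥ b≡ U (2 * M) p room p-small p>0 loss few m T₁ X₁ φ₁ st₁ rounds fits′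
          (subst (λ t → b ^ rounds * (t * 2 ^ m) < suc b ^ rounds) (sym length-is) enough)

        module AfterServing (sup : Supply proj₁ B valid (m * p) (2 * q₀) T₁ X₁ φ₁) where
          open Supply sup

          after-fill : (∃ λ T′ → ∃ λ φ′ → State T′ X₁ φ′ × Q ⊆ T′ × (∀ x → x ∈ T → φ′ x ≡ φ x)) → ∃ λ θ → Emb G H P Q θ
          after-fill (T′ , φ′ , st′ , full , ag) = Absorption.result G H P Q ∣Q∣≡∣P∣ X₁ X₀ φ′ target (λ v x → nbIn x φ′ (adj G v)) L (t₁ * p * L)
              (Emb-mono G H (λ _ p → p) (λ x p → ∈-∖ {A = T′} {X₁} (full x (∧-∈ˡ p)) (∖-∉ {A = Q} {X₁} p)) (emb st′))
              (λ x p → inQ st₁ x (holes st₁ x p)) (λ x p → inQ state x (X₀⊆T x p)) X₀∉X₁ indep₀ target⊆P base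
              (λ v x _ h → nbIn-elim {x} {φ′} {adj G v} h) large
              (λ y v y∈ → closure-full (candidates φ₁ y) (λ _ p → ∧-∈ˡ p) (≤-trans (many y y∈) (*-monoˡ-≤ _ λ₁≤c)) v)
              (≤-reflexive (cong (_* L) ∣X∣≡))
            where
            base : ∀ y v → y ∈ X₁ → v ∈ target y 0 → ∀ z → adj H y z ≡ true → adj G v (φ′ z) ≡ true
            base y v y∈ v∈ z q = trans (cong (adj G v) (trans (ag z (T₁⊆T z zT)) (agree z zT))) (nbIn-elim {y} {φ₁} {adj G v} (∧-∈ʳ {P v} v∈) z q)
              where
              zT : z ∈ T₁
              zT = closed-adj {T₁} (closed st₁) y z (holes st₁ y y∈) q
            large : ∀ v y l → v ∈ target y (suc l) → l < L → v ∉ target y l →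
              t₁ * p * L < ∣ (λ x → X₀ x ∧ (target y l (φ′ x) ∧ nbIn x φ′ (adj G v))) ∣
            large v y l v∈ l<L v∉ = *-cancelˡ-< (2 * q₀) (t₁ * p * L) _ (<-≤-trans absorbable (≤-trans (plenty i ok)
                (*-monoʳ-≤ (2 * q₀) (∣∣-mono {A = λ x → X₀ x ∧ (B i (φ x) ∧ nbIn x φ (adj G v))} {λ x → X₀ x ∧ (target y l (φ′ x) ∧ nbIn x φ′ (adj G v))} inc))))
              where
              i : I
              i = v , y , fromℕ< l<L
              eq : toℕ (fromℕ< l<L) ≡ l
              eq = toℕ-fromℕ< l<L
              ok : valid i ≡ true
              ok = walk-ok (next-walk (target y l) v v∈)
                where
                walk-ok : v ∈ target y l ⊎ n * n ≤ κ * walk2 G P v (target y l) → valid i ≡ true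
                walk-ok (inj₁ q) = true≢false q v∉
                walk-ok (inj₂ q) = T⇒≡ (≤⇒≤ᵇ (subst (λ j → n * n ≤ κ * walk2 G P v (target y j)) (sym eq) q))
              inc : (λ x → X₀ x ∧ (B i (φ x) ∧ nbIn x φ (adj G v))) ⊆ (λ x → X₀ x ∧ (target y l (φ′ x) ∧ nbIn x φ′ (adj G v)))
              inc x q = ∧-∈ {X₀ x} x∈ (∧-∈ {target y l (φ′ x)} (subst₂ (λ j z → z ∈ target y j) eq (sym (ag x (X₀⊆T x x∈))) (∧-∈ˡ {B i (φ x)} r))
                  (nbIn-cong {x} {φ} {φ′} {adj G v} (λ z h → ag z (closed-adj {T} (closed state) x z (X₀⊆T x x∈) h)) (∧-∈ʳ {B i (φ x)} r)))
                where
                x∈ : x ∈ X₀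
                x∈ = ∧-∈ˡ {X₀ x} q
                r : B i (φ x) ∧ nbIn x φ (adj G v) ≡ true
                r = ∧-∈ʳ {X₀ x} q

          filled : ∃ λ θ → Emb G H P Q θ
          filled = after-fill (fill ok₃ ∣ Q ∖ T ∣ T X₁ φ state (≤-trans holes-many (≤-reflexive (cong (cF *_) (sym ∣X∣≡)))) ≤-refl)

        conclusion : ∃ λ θ → Emb G H P Q θ
        conclusion = AfterServing.filled supplied

      piece-embed⁺ : ∃ λ θ → Emb G H P Q θ
      piece-embed⁺ = AfterHoles.conclusion (holes-phase t₁ enough-room)
        where
        enough-room : t₁ * s ≤ U
        enough-room = ≤-trans (*-monoˡ-≤ s (m≤n+m t₁ rounds)) fits

    piece-embed : ∃ λ θ → Emb G H P Q θ
    piece-embed with 0 <? ∣ P ∣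
    ... | yes h = piece-embed⁺ h
    ... | no ¬h = id , record
      { inP = λ x p → ⊥-elim (¬h (≤-trans (∈⇒∣∣>0 Q p) (≤-reflexive ∣Q∣≡∣P∣)))
      ; inj = λ x y p → ⊥-elim (¬h (≤-trans (∈⇒∣∣>0 Q p) (≤-reflexive ∣Q∣≡∣P∣)))
      ; hom = λ x y p → ⊥-elim (¬h (≤-trans (∈⇒∣∣>0 Q p) (≤-reflexive ∣Q∣≡∣P∣))) }

-- Splitting along sparse cuts

∃-set? : ∀ {n} {Φ : VSet n → Set} → (∀ A → Dec (Φ A)) → (∀ {A B} → (∀ x → A x ≡ B x) → Φ A → Φ B) → Dec (∃ Φ)
∃-set? {n} {Φ} dec respects = map′ (λ { (s , p) → lookup s , p })
  (λ { (A , p) → Data.Vec.tabulate A , respects (λ x → sym (Data.Vec.Properties.lookup∘tabulate A x)) p })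
  (Data.Fin.Subset.Properties.anySubset? (λ s → dec (lookup s)))

⊆-dec : ∀ {n} (A B : VSet n) → Dec (A ⊆ B)
⊆-dec A B = map′ to from (∀ᵇ (λ x → not (A x) ∨ B x) Data.Bool.≟ true)
  where
  to : ∀ᵇ (λ x → not (A x) ∨ B x) ≡ true → A ⊆ B
  to h x p with ∀ᵇ-elim {A = λ x → not (A x) ∨ B x} h x
  ... | q rewrite p = q
  from : A ⊆ B → ∀ᵇ (λ x → not (A x) ∨ B x) ≡ true
  from s = ∀ᵇ-intro {A = λ x → not (A x) ∨ B x} pt
    where
    pt : ∀ x → not (A x) ∨ B x ≡ true
    pt x with A x in e
    ... | true = s x e
    ... | false = refl

cut-cong : ∀ {n} (G : Graph n) {A A′ B B′ : VSet n} → (∀ x → A x ≡ A′ x) → (∀ x → B x ≡ B′ x) → cut G A B ≡ cut G A′ B′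
cut-cong {n} G a b = ∑-cong (allFin n) (λ u → cong₂ (λ s t → 𝟙 s * t) (a u) (∣∣-cong (λ v → cong (adj G u v ∧_) (b v))))

cut-mono : ∀ {n} (G : Graph n) {A A′ B B′ : VSet n} → A ⊆ A′ → B ⊆ B′ → cut G A B ≤ cut G A′ B′
cut-mono {n} G {A} {A′} {B} {B′} a b = ∑-mono (allFin n) (λ u → *-mono-≤ (𝟙-mono (a u))
  (∣∣-mono {A = adj G u ∩ B} {adj G u ∩ B′} (λ v p → ∧-∈ (∧-∈ˡ p) (b v (∧-∈ʳ {adj G u v} p)))))

Nb-split : ∀ {n} (G : Graph n) u {A B C : VSet n} → (∀ x → x ∈ A → x ∈ B ⊎ x ∈ C) → Nb G u A ≤ Nb G u B + Nb G u C
Nb-split G u {A} {B} {C} h = ≤-trans (∣∣-mono {A = adj G u ∩ A} {(adj G u ∩ B) ∪ (adj G u ∩ C)} inc) (∣∪∣≤ (adj G u ∩ B) (adj G u ∩ C))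
  where
  inc : (adj G u ∩ A) ⊆ ((adj G u ∩ B) ∪ (adj G u ∩ C))
  inc x p with h x (∧-∈ʳ {adj G u x} p)
  ... | inj₁ q = ∨-∈ˡ (∧-∈ (∧-∈ˡ {adj G u x} p) q)
  ... | inj₂ q = ∨-∈ʳ {adj G u x ∧ B x} (∧-∈ (∧-∈ˡ {adj G u x} p) q)

cut-splitʳ : ∀ {n} (G : Graph n) (U : VSet n) {A B C : VSet n} → (∀ x → x ∈ A → x ∈ B ⊎ x ∈ C) → cut G U A ≤ cut G U B + cut G U C
cut-splitʳ {n} G U {A} {B} {C} h = ≤-trans (∑-mono (allFin n) (λ u → ≤-trans (*-monoʳ-≤ (𝟙 (U u)) (Nb-split G u {A} {B} {C} h))
  (≤-reflexive (*-distribˡ-+ (𝟙 (U u)) (Nb G u B) (Nb G u C))))) (≤-reflexive (∑-+ (allFin n) _ _))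

E≤ : ∀ {n} (G : Graph n) (A : VSet n) → cut G A A ≤ ∣ A ∣ * ∣ A ∣
E≤ {n} G A = ≤-trans (∑-mono (allFin n) (λ u → *-monoʳ-≤ (𝟙 (A u)) (∣∣-mono {A = adj G u ∩ A} {A} (λ x → ∧-∈ʳ {adj G u x}))))
  (≤-reflexive (∑-*ʳ (allFin n) (λ u → 𝟙 (A u)) ∣ A ∣))

cut-single : ∀ {n} (G : Graph n) v (B : VSet n) → cut G ⁅ v ⁆ B ≡ Nb G v B
cut-single G v B = ∑V-δ v (λ u → Nb G u B)

cut-move : ∀ {n} (G : Graph n) (A B : VSet n) v → v ∈ A → v ∉ B →
  cut G (A ∖ ⁅ v ⁆) (B ∪ ⁅ v ⁆) + Nb G v B ≡ cut G A B + Nb G v A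
cut-move {n} G A B v v∈ v∉ = begin
  cut G A′ (B ∪ ⁅ v ⁆) + Nb G v B ≡⟨ cong (_+ Nb G v B) right ⟩
  cut G A′ B + Nb G v A + Nb G v B ≡⟨ l (cut G A′ B) (Nb G v A) (Nb G v B) ⟩
  cut G A′ B + Nb G v B + Nb G v A ≡⟨ cong (_+ Nb G v A) left ⟩
  cut G A B + Nb G v A ∎
  where
  open ≡-Reasoning
  vs = allFin n
  A′ = A ∖ ⁅ v ⁆
  l : ∀ a b c → a + b + c ≡ a + c + b
  l = solve-∀
  left : cut G A′ B + Nb G v B ≡ cut G A B
  left = trans (cong (cut G A′ B +_) (sym (cut-single G v B))) (trans (sym (∑-+ vs _ _)) (∑-cong vs pt))
    where
    pt : ∀ u → 𝟙 (A′ u) * Nb G u B + 𝟙 (⁅ v ⁆ u) * Nb G u B ≡ 𝟙 (A u) * Nb G u B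
    pt u = trans (sym (*-distribʳ-+ (Nb G u B) (𝟙 (A′ u)) (𝟙 (⁅ v ⁆ u)))) (cong (_* Nb G u B) bits)
      where
      bits : 𝟙 (A′ u) + 𝟙 (⁅ v ⁆ u) ≡ 𝟙 (A u)
      bits with A u in e | v ≟F u
      ... | true | yes _ = refl
      ... | true | no _ = refl
      ... | false | yes refl = true≢false v∈ e
      ... | false | no _ = refl
  right : cut G A′ (B ∪ ⁅ v ⁆) ≡ cut G A′ B + Nb G v A
  right = trans (∑-cong vs (λ u → trans (cong (𝟙 (A′ u) *_) (trans (∣∣-cong (λ x → dist (adj G u x) (B x) (⁅ v ⁆ x)))
      (∣∪∣-disjoint (adj G u ∩ B) (adj G u ∩ ⁅ v ⁆) (λ x p q → true≢false (subst (_∈ B) (sym (∈-⁅⁆ (∧-∈ʳ {adj G u x} q))) (∧-∈ʳ {adj G u x} p)) v∉))))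
      (*-distribˡ-+ (𝟙 (A′ u)) (Nb G u B) (Nb G u ⁅ v ⁆)))) (trans (∑-+ vs _ _) (cong (cut G A′ B +_)
      (trans (cut-sym G A′ ⁅ v ⁆) (trans (cut-single G v A′) (∣∣-cong same)))))
    where
    dist : ∀ a b c → a ∧ (b ∨ c) ≡ (a ∧ b) ∨ (a ∧ c)
    dist true b c = refl
    dist false b c = refl
    same : ∀ x → adj G v x ∧ A′ x ≡ adj G v x ∧ A x
    same x with v ≟F x
    ... | no _ = cong (adj G v x ∧_) (∧-identityʳ (A x))
    ... | yes refl rewrite irrefl G v = refl

module Splitting {n : ℕ} (G H : Graph n) (n>0 : 0 < n) (rep : Fin n → Fin n) (rep-adj : ∀ x y → adj H x y ≡ true → rep x ≡ rep y)
  (M J c η : ℕ) (J≡ : J ≡ 2 * M) (degree : ∀ u → n ≤ M * Nb G u (λ _ → true))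
  (c≥ : 4 * (2 ^ J * M) ≤ c) (η≥ : 2 * c * (2 ^ J * M) * suc J < η) (n≥c : c ≤ n)
  (Rich : ℕ → VSet n → Set)
  (split : ∀ j Q a → j < J → Rich j Q → Closed rep Q → n ≤ 2 * M * a → n + 2 * M * a ≤ 2 * M * ∣ Q ∣ →
    ∃ λ R → R ⊆ Q × Closed rep R × ∣ R ∣ ≡ a × Rich (suc j) R × Rich (suc j) (Q ∖ R))
  (embed-piece : ∀ P Q → Closed rep Q → ∣ Q ∣ ≡ ∣ P ∣ → Piece G P (2 ^ J * M) c η → ∃ λ θ → Emb G H P Q θ) where

  private vs = allFin n

  M′ : ℕ → ℕ
  M′ j = 2 ^ j * M

  M>0 : 0 < M
  M>0 = proj₁ (*-pos M _ (<-≤-trans n>0 (degree (fromℕ< n>0))))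

  light-large : ∀ (B X Y : VSet n) Mx t → n ≤ c * ∣ B ∣ → (∀ u → u ∈ B → n ≤ Mx * Nb G u X) → (∀ x → x ∈ X → x ∈ B ⊎ x ∈ Y) →
    η * cut G B Y ≤ t * (n * n) → 2 * c * Mx * t < η → n ≤ 2 * Mx * ∣ B ∣
  light-large B X Y Mx t hB hd cover hc hη with n ≤? 2 * Mx * ∣ B ∣
  ... | yes h = h
  ... | no ¬h = ⊥-elim (<-irrefl refl (<-≤-trans hη (*-cancelʳ-≤ η (2 * c * Mx * t) (n * n) ⦃ >-nonZero (*-mono-≤ n>0 n>0) ⦄ (begin
      η * (n * n) ≤⟨ *-monoʳ-≤ η (*-monoˡ-≤ n hB) ⟩
      η * (c * ∣ B ∣ * n) ≡⟨ l3 η c ∣ B ∣ n ⟩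
      c * η * (∣ B ∣ * n) ≤⟨ *-monoʳ-≤ (c * η) small ⟩
      c * η * (2 * Mx * cut G B Y) ≡⟨ l4 c η Mx (cut G B Y) ⟩
      2 * c * Mx * (η * cut G B Y) ≤⟨ *-monoʳ-≤ (2 * c * Mx) hc ⟩
      2 * c * Mx * (t * (n * n)) ≡⟨ *-assoc (2 * c * Mx) t (n * n) ⟨
      2 * c * Mx * t * (n * n) ∎))))
    where
    open ≤-Reasoning
    l3 : ∀ η c b n → η * (c * b * n) ≡ c * η * (b * n)
    l3 = solve-∀
    l4 : ∀ c η m x → c * η * (2 * m * x) ≡ 2 * c * m * (η * x)
    l4 = solve-∀
    l1 : ∀ m b x → 2 * (m * (b * b + x)) ≡ 2 * m * b * b + 2 * m * x
    l1 = solve-∀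
    l2 : ∀ a x → a + (a + x) + 0 ≡ x + 2 * a
    l2 = solve-∀
    degsum : ∣ B ∣ * n ≤ Mx * (∣ B ∣ * ∣ B ∣ + cut G B Y)
    degsum = begin
      ∣ B ∣ * n ≡⟨ ∑-*ʳ vs (λ u → 𝟙 (B u)) n ⟨
      ∑V (λ u → 𝟙 (B u) * n) ≤⟨ ∑-mono vs pt ⟩
      ∑V (λ u → Mx * (𝟙 (B u) * Nb G u X)) ≡⟨ ∑-*ˡ vs Mx _ ⟩
      Mx * cut G B X ≤⟨ *-monoʳ-≤ Mx (≤-trans (cut-splitʳ G B {X} {B} {Y} cover) (+-monoˡ-≤ (cut G B Y) (E≤ G B))) ⟩
      Mx * (∣ B ∣ * ∣ B ∣ + cut G B Y) ∎
      where
      pt : ∀ u → 𝟙 (B u) * n ≤ Mx * (𝟙 (B u) * Nb G u X)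
      pt u with B u in e
      ... | false = z≤n
      ... | true = ≤-trans (≤-reflexive (+-identityʳ n)) (≤-trans (hd u e) (≤-reflexive (cong (Mx *_) (sym (+-identityʳ (Nb G u X))))))
    small : ∣ B ∣ * n ≤ 2 * Mx * cut G B Y
    small = cancel-cert (∣ B ∣ * n) (2 * Mx * cut G B Y) 0 (begin
      2 * (∣ B ∣ * n) ≤⟨ *-monoʳ-≤ 2 degsum ⟩
      2 * (Mx * (∣ B ∣ * ∣ B ∣ + cut G B Y)) ≡⟨ l1 Mx ∣ B ∣ (cut G B Y) ⟩
      2 * Mx * ∣ B ∣ * ∣ B ∣ + 2 * Mx * cut G B Y ≤⟨ +-monoˡ-≤ (2 * Mx * cut G B Y) (≤-trans (*-monoˡ-≤ ∣ B ∣ (<⇒≤ (≰⇒> ¬h))) (≤-reflexive (*-comm n ∣ B ∣))) ⟩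
      ∣ B ∣ * n + 2 * Mx * cut G B Y ∎) (l2 (∣ B ∣ * n) (2 * Mx * cut G B Y))

  record Part (j : ℕ) (P : VSet n) : Set where
    field
      deg-in : ∀ u → u ∈ P → n ≤ M′ j * Nb G u P
      few-out : η * cut G P (λ x → not (P x)) ≤ j * (n * n)
      size : 2 * M * ∣ P ∣ + j * n ≤ 2 * M * n
  open Part

  record LightCut (P A B : VSet n) : Set where
    field
      cover : ∀ x → x ∈ P → x ∈ A ⊎ x ∈ B
      A⊆ : A ⊆ P
      B⊆ : B ⊆ P
      disj : ∀ x → x ∈ A → x ∉ B
      A-large : n ≤ c * ∣ A ∣
      B-large : n ≤ c * ∣ B ∣
      light : η * cut G A B < n * n
  open LightCut

  swap-cut : ∀ {P A B} → LightCut P A B → LightCut P B A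
  swap-cut {P} {A} {B} h = record
    { cover = λ x p → Data.Sum.swap (cover h x p) ; A⊆ = B⊆ h ; B⊆ = A⊆ h
    ; disj = λ x p → ≢true (λ q → true≢false p (disj h x q)) ; A-large = B-large h ; B-large = A-large h
    ; light = subst (λ t → η * t < n * n) (cut-sym G A B) (light h) }

  module _ (j : ℕ) (j<J : j < J) (P : VSet n) (part : Part j P) where

    M′>0 : 0 < M′ j
    M′>0 = *-mono-≤ (m^n>0 2 j) M>0

    M′≤ : M′ j ≤ 2 ^ J * M
    M′≤ = *-monoˡ-≤ M (^-monoʳ-≤ 2 (<⇒≤ j<J))

    side-large : ∀ {A B} → LightCut P A B → n ≤ 2 * M′ j * ∣ A ∣
    side-large {A} {B} h = light-large A P B (M′ j) 1 (A-large h) (λ u p → deg-in part u (A⊆ h u p)) (cover h)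
      (≤-trans (<⇒≤ (light h)) (≤-reflexive (sym (*-identityˡ (n * n)))))
      (≤-<-trans (*-mono-≤ (*-monoʳ-≤ (2 * c) M′≤) (s≤s z≤n)) η≥)

    move : ∀ {A B} → LightCut P A B → ∀ v → v ∈ A → Nb G v A < Nb G v B → LightCut P (A ∖ ⁅ v ⁆) (B ∪ ⁅ v ⁆) × cut G (A ∖ ⁅ v ⁆) (B ∪ ⁅ v ⁆) < cut G A B
    move {A} {B} h v v∈ lt = record
        { cover = cov ; A⊆ = λ x p → A⊆ h x (∧-∈ˡ p) ; B⊆ = bsub ; disj = dj
        ; A-large = shrunk ; B-large = ≤-trans (B-large h) (*-monoʳ-≤ c (∣∣-mono {A = B} {B ∪ ⁅ v ⁆} (λ _ → ∨-∈ˡ)))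
        ; light = ≤-<-trans (*-monoʳ-≤ η (<⇒≤ drop)) (light h) } , drop
      where
      open ≤-Reasoning
      drop : cut G (A ∖ ⁅ v ⁆) (B ∪ ⁅ v ⁆) < cut G A B
      drop = +-cancelʳ-< (Nb G v B) _ _ (subst (_< cut G A B + Nb G v B) (sym (cut-move G A B v v∈ (disj h v v∈))) (+-monoʳ-< (cut G A B) lt))
      cov : ∀ x → x ∈ P → x ∈ A ∖ ⁅ v ⁆ ⊎ x ∈ B ∪ ⁅ v ⁆
      cov x p with cover h x p | Bool-dec (⁅ v ⁆ x)
      ... | inj₂ q | _ = inj₂ (∨-∈ˡ q)
      ... | inj₁ q | inj₁ r = inj₂ (∨-∈ʳ {B x} r)
      ... | inj₁ q | inj₂ r = inj₁ (∈-∖ {A = A} {⁅ v ⁆} q r)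
      bsub : (B ∪ ⁅ v ⁆) ⊆ P
      bsub x p with ∨-split {B x} p
      ... | inj₁ q = B⊆ h x q
      ... | inj₂ q = subst (_∈ P) (∈-⁅⁆ q) (A⊆ h v v∈)
      dj : ∀ x → x ∈ A ∖ ⁅ v ⁆ → x ∉ B ∪ ⁅ v ⁆
      dj x p = cong₂ _∨_ (disj h x (∧-∈ˡ p)) (∖-∉ {A = A} {⁅ v ⁆} p)
      shrunk : n ≤ c * ∣ A ∖ ⁅ v ⁆ ∣
      shrunk = +-cancelˡ-≤ c n (c * ∣ A ∖ ⁅ v ⁆ ∣) (begin
        c + n ≤⟨ +-monoˡ-≤ n n≥c ⟩
        n + n ≡⟨ l0 n ⟩
        2 * n ≤⟨ *-monoʳ-≤ 2 (side-large h) ⟩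
        2 * (2 * M′ j * ∣ A ∣) ≡⟨ l1 (M′ j) ∣ A ∣ ⟩
        4 * M′ j * ∣ A ∣ ≤⟨ *-monoˡ-≤ ∣ A ∣ (≤-trans (*-monoʳ-≤ 4 M′≤) c≥) ⟩
        c * ∣ A ∣ ≡⟨ cong (c *_) (∣∖⁅⁆∣ {A = A} v∈) ⟩
        c * suc ∣ A ∖ ⁅ v ⁆ ∣ ≡⟨ *-suc c _ ⟩
        c + c * ∣ A ∖ ⁅ v ⁆ ∣ ∎)
        where
        l0 : ∀ n → n + n ≡ 2 * n
        l0 = solve-∀
        l1 : ∀ m a → 2 * (2 * m * a) ≡ 4 * m * a
        l1 = solve-∀

    Stable : VSet n → VSet n → Set
    Stable A B = ∀ v → v ∈ A → Nb G v B ≤ Nb G v A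

    stabilise : ∀ fuel {A B} → LightCut P A B → cut G A B < fuel → ∃ λ A′ → ∃ λ B′ → LightCut P A′ B′ × Stable A′ B′ × Stable B′ A′
    stabilise zero h ()
    stabilise (suc fuel) {A} {B} h bd with Bool-dec (∃ᵇ (λ v → A v ∧ (Nb G v A <ᵇ Nb G v B)))
    ... | inj₁ e = let (v , p) = ∃ᵇ-elim {A = λ v → A v ∧ (Nb G v A <ᵇ Nb G v B)} e
                       (h′ , drop) = move h v (∧-∈ˡ p) (<ᵇ⇒< _ _ (≡⇒T (∧-∈ʳ {A v} p)))
                   in stabilise fuel h′ (<-≤-trans drop (s≤s⁻¹ bd))
    ... | inj₂ e with Bool-dec (∃ᵇ (λ v → B v ∧ (Nb G v B <ᵇ Nb G v A)))
    ...   | inj₁ e′ = let (v , p) = ∃ᵇ-elim {A = λ v → B v ∧ (Nb G v B <ᵇ Nb G v A)} e′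
                          (h′ , drop) = move (swap-cut h) v (∧-∈ˡ p) (<ᵇ⇒< _ _ (≡⇒T (∧-∈ʳ {B v} p)))
                      in stabilise fuel h′ (<-≤-trans drop (≤-trans (≤-reflexive (cut-sym G B A)) (s≤s⁻¹ bd)))
    ...   | inj₂ e′ = A , B , h , stable A B e , stable B A e′
      where
      stable : ∀ A B → ∃ᵇ (λ v → A v ∧ (Nb G v A <ᵇ Nb G v B)) ≡ false → Stable A B
      stable A B e v p = ≮⇒≥ (λ q → true≢false (∃ᵇ-intro {A = λ v → A v ∧ (Nb G v A <ᵇ Nb G v B)} v (∧-∈ p (T⇒≡ (<⇒<ᵇ q)))) e)

    side-out : ∀ {A B} → LightCut P A B → η * cut G A (λ x → not (A x)) ≤ suc j * (n * n)
    side-out {A} {B} h = begin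
      η * cut G A (λ x → not (A x)) ≤⟨ *-monoʳ-≤ η (cut-splitʳ G A {λ x → not (A x)} {B} {λ x → not (P x)} sp) ⟩
      η * (cut G A B + cut G A (λ x → not (P x))) ≡⟨ *-distribˡ-+ η (cut G A B) _ ⟩
      η * cut G A B + η * cut G A (λ x → not (P x)) ≤⟨ +-mono-≤ (<⇒≤ (light h)) (≤-trans (*-monoʳ-≤ η (cut-mono G {A} {P} {λ x → not (P x)} (A⊆ h) (λ _ p → p))) (few-out part)) ⟩
      suc j * (n * n) ∎
      where
      open ≤-Reasoning
      sp : ∀ x → not (A x) ≡ true → x ∈ B ⊎ not (P x) ≡ true
      sp x p with Bool-dec (P x)
      ... | inj₂ q = inj₂ (not-∈ q)
      ... | inj₁ q with cover h x q
      ...   | inj₁ r = true≢false r (not-∉ p)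
      ...   | inj₂ r = inj₁ r

    really-large : ∀ {A B} → LightCut P A B → n ≤ 2 * M * ∣ A ∣
    really-large {A} {B} h = light-large A (λ _ → true) (λ x → not (A x)) M (suc j) (A-large h) (λ u _ → degree u) all (side-out h)
      (≤-<-trans (*-mono-≤ (*-monoʳ-≤ (2 * c) (m≤n*m M (2 ^ J) ⦃ m^n≢0 2 J ⦄)) (s≤s (<⇒≤ j<J))) η≥)
      where
      all : ∀ x → true ≡ true → x ∈ A ⊎ not (A x) ≡ true
      all x _ with A x
      ... | true = inj₁ refl
      ... | false = inj₂ refl

    sizes : ∀ {A B} → LightCut P A B → ∣ P ∣ ≡ ∣ A ∣ + ∣ B ∣
    sizes {A} {B} h = trans (∣∣-cong pt) (∣∪∣-disjoint A B (λ x p q → true≢false q (disj h x p)))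
      where
      pt : ∀ x → P x ≡ A x ∨ B x
      pt x with Bool-dec (P x)
      ... | inj₁ q = trans q (sym (case cover h x q of λ { (inj₁ r) → ∨-∈ˡ r ; (inj₂ r) → ∨-∈ʳ {A x} r }))
      ... | inj₂ q = trans q (sym (cong₂ _∨_ (≢true (λ r → true≢false (A⊆ h x r) q)) (≢true (λ r → true≢false (B⊆ h x r) q))))

    side-part : ∀ {A B} → LightCut P A B → Stable A B → Part (suc j) A
    side-part {A} {B} h st = record { deg-in = di ; few-out = side-out h ; size = sz }
      where
      open ≤-Reasoning
      di : ∀ u → u ∈ A → n ≤ M′ (suc j) * Nb G u A
      di u p = begin
        n ≤⟨ deg-in part u (A⊆ h u p) ⟩
        M′ j * Nb G u P ≤⟨ *-monoʳ-≤ (M′ j) (≤-trans (Nb-split G u {P} {A} {B} (cover h)) (+-monoʳ-≤ (Nb G u A) (st u p))) ⟩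
        M′ j * (Nb G u A + Nb G u A) ≡⟨ l (2 ^ j) M (Nb G u A) ⟩
        M′ (suc j) * Nb G u A ∎
        where l : ∀ e m a → e * m * (a + a) ≡ 2 * e * m * a
              l = solve-∀
      sz : 2 * M * ∣ A ∣ + suc j * n ≤ 2 * M * n
      sz = begin
        2 * M * ∣ A ∣ + (n + j * n) ≤⟨ +-monoʳ-≤ (2 * M * ∣ A ∣) (+-monoˡ-≤ (j * n) (really-large (swap-cut h))) ⟩
        2 * M * ∣ A ∣ + (2 * M * ∣ B ∣ + j * n) ≡⟨ l (2 * M) ∣ A ∣ ∣ B ∣ (j * n) ⟩
        2 * M * (∣ A ∣ + ∣ B ∣) + j * n ≡⟨ cong (λ t → 2 * M * t + j * n) (sizes h) ⟨
        2 * M * ∣ P ∣ + j * n ≤⟨ size part ⟩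
        2 * M * n ∎
        where l : ∀ m a b c → m * a + (m * b + c) ≡ m * (a + b) + c
              l = solve-∀

    cut? : Dec (∃ λ A → A ⊆ P × n ≤ c * ∣ A ∣ × n ≤ c * ∣ P ∖ A ∣ × η * cut G A (P ∖ A) < n * n)
    cut? = ∃-set? (λ A → ⊆-dec A P ×-dec (n ≤? c * ∣ A ∣) ×-dec (n ≤? c * ∣ P ∖ A ∣) ×-dec (η * cut G A (P ∖ A) <? n * n)) respects
      where
      respects : ∀ {A B} → (∀ x → A x ≡ B x) → A ⊆ P × n ≤ c * ∣ A ∣ × n ≤ c * ∣ P ∖ A ∣ × η * cut G A (P ∖ A) < n * n →
        B ⊆ P × n ≤ c * ∣ B ∣ × n ≤ c * ∣ P ∖ B ∣ × η * cut G B (P ∖ B) < n * n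
      respects {A} {B} e (a , b , d , f) = (λ x p → a x (trans (e x) p)) , subst (λ t → n ≤ c * t) (∣∣-cong e) b ,
        subst (λ t → n ≤ c * t) (∣∣-cong (λ x → cong (λ t → P x ∧ not t) (e x))) d ,
        subst (λ t → η * t < n * n) (cut-cong G e (λ x → cong (λ t → P x ∧ not t) (e x))) f

  split-embed : ∀ fuel j → fuel + j ≡ J → ∀ P Q → Part j P → Rich j Q → Closed rep Q → ∣ Q ∣ ≡ ∣ P ∣ → ∃ λ θ → Emb G H P Q θ
  split-embed zero j eq P Q part rich cQ e = id , record
      { inP = λ x p → ⊥-elim (empty x p) ; inj = λ x _ p → ⊥-elim (empty x p) ; hom = λ x _ p → ⊥-elim (empty x p) }
    where
    empty : ∀ x → x ∈ Q → ⊥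
    empty x p = <-irrefl refl (<-≤-trans (*-mono-≤ {1} {2 * M} (≤-trans M>0 (m≤n*m M 2)) (subst (0 <_) e (∈⇒∣∣>0 Q p)))
      (+-cancelʳ-≤ (2 * M * n) (2 * M * ∣ P ∣) 0 (subst (λ t → 2 * M * ∣ P ∣ + t * n ≤ 2 * M * n) (trans eq J≡) (size part))))
  split-embed (suc fuel) j eq P Q part rich cQ e = decide (cut? j j<J P part)
    where
    j<J : j < J
    j<J = ≤-trans (s≤s (m≤n+m j fuel)) (≤-reflexive eq)
    eq′ : fuel + suc j ≡ J
    eq′ = trans (+-suc fuel j) eq
    halves : (∃ λ A → ∃ λ B → LightCut P A B × Stable j j<J P part A B × Stable j j<J P part B A) → ∃ λ θ → Emb G H P Q θ
    halves (A , B , h , sA , sB) = with-split (split j Q ∣ A ∣ j<J rich cQ (really-large j j<J P part h) (begin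
        n + 2 * M * ∣ A ∣ ≤⟨ +-monoˡ-≤ (2 * M * ∣ A ∣) (really-large j j<J P part (swap-cut h)) ⟩
        2 * M * ∣ B ∣ + 2 * M * ∣ A ∣ ≡⟨ l (2 * M) ∣ A ∣ ∣ B ∣ ⟩
        2 * M * (∣ A ∣ + ∣ B ∣) ≡⟨ cong (2 * M *_) (trans (sym (sizes j j<J P part h)) (sym e)) ⟩
        2 * M * ∣ Q ∣ ∎))
      where
      open ≤-Reasoning
      l : ∀ m a b → m * b + m * a ≡ m * (a + b)
      l = solve-∀
      with-split : (∃ λ R → R ⊆ Q × Closed rep R × ∣ R ∣ ≡ ∣ A ∣ × Rich (suc j) R × Rich (suc j) (Q ∖ R)) → ∃ λ θ → Emb G H P Q θ
      with-split (R , R⊆Q , cR , ∣R∣ , rR , rS) = join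
          (split-embed fuel (suc j) eq′ A R (side-part j j<J P part h sA) rR cR ∣R∣)
          (split-embed fuel (suc j) eq′ B (Q ∖ R) (side-part j j<J P part (swap-cut h) sB) rS (Closed-∖ rep {Q} {R} cQ cR) ∣S∣)
        where
        ∣S∣ : ∣ Q ∖ R ∣ ≡ ∣ B ∣
        ∣S∣ = +-cancelˡ-≡ ∣ A ∣ _ _ (trans (cong (_+ ∣ Q ∖ R ∣) (sym ∣R∣)) (trans (sym (∣∖∣-⊆ {A = Q} {R} R⊆Q)) (trans e (sizes j j<J P part h))))
        join : (∃ λ θ → Emb G H A R θ) → (∃ λ θ → Emb G H B (Q ∖ R) θ) → ∃ λ θ → Emb G H P Q θ
        join (θ , eθ) (ψ , eψ) = override G H (Q ∖ R) ψ θ , Emb-mono G H (λ _ p → p) sub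
            (merge G H (Emb-mono G H (A⊆ h) (λ _ p → p) eθ) (Emb-mono G H (B⊆ h) (λ _ p → p) eψ) sep cross)
          where
          sub : Q ⊆ (R ∪ (Q ∖ R))
          sub x p with R x
          ... | true = refl
          ... | false = trans (∧-identityʳ (Q x)) p
          sep : ∀ x y → x ∈ R → x ∉ Q ∖ R → y ∈ Q ∖ R → θ x ≡ ψ y → ⊥
          sep x y p _ q r = true≢false (inP eψ y q) (subst (_∉ B) r (disj h (θ x) (inP eθ x p)))
          cross : ∀ x y → x ∈ R → x ∉ Q ∖ R → y ∈ Q ∖ R → adj H x y ≡ true → adj G (θ x) (ψ y) ≡ true
          cross x y p _ q r = true≢false (cR x y p (rep-adj x y r)) (∖-∉ {A = Q} {R} q)
    decide : Dec (∃ λ A → A ⊆ P × n ≤ c * ∣ A ∣ × n ≤ c * ∣ P ∖ A ∣ × η * cut G A (P ∖ A) < n * n) → ∃ λ θ → Emb G H P Q θ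
    decide (no none) = embed-piece P Q cQ e (record
      { min-degree = λ u p → ≤-trans (deg-in part u p) (*-monoˡ-≤ (Nb G u P) (M′≤ j j<J P part))
      ; no-cut = λ A a b d → ≮⇒≥ (λ f → none (A , a , b , d , f)) })
    decide (yes (A , a , b , d , f)) = halves (stabilise j j<J P part (suc (cut G A (P ∖ A))) (record
      { cover = cv ; A⊆ = a ; B⊆ = λ _ → ∧-∈ˡ ; disj = dj ; A-large = b ; B-large = d ; light = f }) ≤-refl)
      where
      cv : ∀ x → x ∈ P → x ∈ A ⊎ x ∈ P ∖ A
      cv x p with Bool-dec (A x)
      ... | inj₁ q = inj₁ q
      ... | inj₂ q = inj₂ (∈-∖ {A = P} {A} p q)
      dj : ∀ x → x ∈ A → x ∉ P ∖ A
      dj x p = trans (cong (λ t → P x ∧ not t) p) (∧-zeroʳ (P x))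

  whole : Part 0 (λ _ → true)
  whole = record
    { deg-in = λ u _ → ≤-trans (degree u) (≤-reflexive (cong (_* Nb G u (λ _ → true)) (sym (+-identityʳ M))))
    ; few-out = ≤-reflexive (trans (cong (η *_) (trans (∑-cong vs (λ u → trans (*-identityˡ _) (trans (∣∣-cong (λ v → ∧-zeroʳ (adj G u v))) (∣∅∣ {n})))) (∑-0 vs))) (*-zeroʳ η))
    ; size = ≤-trans (≤-reflexive (+-identityʳ _)) (*-monoʳ-≤ (2 * M) (∣∣≤n (λ _ → true))) }

-- Subset sums

vol : ∀ {n} → (Fin n → ℕ) → VSet n → ℕ
vol a Y = ∑V (λ i → 𝟙 (Y i) * a i)

subset-of-size : ∀ {n} e (A : VSet n) → e ≤ ∣ A ∣ → ∃ λ S → S ⊆ A × ∣ S ∣ ≡ e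
subset-of-size {n} zero A _ = ∅ , (λ _ ()) , ∣∅∣ {n}
subset-of-size {n} (suc e) A h with ∣∣-∃ A (≤-trans (s≤s z≤n) h)
... | i , p with subset-of-size e (A ∖ ⁅ i ⁆) (s≤s⁻¹ (≤-trans h (≤-reflexive (∣∖⁅⁆∣ {A = A} p))))
... | S , S⊆ , eq = S ∪ ⁅ i ⁆ , sub , trans (∣∪∣-disjoint S ⁅ i ⁆ (λ j q r → true≢false r (∖-∉ {A = A} {⁅ i ⁆} (S⊆ j q))))
      (trans (cong₂ _+_ eq (∣⁅⁆∣ i)) (+-comm e 1))
  where
  sub : (S ∪ ⁅ i ⁆) ⊆ A
  sub j q with ∨-split {S j} q
  ... | inj₁ r = ∧-∈ˡ (S⊆ j r)
  ... | inj₂ r = subst (_∈ A) (∈-⁅⁆ r) p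

module _ {n : ℕ} (a : Fin n → ℕ) where

  private vs = allFin n

  vol-mono : ∀ {A B} → A ⊆ B → vol a A ≤ vol a B
  vol-mono s = ∑-mono vs (λ i → *-monoˡ-≤ (a i) (𝟙-mono (s i)))

  vol-cong : ∀ {A B} → (∀ i → A i ≡ B i) → vol a A ≡ vol a B
  vol-cong s = ∑-cong vs (λ i → cong (λ t → 𝟙 t * a i) (s i))

  vol-∅ : vol a ∅ ≡ 0
  vol-∅ = ∑-0 vs

  vol-⁅⁆ : ∀ i → vol a ⁅ i ⁆ ≡ a i
  vol-⁅⁆ i = ∑V-δ i a

  vol-∪ : ∀ A B → (∀ i → i ∈ A → i ∉ B) → vol a (A ∪ B) ≡ vol a A + vol a B
  vol-∪ A B d = trans (∑-cong vs pt) (∑-+ vs _ _)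
    where
    pt : ∀ i → 𝟙 (A i ∨ B i) * a i ≡ 𝟙 (A i) * a i + 𝟙 (B i) * a i
    pt i with A i in e
    ... | false = refl
    ... | true = sym (trans (cong (λ t → a i + 0 + 𝟙 t * a i) (d i e)) (+-identityʳ _))

  vol-∖ : ∀ {A B} → B ⊆ A → vol a A ≡ vol a B + vol a (A ∖ B)
  vol-∖ {A} {B} s = trans (vol-cong eq) (vol-∪ B (A ∖ B) (λ i p → trans (cong (λ t → A i ∧ not t) p) (∧-zeroʳ (A i))))
    where
    eq : ∀ i → A i ≡ B i ∨ (A i ∧ not (B i))
    eq i with B i in e
    ... | true = s i e
    ... | false = sym (∧-identityʳ (A i))

  fill-up-to : ∀ w → (∀ i → a i ≤ w) → ∀ A x → x ≤ vol a A → ∃ λ S → S ⊆ A × x ≤ vol a S × vol a S ≤ x + w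
  fill-up-to w aw A x hx = go ∣ A ∣ ∅ (λ _ ()) (∣∣-mono {A = A ∖ ∅} {A} (λ _ → ∧-∈ˡ)) (≤-trans (≤-reflexive vol-∅) z≤n)
    where
    go : ∀ fuel S → S ⊆ A → ∣ A ∖ S ∣ ≤ fuel → vol a S ≤ x + w → ∃ λ S → S ⊆ A × x ≤ vol a S × vol a S ≤ x + w
    go fuel S S⊆ f up with x ≤? vol a S
    ... | yes h = S , S⊆ , h , up
    ... | no ¬h with Bool-dec (∃ᵇ (A ∖ S))
    ...   | inj₂ e = ⊥-elim (¬h (≤-trans hx (vol-mono (λ i p → ∉-∖ {A = A} {S} p (≢true (λ q → true≢false (∃ᵇ-intro {A = A ∖ S} i q) e))))))
    ...   | inj₁ e with ∃ᵇ-elim {A = A ∖ S} e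
    go zero S S⊆ f up | no ¬h | inj₁ e | i , p = ⊥-elim (<-irrefl refl (<-≤-trans (∈⇒∣∣>0 (A ∖ S) p) f))
    go (suc fuel) S S⊆ f up | no ¬h | inj₁ e | i , p = go fuel (S ∪ ⁅ i ⁆) sub smaller
        (≤-trans (≤-reflexive (trans (vol-∪ S ⁅ i ⁆ (λ j q → ∉-⁅⁆ (λ r → true≢false (subst (_∈ S) (sym r) q) (∖-∉ {A = A} {S} p)))) (cong (vol a S +_) (vol-⁅⁆ i))))
          (+-mono-≤ (<⇒≤ (≰⇒> ¬h)) (aw i)))
      where
      sub : (S ∪ ⁅ i ⁆) ⊆ A
      sub j q with ∨-split {S j} q
      ... | inj₁ r = S⊆ j r
      ... | inj₂ r = subst (_∈ A) (∈-⁅⁆ r) (∧-∈ˡ p)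
      smaller : ∣ A ∖ (S ∪ ⁅ i ⁆) ∣ ≤ fuel
      smaller = s≤s⁻¹ (≤-trans (s≤s (∣∣-mono {A = A ∖ (S ∪ ⁅ i ⁆)} {(A ∖ S) ∖ ⁅ i ⁆} inc)) (≤-trans (≤-reflexive (sym (∣∖⁅⁆∣ {A = A ∖ S} p))) f))
        where
        inc : (A ∖ (S ∪ ⁅ i ⁆)) ⊆ ((A ∖ S) ∖ ⁅ i ⁆)
        inc j q with A j | S j | ⁅ i ⁆ j
        ... | true | false | false = refl

∑< : ℕ → (ℕ → ℕ) → ℕ
∑< zero f = 0
∑< (suc l) f = f l + ∑< l f

geometric : ∀ l → suc (∑< l (2 ^_)) ≡ 2 ^ l
geometric zero = refl
geometric (suc l) = trans (sym (+-suc (2 ^ l) _)) (trans (cong (2 ^ l +_) (geometric l)) (cong (2 ^ l +_) (sym (+-identityʳ (2 ^ l)))))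

∑<-mono : ∀ l {f g : ℕ → ℕ} → (∀ e → e < l → f e ≤ g e) → ∑< l f ≤ ∑< l g
∑<-mono zero h = z≤n
∑<-mono (suc l) h = +-mono-≤ (h l ≤-refl) (∑<-mono l (λ e p → h e (m<n⇒m<1+n p)))

dyadic : ∀ l m → m < 2 ^ l → m ≤ ∑< l (λ e → 2 ^ e * 𝟙 (2 ^ e ≤ᵇ m))
dyadic zero m (s≤s z≤n) = z≤n
dyadic (suc l) m h with 2 ^ l ≤ᵇ m in eq
... | false = ≤-trans (dyadic l m (≰⇒> (λ q → true≢false (T⇒≡ (≤⇒≤ᵇ q)) eq))) (m≤n+m _ _)
... | true = s≤s⁻¹ (≤-trans h (≤-trans (≤-reflexive (sym (geometric (suc l)))) (s≤s (+-mono-≤ (≤-reflexive (sym (*-identityʳ (2 ^ l))))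
      (∑<-mono l (λ e p → ≤-reflexive (sym (trans (cong (λ t → 2 ^ e * 𝟙 t) (T⇒≡ (≤⇒≤ᵇ (≤-trans (^-monoʳ-≤ 2 (<⇒≤ p)) (≤ᵇ⇒≤ (2 ^ l) m (≡⇒T eq)))))) (*-identityʳ (2 ^ e))))))))))

∑-∑< : ∀ {A : Set} (xs : List A) l (f : ℕ → A → ℕ) → ∑ xs (λ x → ∑< l (λ e → f e x)) ≡ ∑< l (λ e → ∑ xs (f e))
∑-∑< xs zero f = ∑-0 xs
∑-∑< xs (suc l) f = trans (∑-+ xs _ _) (cong (∑ xs (f l) +_) (∑-∑< xs l f))

∑<-∃ : ∀ l c (f : ℕ → ℕ) → 0 < l → l * c ≤ ∑< l f → ∃ λ e → c ≤ f e
∑<-∃ (suc l) c f _ h with c ≤? f l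
... | yes p = l , p
∑<-∃ (suc zero) c f _ h | no ¬p = ⊥-elim (¬p (≤-trans (≤-reflexive (sym (+-identityʳ c))) (≤-trans h (≤-reflexive (+-identityʳ (f 0))))))
∑<-∃ (suc (suc l)) c f _ h | no ¬p = ∑<-∃ (suc l) c f (s≤s z≤n) (+-cancelˡ-≤ (f (suc l)) _ _ (≤-trans (+-monoˡ-≤ (c + l * c) (<⇒≤ (≰⇒> ¬p))) h))

-- Dyadic pigeonhole on the level sets { v : mult v ≥ 2^e }.
popular-level : ∀ {q} (mult : Fin q → ℕ) l c → 0 < l → (∀ v → mult v < 2 ^ l) → l * c ≤ ∑V mult →
  ∃ λ e → c ≤ 2 ^ e * ∣ (λ v → 2 ^ e ≤ᵇ mult v) ∣
popular-level {q} mult l c l>0 bd h = ∑<-∃ l c _ l>0 (≤-trans h (≤-trans (∑-mono (allFin q) (λ v → dyadic l (mult v) (bd v)))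
  (≤-reflexive (trans (∑-∑< (allFin q) l (λ e v → 2 ^ e * 𝟙 (2 ^ e ≤ᵇ mult v))) (go l)))))
  where
  go : ∀ l → ∑< l (λ e → ∑V (λ v → 2 ^ e * 𝟙 (2 ^ e ≤ᵇ mult v))) ≡ ∑< l (λ e → 2 ^ e * ∣ (λ v → 2 ^ e ≤ᵇ mult v) ∣)
  go zero = refl
  go (suc l) = cong₂ _+_ (∑-*ˡ (allFin q) (2 ^ l) _) (go l)

∣∣-≤1 : ∀ {n} (A : VSet n) → (∀ x y → x ∈ A → y ∈ A → x ≡ y) → ∣ A ∣ ≤ 𝟙 (∃ᵇ A)
∣∣-≤1 {n} A u with Bool-dec (∃ᵇ A)
... | inj₂ e = ≤-trans (≮⇒≥ (λ p → true≢false (T⇒≡ (<⇒<ᵇ p)) e)) z≤n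
... | inj₁ e with ∃ᵇ-elim {A = A} e
... | x , p = ≤-trans (∣∣-mono {A = A} {⁅ x ⁆} (λ y q → subst (λ t → ⁅ x ⁆ t ≡ true) (u x y p q) (⁅⁆-∈ x)))
      (≤-reflexive (trans (∣⁅⁆∣ x) (sym (𝟙-true e))))

∣∣≤im : ∀ {n} (dom : VSet n) (φ : Fin n → Fin n) → (∀ x y → x ∈ dom → y ∈ dom → φ x ≡ φ y → x ≡ y) → ∣ dom ∣ ≤ ∣ im dom φ ∣
∣∣≤im {n} dom φ inj = begin
  ∑V (λ x → 𝟙 (dom x)) ≡⟨ ∑-cong vs (λ x → trans (∑-cong vs (λ v → 𝟙-∧ (dom x) _)) (trans (∑-*ˡ vs (𝟙 (dom x)) _) (trans (cong (𝟙 (dom x) *_) (∣⁅⁆∣ (φ x))) (*-identityʳ _)))) ⟨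
  ∑V (λ x → ∑V (λ v → 𝟙 (dom x ∧ ⁅ φ x ⁆ v))) ≡⟨ ∑-swap vs vs _ ⟩
  ∑V (λ v → ∑V (λ x → 𝟙 (dom x ∧ ⁅ φ x ⁆ v))) ≤⟨ ∑-mono vs (λ v → ∣∣-≤1 (λ x → dom x ∧ ⁅ φ x ⁆ v) (λ x y p q →
      inj x y (∧-∈ˡ p) (∧-∈ˡ q) (trans (∈-⁅⁆ (∧-∈ʳ {dom x} p)) (sym (∈-⁅⁆ (∧-∈ʳ {dom y} q)))))) ⟩
  ∑V (λ v → 𝟙 (im dom φ v)) ∎
  where
  open ≤-Reasoning
  vs = allFin n

module Residues (q′ : ℕ) where

  q : ℕ
  q = suc q′

  opaque
    res : ℕ → Fin q
    res a = fromℕ< (m%n<n a q)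

    res-cong : ∀ {a b} → a % q ≡ b % q → res a ≡ res b
    res-cong {a} {b} e = toℕ-injective (trans (toℕ-fromℕ< (m%n<n a q)) (trans e (sym (toℕ-fromℕ< (m%n<n b q)))))

    res-% : ∀ {a b} → res a ≡ res b → a % q ≡ b % q
    res-% {a} {b} e = trans (sym (toℕ-fromℕ< (m%n<n a q))) (trans (cong toℕ e) (toℕ-fromℕ< (m%n<n b q)))

    res-toℕ : ∀ y → res (toℕ y) ≡ y
    res-toℕ y = toℕ-injective (trans (toℕ-fromℕ< (m%n<n (toℕ y) q)) (m<n⇒m%n≡m (toℕ<n y)))

    res-+ : ∀ a x → res (toℕ (res a) + x) ≡ res (a + x)
    res-+ a x = res-cong {toℕ (res a) + x} {a + x} (trans (cong (λ t → (t + x) % q) (toℕ-fromℕ< (m%n<n a q)))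
      (trans (%-distribˡ-+ (a % q) x q) (trans (cong (λ t → (t + x % q) % q) (m%n%n≡m%n a q)) (sym (%-distribˡ-+ a x q)))))

    res-q : ∀ a k → res (a + k * q) ≡ res a
    res-q a k = res-cong {a + k * q} {a} ([m+kn]%n≡m%n a k q)

  res-+-cong : ∀ {a b} x → res a ≡ res b → res (a + x) ≡ res (b + x)
  res-+-cong {a} {b} x e = trans (sym (res-+ a x)) (trans (cong (λ t → res (toℕ t + x)) e) (res-+ b x))

  shift : ℕ → Fin q → Fin q
  shift x y = res (toℕ y + x)

  neg : ℕ → ℕ
  neg x = x * q′

  shift-shift : ∀ x z y → shift x (shift z y) ≡ shift (z + x) y
  shift-shift x z y = trans (res-+ (toℕ y + z) x) (cong res (+-assoc (toℕ y) z x))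

  shift-q : ∀ k y → shift (k * q) y ≡ y
  shift-q k y = trans (res-q (toℕ y) k) (res-toℕ y)

  neg-shift : ∀ x y → shift (neg x) (shift x y) ≡ y
  neg-shift x y = trans (shift-shift (neg x) x y) (trans (cong (λ t → shift t y) (sym (*-suc x q′))) (shift-q x y))

  shift-neg : ∀ x y → shift x (shift (neg x) y) ≡ y
  shift-neg x y = trans (shift-shift x (neg x) y) (trans (cong (λ t → shift t y) (trans (+-comm (neg x) x) (sym (*-suc x q′)))) (shift-q x y))

  Invariant : VSet q → ℕ → Set
  Invariant S x = ∀ y → y ∈ S → shift x y ∈ S

  Invariant-+ : ∀ {S} x z → Invariant S x → Invariant S z → Invariant S (x + z)
  Invariant-+ {S} x z ix iz y p = subst (_∈ S) (shift-shift z x y) (iz _ (ix y p))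

  Invariant-0 : ∀ {S} → Invariant S 0
  Invariant-0 {S} y p = subst (_∈ S) (sym (trans (cong res (+-identityʳ (toℕ y))) (res-toℕ y))) p

  Invariant-* : ∀ {S} k x → Invariant S x → Invariant S (k * x)
  Invariant-* {S} zero x ix = Invariant-0 {S}
  Invariant-* {S} (suc k) x ix = Invariant-+ {S} x (k * x) ix (Invariant-* {S} k x ix)

  Invariant-neg : ∀ {S} x → Invariant S x → Invariant S (neg x)
  Invariant-neg {S} x ix = subst (Invariant S) (*-comm q′ x) (Invariant-* {S} q′ x ix)

  Invariant-sub : ∀ {S} d c → Invariant S (d + c) → Invariant S c → Invariant S d
  Invariant-sub {S} d c idc ic y p = subst (_∈ S) eq (Invariant-neg {S} c ic _ (idc y p))
    where
    eq : shift (neg c) (shift (d + c) y) ≡ shift d y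
    eq = trans (shift-shift (neg c) (d + c) y) (trans (cong (λ t → shift t y) (trans (+-assoc d c (neg c)) (cong (d +_) (sym (*-suc c q′)))))
      (trans (cong res (sym (+-assoc (toℕ y) d (c * q)))) (res-q (toℕ y + d) c)))

  Invariant-gcd : ∀ {S} a b → Invariant S a → Invariant S b → Invariant S (gcd a b)
  Invariant-gcd {S} a b ia ib with Bézout.identity (gcd-GCD a b)
  ... | Bézout.Identity.+- x y e = Invariant-sub {S} (gcd a b) (y * b) (subst (Invariant S) (sym e) (Invariant-* {S} x a ia)) (Invariant-* {S} y b ib)
  ... | Bézout.Identity.-+ x y e = Invariant-sub {S} (gcd a b) (x * a) (subst (Invariant S) (sym e) (Invariant-* {S} y b ib)) (Invariant-* {S} x a ia)

  Invariant-gcds : ∀ {A : Set} {S} (f : A → ℕ) xs → (∀ x → Invariant S (f x)) → Invariant S (foldr gcd 0 (map f xs))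
  Invariant-gcds {S = S} f [] h = Invariant-0 {S}
  Invariant-gcds {S = S} f (x ∷ xs) h = Invariant-gcd {S} (f x) _ (h x) (Invariant-gcds {S = S} f xs h)

  Invariant-1 : ∀ {S} → Invariant S 1 → ∀ {y} → y ∈ S → ∀ z → z ∈ S
  Invariant-1 {S} i₁ {y} p z = subst (_∈ S) eq (subst (Invariant S) (*-identityʳ (toℕ z + neg (toℕ y))) (Invariant-* {S} (toℕ z + neg (toℕ y)) 1 i₁) y p)
    where
    l : ∀ y z q → y + (z + y * q) ≡ z + y * suc q
    l = solve-∀
    eq : shift (toℕ z + neg (toℕ y)) y ≡ z
    eq = trans (cong res (l (toℕ y) (toℕ z) q′)) (trans (res-q (toℕ z) (toℕ y)) (res-toℕ z))

  val : Fin q → ℕ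
  val v = suc (toℕ v)

  module Ball (X : VSet q) where

    translate : Fin q → VSet q
    translate y = im X (λ v → shift (val v) y)

    ∣translate∣ : ∀ y → ∣ X ∣ ≤ ∣ translate y ∣
    ∣translate∣ y = ∣∣≤im X (λ v → shift (val v) y) (λ v v′ _ _ e → shift-inj v v′ (trans (sym (flip v)) (trans e (flip v′))))
      where
      flip : ∀ v → shift (val v) y ≡ shift (suc (toℕ y)) v
      flip v = cong res (trans (+-suc (toℕ y) (toℕ v)) (trans (cong suc (+-comm (toℕ y) (toℕ v))) (sym (+-suc (toℕ v) (toℕ y)))))
      shift-inj : ∀ v v′ → shift (suc (toℕ y)) v ≡ shift (suc (toℕ y)) v′ → v ≡ v′
      shift-inj v v′ e = trans (sym (neg-shift (suc (toℕ y)) v)) (trans (cong (shift (neg (suc (toℕ y)))) e) (neg-shift (suc (toℕ y)) v′))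

    translate-grows : ∀ {S S′} y → S ⊆ S′ → (∀ v → v ∈ X → shift (val v) y ∈ S′) → (∀ v → v ∈ X → shift (val v) y ∉ S) →
      ∣ S ∣ + ∣ X ∣ ≤ ∣ S′ ∣
    translate-grows {S} {S′} y S⊆ into out = ≤-trans (+-monoʳ-≤ ∣ S ∣ (∣translate∣ y)) (≤-trans
      (≤-reflexive (sym (∣∪∣-disjoint S (translate y) disj))) (∣∣-mono {A = S ∪ translate y} {S′} sub))
      where
      disj : ∀ z → z ∈ S → z ∈ translate y → ⊥
      disj z p r with im-elim {dom = X} (λ v → shift (val v) y) z r
      ... | v , vX , e = true≢false (subst (_∈ S) (sym e) p) (out v vX)
      sub : (S ∪ translate y) ⊆ S′
      sub z p with ∨-split {S z} p
      ... | inj₁ r = S⊆ z r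
      ... | inj₂ r with im-elim {dom = X} (λ v → shift (val v) y) z r
      ...   | v , vX , e = subst (_∈ S′) e (into v vX)

    ball : ℕ → VSet q
    ball zero = ⁅ res 0 ⁆
    ball (suc h) y = ball h y ∨ ∃ᵇ (λ v → X v ∧ (ball h (shift (val v) y) ∨ ball h (shift (neg (val v)) y)))

    ball-⊆ : ∀ h → ball h ⊆ ball (suc h)
    ball-⊆ h y p = ∨-∈ˡ p

    step-up : ∀ h y v → v ∈ X → y ∈ ball h → shift (val v) y ∈ ball (suc h)
    step-up h y v vX p = ∨-∈ʳ {ball h (shift (val v) y)} (∃ᵇ-intro {A = λ u → X u ∧ (ball h (shift (val u) (shift (val v) y)) ∨ ball h (shift (neg (val u)) (shift (val v) y)))} v
      (∧-∈ vX (∨-∈ʳ {ball h (shift (val v) (shift (val v) y))} (subst (_∈ ball h) (sym (neg-shift (val v) y)) p))))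

    step-back : ∀ h y v → v ∈ X → shift (val v) y ∈ ball h → y ∈ ball (suc h)
    step-back h y v vX p = ∨-∈ʳ {ball h y} (∃ᵇ-intro {A = λ u → X u ∧ (ball h (shift (val u) y) ∨ ball h (shift (neg (val u)) y))} v
      (∧-∈ vX (∨-∈ˡ p)))

    Stable-at : ℕ → Set
    Stable-at h = ball (suc h) ⊆ ball h

    -- If y enters at step h + 2, its translate y + X enters by step h + 3 and misses the ball of radius h.
    stabilises : 0 < ∣ X ∣ → ∃ λ h → ∃ λ i → h ≤ 3 * i + 1 × i * ∣ X ∣ ≤ q × Stable-at h
    stabilises X>0 = go (suc q) 0 0 z≤n z≤n (≤-reflexive (sym (+-identityʳ (suc q))))
      where
      go : ∀ fuel i h → h ≤ 3 * i → i * ∣ X ∣ ≤ ∣ ball h ∣ → suc q ≤ fuel + i → ∃ λ h → ∃ λ i → h ≤ 3 * i + 1 × i * ∣ X ∣ ≤ q × Stable-at h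
      go zero i h hi sz f = ⊥-elim (<-irrefl refl (≤-trans f (≤-trans (≤-trans (≤-reflexive (sym (*-identityʳ i))) (*-monoʳ-≤ i X>0)) (≤-trans sz (∣∣≤n (ball h))))))
      go (suc fuel) i h hi sz f = next (Bool-dec (∃ᵇ (ball (suc (suc h)) ∖ ball (suc h))))
        where
        l : ∀ i → 3 + 3 * i ≡ 3 * suc i
        l = solve-∀
        enlarge : (∃ λ y → y ∈ ball (suc (suc h)) ∖ ball (suc h)) → ∃ λ h → ∃ λ i → h ≤ 3 * i + 1 × i * ∣ X ∣ ≤ q × Stable-at h
        enlarge (y , p) = go fuel (suc i) (suc (suc (suc h))) (≤-trans (+-monoʳ-≤ 3 hi) (≤-reflexive (l i)))
            (≤-trans (≤-reflexive (+-comm ∣ X ∣ (i * ∣ X ∣))) (≤-trans (+-monoˡ-≤ ∣ X ∣ sz)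
              (translate-grows {ball h} {ball (suc (suc (suc h)))} y (λ z r → ball-⊆ (suc (suc h)) z (ball-⊆ (suc h) z (ball-⊆ h z r)))
                (λ v vX → step-up (suc (suc h)) y v vX (∧-∈ˡ p))
                (λ v vX → ≢true (λ r → true≢false (step-back h y v vX r) (∖-∉ {A = ball (suc (suc h))} {ball (suc h)} p))))))
            (≤-trans f (≤-reflexive (sym (+-suc fuel i))))
        next : ∃ᵇ (ball (suc (suc h)) ∖ ball (suc h)) ≡ true ⊎ ∃ᵇ (ball (suc (suc h)) ∖ ball (suc h)) ≡ false →
          ∃ λ h → ∃ λ i → h ≤ 3 * i + 1 × i * ∣ X ∣ ≤ q × Stable-at h
        next (inj₁ e) = enlarge (∃ᵇ-elim {A = ball (suc (suc h)) ∖ ball (suc h)} e)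
        next (inj₂ e) = suc h , i , ≤-trans (s≤s hi) (≤-reflexive (+-comm 1 (3 * i))) , ≤-trans sz (∣∣≤n (ball h)) ,
            (λ y p → ∉-∖ {A = ball (suc (suc h))} {ball (suc h)} p (≢true (λ r → true≢false (∃ᵇ-intro {A = ball (suc (suc h)) ∖ ball (suc h)} y r) e)))

    record Word (h : ℕ) (z : Fin q) : Set where
      field
        plus minus : Fin q → ℕ
        plus-supp : ∀ v → v ∉ X → plus v ≡ 0
        minus-supp : ∀ v → v ∉ X → minus v ≡ 0
        short : ∑V plus + ∑V minus ≤ h
        spells : res (∑V (λ v → plus v * val v)) ≡ res (toℕ z + ∑V (λ v → minus v * val v))

    bump : (Fin q → ℕ) → Fin q → Fin q → ℕ
    bump f v u = 𝟙 (⁅ v ⁆ u) + f u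

    ∑-bump : ∀ f v → ∑V (bump f v) ≡ suc (∑V f)
    ∑-bump f v = trans (∑-+ (allFin q) (λ u → 𝟙 (⁅ v ⁆ u)) f) (cong (_+ ∑V f) (∣⁅⁆∣ v))

    ∑-bump-val : ∀ f v → ∑V (λ u → bump f v u * val u) ≡ val v + ∑V (λ u → f u * val u)
    ∑-bump-val f v = trans (∑-cong (allFin q) (λ u → *-distribʳ-+ (val u) (𝟙 (⁅ v ⁆ u)) (f u)))
      (trans (∑-+ (allFin q) (λ u → 𝟙 (⁅ v ⁆ u) * val u) (λ u → f u * val u)) (cong (_+ ∑V (λ u → f u * val u)) (∑V-δ v val)))

    bump-supp : ∀ f v → v ∈ X → (∀ u → u ∉ X → f u ≡ 0) → ∀ u → u ∉ X → bump f v u ≡ 0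
    bump-supp f v vX s u p = cong₂ (λ t r → 𝟙 t + r) (∉-⁅⁆ {x = u} {v} (λ e → true≢false (subst (_∈ X) e vX) p)) (s u p)

    word : ∀ h z → z ∈ ball h → Word h z
    word zero z p = record
      { plus = λ _ → 0 ; minus = λ _ → 0 ; plus-supp = λ _ _ → refl ; minus-supp = λ _ _ → refl
      ; short = ≤-reflexive (cong₂ _+_ (∑-0 (allFin q)) (∑-0 (allFin q)))
      ; spells = trans (cong res (∑-0 (allFin q))) (trans (∈-⁅⁆ p) (trans (sym (res-toℕ z)) (cong res (trans (sym (+-identityʳ (toℕ z))) (cong (toℕ z +_) (sym (∑-0 (allFin q)))))))) }
    word (suc h) z p with ∨-split {ball h z} p
    ... | inj₁ r = let W = word h z r in record
      { plus = Word.plus W ; minus = Word.minus W ; plus-supp = Word.plus-supp W ; minus-supp = Word.minus-supp W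
      ; short = m≤n⇒m≤1+n (Word.short W) ; spells = Word.spells W }
    ... | inj₂ r with ∃ᵇ-elim {A = λ v → X v ∧ (ball h (shift (val v) z) ∨ ball h (shift (neg (val v)) z))} r
    ... | v , s with ∨-split {ball h (shift (val v) z)} (∧-∈ʳ {X v} s)
    ...   | inj₁ t = go (word h (shift (val v) z) t)
      where
      l : ∀ z v m → z + v + m ≡ z + (v + m)
      l = solve-∀
      go : Word h (shift (val v) z) → Word (suc h) z
      go W = record
        { plus = plus ; minus = bump minus v ; plus-supp = plus-supp ; minus-supp = bump-supp minus v (∧-∈ˡ s) minus-supp
        ; short = ≤-trans (≤-reflexive (trans (cong (∑V plus +_) (∑-bump minus v)) (+-suc (∑V plus) (∑V minus)))) (s≤s short)
        ; spells = trans spells (trans (res-+ (toℕ z + val v) _) (cong res (trans (l (toℕ z) (val v) _) (cong (toℕ z +_) (sym (∑-bump-val minus v)))))) }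
        where open Word W
    ...   | inj₂ t = go (word h (shift (neg (val v)) z) t)
      where
      l : ∀ z x m v → z + x + m + v ≡ z + m + (v + x)
      l = solve-∀
      go : Word h (shift (neg (val v)) z) → Word (suc h) z
      go W = record
        { plus = bump plus v ; minus = minus ; plus-supp = bump-supp plus v (∧-∈ˡ s) plus-supp ; minus-supp = minus-supp
        ; short = ≤-trans (≤-reflexive (cong (_+ ∑V minus) (∑-bump plus v))) (s≤s short)
        ; spells = trans (cong res (trans (∑-bump-val plus v) (+-comm (val v) _)))
            (trans (res-+-cong {∑V (λ u → plus u * val u)} {toℕ (shift (neg (val v)) z) + Mm} (val v) spells)
            (trans (res-+-cong {toℕ (shift (neg (val v)) z) + Mm} {toℕ z + neg (val v) + Mm} (val v) (res-+ (toℕ z + neg (val v)) Mm))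
            (trans (cong res (trans (l (toℕ z) (neg (val v)) Mm (val v)) (cong (toℕ z + Mm +_) (sym (*-suc (val v) q′))))) (res-q (toℕ z + Mm) (val v))))) }
        where
        open Word W
        Mm = ∑V (λ u → minus u * val u)

∑<-head : ∀ l (f : ℕ → ℕ) → ∑< (suc l) f ≡ f 0 + ∑< l (f ∘ suc)
∑<-head zero f = refl
∑<-head (suc l) f = trans (cong (f (suc l) +_) (∑<-head l f)) (l₁ (f (suc l)) (f 0) (∑< l (f ∘ suc)))
  where l₁ : ∀ a b c → a + (b + c) ≡ b + (a + c)
        l₁ = solve-∀

∑V-∑< : ∀ q (f : ℕ → ℕ) → ∑V {q} (λ v → f (toℕ v)) ≡ ∑< q f
∑V-∑< zero f = refl
∑V-∑< (suc q) f = trans (∑V-suc {q} (λ v → f (toℕ v))) (trans (cong (f 0 +_) (∑V-∑< q (f ∘ suc))) (sym (∑<-head q f)))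

last-true : ∀ w (f : ℕ → Bool) → 0 < ∑< w (λ v → 𝟙 (f v)) → ∃ λ q → q < w × f q ≡ true × ∑< (suc q) (λ v → 𝟙 (f v)) ≡ ∑< w (λ v → 𝟙 (f v))
last-true (suc w) f h with f w in e
... | true = w , ≤-refl , e , cong (λ t → 𝟙 t + ∑< w (λ v → 𝟙 (f v))) e
... | false with last-true w f h
... | q , lt , p , eq = q , m<n⇒m<1+n lt , p , eq

module Reserve {n : ℕ} (a : Fin n → ℕ) (τ : Fin n → Fin n) (w′ : ℕ)
  (tile-small : ∀ t → vol a (λ i → ⁅ t ⁆ (τ i)) ≤ suc w′)
  (tile-gcd : ∀ t → 0 < vol a (λ i → ⁅ t ⁆ (τ i)) → foldr gcd 0 (map (λ i → if ⁅ t ⁆ (τ i) then a i else 0) (allFin n)) ≡ 1) where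

  private vs = allFin n

  w : ℕ
  w = suc w′

  tile : Fin n → VSet n
  tile t i = ⁅ t ⁆ (τ i)

  items : VSet n → VSet n
  items R i = R (τ i)

  tile-vol : Fin n → ℕ
  tile-vol t = vol a (tile t)

  a≤w : ∀ i → a i ≤ w
  a≤w i = ≤-trans (≤-reflexive (sym (trans (cong (λ t → 𝟙 t * a i) (⁅⁆-∈ (τ i))) (+-identityʳ (a i)))))
    (≤-trans (∑V-single i (λ j → 𝟙 (tile (τ i) j) * a j)) (tile-small (τ i)))

  vol-items : ∀ R → vol tile-vol R ≡ vol a (items R)
  vol-items R = trans (∑-cong vs (λ t → sym (∑-*ˡ vs (𝟙 (R t)) _))) (trans (∑-swap vs vs _) (∑-cong vs pt))
    where
    pt : ∀ i → ∑V (λ t → 𝟙 (R t) * (𝟙 (⁅ t ⁆ (τ i)) * a i)) ≡ 𝟙 (R (τ i)) * a i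
    pt i = trans (∑-cong vs (λ t → trans (l (𝟙 (R t)) (𝟙 (⁅ t ⁆ (τ i))) (a i)) (cong (λ b → 𝟙 b * (𝟙 (R t) * a i)) (flip t)))) (∑V-δ (τ i) (λ t → 𝟙 (R t) * a i))
      where
      l : ∀ x y z → x * (y * z) ≡ y * (x * z)
      l = solve-∀
      flip : ∀ t → ⁅ t ⁆ (τ i) ≡ ⁅ τ i ⁆ t
      flip t with t ≟F τ i | τ i ≟F t
      ... | yes _ | yes _ = refl
      ... | no _ | no _ = refl
      ... | yes p | no ¬p = ⊥-elim (¬p (sym p))
      ... | no ¬p | yes p = ⊥-elim (¬p (sym p))

  module Cover (q′ : ℕ) (X : VSet (suc q′)) (X>0 : 0 < ∣ X ∣) (K : VSet (suc q′))
    (K-inv : ∀ v → v ∈ X → Residues.Invariant q′ K (Residues.val q′ v)) (z₀ : Fin (suc q′)) (z₀∈K : z₀ ∈ K)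
    (R : VSet n) (many : suc q′ < ∣ (λ t → R t ∧ (0 <ᵇ tile-vol t)) ∣) where

    open Residues q′
    open Ball X

    record Stage (t : ℕ) : Set where
      field
        used : VSet n
        S : VSet q
        used⊆R : used ⊆ R
        ∣used∣ : ∣ used ∣ ≤ t
        z₀∈S : z₀ ∈ S
        S-inv : ∀ v → v ∈ X → Invariant S (val v)
        S-size : t * ∣ X ∣ ≤ ∣ S ∣
        source : ∀ y → y ∈ S → ∃ λ U → (∀ i → i ∈ U → τ i ∈ used) × vol a U ≤ t * w × (∃ λ z → z ∈ K × y ≡ shift (vol a U) z)

    first : Stage 0
    first = record
      { used = ∅ ; S = K ; used⊆R = λ _ () ; ∣used∣ = ≤-reflexive (∣∅∣ {n}) ; z₀∈S = z₀∈K ; S-inv = K-inv ; S-size = z≤n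
      ; source = λ y p → ∅ , (λ _ ()) , ≤-reflexive (vol-∅ a) , y , p , sym (trans (cong (λ t → shift t y) (vol-∅ a)) (shift-q 0 y)) }

    shift-comm : ∀ x z y → shift x (shift z y) ≡ shift z (shift x y)
    shift-comm x z y = trans (shift-shift x z y) (trans (cong (λ t → shift t y) (+-comm z x)) (sym (shift-shift z x y)))

    extend : ∀ {t} → t ≤ q → (st : Stage t) → ∀ y₁ → y₁ ∉ Stage.S st → Stage (suc t)
    extend {t} t≤q st y₁ y₁∉ = with-tile (∣∣-∃< used (λ t → R t ∧ (0 <ᵇ tile-vol t)) (≤-<-trans ∣used∣ (≤-<-trans t≤q many)))
      where
      open Stage st
      with-tile : (∃ λ t → (R t ∧ (0 <ᵇ tile-vol t) ≡ true) × t ∉ used) → Stage (suc t)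
      with-tile (t₀ , Rt , t∉) = search (Bool-dec (∃ᵇ (λ i → tile t₀ i ∧ ∃ᵇ (λ y → S y ∧ not (S (shift (a i) y))))))
        where
        f : Fin n → ℕ
        f i = if tile t₀ i then a i else 0
        search : ∃ᵇ (λ i → tile t₀ i ∧ ∃ᵇ (λ y → S y ∧ not (S (shift (a i) y)))) ≡ true ⊎ ∃ᵇ (λ i → tile t₀ i ∧ ∃ᵇ (λ y → S y ∧ not (S (shift (a i) y)))) ≡ false → Stage (suc t)
        search (inj₂ e) = true≢false (Invariant-1 {S} (subst (Invariant S) (tile-gcd t₀ (<ᵇ⇒< 0 _ (≡⇒T (∧-∈ʳ {R t₀} Rt)))) (Invariant-gcds {S = S} f vs inv)) z₀∈S y₁) y₁∉
          where
          inv : ∀ i → Invariant S (f i)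
          inv i with tile t₀ i in e₁
          ... | false = Invariant-0 {S}
          ... | true = λ y p → decide y p (Bool-dec (S (shift (a i) y)))
            where
            decide : ∀ y → y ∈ S → S (shift (a i) y) ≡ true ⊎ S (shift (a i) y) ≡ false → shift (a i) y ∈ S
            decide y p (inj₁ r) = r
            decide y p (inj₂ r) = true≢false (∃ᵇ-intro {A = λ i → tile t₀ i ∧ ∃ᵇ (λ y → S y ∧ not (S (shift (a i) y)))} i
              (∧-∈ e₁ (∃ᵇ-intro {A = λ y → S y ∧ not (S (shift (a i) y))} y (∧-∈ p (not-∈ r))))) e
        search (inj₁ e) = use-item (∃ᵇ-elim {A = λ i → tile t₀ i ∧ ∃ᵇ (λ y → S y ∧ not (S (shift (a i) y)))} e)
          where
          use-item : (∃ λ i → tile t₀ i ∧ ∃ᵇ (λ y → S y ∧ not (S (shift (a i) y))) ≡ true) → Stage (suc t)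
          use-item (i , p) = use-residue (∃ᵇ-elim {A = λ y → S y ∧ not (S (shift (a i) y))} (∧-∈ʳ {tile t₀ i} p))
            where
            τi : t₀ ≡ τ i
            τi = ∈-⁅⁆ (∧-∈ˡ p)
            use-residue : (∃ λ y → S y ∧ not (S (shift (a i) y)) ≡ true) → Stage (suc t)
            use-residue (y , p′) = record
              { used = used ∪ ⁅ t₀ ⁆ ; S = S′ ; used⊆R = us ; ∣used∣ = ≤-trans (∣∪∣≤ used ⁅ t₀ ⁆) (≤-trans (+-mono-≤ ∣used∣ (≤-reflexive (∣⁅⁆∣ t₀))) (≤-reflexive (+-comm t 1)))
              ; z₀∈S = ∨-∈ˡ z₀∈S ; S-inv = inv′
              ; S-size = ≤-trans (≤-reflexive (+-comm ∣ X ∣ (t * ∣ X ∣))) (≤-trans (+-monoˡ-≤ ∣ X ∣ S-size) (translate-grows {S} {S′} y′ (λ _ → ∨-∈ˡ) into out))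
              ; source = src }
              where
              S′ : VSet q
              S′ z = S z ∨ S (shift (neg (a i)) z)
              y′ = shift (a i) y
              us : (used ∪ ⁅ t₀ ⁆) ⊆ R
              us s r with ∨-split {used s} r
              ... | inj₁ x = used⊆R s x
              ... | inj₂ x = subst (_∈ R) (∈-⁅⁆ x) (∧-∈ˡ Rt)
              inv′ : ∀ v → v ∈ X → Invariant S′ (val v)
              inv′ v vX z r with ∨-split {S z} r
              ... | inj₁ x = ∨-∈ˡ (S-inv v vX z x)
              ... | inj₂ x = ∨-∈ʳ {S (shift (val v) z)} (subst (_∈ S) (shift-comm (val v) (neg (a i)) z) (S-inv v vX _ x))
              into : ∀ v → v ∈ X → shift (val v) y′ ∈ S′
              into v vX = ∨-∈ʳ {S (shift (val v) y′)} (subst (_∈ S) (sym (trans (sym (shift-comm (val v) (neg (a i)) y′)) (cong (shift (val v)) (neg-shift (a i) y)))) (S-inv v vX y (∧-∈ˡ p′)))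
              out : ∀ v → v ∈ X → shift (val v) y′ ∉ S
              out v vX = ≢true (λ r → true≢false (subst (_∈ S) (neg-shift (val v) y′) (Invariant-neg {S} (val v) (S-inv v vX) _ r)) (not-∉ (∧-∈ʳ {S y} p′)))
              src : ∀ z → z ∈ S′ → ∃ λ U → (∀ j → j ∈ U → τ j ∈ used ∪ ⁅ t₀ ⁆) × vol a U ≤ suc t * w × (∃ λ x → x ∈ K × z ≡ shift (vol a U) x)
              src z r with ∨-split {S z} r
              ... | inj₁ s = let (U , c , b , x , d , e) = source z s in U , (λ j m → ∨-∈ˡ (c j m)) , ≤-trans b (m≤n+m (t * w) w) , x , d , e
              ... | inj₂ s = let (U , c , b , x , d , e) = source (shift (neg (a i)) z) s in add U c b x d e
                where
                add : ∀ U → (∀ j → j ∈ U → τ j ∈ used) → vol a U ≤ t * w → ∀ x → x ∈ K → shift (neg (a i)) z ≡ shift (vol a U) x →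
                  ∃ λ U → (∀ j → j ∈ U → τ j ∈ used ∪ ⁅ t₀ ⁆) × vol a U ≤ suc t * w × (∃ λ x → x ∈ K × z ≡ shift (vol a U) x)
                add U c b x d e = U ∪ ⁅ i ⁆ , c′ , ≤-trans (≤-reflexive vU) (≤-trans (+-mono-≤ b (a≤w i)) (≤-reflexive (+-comm (t * w) w))) , x , d ,
                    trans (sym (shift-neg (a i) z)) (trans (cong (shift (a i)) e) (trans (shift-shift (a i) (vol a U) x) (cong (λ t → shift t x) (sym vU))))
                  where
                  vU : vol a (U ∪ ⁅ i ⁆) ≡ vol a U + a i
                  vU = trans (vol-∪ a U ⁅ i ⁆ (λ j m → ∉-⁅⁆ (λ q → true≢false (c j m) (subst (λ t → used t ≡ false) (trans τi (cong τ q)) t∉)))) (cong (vol a U +_) (vol-⁅⁆ a i))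
                  c′ : ∀ j → j ∈ U ∪ ⁅ i ⁆ → τ j ∈ used ∪ ⁅ t₀ ⁆
                  c′ j m with ∨-split {U j} m
                  ... | inj₁ s = ∨-∈ˡ (c j s)
                  ... | inj₂ s = ∨-∈ʳ {used (τ j)} (subst (λ k → ⁅ t₀ ⁆ (τ k) ≡ true) (∈-⁅⁆ s) (subst (λ k → ⁅ t₀ ⁆ k ≡ true) τi (⁅⁆-∈ t₀)))

    All-residues : Set
    All-residues = ∃ λ t → t * ∣ X ∣ ≤ q × (∀ y → ∃ λ U → U ⊆ items R × vol a U ≤ t * w × (∃ λ z → z ∈ K × y ≡ shift (vol a U) z))

    all-residues : All-residues
    all-residues = go (suc q) 0 (≤-reflexive (sym (+-identityʳ (suc q)))) first
      where
      go : ∀ fuel t → suc q ≤ fuel + t → Stage t → All-residues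
      t≤q : ∀ t → Stage t → t ≤ q
      t≤q t st = ≤-trans (≤-reflexive (sym (*-identityʳ t))) (≤-trans (*-monoʳ-≤ t X>0) (≤-trans (Stage.S-size st) (∣∣≤n (Stage.S st))))
      go zero t f st = ⊥-elim (<-irrefl refl (≤-trans f (t≤q t st)))
      go (suc fuel) t f st with Bool-dec (∃ᵇ (λ y → not (Stage.S st y)))
      ... | inj₁ e = let (y , p) = ∃ᵇ-elim {A = λ y → not (Stage.S st y)} e
                     in go fuel (suc t) (≤-trans f (≤-reflexive (sym (+-suc fuel t)))) (extend (t≤q t st) st y (not-∉ p))
      ... | inj₂ e = t , ≤-trans (Stage.S-size st) (∣∣≤n (Stage.S st)) , λ y →
            let (U , c , b , z , d , eq) = Stage.source st y (full y) in U , (λ i p → Stage.used⊆R st _ (c i p)) , b , z , d , eq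
        where
        full : ∀ y → y ∈ Stage.S st
        full y with Bool-dec (Stage.S st y)
        ... | inj₁ r = r
        ... | inj₂ r = true≢false (∃ᵇ-intro {A = λ y → not (Stage.S st y)} y (not-∈ r)) e

  of-size : VSet n → ℕ → VSet n
  of-size R v i = R (τ i) ∧ (a i ≡ᵇ v)

  realise : ∀ R {q} (e : Fin q → ℕ) → (∀ v → e v ≤ ∣ of-size R (suc (toℕ v)) ∣) →
    ∃ λ S → S ⊆ items R × vol a S ≡ ∑V (λ v → e v * suc (toℕ v))
  realise R {q} e h = S , sub , volume
    where
    part : ∀ v → ∃ λ S → S ⊆ of-size R (suc (toℕ v)) × ∣ S ∣ ≡ e v
    part v = subset-of-size (e v) (of-size R (suc (toℕ v))) (h v)
    Sv : Fin q → VSet n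
    Sv v = proj₁ (part v)
    S : VSet n
    S i = ∃ᵇ (λ v → Sv v i)
    size-of : ∀ v i → i ∈ Sv v → a i ≡ suc (toℕ v)
    size-of v i p = ≡ᵇ⇒≡ (a i) (suc (toℕ v)) (≡⇒T (∧-∈ʳ {R (τ i)} (proj₁ (proj₂ (part v)) i p)))
    sub : S ⊆ items R
    sub i p with ∃ᵇ-elim {A = λ v → Sv v i} p
    ... | v , r = ∧-∈ˡ (proj₁ (proj₂ (part v)) i r)
    volume : vol a S ≡ ∑V (λ v → e v * suc (toℕ v))
    volume = begin
      ∑V (λ i → 𝟙 (S i) * a i) ≡⟨ ∑-cong vs (λ i → cong (_* a i) (≤-antisym (𝟙-∃ᵇ (λ v → Sv v i)) (∣∣-≤1 (λ v → Sv v i) (λ v v′ p p′ →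
           toℕ-injective (suc-injective (trans (sym (size-of v i p)) (size-of v′ i p′))))))) ⟩
      ∑V (λ i → ∣ (λ v → Sv v i) ∣ * a i) ≡⟨ ∑-cong vs (λ i → sym (∑-*ʳ (allFin q) (λ v → 𝟙 (Sv v i)) (a i))) ⟩
      ∑V (λ i → ∑V (λ v → 𝟙 (Sv v i) * a i)) ≡⟨ ∑-swap vs (allFin q) _ ⟩
      ∑V (λ v → ∑V (λ i → 𝟙 (Sv v i) * a i)) ≡⟨ ∑-cong (allFin q) (λ v → trans (∑-cong vs (λ i → pt v i)) (trans (∑-*ʳ vs (λ i → 𝟙 (Sv v i)) (suc (toℕ v))) (cong (_* suc (toℕ v)) (proj₂ (proj₂ (part v)))))) ⟩
      ∑V (λ v → e v * suc (toℕ v)) ∎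
      where
      open ≡-Reasoning
      pt : ∀ v i → 𝟙 (Sv v i) * a i ≡ 𝟙 (Sv v i) * suc (toℕ v)
      pt v i with Bool-dec (Sv v i)
      ... | inj₁ p = cong (𝟙 (Sv v i) *_) (size-of v i p)
      ... | inj₂ p = trans (cong (λ t → 𝟙 t * a i) p) (sym (cong (λ t → 𝟙 t * suc (toℕ v)) p))

  vol≤mult : ∀ R → vol a (items R) ≤ w * ∑V {w} (λ v → ∣ of-size R (suc (toℕ v)) ∣)
  vol≤mult R = begin
    ∑V (λ i → 𝟙 (R (τ i)) * a i) ≤⟨ ∑-mono vs pt ⟩
    ∑V (λ i → w * ∑V {w} (λ v → 𝟙 (of-size R (suc (toℕ v)) i))) ≡⟨ ∑-*ˡ vs w _ ⟩
    w * ∑V (λ i → ∑V {w} (λ v → 𝟙 (of-size R (suc (toℕ v)) i))) ≡⟨ cong (w *_) (∑-swap vs (allFin w) _) ⟩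
    w * ∑V {w} (λ v → ∣ of-size R (suc (toℕ v)) ∣) ∎
    where
    open ≤-Reasoning
    pt : ∀ i → 𝟙 (R (τ i)) * a i ≤ w * ∑V {w} (λ v → 𝟙 (of-size R (suc (toℕ v)) i))
    pt i with R (τ i) in e₁ | a i in e₂ | a≤w i
    ... | false | _ | _ = z≤n
    ... | true | zero | _ = z≤n
    ... | true | suc b | h = ≤-trans (≤-reflexive (+-identityʳ (suc b))) (≤-trans h (≤-trans (≤-reflexive (sym (*-identityʳ w))) (*-monoʳ-≤ w
          (≤-trans (≤-reflexive (sym here)) (∑V-single (fromℕ< h) (λ v → 𝟙 (true ∧ (suc b ≡ᵇ suc (toℕ v)))))))))
      where
      here : 𝟙 (true ∧ (suc b ≡ᵇ suc (toℕ (fromℕ< h)))) ≡ 1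
      here = 𝟙-true (T⇒≡ (≡⇒≡ᵇ (suc b) _ (cong suc (sym (toℕ-fromℕ< h)))))

congruent-gap : ∀ q′ x y → Residues.res q′ x ≡ Residues.res q′ y → y ≤ x → ∃ λ L → x ≡ y + L * suc q′
congruent-gap q′ x y e y≤x = x / q ∸ y / q , (begin
    x ≡⟨ m≡m%n+[m/n]*n x q ⟩
    x % q + x / q * q ≡⟨ cong₂ (λ s t → s + t * q) (Residues.res-% q′ e) (sym (m+[n∸m]≡n (/-monoˡ-≤ q y≤x))) ⟩
    y % q + (y / q + (x / q ∸ y / q)) * q ≡⟨ l (y % q) (y / q) (x / q ∸ y / q) q ⟩
    y % q + y / q * q + (x / q ∸ y / q) * q ≡⟨ cong (_+ (x / q ∸ y / q) * q) (m≡m%n+[m/n]*n y q) ⟨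
    y + (x / q ∸ y / q) * q ∎)
  where
  open ≡-Reasoning
  q = suc q′
  l : ∀ a b c d → a + (b + c) * d ≡ a + b * d + c * d
  l = solve-∀

∑V-≤-mul : ∀ {q} (f : Fin q → ℕ) → ∑V (λ v → f v * suc (toℕ v)) ≤ ∑V f * q
∑V-≤-mul {q} f = ≤-trans (∑-mono (allFin q) (λ v → *-monoʳ-≤ (f v) (toℕ<n v))) (≤-reflexive (∑-*ʳ (allFin q) f q))

copies-bound : ∀ r Mm h i t q w L → 0 < r → 0 < q → q ≤ w → r ≤ q → h ≤ 3 * i + 1 → i * r ≤ q → t * r ≤ q →
  18 * w ≤ Mm * r → L * q ≤ 2 * (h * q) + (t * w + w) → h + h + L ≤ Mm
copies-bound r Mm h i t q w L r>0 q>0 q≤w r≤q h≤ ir tr big Lq = *-cancelʳ-≤ (h + h + L) Mm r ⦃ >-nonZero r>0 ⦄ (begin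
    (h + h + L) * r ≡⟨ l₁ h L r ⟩
    2 * (h * r) + L * r ≤⟨ +-monoʳ-≤ (2 * (h * r)) Lr ⟩
    2 * (h * r) + (2 * (h * r) + 2 * w) ≡⟨ l₂ (h * r) w ⟩
    4 * (h * r) + 2 * w ≤⟨ +-monoˡ-≤ (2 * w) (*-monoʳ-≤ 4 (≤-trans hr (*-monoʳ-≤ 4 q≤w))) ⟩
    4 * (4 * w) + 2 * w ≡⟨ l₃ w ⟩
    18 * w ≤⟨ big ⟩
    Mm * r ∎)
  where
  open ≤-Reasoning
  l₁ : ∀ h L r → (h + h + L) * r ≡ 2 * (h * r) + L * r
  l₁ = solve-∀
  l₂ : ∀ x w → 2 * x + (2 * x + 2 * w) ≡ 4 * x + 2 * w
  l₂ = solve-∀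
  l₃ : ∀ w → 4 * (4 * w) + 2 * w ≡ 18 * w
  l₃ = solve-∀
  l₄ : ∀ i r → (3 * i + 1) * r ≡ 3 * (i * r) + r
  l₄ = solve-∀
  l₅ : ∀ q → 3 * q + q ≡ 4 * q
  l₅ = solve-∀
  hr : h * r ≤ 4 * q
  hr = ≤-trans (*-monoˡ-≤ r h≤) (≤-trans (≤-reflexive (l₄ i r)) (≤-trans (+-mono-≤ (*-monoʳ-≤ 3 ir) r≤q) (≤-reflexive (l₅ q))))
  l₆ : ∀ L q r → L * r * q ≡ L * q * r
  l₆ = solve-∀
  l₇ : ∀ h q t w r → (2 * (h * q) + (t * w + w)) * r ≡ 2 * (h * r) * q + (t * r + r) * w
  l₇ = solve-∀
  l₈ : ∀ x q w → 2 * x * q + (q + q) * w ≡ (2 * x + 2 * w) * q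
  l₈ = solve-∀
  Lr : L * r ≤ 2 * (h * r) + 2 * w
  Lr = *-cancelʳ-≤ (L * r) (2 * (h * r) + 2 * w) q ⦃ >-nonZero q>0 ⦄ (begin
    L * r * q ≡⟨ l₆ L q r ⟩
    L * q * r ≤⟨ *-monoˡ-≤ r Lq ⟩
    (2 * (h * q) + (t * w + w)) * r ≡⟨ l₇ h q t w r ⟩
    2 * (h * r) * q + (t * r + r) * w ≤⟨ +-monoʳ-≤ (2 * (h * r) * q) (*-monoˡ-≤ w (+-mono-≤ tr r≤q)) ⟩
    2 * (h * r) * q + (q + q) * w ≡⟨ l₈ (h * r) q w ⟩
    (2 * (h * r) + 2 * w) * q ∎)

module Interval {n : ℕ} (a : Fin n → ℕ) (τ : Fin n → Fin n) (w′ : ℕ)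
  (tile-small : ∀ t → vol a (λ i → ⁅ t ⁆ (τ i)) ≤ suc w′)
  (tile-gcd : ∀ t → 0 < vol a (λ i → ⁅ t ⁆ (τ i)) → foldr gcd 0 (map (λ i → if ⁅ t ⁆ (τ i) then a i else 0) (allFin n)) ≡ 1) where

  open Reserve a τ w′ tile-small tile-gcd public

  private vs = allFin n

  Interval : VSet n → Set
  Interval R = ∃ λ b → ∀ T → b ≤ T → T ≤ b + w → ∃ λ S → S ⊆ items R × vol a S ≡ T

  module Assemble (q′ : ℕ) (q≤w : suc q′ ≤ w) (X : VSet (suc q′)) (top : Fin (suc q′)) (top∈X : top ∈ X) (top-val : suc (toℕ top) ≡ suc q′)
    (Mm : ℕ) (R₁ R₂ R : VSet n) (R₁⊆R : R₁ ⊆ R) (R₂⊆R : R₂ ⊆ R) (disjoint : ∀ t → t ∈ R₁ → t ∉ R₂)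
    (plentiful : ∀ v → v ∈ X → Mm ≤ ∣ of-size R₁ (suc (toℕ v)) ∣) (big : 18 * w ≤ Mm * ∣ X ∣)
    (many : suc q′ < ∣ (λ t → R₂ t ∧ (0 <ᵇ tile-vol t)) ∣) where

    open Residues q′
    open Ball X

    X>0 : 0 < ∣ X ∣
    X>0 = ∈⇒∣∣>0 X top∈X

    interval : Interval R
    interval = with-ball (stabilises X>0)
      where
      with-ball : (∃ λ h → ∃ λ i → h ≤ 3 * i + 1 × i * ∣ X ∣ ≤ q × Stable-at h) → Interval R
      with-ball (h , i , h≤ , ir , stable) = with-cover (Cover.all-residues q′ X X>0 (ball h) K-inv (res 0) (centre h) R₂ many)
        where
        centre : ∀ h → res 0 ∈ ball h
        centre zero = ⁅⁆-∈ (res 0)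
        centre (suc h) = ∨-∈ˡ (centre h)
        K-inv : ∀ v → v ∈ X → Invariant (ball h) (val v)
        K-inv v vX y p = stable _ (step-up h y v vX p)
        with-cover : (∃ λ t → t * ∣ X ∣ ≤ q × (∀ y → ∃ λ U → U ⊆ items R₂ × vol a U ≤ t * w × (∃ λ z → z ∈ ball h × y ≡ shift (vol a U) z))) → Interval R
        with-cover (t , tr , cov) = β + (h * q + t * w) , hit
          where
          β : ℕ
          β = ∑V (λ v → 𝟙 (X v) * h * val v)
          hit : ∀ T → β + (h * q + t * w) ≤ T → T ≤ β + (h * q + t * w) + w → ∃ λ S → S ⊆ items R × vol a S ≡ T
          hit T lo hi = with-residue (m≤n⇒∃[o]m+o≡n (≤-trans (m≤m+n β _) lo))
            where
            with-residue : (∃ λ d → β + d ≡ T) → ∃ λ S → S ⊆ items R × vol a S ≡ T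
            with-residue (d , β+d) = with-U (cov (res d))
              where
              d-lo : h * q + t * w ≤ d
              d-lo = +-cancelˡ-≤ β _ _ (≤-trans lo (≤-reflexive (sym β+d)))
              d-hi : d ≤ h * q + t * w + w
              d-hi = +-cancelˡ-≤ β _ _ (≤-trans (≤-reflexive β+d) (≤-trans hi (≤-reflexive (+-assoc β _ w))))
              with-U : (∃ λ U → U ⊆ items R₂ × vol a U ≤ t * w × (∃ λ z → z ∈ ball h × res d ≡ shift (vol a U) z)) → ∃ λ S → S ⊆ items R × vol a S ≡ T
              with-U (U , U⊆ , vU , z , z∈ , dz) = with-word (word h z z∈)
                where
                with-word : Word h z → ∃ λ S → S ⊆ items R × vol a S ≡ T
                with-word W = with-copies (congruent-gap q′ (d + mn) (pl + vol a U) same (≤-trans (+-mono-≤ pl≤ vU) (≤-trans d-lo (m≤m+n d mn))))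
                  where
                  open Word W
                  pl = ∑V (λ v → plus v * val v)
                  mn = ∑V (λ v → minus v * val v)
                  pl≤ : pl ≤ h * q
                  pl≤ = ≤-trans (∑V-≤-mul plus) (*-monoˡ-≤ q (≤-trans (m≤m+n (∑V plus) (∑V minus)) short))
                  mn≤ : mn ≤ h * q
                  mn≤ = ≤-trans (∑V-≤-mul minus) (*-monoˡ-≤ q (≤-trans (m≤n+m (∑V minus) (∑V plus)) short))
                  l₁ : ∀ a b c → a + b + c ≡ a + c + b
                  l₁ = solve-∀
                  same : res (d + mn) ≡ res (pl + vol a U)
                  same = trans (res-+-cong {d} {toℕ z + vol a U} mn dz) (trans (cong res (l₁ (toℕ z) (vol a U) mn))
                    (res-+-cong {toℕ z + mn} {pl} (vol a U) (sym spells)))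
                  with-copies : (∃ λ L → d + mn ≡ pl + vol a U + L * q) → ∃ λ S → S ⊆ items R × vol a S ≡ T
                  with-copies (L , gap) = finish (realise R₁ e e≤)
                    where
                    open ≤-Reasoning
                    Lq : L * q ≤ 2 * (h * q) + (t * w + w)
                    Lq = begin
                      L * q ≤⟨ m≤n+m (L * q) (pl + vol a U) ⟩
                      pl + vol a U + L * q ≡⟨ gap ⟨
                      d + mn ≤⟨ +-mono-≤ d-hi mn≤ ⟩
                      h * q + t * w + w + h * q ≡⟨ l₂ (h * q) (t * w) w ⟩
                      2 * (h * q) + (t * w + w) ∎
                      where l₂ : ∀ x y z → x + y + z + x ≡ 2 * x + (y + z)
                            l₂ = solve-∀
                    enough : h + h + L ≤ Mm
                    enough = copies-bound ∣ X ∣ Mm h i t q w L X>0 (s≤s z≤n) q≤w (∣∣≤n X) h≤ ir tr big Lq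
                    e : Fin q → ℕ
                    e v = (𝟙 (X v) * h ∸ minus v) + plus v + 𝟙 (⁅ top ⁆ v) * L
                    minus≤ : ∀ v → minus v ≤ 𝟙 (X v) * h
                    minus≤ v with Bool-dec (X v)
                    ... | inj₁ p = ≤-trans (∑V-single v minus) (≤-trans (≤-trans (m≤n+m (∑V minus) (∑V plus)) short) (≤-reflexive (sym (trans (cong (λ s → 𝟙 s * h) p) (+-identityʳ h)))))
                    ... | inj₂ p = ≤-trans (≤-reflexive (minus-supp v p)) z≤n
                    e≤ : ∀ v → e v ≤ ∣ of-size R₁ (suc (toℕ v)) ∣
                    e≤ v with Bool-dec (X v)
                    ... | inj₁ p = ≤-trans (+-mono-≤ (+-mono-≤ (≤-trans (m∸n≤m _ (minus v)) (≤-trans (*-monoˡ-≤ h (𝟙≤1 (X v))) (≤-reflexive (+-identityʳ h))))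
                             (≤-trans (∑V-single v plus) (≤-trans (m≤m+n (∑V plus) (∑V minus)) short)))
                             (≤-trans (*-monoˡ-≤ L (𝟙≤1 (⁅ top ⁆ v))) (≤-reflexive (+-identityʳ L)))) (≤-trans enough (plentiful v p))
                    ... | inj₂ p = ≤-trans (≤-reflexive (cong₂ _+_ (cong₂ _+_ (trans (cong (λ s → 𝟙 s * h ∸ minus v) p) (0∸n≡0 (minus v))) (plus-supp v p))
                             (cong (λ s → 𝟙 s * L) (∉-⁅⁆ {x = v} {top} (λ q → true≢false (subst (_∈ X) q top∈X) p))))) z≤n
                    total : ∑V (λ v → e v * val v) + mn ≡ β + pl + L * q
                    total = begin-equality
                      ∑V (λ v → e v * val v) + mn ≡⟨ ∑-+ (allFin q) (λ v → e v * val v) (λ v → minus v * val v) ⟨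
                      ∑V (λ v → e v * val v + minus v * val v) ≡⟨ ∑-cong (allFin q) (λ v → trans (l₃ (𝟙 (X v) * h ∸ minus v) (plus v) (𝟙 (⁅ top ⁆ v)) L (minus v) (val v))
                           (cong (λ s → s * val v + plus v * val v + 𝟙 (⁅ top ⁆ v) * (L * val v)) (m∸n+n≡m (minus≤ v)))) ⟩
                      ∑V (λ v → 𝟙 (X v) * h * val v + plus v * val v + 𝟙 (⁅ top ⁆ v) * (L * val v)) ≡⟨ trans (∑-+ (allFin q) (λ v → 𝟙 (X v) * h * val v + plus v * val v) (λ v → 𝟙 (⁅ top ⁆ v) * (L * val v)))
                           (cong₂ _+_ (∑-+ (allFin q) (λ v → 𝟙 (X v) * h * val v) (λ v → plus v * val v)) (trans (∑V-δ top (λ v → L * val v)) (cong (L *_) top-val))) ⟩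
                      β + pl + L * q ∎
                      where
                      l₃ : ∀ x p s L m v → (x + p + s * L) * v + m * v ≡ (x + m) * v + p * v + s * (L * v)
                      l₃ = solve-∀
                    finish : (∃ λ S → S ⊆ items R₁ × vol a S ≡ ∑V (λ v → e v * suc (toℕ v))) → ∃ λ S → S ⊆ items R × vol a S ≡ T
                    finish (S , S⊆ , vS) = S ∪ U , sub , trans (vol-∪ a S U (λ j p → ≢true (λ r → true≢false (U⊆ j r) (disjoint (τ j) (S⊆ j p)))))
                        (+-cancelʳ-≡ mn _ _ (begin-equality
                          vol a S + vol a U + mn ≡⟨ cong (λ s → s + vol a U + mn) vS ⟩
                          ∑V (λ v → e v * val v) + vol a U + mn ≡⟨ l₁ (∑V (λ v → e v * val v)) (vol a U) mn ⟩
                          ∑V (λ v → e v * val v) + mn + vol a U ≡⟨ cong (_+ vol a U) total ⟩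
                          β + pl + L * q + vol a U ≡⟨ l₄ β pl (L * q) (vol a U) ⟩
                          β + (pl + vol a U + L * q) ≡⟨ cong (β +_) gap ⟨
                          β + (d + mn) ≡⟨ +-assoc β d mn ⟨
                          β + d + mn ≡⟨ cong (_+ mn) β+d ⟩
                          T + mn ∎))
                      where
                      l₄ : ∀ b p x u → b + p + x + u ≡ b + (p + u + x)
                      l₄ = solve-∀
                      sub : (S ∪ U) ⊆ items R
                      sub j p with ∨-split {S j} p
                      ... | inj₁ r = R₁⊆R (τ j) (S⊆ j r)
                      ... | inj₂ r = R₂⊆R (τ j) (U⊆ j r)

  reserve-size : ℕ → ℕ
  reserve-size l = w * (l * (18 * w)) + w + w * suc w

  reserve : ∀ l → 0 < l → n < 2 ^ l → ∀ R → reserve-size l ≤ vol tile-vol R → Interval R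
  reserve l l>0 n<2^l R hR = with-R₁ (fill-up-to tile-vol w tile-small R (w * (l * (18 * w))) (≤-trans (≤-trans (m≤m+n _ w) (m≤m+n _ (w * suc w))) hR))
    where
    with-R₁ : (∃ λ R₁ → R₁ ⊆ R × w * (l * (18 * w)) ≤ vol tile-vol R₁ × vol tile-vol R₁ ≤ w * (l * (18 * w)) + w) → Interval R
    with-R₁ (R₁ , R₁⊆R , lo , hi) = with-level (popular-level {w} mult l (18 * w) l>0 (λ v → ≤-<-trans (∣∣≤n (of-size R₁ (suc (toℕ v)))) n<2^l)
        (*-cancelˡ-≤ w (≤-trans lo (≤-trans (≤-reflexive (vol-items R₁)) (vol≤mult R₁)))))
      where
      open ≤-Reasoning
      R₂ = R ∖ R₁
      mult : Fin w → ℕ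
      mult v = ∣ of-size R₁ (suc (toℕ v)) ∣
      R₂-large : w * suc w ≤ vol tile-vol R₂
      R₂-large = +-cancelˡ-≤ (w * (l * (18 * w)) + w) _ _ (≤-trans hR (≤-trans (≤-reflexive (vol-∖ tile-vol R₁⊆R)) (+-monoˡ-≤ (vol tile-vol R₂) hi)))
      tiles : suc w ≤ ∣ (λ t → R₂ t ∧ (0 <ᵇ tile-vol t)) ∣
      tiles = *-cancelˡ-≤ w (≤-trans R₂-large (≤-trans (∑-mono vs pt) (≤-reflexive (∑-*ˡ vs w (λ t → 𝟙 (R₂ t ∧ (0 <ᵇ tile-vol t)))))))
        where
        pt : ∀ t → 𝟙 (R₂ t) * tile-vol t ≤ w * 𝟙 (R₂ t ∧ (0 <ᵇ tile-vol t))
        pt t = bound (R₂ t) (tile-vol t) (tile-small t)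
          where
          bound : ∀ b x → x ≤ w → 𝟙 b * x ≤ w * 𝟙 (b ∧ (0 <ᵇ x))
          bound false x h = z≤n
          bound true zero h = z≤n
          bound true (suc x) h = ≤-trans (≤-reflexive (+-identityʳ (suc x))) (≤-trans h (≤-reflexive (sym (*-identityʳ w))))
      with-level : (∃ λ e → 18 * w ≤ 2 ^ e * ∣ (λ v → 2 ^ e ≤ᵇ mult v) ∣) → Interval R
      with-level (e , big) = with-top (last-true w f (subst (0 <_) (∑V-∑< w (λ v → 𝟙 (f v))) (proj₂ (*-pos (2 ^ e) _ (<-≤-trans (s≤s z≤n) big)))))
        where
        f : ℕ → Bool
        f v = 2 ^ e ≤ᵇ ∣ of-size R₁ (suc v) ∣
        with-top : (∃ λ q → q < w × f q ≡ true × ∑< (suc q) (λ v → 𝟙 (f v)) ≡ ∑< w (λ v → 𝟙 (f v))) → Interval R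
        with-top (q′ , q′<w , fq , eq) = Assemble.interval q′ q′<w X top (trans (cong f (toℕ-fromℕ< ≤-refl)) fq) (cong suc (toℕ-fromℕ< (≤-refl {suc q′}))) (2 ^ e) R₁ R₂ R R₁⊆R (λ t → ∧-∈ˡ)
            (λ t p → trans (cong (λ b → R t ∧ not b) p) (∧-zeroʳ (R t))) (λ v p → ≤ᵇ⇒≤ (2 ^ e) _ (≡⇒T p))
            (≤-trans big (≤-reflexive (cong (2 ^ e *_) (trans (∑V-∑< w (λ v → 𝟙 (f v))) (trans (sym eq) (sym (∑V-∑< (suc q′) (λ v → 𝟙 (f v)))))))))
            (≤-trans (s≤s q′<w) tiles)
          where
          X : VSet (suc q′)
          X v = f (toℕ v)
          top : Fin (suc q′)
          top = fromℕ< (≤-refl {suc q′})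

-- Components and tiles

any-map : ∀ {A B : Set} (g : A → B) (f : B → Bool) xs → any f (map g xs) ≡ any (f ∘ g) xs
any-map g f [] = refl
any-map g f (x ∷ xs) = cong (f (g x) ∨_) (any-map g f xs)

any-intro : ∀ {n} (f : Fin n → Bool) i → f i ≡ true → any f (allFin n) ≡ true
any-intro {suc n} f zero p = ∨-∈ˡ p
any-intro {suc n} f (suc i) p = ∨-∈ʳ {f zero} (trans (cong (any f) (sym (map-tabulate id suc))) (trans (any-map suc f (allFin n)) (any-intro (f ∘ suc) i p)))

any-elim : ∀ {A : Set} (f : A → Bool) xs → any f xs ≡ true → ∃ λ i → f i ≡ true
any-elim f (x ∷ xs) p with ∨-split {f x} p
... | inj₁ q = x , q
... | inj₂ q = any-elim f xs q

least : ∀ {m} → VSet m → Maybe (Fin m)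
least {zero} A = nothing
least {suc m} A = if A zero then just zero else mapMaybe suc (least (A ∘ suc))

least-cong : ∀ {m} {A B : VSet m} → (∀ x → A x ≡ B x) → least A ≡ least B
least-cong {zero} e = refl
least-cong {suc m} e = cong₂ (λ b r → if b then just zero else mapMaybe suc r) (e zero) (least-cong (e ∘ suc))

least-∈ : ∀ {m} {A : VSet m} {x} → x ∈ A → ∃ λ i → least A ≡ just i × i ∈ A
least-∈ {suc m} {A} {x} p with A zero in e
... | true = zero , refl , e
least-∈ {suc m} {A} {zero} p | false = true≢false p e
least-∈ {suc m} {A} {suc x} p | false with least-∈ {m} {A ∘ suc} {x} p
... | i , q , r = suc i , cong (mapMaybe suc) q , r

module Components {n : ℕ} (H : Graph n) where

  comp : Fin n → VSet n
  comp i = reach H n i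

  reach-step : ∀ t i j l → j ∈ reach H t i → adj H j l ≡ true → l ∈ reach H (suc t) i
  reach-step t i j l p q = ∨-∈ʳ {reach H t i l} (any-intro (λ l′ → reach H t i l′ ∧ adj H l′ l) j (∧-∈ p q))

  reach-split : ∀ t i l → l ∈ reach H (suc t) i → l ∈ reach H t i ⊎ (∃ λ j → j ∈ reach H t i × adj H j l ≡ true)
  reach-split t i l p with ∨-split {reach H t i l} p
  ... | inj₁ q = inj₁ q
  ... | inj₂ q with any-elim (λ j → reach H t i j ∧ adj H j l) (allFin n) q
  ...   | j , r = inj₂ (j , ∧-∈ˡ r , ∧-∈ʳ {reach H t i j} r)

  reach-self : ∀ t i → i ∈ reach H t i
  reach-self zero i = ⁅⁆-∈ i
  reach-self (suc t) i = ∨-∈ˡ (reach-self t i)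

  ClosedFrom : ℕ → Fin n → Set
  ClosedFrom t i = ∀ j l → j ∈ reach H t i → adj H j l ≡ true → l ∈ reach H t i

  reach-closed : ∀ i → ClosedFrom n i
  reach-closed i with go n
    where
    stable : ∀ t → ClosedFrom t i → ClosedFrom (suc t) i
    stable t c j l p q with reach-split t i j p
    ... | inj₁ r = ∨-∈ˡ (c j l r q)
    ... | inj₂ (m , r , s) = ∨-∈ˡ (c j l (c m j r s) q)
    go : ∀ t → ClosedFrom t i ⊎ suc t ≤ ∣ reach H t i ∣
    go zero = inj₂ (∈⇒∣∣>0 (reach H 0 i) (reach-self 0 i))
    go (suc t) with go t
    ... | inj₁ c = inj₁ (stable t c)
    ... | inj₂ h with Bool-dec (∃ᵇ (reach H (suc t) i ∖ reach H t i))
    ...   | inj₁ e = inj₂ (≤-trans (+-mono-≤ (<ᵇ⇒< 0 _ (≡⇒T e)) h) (≤-reflexive (trans (+-comm ∣ reach H (suc t) i ∖ reach H t i ∣ _)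
              (sym (∣∖∣-⊆ {A = reach H (suc t) i} {reach H t i} (λ x p → ∨-∈ˡ p))))))
    ...   | inj₂ e = inj₁ (stable t (λ j l p q → ∉-∖ {A = reach H (suc t) i} {reach H t i} (reach-step t i j l p q)
              (≢true (λ r → true≢false (∃ᵇ-intro {A = reach H (suc t) i ∖ reach H t i} l r) e))))
  ... | inj₁ c = c
  ... | inj₂ h = ⊥-elim (<-irrefl refl (<-≤-trans h (∣∣≤n (reach H n i))))

  comp-⊆ : ∀ i j → j ∈ comp i → comp j ⊆ comp i
  comp-⊆ i j p = go n
    where
    go : ∀ t → reach H t j ⊆ comp i
    go zero x q = subst (_∈ comp i) (∈-⁅⁆ {x = x} {j} q) p
    go (suc t) x q with reach-split t j x q
    ... | inj₁ r = go t x r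
    ... | inj₂ (l , r , s) = reach-closed i l x (go t l r) s

  comp-adj : ∀ i j → adj H i j ≡ true → j ∈ comp i
  comp-adj i j p = reach-closed i i j (reach-self n i) p

  comp-sym : ∀ i j → j ∈ comp i → i ∈ comp j
  comp-sym i = go n
    where
    go : ∀ t j → j ∈ reach H t i → i ∈ comp j
    go zero j p = subst (λ k → i ∈ comp k) (∈-⁅⁆ {x = j} {i} p) (reach-self n i)
    go (suc t) j p with reach-split t i j p
    ... | inj₁ q = go t j q
    ... | inj₂ (l , q , r) = comp-⊆ j l (comp-adj j l (trans (adj-sym H j l) r)) i (go t l q)

  comp-≡ : ∀ i j → j ∈ comp i → ∀ x → comp i x ≡ comp j x
  comp-≡ i j p x with Bool-dec (comp i x) | Bool-dec (comp j x)
  ... | inj₁ a | inj₁ b = trans a (sym b)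
  ... | inj₂ a | inj₂ b = trans a (sym b)
  ... | inj₁ a | inj₂ b = true≢false (comp-⊆ j i (comp-sym i j p) x a) b
  ... | inj₂ a | inj₁ b = true≢false (comp-⊆ i j p x b) a

  rep : Fin n → Fin n
  rep v = fromMaybe v (least (comp v))

  rep-least : ∀ v → ∃ λ i → least (comp v) ≡ just i × i ∈ comp v × rep v ≡ i
  rep-least v with least-∈ {A = comp v} (reach-self n v)
  ... | i , p , q = i , p , q , cong (fromMaybe v) p

  rep-∈ : ∀ v → rep v ∈ comp v
  rep-∈ v with rep-least v
  ... | i , _ , q , e = subst (_∈ comp v) (sym e) q

  comp⇒rep : ∀ u v → v ∈ comp u → rep u ≡ rep v
  comp⇒rep u v p with rep-least u | rep-least v
  ... | i , a , _ , b | j , c , _ , d = trans b (trans (just-injective (trans (sym a) (trans (least-cong (comp-≡ u v p)) c))) (sym d))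

  rep⇒comp : ∀ u v → rep u ≡ rep v → v ∈ comp u
  rep⇒comp u v e = comp-⊆ u (rep u) (rep-∈ u) v (comp-sym v (rep u) (subst (_∈ comp v) (sym e) (rep-∈ v)))

  rep-adj : ∀ x y → adj H x y ≡ true → rep x ≡ rep y
  rep-adj x y p = comp⇒rep x y (comp-adj x y p)

  size : Fin n → ℕ
  size i = ∣ class rep i ∣

  size-rep : ∀ v → size (rep v) ≡ componentOrder H v
  size-rep v = ∣∣-cong same
    where
    same : ∀ u → ⁅ rep v ⁆ (rep u) ≡ comp v u
    same u with rep v ≟F rep u | Bool-dec (comp v u)
    ... | yes _ | inj₁ q = sym q
    ... | no _ | inj₂ q = sym q
    ... | yes p | inj₂ q = true≢false (rep⇒comp v u p) q
    ... | no ¬p | inj₁ q = ⊥-elim (¬p (comp⇒rep v u q))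

  comp-label : (f : Fin n → Fin n) → (∀ i j → adj H i j ≡ true → f i ≡ f j) → ∀ i j → j ∈ comp i → f i ≡ f j
  comp-label f h i = go n
    where
    go : ∀ t j → j ∈ reach H t i → f i ≡ f j
    go zero j p = cong f (∈-⁅⁆ {x = j} {i} p)
    go (suc t) j p with reach-split t i j p
    ... | inj₁ q = go t j q
    ... | inj₂ (l , q , r) = trans (go t l q) (h l j r)

  ⁅⁆-flip : ∀ (i j : Fin n) → ⁅ i ⁆ j ≡ ⁅ j ⁆ i
  ⁅⁆-flip i j with i ≟F j | j ≟F i
  ... | yes _ | yes _ = refl
  ... | no _ | no _ = refl
  ... | yes p | no ¬p = ⊥-elim (¬p (sym p))
  ... | no ¬p | yes p = ⊥-elim (¬p (sym p))

  ∣∘rep∣ : ∀ Y → ∣ (λ v → Y (rep v)) ∣ ≡ vol size Y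
  ∣∘rep∣ Y = sym (trans (∑-cong vs (λ i → sym (∑-*ˡ vs (𝟙 (Y i)) _))) (trans (∑-swap vs vs _) (∑-cong vs pt)))
    where
    vs = allFin n
    pt : ∀ v → ∑V (λ i → 𝟙 (Y i) * 𝟙 (⁅ i ⁆ (rep v))) ≡ 𝟙 (Y (rep v))
    pt v = trans (∑-cong vs (λ i → trans (*-comm (𝟙 (Y i)) _) (cong (λ b → 𝟙 b * 𝟙 (Y i)) (⁅⁆-flip i (rep v))))) (∑V-δ (rep v) (λ i → 𝟙 (Y i)))

  -- Items are the representatives, weighted by component order (other vertices weigh 0).
  module Tiled (part : Fin n → Fin n) (part-adj : ∀ i j → adj H i j ≡ true → part i ≡ part j) (w′ : ℕ)
    (small : ∀ v → ∣ (λ u → ⌊ part u ≟F part v ⌋) ∣ ≤ suc w′)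
    (coprime : ∀ v → foldr gcd 0 (map (λ u → if ⌊ part u ≟F part v ⌋ then componentOrder H u else 0) (allFin n)) ≡ 1) where

    tile-volume : ∀ t → vol size (λ i → ⁅ t ⁆ (part i)) ≡ ∣ (λ v → ⁅ t ⁆ (part v)) ∣
    tile-volume t = trans (sym (∣∘rep∣ (λ i → ⁅ t ⁆ (part i)))) (∣∣-cong (λ v → cong ⁅ t ⁆ (sym (comp-label part part-adj v (rep v) (rep-∈ v)))))

    tile-small : ∀ t → vol size (λ i → ⁅ t ⁆ (part i)) ≤ suc w′
    tile-small t with Bool-dec (∃ᵇ (λ v → ⁅ t ⁆ (part v)))
    ... | inj₂ e = ≤-trans (≤-reflexive (tile-volume t)) (≤-trans (≮⇒≥ (λ p → true≢false (T⇒≡ (<⇒<ᵇ p)) e)) z≤n)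
    ... | inj₁ e with ∃ᵇ-elim {A = λ v → ⁅ t ⁆ (part v)} e
    ... | v , p = ≤-trans (≤-reflexive (trans (tile-volume t) (∣∣-cong (λ u → trans (cong (λ s → ⁅ s ⁆ (part u)) (∈-⁅⁆ {x = part v} {t} p)) (⁅⁆-flip (part v) (part u)))))) (small v)

    ∣-foldr : ∀ {A : Set} (f : A → ℕ) xs d → (∀ x → d ∣ f x) → d ∣ foldr gcd 0 (map f xs)
    ∣-foldr f [] d h = d ∣0
    ∣-foldr f (x ∷ xs) d h = gcd-greatest (h x) (∣-foldr f xs d h)

    foldr-∣ : ∀ {m} (f : Fin m → ℕ) i → foldr gcd 0 (map f (allFin m)) ∣ f i
    foldr-∣ {suc m} f zero = gcd[m,n]∣m (f zero) _
    foldr-∣ {suc m} f (suc i) = ∣-trans (gcd[m,n]∣n (f zero) _)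
      (subst (λ l → foldr gcd 0 l ∣ f (suc i)) (trans (map-tabulate id (f ∘ suc)) (sym (map-tabulate suc f))) (foldr-∣ (f ∘ suc) i))

    tile-gcd : ∀ t → 0 < vol size (λ i → ⁅ t ⁆ (part i)) → foldr gcd 0 (map (λ i → if ⁅ t ⁆ (part i) then size i else 0) (allFin n)) ≡ 1
    tile-gcd t h with ∣∣-∃ (λ v → ⁅ t ⁆ (part v)) (subst (0 <_) (tile-volume t) h)
    ... | v , p = ∣1⇒≡1 (subst (g ∣_) (coprime v) (∣-foldr (λ u → if ⌊ part u ≟F part v ⌋ then componentOrder H u else 0) (allFin n) g divides-all))
      where
      f : Fin n → ℕ
      f i = if ⁅ t ⁆ (part i) then size i else 0
      g : ℕ
      g = foldr gcd 0 (map f (allFin n))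
      tv : t ≡ part v
      tv = ∈-⁅⁆ {x = part v} {t} p
      divides-all : ∀ u → g ∣ (if ⌊ part u ≟F part v ⌋ then componentOrder H u else 0)
      divides-all u with part u ≟F part v
      ... | no _ = g ∣0
      ... | yes q = subst (g ∣_) (trans (cong (λ b → if b then size (rep u) else 0) in-tile) (size-rep u)) (foldr-∣ f (rep u))
        where
        in-tile : ⁅ t ⁆ (part (rep u)) ≡ true
        in-tile = subst (λ s → ⁅ t ⁆ s ≡ true) (trans tv (trans (sym q) (comp-label part part-adj u (rep u) (rep-∈ u)))) (⁅⁆-∈ t)

    open Interval size part w′ tile-small tile-gcd

    record Rich (y : ℕ) (Q : VSet n) : Set where
      field
        Y : VSet n
        Q-items : ∀ v → Q v ≡ Y (rep v)
        intact : VSet n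
        intact⊆ : items intact ⊆ Y
        intact-large : y ≤ vol tile-vol intact

    rich-whole : ∀ y → y ≤ n → Rich y (λ _ → true)
    rich-whole y h = record
      { Y = λ _ → true ; Q-items = λ _ → refl ; intact = λ _ → true ; intact⊆ = λ _ _ → refl
      ; intact-large = ≤-trans h (≤-reflexive (sym (trans (vol-items (λ _ → true)) (trans (sym (∣∘rep∣ (λ _ → true)))
          (trans (∑V-const {n} 1) (*-identityʳ n)))))) }

    split-rich : ∀ l → 0 < l → n < 2 ^ l → ∀ x y → reserve-size l ≤ x → 3 * (x + w) ≤ y → ∀ Q t → Rich y Q →
      2 * (x + w) ≤ t → t + 2 * (x + w) ≤ ∣ Q ∣ →
      ∃ λ R → R ⊆ Q × Closed rep R × ∣ R ∣ ≡ t × Rich x R × Rich x (Q ∖ R)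
    split-rich l l>0 n<2^l x y x≥ y≥ Q t rich t≥ t≤ = step₁ (fill-up-to tile-vol w tile-small intact x (≤-trans (≤-trans (m≤m+n x w) (m≤n*m (x + w) 3)) hy))
      where
      open Rich rich
      open ≤-Reasoning
      hy : 3 * (x + w) ≤ vol tile-vol intact
      hy = ≤-trans y≥ intact-large
      Result : Set
      Result = ∃ λ R → R ⊆ Q × Closed rep R × ∣ R ∣ ≡ t × Rich x R × Rich x (Q ∖ R)
      step₁ : (∃ λ A → A ⊆ intact × x ≤ vol tile-vol A × vol tile-vol A ≤ x + w) → Result
      step₁ (A , A⊆ , A≥ , A≤) = step₂ (fill-up-to tile-vol w tile-small A′ x (≤-trans (≤-trans (m≤m+n x w) (m≤n*m (x + w) 2)) hA′))
        where
        A′ = intact ∖ A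
        l₁ : ∀ z → 3 * z ≡ z + 2 * z
        l₁ = solve-∀
        hA′ : 2 * (x + w) ≤ vol tile-vol A′
        hA′ = +-cancelˡ-≤ (x + w) _ _ (≤-trans (≤-reflexive (sym (l₁ (x + w)))) (≤-trans hy (≤-trans (≤-reflexive (vol-∖ tile-vol A⊆)) (+-monoˡ-≤ (vol tile-vol A′) A≤))))
        step₂ : (∃ λ B → B ⊆ A′ × x ≤ vol tile-vol B × vol tile-vol B ≤ x + w) → Result
        step₂ (B , B⊆ , B≥ , B≤) = step₃ (fill-up-to tile-vol w tile-small B′ x (≤-trans (m≤m+n x w) hB′))
          where
          B′ = A′ ∖ B
          l₂ : ∀ z → 2 * z ≡ z + z
          l₂ = solve-∀
          hB′ : x + w ≤ vol tile-vol B′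
          hB′ = +-cancelˡ-≤ (x + w) _ _ (≤-trans (≤-reflexive (sym (l₂ (x + w)))) (≤-trans hA′ (≤-trans (≤-reflexive (vol-∖ tile-vol B⊆)) (+-monoˡ-≤ (vol tile-vol B′) B≤))))
          step₃ : (∃ λ E → E ⊆ B′ × x ≤ vol tile-vol E × vol tile-vol E ≤ x + w) → Result
          step₃ (E , E⊆ , E≥ , E≤) = step₄ (reserve l l>0 n<2^l E (≤-trans x≥ E≥))
            where
            iA iB iE O : VSet n
            iA = items A
            iB = items B
            iE = items E
            O = ((Y ∖ iA) ∖ iB) ∖ iE
            A-tile : ∀ s → s ∈ A → s ∉ B × s ∉ E
            A-tile s p = ≢true (λ q → true≢false p (∖-∉ {A = intact} {A} (B⊆ s q))) , ≢true (λ q → true≢false p (∖-∉ {A = intact} {A} (∧-∈ˡ (E⊆ s q))))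
            B-tile : ∀ s → s ∈ B → s ∉ E
            B-tile s p = ≢true (λ q → true≢false p (∖-∉ {A = A′} {B} (E⊆ s q)))
            iA⊆Y : iA ⊆ Y
            iA⊆Y i p = intact⊆ i (A⊆ (part i) p)
            iB⊆ : iB ⊆ (Y ∖ iA)
            iB⊆ i p = ∈-∖ {A = Y} {iA} (intact⊆ i (∧-∈ˡ (B⊆ (part i) p))) (∖-∉ {A = intact} {A} (B⊆ (part i) p))
            iE⊆ : iE ⊆ ((Y ∖ iA) ∖ iB)
            iE⊆ i p = ∈-∖ {A = Y ∖ iA} {iB} (∈-∖ {A = Y} {iA} (intact⊆ i (∧-∈ˡ (∧-∈ˡ (E⊆ (part i) p)))) (∖-∉ {A = intact} {A} (∧-∈ˡ (E⊆ (part i) p)))) (∖-∉ {A = A′} {B} (E⊆ (part i) p))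
            volA volB volE volO : ℕ
            volA = vol size iA
            volB = vol size iB
            volE = vol size iE
            volO = vol size O
            volA≤ : volA ≤ x + w
            volA≤ = ≤-trans (≤-reflexive (sym (vol-items A))) A≤
            volB≤ : volB ≤ x + w
            volB≤ = ≤-trans (≤-reflexive (sym (vol-items B))) B≤
            volE≤ : volE ≤ x + w
            volE≤ = ≤-trans (≤-reflexive (sym (vol-items E))) E≤
            ∣Q∣≡ : ∣ Q ∣ ≡ volA + (volB + (volE + volO))
            ∣Q∣≡ = trans (∣∣-cong Q-items) (trans (∣∘rep∣ Y) (trans (vol-∖ size iA⊆Y) (cong (volA +_) (trans (vol-∖ size iB⊆) (cong (volB +_) (vol-∖ size iE⊆))))))
            step₄ : Interval E → Result
            step₄ (b , hit) = step₅ (m≤n⇒∃[o]m+o≡n base≤t)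
              where
              b+w≤ : b + w ≤ volE
              b+w≤ with hit (b + w) (m≤m+n b w) ≤-refl
              ... | S , S⊆ , e = ≤-trans (≤-reflexive (sym e)) (vol-mono size S⊆)
              base≤t : volA + (b + w) ≤ t
              base≤t = ≤-trans (+-mono-≤ volA≤ (≤-trans b+w≤ volE≤)) (≤-trans (≤-reflexive (sym (l₂ (x + w)))) t≥)
              step₅ : (∃ λ o → volA + (b + w) + o ≡ t) → Result
              step₅ (o , eo) = step₆ (fill-up-to size w a≤w O o o≤)
                where
                l₃ : ∀ a b e o → a + (b + (e + o)) ≡ a + o + (b + e)
                l₃ = solve-∀
                o≤ : o ≤ volO
                o≤ = ≤-trans (m≤n+m o (b + w)) (+-cancelˡ-≤ volA _ _ (≤-trans (≤-reflexive (trans (sym (+-assoc volA (b + w) o)) eo)) t≤A))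
                  where
                  t≤A : t ≤ volA + volO
                  t≤A = +-cancelʳ-≤ (volB + volE) t (volA + volO) (begin
                    t + (volB + volE) ≤⟨ +-monoʳ-≤ t (≤-trans (+-mono-≤ volB≤ volE≤) (≤-reflexive (sym (l₂ (x + w))))) ⟩
                    t + 2 * (x + w) ≤⟨ t≤ ⟩
                    ∣ Q ∣ ≡⟨ trans ∣Q∣≡ (l₃ volA volB volE volO) ⟩
                    volA + volO + (volB + volE) ∎)
                step₆ : (∃ λ S → S ⊆ O × o ≤ vol size S × vol size S ≤ o + w) → Result
                step₆ (S , S⊆ , S≥ , S≤) = step₇ (m≤n⇒∃[o]m+o≡n lower)
                  where
                  l₄ : ∀ a b w o → a + (b + w) + o ≡ a + (o + w) + b
                  l₄ = solve-∀
                  lower : volA + vol size S + b ≤ t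
                  lower = ≤-trans (+-monoˡ-≤ b (+-monoʳ-≤ volA S≤)) (≤-reflexive (trans (sym (l₄ volA b w o)) eo))
                  step₇ : (∃ λ d → volA + vol size S + b + d ≡ t) → Result
                  step₇ (d , ed) = step₈ (hit (b + d) (m≤m+n b d) (+-monoʳ-≤ b d≤w))
                    where
                    l₅ : ∀ a b w o → a + (b + w) + o ≡ a + o + b + w
                    l₅ = solve-∀
                    d≤w : d ≤ w
                    d≤w = +-cancelˡ-≤ (volA + vol size S + b) d w (≤-trans (≤-reflexive (trans ed (trans (sym eo) (l₅ volA b w o)))) (+-monoˡ-≤ w (+-monoˡ-≤ b (+-monoʳ-≤ volA S≥))))
                    step₈ : (∃ λ V → V ⊆ items E × vol size V ≡ b + d) → Result
                    step₈ (V , V⊆ , eV) = R , R⊆Q , cR , ∣R∣ , richR , richS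
                      where
                      Z : VSet n
                      Z = iA ∪ (S ∪ V)
                      R : VSet n
                      R v = Z (rep v)
                      S∉iA : ∀ i → i ∈ S → i ∉ iA
                      S∉iA i p = ∖-∉ {A = Y} {iA} (∧-∈ˡ (∧-∈ˡ (S⊆ i p)))
                      V∉iA : ∀ i → i ∈ V → i ∉ iA
                      V∉iA i p = ≢true (λ q → true≢false (V⊆ i p) (proj₂ (A-tile (part i) q)))
                      Z⊆Y : Z ⊆ Y
                      Z⊆Y i p with ∨-split {iA i} p
                      ... | inj₁ q = iA⊆Y i q
                      ... | inj₂ q with ∨-split {S i} q
                      ...   | inj₁ r = ∧-∈ˡ (∧-∈ˡ (∧-∈ˡ (S⊆ i r)))
                      ...   | inj₂ r = ∧-∈ˡ (∧-∈ˡ (iE⊆ i (V⊆ i r)))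
                      R⊆Q : R ⊆ Q
                      R⊆Q v p = trans (Q-items v) (Z⊆Y (rep v) p)
                      cR : Closed rep R
                      cR u v p e = subst (_∈ Z) e p
                      ∣R∣ : ∣ R ∣ ≡ t
                      ∣R∣ = trans (∣∘rep∣ Z) (trans (vol-∪ size iA (S ∪ V) (λ i p → cong₂ _∨_ (≢true (λ q → true≢false p (S∉iA i q))) (≢true (λ q → true≢false p (V∉iA i q)))))
                        (trans (cong (volA +_) (trans (vol-∪ size S V (λ i p → ≢true (λ q → true≢false (V⊆ i q) (∖-∉ {A = (Y ∖ iA) ∖ iB} {iE} (S⊆ i p))))) (cong (vol size S +_) eV)))
                          (trans (l₆ volA (vol size S) b d) ed)))
                        where l₆ : ∀ a s b d → a + (s + (b + d)) ≡ a + s + b + d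
                              l₆ = solve-∀
                      richR : Rich x R
                      richR = record { Y = Z ; Q-items = λ _ → refl ; intact = A ; intact⊆ = λ i p → ∨-∈ˡ p ; intact-large = A≥ }
                      richS : Rich x (Q ∖ R)
                      richS = record { Y = Y ∖ Z ; Q-items = λ v → cong (_∧ not (Z (rep v))) (Q-items v) ; intact = B ; intact⊆ = inB ; intact-large = B≥ }
                        where
                        inB : items B ⊆ (Y ∖ Z)
                        inB i p = ∈-∖ {A = Y} {Z} (∧-∈ˡ (iB⊆ i p)) (cong₂ _∨_ (∖-∉ {A = Y} {iA} (iB⊆ i p)) (cong₂ _∨_
                          (≢true (λ q → true≢false p (∖-∉ {A = Y ∖ iA} {iB} (∧-∈ˡ (S⊆ i q))))) (≢true (λ q → true≢false (V⊆ i q) (B-tile (part i) p)))))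

-- Constants

quotient : ∀ a d → 0 < d → ∃ λ x → d * x ≤ a × a < d * suc x
quotient a (suc d) _ = a / suc d ,
  ≤-trans (≤-reflexive (*-comm (suc d) (a / suc d))) (≤-trans (m≤n+m _ (a % suc d)) (≤-reflexive (sym (m≡m%n+[m/n]*n a (suc d))))) ,
  (begin-strict
    a ≡⟨ m≡m%n+[m/n]*n a (suc d) ⟩
    a % suc d + a / suc d * suc d <⟨ +-monoˡ-< (a / suc d * suc d) (m%n<n a (suc d)) ⟩
    suc d + a / suc d * suc d ≡⟨ *-comm (suc (a / suc d)) (suc d) ⟩
    suc d * suc (a / suc d) ∎)
  where open ≤-Reasoning

bernoulli : ∀ b m → b ^ m * (b + m) ≤ suc b ^ m * b
bernoulli b zero = ≤-reflexive (l b)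
  where l : ∀ b → 1 * (b + 0) ≡ 1 * b
        l = solve-∀
bernoulli b (suc m) = begin
  b * b ^ m * (b + suc m) ≡⟨ l₁ b (b ^ m) m ⟩
  b * (b ^ m * (b + m)) + b ^ m * b ≤⟨ +-monoʳ-≤ (b * (b ^ m * (b + m))) (*-monoʳ-≤ (b ^ m) (m≤m+n b m)) ⟩
  b * (b ^ m * (b + m)) + b ^ m * (b + m) ≡⟨ +-comm (b * (b ^ m * (b + m))) _ ⟩
  suc b * (b ^ m * (b + m)) ≤⟨ *-monoʳ-≤ (suc b) (bernoulli b m) ⟩
  suc b * (suc b ^ m * b) ≡⟨ *-assoc (suc b) (suc b ^ m) b ⟨
  suc b * suc b ^ m * b ∎
  where
  open ≤-Reasoning
  l₁ : ∀ b p m → b * p * (b + suc m) ≡ b * (p * (b + m)) + p * b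
  l₁ = solve-∀

doubling : ∀ b N → 0 < b → 2 ^ N * b ^ (suc b * N) ≤ suc b ^ (suc b * N)
doubling b N b>0 = begin
  2 ^ N * b ^ (suc b * N) ≡⟨ cong (2 ^ N *_) (^-*-assoc b (suc b) N) ⟨
  2 ^ N * (b ^ suc b) ^ N ≡⟨ *-^ 2 (b ^ suc b) N ⟨
  (2 * b ^ suc b) ^ N ≤⟨ ^-monoˡ-≤ N base ⟩
  (suc b ^ suc b) ^ N ≡⟨ ^-*-assoc (suc b) (suc b) N ⟩
  suc b ^ (suc b * N) ∎
  where
  open ≤-Reasoning
  l : ∀ p b → 2 * p * b ≡ p * (b + b)
  l = solve-∀
  base : 2 * b ^ suc b ≤ suc b ^ suc b
  base = *-cancelʳ-≤ (2 * b ^ suc b) (suc b ^ suc b) b ⦃ >-nonZero b>0 ⦄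
    (≤-trans (≤-reflexive (l (b ^ suc b) b)) (≤-trans (*-monoʳ-≤ (b ^ suc b) (+-monoʳ-≤ b (n≤1+n b))) (bernoulli b (suc b))))

rounds-suffice : ∀ b n κ m ℓ ℓκ → 0 < b → n < 2 ^ ℓ → suc κ < 2 ^ ℓκ →
  b ^ (suc b * (ℓ + (ℓ + (ℓκ + m)))) * (n * (n * suc κ) * 2 ^ m) < suc b ^ (suc b * (ℓ + (ℓ + (ℓκ + m))))
rounds-suffice b n κ m ℓ ℓκ b>0 hn hκ = begin-strict
  b ^ r * (n * (n * suc κ) * 2 ^ m) <⟨ *-monoʳ-< (b ^ r) ⦃ m^n≢0 b r ⦃ >-nonZero b>0 ⦄ ⦄ below ⟩
  b ^ r * 2 ^ N ≡⟨ *-comm (b ^ r) (2 ^ N) ⟩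
  2 ^ N * b ^ r ≤⟨ doubling b N b>0 ⟩
  suc b ^ r ∎
  where
  open ≤-Reasoning
  N = ℓ + (ℓ + (ℓκ + m))
  r = suc b * N
  l : ∀ n k e → n * (n * k) * e ≡ n * (n * (k * e))
  l = solve-∀
  below : n * (n * suc κ) * 2 ^ m < 2 ^ N
  below = begin-strict
    n * (n * suc κ) * 2 ^ m ≡⟨ l n (suc κ) (2 ^ m) ⟩
    n * (n * (suc κ * 2 ^ m)) ≤⟨ *-mono-≤ (<⇒≤ hn) (*-monoˡ-≤ (suc κ * 2 ^ m) (<⇒≤ hn)) ⟩
    2 ^ ℓ * (2 ^ ℓ * (suc κ * 2 ^ m)) <⟨ *-monoʳ-< (2 ^ ℓ) ⦃ m^n≢0 2 ℓ ⦄ (*-monoʳ-< (2 ^ ℓ) ⦃ m^n≢0 2 ℓ ⦄ (*-monoˡ-< (2 ^ m) ⦃ m^n≢0 2 m ⦄ hκ)) ⟩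
    2 ^ ℓ * (2 ^ ℓ * (2 ^ ℓκ * 2 ^ m)) ≡⟨ cong (λ z → 2 ^ ℓ * (2 ^ ℓ * z)) (^-distribˡ-+-* 2 ℓκ m) ⟨
    2 ^ ℓ * (2 ^ ℓ * 2 ^ (ℓκ + m)) ≡⟨ cong (2 ^ ℓ *_) (^-distribˡ-+-* 2 ℓ (ℓκ + m)) ⟨
    2 ^ ℓ * 2 ^ (ℓ + (ℓκ + m)) ≡⟨ ^-distribˡ-+-* 2 ℓ (ℓ + (ℓκ + m)) ⟨
    2 ^ N ∎

n<2^n : ∀ n → n < 2 ^ n
n<2^n zero = s≤s z≤n
n<2^n (suc n) = ≤-trans (+-mono-≤ (m^n>0 2 n) (n<2^n n)) (≤-reflexive (cong (2 ^ n +_) (sym (+-identityʳ (2 ^ n)))))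

opaque
  block-C : (D Δ k c W : ℕ) → ℕ
  block-C D Δ k c W = drc-chain-bound D Δ k c + clique-bound D Δ (level-const D Δ k c * W)

  block-w : (D Δ k c : ℕ) → ℕ
  block-w D Δ k c = 2 * level-const D Δ k c

  block-n : (D Δ k c : ℕ) → ℕ
  block-n D Δ k c = suc (drc-chain-threshold D Δ 4 k c)

  block-ok : ∀ {n D C Δ k c W w} → block-C D Δ k c W ≤ C → block-w D Δ k c ≤ w → block-n D Δ k c ≤ n → w * w ≤ n →
    BlockOK n D C Δ k (w + w) c W
  block-ok {n} {D} {C} {Δ} {k} {c} {W} {w} hC hw hn hww = record
    { K = 4 ; s² = ≤-trans (≤-reflexive (l₁ w)) (*-monoʳ-≤ 4 hww)
    ; chain-bound = ≤-trans (m≤m+n _ _) hC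
    ; threshold = hn
    ; small = ≤-trans (≤-reflexive (l₂ (level-const D Δ k c) w)) (≤-trans (*-monoˡ-≤ w hw) hww)
    ; gain-bound = ≤-trans (m≤n+m _ (drc-chain-bound D Δ k c)) hC }
    where
    l₁ : ∀ w → (w + w) * (w + w) ≡ 4 * (w * w)
    l₁ = solve-∀
    l₂ : ∀ a w → a * (w + w) ≡ 2 * a * w
    l₂ = solve-∀

record Constants (D Δ k M η ball : ℕ) : Set where
  field
    κ W q₀ b ℓκ A B θ cF C w₀ n₀ : ℕ
    κ₁ : 2 * (2 * (2 * η * (2 * η) * D) * (2 * η)) ≤ κ
    κ₂ : 2 * (2 * M * (2 * M) * D) ≤ κ
    W≥ : 2 * (2 * κ) ≤ W
    q₀≥ : 2 * gain-const D Δ k W W ≤ q₀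
    q₀>0 : 0 < q₀
    b≡ : suc b ≡ 4 * q₀
    κ< : suc κ < 2 ^ ℓκ
    A≡ : A ≡ 2 * q₀ * suc κ
    B≡ : B ≡ suc b * suc A + 1
    θ≡ : θ ≡ 4 * κ + 4 * M
    cF≡ : cF ≡ 8 * (θ * (B * ball))
    C≥η : 2 * η ≤ C
    C≥M : 2 * M ≤ C
    C₁ : block-C D Δ k (2 * M) M ≤ C
    C₂ : block-C D Δ k W W ≤ C
    C₃ : block-C D Δ k cF 1 ≤ C
    w₁ : block-w D Δ k (2 * M) ≤ w₀
    w₂ : block-w D Δ k W ≤ w₀
    w₃ : block-w D Δ k cF ≤ w₀
    w₄ : 4 * M ≤ w₀
    w₅ : suc (q₀ * 2) ≤ w₀
    w₆ : ball ≤ w₀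
    w₇ : (3 + ℓκ) * (2 * (θ * B)) ≤ w₀
    w₈ : 4 * (θ * B) ≤ w₀
    n₁ : block-n D Δ k (2 * M) ≤ n₀
    n₂ : block-n D Δ k W ≤ n₀
    n₃ : block-n D Δ k cF ≤ n₀

constants : ∀ D Δ k M η ball → Constants D Δ k M η ball
constants D Δ k M η ball = build (x₁ + x₂) (m≤m+n x₁ x₂) (m≤n+m x₂ x₁)
  where
  x₁ x₂ : ℕ
  x₁ = 2 * (2 * (2 * η * (2 * η) * D) * (2 * η))
  x₂ = 2 * (2 * M * (2 * M) * D)
  build : ∀ κ → x₁ ≤ κ → x₂ ≤ κ → Constants D Δ k M η ball
  build κ κ₁ κ₂ = build₂ (2 * (2 * κ)) ≤-refl
    where
    build₂ : ∀ W → 2 * (2 * κ) ≤ W → Constants D Δ k M η ball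
    build₂ W W≥ = build₃ (suc (2 * gain-const D Δ k W W)) (n≤1+n _) (s≤s z≤n)
      where
      build₃ : ∀ q₀ → 2 * gain-const D Δ k W W ≤ q₀ → 0 < q₀ → Constants D Δ k M η ball
      build₃ q₀ q₀≥ q₀>0 = build₄ (pred (4 * q₀)) (suc-pred (4 * q₀) ⦃ >-nonZero (≤-trans q₀>0 (m≤n*m q₀ 4)) ⦄) (2 * q₀ * suc κ) refl (4 * κ + 4 * M) refl
        where
        build₄ : ∀ b → suc b ≡ 4 * q₀ → ∀ A → A ≡ 2 * q₀ * suc κ → ∀ θ → θ ≡ 4 * κ + 4 * M → Constants D Δ k M η ball
        build₄ b b≡ A A≡ θ θ≡ = build₅ (suc b * suc A + 1) refl
          where
          build₅ : ∀ B → B ≡ suc b * suc A + 1 → Constants D Δ k M η ball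
          build₅ B B≡ = build₆ (8 * (θ * (B * ball))) refl
            where
            build₆ : ∀ cF → cF ≡ 8 * (θ * (B * ball)) → Constants D Δ k M η ball
            build₆ cF cF≡ = record
              { κ = κ ; W = W ; q₀ = q₀ ; b = b ; ℓκ = suc κ ; A = A ; B = B ; θ = θ ; cF = cF
              ; C = sum Cs ; w₀ = sum ws ; n₀ = sum ns
              ; κ₁ = κ₁ ; κ₂ = κ₂ ; W≥ = W≥ ; q₀≥ = q₀≥ ; q₀>0 = q₀>0 ; b≡ = b≡ ; κ< = n<2^n (suc κ)
              ; A≡ = A≡ ; B≡ = B≡ ; θ≡ = θ≡ ; cF≡ = cF≡
              ; C≥η = at Cs zero ; C≥M = at Cs (suc zero) ; C₁ = at Cs (suc (suc zero)) ; C₂ = at Cs (suc (suc (suc zero))) ; C₃ = at Cs (suc (suc (suc (suc zero))))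
              ; w₁ = at ws zero ; w₂ = at ws (suc zero) ; w₃ = at ws (suc (suc zero)) ; w₄ = at ws (suc (suc (suc zero)))
              ; w₅ = at ws (suc (suc (suc (suc zero)))) ; w₆ = at ws (suc (suc (suc (suc (suc zero)))))
              ; w₇ = at ws (suc (suc (suc (suc (suc (suc zero)))))) ; w₈ = at ws (suc (suc (suc (suc (suc (suc (suc zero)))))))
              ; n₁ = at ns zero ; n₂ = at ns (suc zero) ; n₃ = at ns (suc (suc zero)) }
              where
              at : ∀ xs i → Data.List.lookup xs i ≤ sum xs
              at (x ∷ xs) zero = m≤m+n x _
              at (x ∷ xs) (suc i) = ≤-trans (at xs i) (m≤n+m _ x)
              Cs ws ns : List ℕ
              Cs = 2 * η ∷ 2 * M ∷ block-C D Δ k (2 * M) M ∷ block-C D Δ k W W ∷ block-C D Δ k cF 1 ∷ []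
              ws = block-w D Δ k (2 * M) ∷ block-w D Δ k W ∷ block-w D Δ k cF ∷ 4 * M ∷ suc (q₀ * 2) ∷ ball ∷ (3 + suc κ) * (2 * (θ * B)) ∷ 4 * (θ * B) ∷ []
              ns = block-n D Δ k (2 * M) ∷ block-n D Δ k W ∷ block-n D Δ k cF ∷ []

module _ {D Δ k M η ball : ℕ} (cs : Constants D Δ k M η ball) where
  open Constants cs

  piece-numbers : ∀ n w ℓ c → 0 < M → 0 < ball → 0 < D → 0 < w → w₀ ≤ w → n₀ ≤ n → 0 < ℓ → n < 2 ^ ℓ → w * w * ℓ ≤ n →
    2 * M ≤ c → gain-const D Δ k (2 * M) M ≤ c → PieceNumbers n D C Δ k M c η w ball
  piece-numbers n w ℓ c M>0 ball>0 D>0 w>0 w₀≤ n₀≤ ℓ>0 n<2^ℓ wwℓ M≤c λ₁≤c =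
    with-p (quotient w ball ball>0)
    where
    open ≤-Reasoning
    B>0 : 0 < B
    B>0 = subst (0 <_) (sym B≡) (m≤n+m 1 (suc b * suc A))
    θ>0 : 0 < θ
    θ>0 = subst (0 <_) (sym θ≡) (≤-trans M>0 (≤-trans (m≤n*m M 4) (m≤n+m (4 * M) (4 * κ))))
    θB>0 : 0 < 2 * (θ * B * w)
    θB>0 = ≤-trans (*-mono-≤ (*-mono-≤ θ>0 B>0) w>0) (m≤n*m (θ * B * w) 2)
    b>0 : 0 < b
    b>0 = s≤s⁻¹ (≤-trans (≤-trans (s≤s (s≤s z≤n)) (*-monoʳ-≤ 4 q₀>0)) (≤-reflexive (sym b≡)))
    ww : w * w ≤ n
    ww = ≤-trans (m≤m*n (w * w) ℓ ⦃ >-nonZero ℓ>0 ⦄) wwℓ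
    lin-w : ∀ a → a ≤ w₀ → a * w ≤ n
    lin-w a h = ≤-trans (*-monoˡ-≤ w (≤-trans h w₀≤)) ww
    with-p : (∃ λ p → ball * p ≤ w × w < ball * suc p) → PieceNumbers n D C Δ k M c η w ball
    with-p (p , p≤ , p>) = with-U (quotient n θ θ>0)
      where
      p>0 : 0 < p
      p>0 = *-cancelˡ-< ball 0 p (subst (_< ball * p) (sym (*-zeroʳ ball)) pos)
        where
        pos : 0 < ball * p
        pos = ≮⇒≥ (λ h → <-irrefl refl (≤-<-trans (≤-trans w₆ w₀≤) (<-≤-trans p> (≤-trans (≤-reflexive (*-suc ball p))
          (≤-trans (+-monoʳ-≤ ball (s≤s⁻¹ h)) (≤-reflexive (+-identityʳ ball)))))))
      with-U : (∃ λ U → θ * U ≤ n × n < θ * suc U) → PieceNumbers n D C Δ k M c η w ball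
      with-U (U , U≤ , U>) = with-t (quotient n (2 * (θ * B * w)) θB>0)
        where
        with-t : (∃ λ t → 2 * (θ * B * w) * t ≤ n × n < 2 * (θ * B * w) * suc t) → PieceNumbers n D C Δ k M c η w ball
        with-t (t₁ , t≤ , t>) = record
          { κ = κ ; W = W ; q₀ = q₀ ; b = b ; U = U ; p = p ; m = m ; t₁ = t₁ ; rounds = rounds ; cF = cF
          ; κ₁ = κ₁ ; κ₂ = κ₂ ; η≤C = C≥η ; M≤C = C≥M ; M≤c = M≤c
          ; ok₁ = block-ok C₁ (≤-trans w₁ w₀≤) (≤-trans n₁ n₀≤) ww
          ; λ₁≤c = λ₁≤c ; W≥ = W≥
          ; ok₂ = block-ok C₂ (≤-trans w₂ w₀≤) (≤-trans n₂ n₀≤) ww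
          ; q₀≥ = q₀≥ ; b≡ = b≡
          ; p-small = ≤-trans (≤-reflexive (*-comm p ball)) p≤ ; p>0 = p>0
          ; loss = ≤-trans (*-monoˡ-≤ U (≤-trans (m≤m+n (4 * κ) (4 * M)) (≤-reflexive (sym θ≡)))) U≤
          ; few = ≤-trans (s≤s (≤-reflexive (l₁ q₀ w))) (≤-trans (+-monoˡ-≤ (q₀ * 2 * w) w>0) (lin-w (suc (q₀ * 2)) w₅))
          ; fits = fits
          ; enough = rounds-suffice b n κ m ℓ ℓκ b>0 n<2^ℓ κ<
          ; ok₃ = block-ok C₃ (≤-trans w₃ w₀≤) (≤-trans n₃ n₀≤) ww
          ; holes-many = holes
          ; absorbable = absorb
          ; roomy = roomy }
          where
          m = A * t₁ + 1
          N = ℓ + (ℓ + (ℓκ + m))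
          rounds = suc b * N
          l₁ : ∀ q w → q * (w + w) ≡ q * 2 * w
          l₁ = solve-∀
          -- t₁ dominates the logarithmic terms.
          t-big : 1 + (ℓ + (ℓ + ℓκ)) ≤ t₁
          t-big = s≤s⁻¹ (*-cancelˡ-< (2 * (θ * B * w)) (1 + (ℓ + (ℓ + ℓκ))) (suc t₁) (≤-<-trans (begin
            2 * (θ * B * w) * (1 + (ℓ + (ℓ + ℓκ))) ≤⟨ *-monoʳ-≤ (2 * (θ * B * w)) le ⟩
            2 * (θ * B * w) * ((3 + ℓκ) * ℓ) ≡⟨ l₂ (θ * B) w (3 + ℓκ) ℓ ⟩
            (3 + ℓκ) * (2 * (θ * B)) * (w * ℓ) ≤⟨ *-monoˡ-≤ (w * ℓ) (≤-trans w₇ w₀≤) ⟩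
            w * (w * ℓ) ≡⟨ *-assoc w w ℓ ⟨
            w * w * ℓ ≤⟨ wwℓ ⟩
            n ∎) t>))
            where
            l₂ : ∀ x w e ℓ → 2 * (x * w) * (e * ℓ) ≡ e * (2 * x) * (w * ℓ)
            l₂ = solve-∀
            l₃ : ∀ ℓ e → ℓ + (ℓ + (ℓ + e * ℓ)) ≡ (3 + e) * ℓ
            l₃ = solve-∀
            le : 1 + (ℓ + (ℓ + ℓκ)) ≤ (3 + ℓκ) * ℓ
            le = ≤-trans (+-mono-≤ ℓ>0 (+-monoʳ-≤ ℓ (+-monoʳ-≤ ℓ (m≤m*n ℓκ ℓ ⦃ >-nonZero ℓ>0 ⦄)))) (≤-reflexive (l₃ ℓ ℓκ))
          t>0 : 0 < t₁
          t>0 = ≤-trans (s≤s z≤n) t-big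
          fits : (rounds + t₁) * (w + w) ≤ U
          fits = s≤s⁻¹ (*-cancelˡ-< θ ((rounds + t₁) * (w + w)) (suc U) (≤-<-trans (begin
            θ * ((rounds + t₁) * (w + w)) ≤⟨ *-monoʳ-≤ θ (*-monoˡ-≤ (w + w) bound) ⟩
            θ * (B * t₁ * (w + w)) ≡⟨ l₄ θ B t₁ w ⟩
            2 * (θ * B * w) * t₁ ≤⟨ t≤ ⟩
            n ∎) U>))
            where
            l₄ : ∀ θ B t w → θ * (B * t * (w + w)) ≡ 2 * (θ * B * w) * t
            l₄ = solve-∀
            l₅ : ∀ ℓ e A t → ℓ + (ℓ + (e + (A * t + 1))) ≡ A * t + (1 + (ℓ + (ℓ + e)))
            l₅ = solve-∀
            l₆ : ∀ b A t → b * (A * t + t) + t ≡ (b * suc A + 1) * t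
            l₆ = solve-∀
            bound : rounds + t₁ ≤ B * t₁
            bound = ≤-trans (+-monoˡ-≤ t₁ (*-monoʳ-≤ (suc b) (≤-trans (≤-reflexive (l₅ ℓ ℓκ A t₁)) (+-monoʳ-≤ (A * t₁) t-big))))
              (≤-reflexive (trans (l₆ (suc b) A t₁) (cong (_* t₁) (sym B≡))))
          holes : n ≤ cF * (t₁ * p)
          holes = begin
            n ≤⟨ <⇒≤ t> ⟩
            2 * (θ * B * w) * suc t₁ ≤⟨ *-monoʳ-≤ (2 * (θ * B * w)) (≤-trans (+-monoˡ-≤ t₁ t>0) (≤-reflexive (l₇ t₁))) ⟩
            2 * (θ * B * w) * (2 * t₁) ≡⟨ l₈ (θ * B) w t₁ ⟩
            4 * (θ * B) * t₁ * w ≤⟨ *-monoʳ-≤ (4 * (θ * B) * t₁) (≤-trans (<⇒≤ p>) (*-monoʳ-≤ ball (≤-trans (+-monoˡ-≤ p p>0) (≤-reflexive (l₇ p))))) ⟩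
            4 * (θ * B) * t₁ * (ball * (2 * p)) ≡⟨ l₉ θ B t₁ ball p ⟩
            8 * (θ * (B * ball)) * (t₁ * p) ≡⟨ cong (_* (t₁ * p)) cF≡ ⟨
            cF * (t₁ * p) ∎
            where
            l₇ : ∀ t → t + t ≡ 2 * t
            l₇ = solve-∀
            l₈ : ∀ x w t → 2 * (x * w) * (2 * t) ≡ 4 * x * t * w
            l₈ = solve-∀
            l₉ : ∀ θ B t r p → 4 * (θ * B) * t * (r * (2 * p)) ≡ 8 * (θ * (B * r)) * (t * p)
            l₉ = solve-∀
          absorb : 2 * q₀ * (t₁ * p * suc κ) < m * p
          absorb = begin-strict
            2 * q₀ * (t₁ * p * suc κ) ≡⟨ l₁₀ (2 * q₀) t₁ p (suc κ) ⟩
            2 * q₀ * suc κ * t₁ * p ≡⟨ cong (λ z → z * t₁ * p) A≡ ⟨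
            A * t₁ * p <⟨ *-monoˡ-< p ⦃ >-nonZero p>0 ⦄ (≤-reflexive (+-comm 1 (A * t₁))) ⟩
            m * p ∎
            where
            l₁₀ : ∀ q t p k → q * (t * p * k) ≡ q * k * t * p
            l₁₀ = solve-∀
          roomy : 2 * M * (U + w) ≤ n
          roomy = *-cancelˡ-≤ 2 (begin
            2 * (2 * M * (U + w)) ≡⟨ l₁₁ M U w ⟩
            4 * M * U + 4 * M * w ≤⟨ +-mono-≤ (≤-trans (*-monoˡ-≤ U (≤-trans (m≤n+m (4 * M) (4 * κ)) (≤-reflexive (sym θ≡)))) U≤) (lin-w (4 * M) w₄) ⟩
            n + n ≡⟨ l₁₂ n ⟩
            2 * n ∎)
            where
            l₁₁ : ∀ M U w → 2 * (2 * M * (U + w)) ≡ 4 * M * U + 4 * M * w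
            l₁₁ = solve-∀
            l₁₂ : ∀ n → n + n ≡ 2 * n
            l₁₂ = solve-∀

-- The spanning embedding

reserve-factor : ℕ → ℕ
reserve-factor zero = 21
reserve-factor (suc i) = 3 * (reserve-factor i + 1)

reserve-factor≥ : ∀ i → 21 ≤ reserve-factor i
reserve-factor≥ zero = ≤-refl
reserve-factor≥ (suc i) = ≤-trans (reserve-factor≥ i) (≤-trans (m≤m+n _ 1) (m≤n*m (reserve-factor i + 1) 3))

reserve-factor-mono : ∀ {i j} → i ≤ j → reserve-factor i ≤ reserve-factor j
reserve-factor-mono {i} {j} le with m≤n⇒∃[o]m+o≡n le
... | o , refl = go o
  where
  go : ∀ o → reserve-factor i ≤ reserve-factor (i + o)
  go zero = ≤-reflexive (cong reserve-factor (sym (+-identityʳ i)))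
  go (suc o) = ≤-trans (go o) (≤-trans (≤-trans (m≤m+n _ 1) (m≤n*m (reserve-factor (i + o) + 1) 3)) (≤-reflexive (cong reserve-factor (sym (+-suc i o)))))

separation-degree : ℕ → ℕ
separation-degree Δ = suc Δ * (suc Δ * suc Δ)

record Setting (Δ k D M : ℕ) : Set where
  field
    J M′ c η K : ℕ
    J≡ : J ≡ 2 * M
    M′≡ : M′ ≡ 2 ^ J * M
    c≥ : 4 * M′ ≤ c
    λ≤c : gain-const D Δ k (2 * M′) M′ ≤ c
    η≥ : 2 * c * M′ * suc J < η
    K≡ : K ≡ 2 * M * reserve-factor J
    consts : Constants D Δ k M′ η (separation-degree Δ)

setting : ∀ Δ k D M → Setting Δ k D M
setting Δ k D M = build (2 * M) refl
  where
  build : ∀ J → J ≡ 2 * M → Setting Δ k D M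
  build J J≡ = build₂ (2 ^ J * M) refl
    where
    build₂ : ∀ M′ → M′ ≡ 2 ^ J * M → Setting Δ k D M
    build₂ M′ M′≡ = build₃ (4 * M′ + gain-const D Δ k (2 * M′) M′) (m≤m+n _ _) (m≤n+m _ (4 * M′))
      where
      build₃ : ∀ c → 4 * M′ ≤ c → gain-const D Δ k (2 * M′) M′ ≤ c → Setting Δ k D M
      build₃ c c≥ λ≤c = record
        { J = J ; M′ = M′ ; c = c ; η = suc (2 * c * M′ * suc J) ; K = 2 * M * reserve-factor J ; J≡ = J≡ ; M′≡ = M′≡
        ; c≥ = c≥ ; λ≤c = λ≤c ; η≥ = ≤-refl ; K≡ = refl ; consts = constants D Δ k M′ _ (separation-degree Δ) }

module _ {Δ k D M : ℕ} (st : Setting Δ k D M) (D>0 : 0 < D) (M>0 : 0 < M) (Δ>0 : 0 < Δ) where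
  open Setting st
  open Constants consts using (C; w₀; n₀)

  module _ {n : ℕ} (w′ ℓ : ℕ) (n>0 : 0 < n) (c≤n : c ≤ n) (n₀≤n : n₀ ≤ n) (w₀≤w : w₀ ≤ suc w′) (ℓ>0 : 0 < ℓ) (n<2^ℓ : n < 2 ^ ℓ)
    (K-fits : K * (suc w′ * suc w′ * ℓ) ≤ n)
    (G H : Graph n) (lin : Lin G D C) (degree : ∀ u → n ≤ M * Nb G u (λ _ → true))
    (maxdeg : ∀ v → ∣ adj H v ∣ ≤ Δ) (col : Fin n → Fin k) (proper : ∀ x y → adj H x y ≡ true → ¬ (col x ≡ col y))
    (part : Fin n → Fin n) (part-adj : ∀ i j → adj H i j ≡ true → part i ≡ part j)
    (small : ∀ v → ∣ (λ u → ⌊ part u ≟F part v ⌋) ∣ ≤ suc w′)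
    (coprime : ∀ v → foldr gcd 0 (map (λ u → if ⌊ part u ≟F part v ⌋ then componentOrder H u else 0) (allFin n)) ≡ 1) where

    open Components H
    open Tiled part part-adj w′ small coprime
    open Interval size part w′ tile-small tile-gcd using (w; a≤w; reserve-size)

    private
      Z : ℕ
      Z = w * w * ℓ

      w≤ww : w ≤ w * w
      w≤ww = m≤m*n w w

      ww≤Z : w * w ≤ Z
      ww≤Z = m≤m*n (w * w) ℓ ⦃ >-nonZero ℓ>0 ⦄

      w≤Z : w ≤ Z
      w≤Z = ≤-trans w≤ww ww≤Z

      level : ℕ → ℕ
      level j = reserve-factor (J ∸ j) * Z

      K>0 : 0 < K
      K>0 = subst (0 <_) (sym K≡) (*-mono-≤ (≤-trans M>0 (m≤n*m M 2)) (≤-trans (s≤s z≤n) (reserve-factor≥ J)))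

      Z≤n : Z ≤ n
      Z≤n = ≤-trans (m≤n*m Z K ⦃ >-nonZero K>0 ⦄) K-fits

      top-level : 2 * M * (reserve-factor J * Z) ≤ n
      top-level = ≤-trans (≤-reflexive (trans (sym (*-assoc (2 * M) (reserve-factor J) Z)) (cong (_* Z) (sym K≡)))) K-fits

      reserve≤ : ∀ i → reserve-size ℓ ≤ reserve-factor i * Z
      reserve≤ i = ≤-trans (+-mono-≤ (+-mono-≤ (≤-reflexive (l₁ w ℓ)) w≤Z) (≤-trans (≤-reflexive (*-suc w w)) (+-mono-≤ w≤Z ww≤Z)))
          (≤-trans (≤-reflexive (l₂ Z)) (*-monoˡ-≤ Z (reserve-factor≥ i)))
        where
        l₁ : ∀ w ℓ → w * (ℓ * (18 * w)) ≡ 18 * (w * w * ℓ)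
        l₁ = solve-∀
        l₂ : ∀ z → 18 * z + z + (z + z) ≡ 21 * z
        l₂ = solve-∀

      grow-level : ∀ i → 3 * (reserve-factor i * Z + w) ≤ reserve-factor (suc i) * Z
      grow-level i = ≤-trans (*-monoʳ-≤ 3 (+-monoʳ-≤ (reserve-factor i * Z) w≤Z)) (≤-reflexive (l (reserve-factor i) Z))
        where
        l : ∀ e z → 3 * (e * z + z) ≡ 3 * (e + 1) * z
        l = solve-∀

      2M>0 : 0 < 2 * M
      2M>0 = ≤-trans M>0 (m≤n*m M 2)

      split : ∀ j Q t → j < J → Rich (level j) Q → Closed rep Q → n ≤ 2 * M * t → n + 2 * M * t ≤ 2 * M * ∣ Q ∣ →
        ∃ λ R → R ⊆ Q × Closed rep R × ∣ R ∣ ≡ t × Rich (level (suc j)) R × Rich (level (suc j)) (Q ∖ R)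
      split j Q t j<J rich cQ ht hQ = split-rich ℓ ℓ>0 n<2^ℓ x (level j) (reserve≤ i) step Q t rich
          (*-cancelˡ-≤ (2 * M) ⦃ >-nonZero 2M>0 ⦄ (≤-trans cost ht))
          (*-cancelˡ-≤ (2 * M) ⦃ >-nonZero 2M>0 ⦄ (≤-trans (≤-reflexive (*-distribˡ-+ (2 * M) t _)) (≤-trans (+-monoʳ-≤ (2 * M * t) cost) (≤-trans (≤-reflexive (+-comm (2 * M * t) n)) hQ))))
        where
        i = J ∸ suc j
        x = reserve-factor i * Z
        J∸j : J ∸ j ≡ suc i
        J∸j = +-∸-assoc 1 j<J
        step : 3 * (x + w) ≤ level j
        step = ≤-trans (grow-level i) (≤-reflexive (cong (λ z → reserve-factor z * Z) (sym J∸j)))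
        cost : 2 * M * (2 * (x + w)) ≤ n
        cost = ≤-trans (*-monoʳ-≤ (2 * M) (≤-trans (*-monoˡ-≤ (x + w) (n≤1+n 2)) (≤-trans step (*-monoˡ-≤ Z (reserve-factor-mono (m∸n≤m J j)))))) top-level

      M′>0 : 0 < M′
      M′>0 = subst (0 <_) (sym M′≡) (*-mono-≤ (m^n>0 2 J) M>0)

      embed-piece : ∀ P Q → Closed rep Q → ∣ Q ∣ ≡ ∣ P ∣ → Piece G P M′ c η → ∃ λ θ → Emb G H P Q θ
      embed-piece P Q cQ e piece = Phases.piece-embed G H D C lin n>0 Δ Δ>0 maxdeg k col proper rep rep-adj w (s≤s z≤n) a≤w
        P Q cQ e M′ c η piece (piece-numbers consts n w ℓ c M′>0 (s≤s z≤n) D>0 (s≤s z≤n) w₀≤w n₀≤n ℓ>0 n<2^ℓ Z≤n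
          (≤-trans (*-monoˡ-≤ M′ {2} {4} (s≤s (s≤s z≤n))) c≥) λ≤c)

    spanning-embedding : ∃ λ θ → Emb G H (λ _ → true) (λ _ → true) θ
    spanning-embedding = S.split-embed J 0 (+-identityʳ J) (λ _ → true) (λ _ → true) S.whole
        (rich-whole (level 0) (≤-trans (m≤n*m (level 0) (2 * M) ⦃ >-nonZero 2M>0 ⦄) top-level)) (λ _ _ _ _ → refl) refl
      where
      module S = Splitting G H n>0 rep rep-adj M J c η J≡ degree (subst (λ z → 4 * z ≤ c) M′≡ c≥) (subst (λ z → 2 * c * z * suc J < η) M′≡ η≥) c≤n
        (λ j → Rich (level j)) split (λ P Q cQ e piece → embed-piece P Q cQ e (subst (λ z → Piece G P z c η) (sym M′≡) piece))

-- The exponential bound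

power-step : ∀ t N → suc t ^ N ≤ t ^ N + N * suc t ^ pred N
power-step t zero = ≤-refl
power-step t (suc N) = begin
  suc t * suc t ^ N ≡⟨⟩
  suc t ^ N + t * suc t ^ N ≤⟨ +-monoʳ-≤ (suc t ^ N) (*-monoʳ-≤ t (power-step t N)) ⟩
  suc t ^ N + t * (t ^ N + N * suc t ^ pred N) ≡⟨ l (suc t ^ N) t (t ^ N) N (suc t ^ pred N) ⟩
  t * t ^ N + (suc t ^ N + N * (t * suc t ^ pred N)) ≤⟨ +-monoʳ-≤ (t * t ^ N) (+-monoʳ-≤ (suc t ^ N) (shrink N)) ⟩
  t * t ^ N + suc N * suc t ^ N ∎
  where
  open ≤-Reasoning
  l : ∀ s t p N r → s + t * (p + N * r) ≡ t * p + (s + N * (t * r))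
  l = solve-∀
  shrink : ∀ N → N * (t * suc t ^ pred N) ≤ N * suc t ^ N
  shrink zero = z≤n
  shrink (suc N) = *-monoʳ-≤ (suc N) (*-monoˡ-≤ (suc t ^ N) (n≤1+n t))

-- expSum N t = 2^N N! Σ_{j<N} (t/2)^j / j!
expSum : ℕ → ℕ → ℕ
expSum zero t = 0
expSum (suc N) t = 2 * suc N * (expSum N t + t ^ N)

-- The derivative of the truncated exponential series is the shorter series.
expSum-step : ∀ N t → expSum (suc N) (suc t) ≤ expSum (suc N) t + suc N * expSum N (suc t)
expSum-step zero t = ≤-refl
expSum-step (suc N) t = begin
  2 * suc (suc N) * (expSum (suc N) (suc t) + suc t ^ suc N) ≤⟨ *-monoʳ-≤ (2 * suc (suc N)) (+-mono-≤ (expSum-step N t) (power-step t (suc N))) ⟩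
  2 * suc (suc N) * ((expSum (suc N) t + suc N * expSum N (suc t)) + (t ^ suc N + suc N * suc t ^ N)) ≡⟨ l (suc (suc N)) (suc N) (expSum (suc N) t) (expSum N (suc t)) (t ^ suc N) (suc t ^ N) ⟩
  2 * suc (suc N) * (expSum (suc N) t + t ^ suc N) + suc (suc N) * (2 * suc N * (expSum N (suc t) + suc t ^ N)) ∎
  where
  open ≤-Reasoning
  l : ∀ n m x y p r → 2 * n * ((x + m * y) + (p + m * r)) ≡ 2 * n * (x + p) + n * (2 * m * (y + r))
  l = solve-∀

expSum-double : ∀ N t → expSum N (suc t) ≤ 2 * expSum N t
expSum-double zero t = z≤n
expSum-double (suc N) t = cancel-double (expSum (suc N) (suc t)) (expSum (suc N) t) (suc N * expSum N (suc t)) (expSum-step N t)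
  (≤-trans (≤-reflexive (sym (*-assoc 2 (suc N) (expSum N (suc t))))) (*-monoʳ-≤ (2 * suc N) (m≤m+n (expSum N (suc t)) (suc t ^ N))))
  where
  cancel-double : ∀ a b d → a ≤ b + d → 2 * d ≤ a → a ≤ 2 * b
  cancel-double a b d h₁ h₂ = +-cancelʳ-≤ a a (2 * b) (≤-trans (≤-reflexive (l₁ a)) (≤-trans (*-monoʳ-≤ 2 h₁) (≤-trans (≤-reflexive (*-distribˡ-+ 2 b d)) (+-monoʳ-≤ (2 * b) h₂))))
    where l₁ : ∀ a → a + a ≡ 2 * a
          l₁ = solve-∀

expSum-bound : ∀ N t → expSum N t ≤ 2 ^ N * N ! * 2 ^ t
expSum-bound N (suc t) = ≤-trans (expSum-double N t) (≤-trans (*-monoʳ-≤ 2 (expSum-bound N t)) (≤-reflexive (l (2 ^ N * N !) (2 ^ t))))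
  where l : ∀ a b → 2 * (a * b) ≡ a * (2 * b)
        l = solve-∀
expSum-bound N zero = ≤-trans (at-zero N) (≤-reflexive (sym (*-identityʳ _)))
  where
  at-zero : ∀ N → expSum N 0 ≤ 2 ^ N * N !
  at-zero zero = z≤n
  at-zero (suc zero) = ≤-refl
  at-zero (suc (suc N)) = ≤-trans (≤-reflexive (cong (2 * suc (suc N) *_) (+-identityʳ (expSum (suc N) 0))))
    (≤-trans (*-monoʳ-≤ (2 * suc (suc N)) (at-zero (suc N))) (≤-reflexive (l (suc (suc N)) (2 ^ suc N) (suc N !))))
    where l : ∀ n p f → 2 * n * (p * f) ≡ 2 * p * (n * f)
          l = solve-∀

-- series N s = N! Σ_{j<N} s^j / j!
series : ℕ → ℕ → ℕ
series zero s = 0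
series (suc N) s = suc N * (series N s + s ^ N)

expSum-series : ∀ N s → expSum N (2 * s) ≡ 2 ^ N * series N s
expSum-series zero s = refl
expSum-series (suc N) s = trans (cong₂ (λ a b → 2 * suc N * (a + b)) (expSum-series N s) (*-^ 2 s N)) (l (suc N) (2 ^ N) (series N s) (s ^ N))
  where l : ∀ n p v r → 2 * n * (p * v + p * r) ≡ 2 * p * (n * (v + r))
        l = solve-∀

series-bound : ∀ N s → series N s ≤ N ! * 2 ^ (2 * s)
series-bound N s = *-cancelˡ-≤ (2 ^ N) ⦃ m^n≢0 2 N ⦄ (≤-trans (≤-reflexive (sym (expSum-series N s))) (≤-trans (expSum-bound N (2 * s)) (≤-reflexive (*-assoc (2 ^ N) (N !) _))))

ℚ-ring : AlmostCommutativeRing 0ℓ 0ℓ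
ℚ-ring = fromCommutativeRing ℚₚ.+-*-commutativeRing (λ _ → nothing)

ℚᵘ-of : ∀ a d → ℚ.toℚᵘ (ℤ.+ a ℚ./ suc d) ℚᵘ.≃ ℚᵘ.mkℚᵘ (ℤ.+ a) d
ℚᵘ-of a d = ℚₚ.toℚᵘ-fromℚᵘ (ℚᵘ.mkℚᵘ (ℤ.+ a) d)

ℕ→ℚ-+ : ∀ a b → ℕ→ℚ (a + b) ≡ ℕ→ℚ a ℚ.+ ℕ→ℚ b
ℕ→ℚ-+ a b = ℚₚ.toℚᵘ-injective (ℚᵘₚ.≃-trans (ℚᵘ-of (a + b) 0) (ℚᵘₚ.≃-sym (ℚᵘₚ.≃-trans (ℚₚ.toℚᵘ-homo-+ (ℕ→ℚ a) (ℕ→ℚ b))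
  (ℚᵘₚ.≃-trans (ℚᵘₚ.+-cong (ℚᵘ-of a 0) (ℚᵘ-of b 0)) (ℚᵘ.*≡* (cong (ℤ._* ℤ.+ 1) (cong₂ ℤ._+_ (ℤₚ.*-identityʳ (ℤ.+ a)) (ℤₚ.*-identityʳ (ℤ.+ b)))))))))

ℕ→ℚ-* : ∀ a b → ℕ→ℚ (a * b) ≡ ℕ→ℚ a ℚ.* ℕ→ℚ b
ℕ→ℚ-* a b = ℚₚ.toℚᵘ-injective (ℚᵘₚ.≃-trans (ℚᵘ-of (a * b) 0) (ℚᵘₚ.≃-sym (ℚᵘₚ.≃-trans (ℚₚ.toℚᵘ-homo-* (ℕ→ℚ a) (ℕ→ℚ b))
  (ℚᵘₚ.≃-trans (ℚᵘₚ.*-cong (ℚᵘ-of a 0) (ℚᵘ-of b 0)) (ℚᵘ.*≡* (cong (ℤ._* ℤ.+ 1) (sym (ℤₚ.pos-* a b))))))))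

ℕ→ℚ-mono : ∀ {a b} → a ≤ b → ℕ→ℚ a ℚ.≤ ℕ→ℚ b
ℕ→ℚ-mono {a} {b} h = ℚₚ.toℚᵘ-cancel-≤ (ℚᵘₚ.≤-respˡ-≃ (ℚᵘₚ.≃-sym (ℚᵘ-of a 0)) (ℚᵘₚ.≤-respʳ-≃ (ℚᵘₚ.≃-sym (ℚᵘ-of b 0))
  (ℚᵘ.*≤* (ℤₚ.*-monoʳ-≤-nonNeg (ℤ.+ 1) (ℤ.+≤+ h)))))

ℕ→ℚ-reflect : ∀ {a b} → ℕ→ℚ a ℚ.≤ ℕ→ℚ b → a ≤ b
ℕ→ℚ-reflect {a} {b} h with ℚᵘₚ.≤-respˡ-≃ (ℚᵘ-of a 0) (ℚᵘₚ.≤-respʳ-≃ (ℚᵘ-of b 0) (ℚₚ.toℚᵘ-mono-≤ h))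
... | ℚᵘ.*≤* le = ℤₚ.drop‿+≤+ (subst₂ ℤ._≤_ (ℤₚ.*-identityʳ (ℤ.+ a)) (ℤₚ.*-identityʳ (ℤ.+ b)) le)

fraction-* : ∀ a d .⦃ _ : NonZero d ⦄ → (ℤ.+ a ℚ./ d) ℚ.* ℕ→ℚ d ≡ ℕ→ℚ a
fraction-* a (suc d) = ℚₚ.toℚᵘ-injective (ℚᵘₚ.≃-trans (ℚₚ.toℚᵘ-homo-* (ℤ.+ a ℚ./ suc d) (ℕ→ℚ (suc d)))
  (ℚᵘₚ.≃-trans (ℚᵘₚ.*-cong (ℚᵘ-of a d) (ℚᵘ-of (suc d) 0)) (ℚᵘₚ.≃-trans (ℚᵘ.*≡* eq) (ℚᵘₚ.≃-sym (ℚᵘ-of a 0)))))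
  where
  eq : (ℤ.+ a ℤ.* ℤ.+ suc d) ℤ.* ℤ.+ 1 ≡ ℤ.+ a ℤ.* ℤ.+ suc (d * 1)
  eq = trans (ℤₚ.*-identityʳ _) (cong (λ z → ℤ.+ a ℤ.* ℤ.+ suc z) (sym (*-identityʳ d)))

0≤ℕ→ℚ : ∀ a → 0ℚ ℚ.≤ ℕ→ℚ a
0≤ℕ→ℚ a = ℕ→ℚ-mono {0} {a} z≤n

*-monoˡ : ∀ {p q} r → 0ℚ ℚ.≤ r → p ℚ.≤ q → r ℚ.* p ℚ.≤ r ℚ.* q
*-monoˡ r h le = ℚₚ.*-monoˡ-≤-nonNeg r ⦃ ℚ.nonNegative h ⦄ le

*-nonNeg : ∀ {p q} → 0ℚ ℚ.≤ p → 0ℚ ℚ.≤ q → 0ℚ ℚ.≤ p ℚ.* q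
*-nonNeg {p} {q} hp hq = ℚₚ.≤-trans (ℚₚ.≤-reflexive (sym (ℚₚ.*-zeroʳ p))) (*-monoˡ p hp hq)

0≤fraction : ∀ a d .⦃ _ : NonZero d ⦄ → 0ℚ ℚ.≤ ℤ.+ a ℚ./ d
0≤fraction a d = ℚₚ.nonNegative⁻¹ (ℤ.+ a ℚ./ d) ⦃ ℚₚ.normalize-nonNeg a d ⦄

0≤+ : ∀ {p q} → 0ℚ ℚ.≤ p → 0ℚ ℚ.≤ q → 0ℚ ℚ.≤ p ℚ.+ q
0≤+ hp hq = ℚₚ.+-mono-≤ hp hq

expOdd≥0 : ∀ K x → 0ℚ ℚ.≤ expOdd K x
expOdd≥0 zero x = ℚₚ.≤-refl
expOdd≥0 (suc K) x = 0≤+ (expOdd≥0 K x) (0≤fraction (x ^ K) (suc (2 * K) !) ⦃ suc (2 * K) !≢0 ⦄)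

exp-series : ∀ n s K → n ≤ s * s → (expEven K n ℚ.+ ℕ→ℚ s ℚ.* expOdd K n) ℚ.* ℕ→ℚ ((2 * K) !) ℚ.≤ ℕ→ℚ (series (2 * K) s)
exp-series n s zero h = ℚₚ.≤-reflexive (trans (cong (ℚ._* ℕ→ℚ 1) (trans (cong (0ℚ ℚ.+_) (ℚₚ.*-zeroʳ (ℕ→ℚ s))) (ℚₚ.+-identityʳ 0ℚ))) (ℚₚ.*-zeroˡ (ℕ→ℚ 1)))
exp-series n s (suc K) h = subst (λ N → lhs ℚ.* ℕ→ℚ (N !) ℚ.≤ ℕ→ℚ (series N s)) (sym (l₀ K)) main
  where
  l₀ : ∀ K → 2 * suc K ≡ suc (suc (2 * K))
  l₀ = solve-∀
  N = 2 * K
  f = N !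
  A = expEven K n
  B = expOdd K n
  u = (ℤ.+ (n ^ K) ℚ./ f) ⦃ N !≢0 ⦄
  v = (ℤ.+ (n ^ K) ℚ./ (suc N !)) ⦃ suc N !≢0 ⦄
  lhs = (A ℚ.+ u) ℚ.+ ℕ→ℚ s ℚ.* (B ℚ.+ v)
  c₁ = suc N
  c₂ = suc (suc N)
  factor : ℕ→ℚ (suc (suc N) !) ≡ ℕ→ℚ c₂ ℚ.* (ℕ→ℚ c₁ ℚ.* ℕ→ℚ f)
  factor = trans (ℕ→ℚ-* c₂ (c₁ * f)) (cong (ℕ→ℚ c₂ ℚ.*_) (ℕ→ℚ-* c₁ f))
  vf : v ℚ.* (ℕ→ℚ c₁ ℚ.* ℕ→ℚ f) ≡ ℕ→ℚ (n ^ K)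
  vf = trans (cong (v ℚ.*_) (sym (ℕ→ℚ-* c₁ f))) (fraction-* (n ^ K) (suc N !) ⦃ suc N !≢0 ⦄)
  expand : ∀ A B u v S f c₁ c₂ → ((A ℚ.+ u) ℚ.+ S ℚ.* (B ℚ.+ v)) ℚ.* (c₂ ℚ.* (c₁ ℚ.* f)) ≡
    (c₂ ℚ.* c₁) ℚ.* ((A ℚ.+ S ℚ.* B) ℚ.* f) ℚ.+ ((c₂ ℚ.* c₁) ℚ.* (u ℚ.* f) ℚ.+ (c₂ ℚ.* S) ℚ.* (v ℚ.* (c₁ ℚ.* f)))
  expand = Tactic.RingSolver.solve-∀ ℚ-ring
  collect : (ℕ→ℚ c₂ ℚ.* ℕ→ℚ c₁) ℚ.* ℕ→ℚ (series N s) ℚ.+ ((ℕ→ℚ c₂ ℚ.* ℕ→ℚ c₁) ℚ.* ℕ→ℚ (n ^ K) ℚ.+ (ℕ→ℚ c₂ ℚ.* ℕ→ℚ s) ℚ.* ℕ→ℚ (n ^ K)) ≡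
    ℕ→ℚ (c₂ * c₁ * series N s + (c₂ * c₁ * n ^ K + c₂ * s * n ^ K))
  collect = sym (trans (ℕ→ℚ-+ (c₂ * c₁ * series N s) _) (cong₂ ℚ._+_ (prod c₂ c₁ (series N s)) (trans (ℕ→ℚ-+ (c₂ * c₁ * n ^ K) _) (cong₂ ℚ._+_ (prod c₂ c₁ (n ^ K)) (prod c₂ s (n ^ K))))))
    where
    prod : ∀ a b c → ℕ→ℚ (a * b * c) ≡ (ℕ→ℚ a ℚ.* ℕ→ℚ b) ℚ.* ℕ→ℚ c
    prod a b c = trans (ℕ→ℚ-* (a * b) c) (cong (ℚ._* ℕ→ℚ c) (ℕ→ℚ-* a b))
  nK : n ^ K ≤ s ^ N
  nK = ≤-trans (^-monoˡ-≤ K h) (≤-reflexive (trans (cong (_^ K) (cong (s *_) (sym (*-identityʳ s)))) (^-*-assoc s 2 K)))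
  below : c₂ * c₁ * series N s + (c₂ * c₁ * n ^ K + c₂ * s * n ^ K) ≤ series (suc (suc N)) s
  below = ≤-trans (+-monoʳ-≤ (c₂ * c₁ * series N s) (+-mono-≤ (*-monoʳ-≤ (c₂ * c₁) nK) (*-monoʳ-≤ (c₂ * s) nK))) (≤-reflexive (l c₂ c₁ (series N s) s (s ^ N)))
    where
    l : ∀ a b x s p → a * b * x + (a * b * p + a * s * p) ≡ a * (b * (x + p) + s * p)
    l = solve-∀
  main : lhs ℚ.* ℕ→ℚ (suc (suc N) !) ℚ.≤ ℕ→ℚ (series (suc (suc N)) s)
  main = ℚₚ.≤-trans (ℚₚ.≤-reflexive (trans (cong (lhs ℚ.*_) factor) (trans (expand A B u v (ℕ→ℚ s) (ℕ→ℚ f) (ℕ→ℚ c₁) (ℕ→ℚ c₂))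
      (cong (((ℕ→ℚ c₂ ℚ.* ℕ→ℚ c₁) ℚ.* ((A ℚ.+ ℕ→ℚ s ℚ.* B) ℚ.* ℕ→ℚ f)) ℚ.+_) (cong₂ ℚ._+_ (cong ((ℕ→ℚ c₂ ℚ.* ℕ→ℚ c₁) ℚ.*_) (fraction-* (n ^ K) f ⦃ N !≢0 ⦄)) (cong ((ℕ→ℚ c₂ ℚ.* ℕ→ℚ s) ℚ.*_) vf))))))
    (ℚₚ.≤-trans (ℚₚ.+-monoˡ-≤ _ (*-monoˡ (ℕ→ℚ c₂ ℚ.* ℕ→ℚ c₁) (*-nonNeg (0≤ℕ→ℚ c₂) (0≤ℕ→ℚ c₁)) (exp-series n s K h)))
      (ℚₚ.≤-trans (ℚₚ.≤-reflexive collect) (ℕ→ℚ-mono below)))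

AtMostSqrtOverLog⇒ : ∀ m n s → n ≤ s * s → AtMostSqrtOverLog m n → n ^ m ≤ 2 ^ (2 * s)
AtMostSqrtOverLog⇒ m n s hs (K , h) = *-cancelʳ-≤ (n ^ m) (2 ^ (2 * s)) ((2 * K) !) ⦃ (2 * K) !≢0 ⦄ (ℕ→ℚ-reflect (ℚₚ.≤-trans (ℚₚ.≤-reflexive (ℕ→ℚ-* (n ^ m) ((2 * K) !)))
    (ℚₚ.≤-trans (ℚₚ.*-monoʳ-≤-nonNeg (ℕ→ℚ ((2 * K) !)) ⦃ ℚ.nonNegative (0≤ℕ→ℚ ((2 * K) !)) ⦄ below) (ℚₚ.≤-trans (exp-series n s K hs)
      (ℕ→ℚ-mono (≤-trans (series-bound (2 * K) s) (≤-reflexive (*-comm ((2 * K) !) (2 ^ (2 * s))))))))))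
  where
  A = expEven K n
  B = expOdd K n
  X = ℕ→ℚ (n ^ m)
  SB = ℕ→ℚ s ℚ.* B
  SB≥0 : 0ℚ ℚ.≤ SB
  SB≥0 = *-nonNeg (0≤ℕ→ℚ s) (expOdd≥0 K n)
  deviation : (X ℚ.- A ℚ.≤ 0ℚ) ⊎ ((X ℚ.- A) ℚ.* (X ℚ.- A) ℚ.≤ ℕ→ℚ n ℚ.* B ℚ.* B) → X ℚ.- A ℚ.≤ SB
  deviation (inj₁ neg) = ℚₚ.≤-trans neg SB≥0
  deviation (inj₂ sq) = by-order ((X ℚ.- A) ℚₚ.≤? SB)
    where
    swap : ∀ S B → (S ℚ.* S) ℚ.* (B ℚ.* B) ≡ (S ℚ.* B) ℚ.* (S ℚ.* B)
    swap = Tactic.RingSolver.solve-∀ ℚ-ring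
    Dv = X ℚ.- A
    contradict : SB ℚ.< Dv → X ℚ.- A ℚ.≤ SB
    contradict gt = ⊥-elim (ℚₚ.<-irrefl refl (ℚₚ.<-≤-trans (strict gt) (ℚₚ.≤-trans sq (ℚₚ.≤-trans (ℚₚ.≤-reflexive (ℚₚ.*-assoc (ℕ→ℚ n) B B))
            (ℚₚ.≤-trans (ℚₚ.*-monoʳ-≤-nonNeg (B ℚ.* B) ⦃ ℚ.nonNegative (*-nonNeg (expOdd≥0 K n) (expOdd≥0 K n)) ⦄ (ℕ→ℚ-mono hs))
              (ℚₚ.≤-reflexive (trans (cong (ℚ._* (B ℚ.* B)) (ℕ→ℚ-* s s)) (swap (ℕ→ℚ s) B))))))))
      where
      strict : SB ℚ.< Dv → SB ℚ.* SB ℚ.< Dv ℚ.* Dv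
      strict gt = ℚₚ.≤-<-trans (*-monoˡ SB SB≥0 (ℚₚ.<⇒≤ gt)) (ℚₚ.*-monoˡ-<-pos Dv ⦃ ℚ.positive (ℚₚ.≤-<-trans SB≥0 gt) ⦄ gt)
    by-order : Dec (X ℚ.- A ℚ.≤ SB) → X ℚ.- A ℚ.≤ SB
    by-order (yes le) = le
    by-order (no nle) = contradict (ℚₚ.≰⇒> nle)
  below : X ℚ.≤ A ℚ.+ SB
  below = ℚₚ.≤-trans (ℚₚ.≤-reflexive (restore X A)) (ℚₚ.+-mono-≤ (ℚₚ.≤-refl {A}) (deviation h))
    where
    restore : ∀ X A → X ≡ A ℚ.+ (X ℚ.- A)
    restore X A = sym (trans (ℚₚ.+-comm A (X ℚ.- A)) (trans (ℚₚ.+-assoc X (ℚ.- A) A) (trans (cong (X ℚ.+_) (ℚₚ.+-inverseˡ A)) (ℚₚ.+-identityʳ X))))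

-- From rationals to naturals

2edges≤E : ∀ {n} (G : Graph n) U → 2 * edgesIn G U ≤ E G U
2edges≤E {n} G U = begin
  2 * edgesIn G U ≡⟨ l (edgesIn G U) ⟩
  edgesIn G U + edgesIn G U ≡⟨ cong (edgesIn G U +_) (∑-swap vs vs _) ⟩
  edgesIn G U + ∑V (λ i → ∑V (λ j → 𝟙 (x j i))) ≡⟨ trans (sym (∑-+ vs _ _)) (∑-cong vs (λ i → sym (∑-+ vs _ _))) ⟩
  ∑V (λ i → ∑V (λ j → 𝟙 (x i j) + 𝟙 (x j i))) ≤⟨ ∑-mono vs (λ i → ≤-trans (∑-mono vs (pt i)) (≤-reflexive (∑-*ˡ vs (𝟙 (U i)) _))) ⟩
  E G U ∎
  where
  open ≤-Reasoning
  vs = allFin n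
  l : ∀ a → 2 * a ≡ a + a
  l = solve-∀
  x : Fin n → Fin n → Bool
  x i j = ⌊ i Fin.<? j ⌋ ∧ U i ∧ U j ∧ adj G i j
  pt : ∀ i j → 𝟙 (x i j) + 𝟙 (x j i) ≤ 𝟙 (U i) * 𝟙 (adj G i j ∧ U j)
  pt i j rewrite adj-sym G j i with i Fin.<? j | j Fin.<? i | U i | U j | adj G i j
  ... | yes p | yes q | _ | _ | _ = ⊥-elim (<-asym p q)
  ... | yes p | no q | true | true | true = s≤s z≤n
  ... | yes p | no q | true | true | false = z≤n
  ... | yes p | no q | true | false | _ = z≤n
  ... | yes p | no q | false | true | _ = z≤n
  ... | yes p | no q | false | false | _ = z≤n
  ... | no p | yes q | true | true | true = s≤s z≤n
  ... | no p | yes q | true | true | false = z≤n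
  ... | no p | yes q | true | false | _ = z≤n
  ... | no p | yes q | false | true | _ = z≤n
  ... | no p | yes q | false | false | _ = z≤n
  ... | no p | no q | _ | _ | _ = z≤n

archimedes : ∀ d → 0ℚ ℚ.< d → ∃ λ D → 0 < D × 1ℚ ℚ.≤ d ℚ.* ℕ→ℚ D
archimedes d@(ℚ.mkℚ (ℤ.+ suc a) b _) _ = suc b , s≤s z≤n , ℚₚ.≤-trans (ℕ→ℚ-mono {1} {suc a} (s≤s z≤n))
  (ℚₚ.≤-reflexive (trans (sym (fraction-* (suc a) (suc b))) (cong (ℚ._* ℕ→ℚ (suc b)) (ℚₚ.↥p/↧p≡p d))))
archimedes (ℚ.mkℚ (ℤ.+ zero) b _) (ℚ.*<* h) = ⊥-elim (impossible h)
  where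
  impossible : ¬ (ℤ.+ 0 ℤ.* ℤ.+ 1 ℤ.< ℤ.+ 0 ℤ.* ℤ.+ suc b)
  impossible (ℤ.+<+ ())
archimedes (ℚ.mkℚ -[1+ a ] b _) (ℚ.*<* ())

dense-ℕ : ∀ {n} (G : Graph n) (ρ d : ℚ) D R → 1ℚ ℚ.≤ d ℚ.* ℕ→ℚ D → ρ ℚ.* ℕ→ℚ R ≡ 1ℚ → Dense ρ d G →
  ∀ U → R * (∣ U ∣ * ∣ U ∣) ≤ R * D * E G U + 2 * D * (n * n)
dense-ℕ {n} G ρ d D R dD ρR dense U = ≤-trans (ℕ→ℚ-reflect scaled) (+-monoˡ-≤ (2 * D * (n * n)) (≤-trans (≤-reflexive (l R D (edgesIn G U))) (*-monoʳ-≤ (R * D) (2edges≤E G U))))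
  where
  l : ∀ R D e → 2 * D * R * e ≡ R * D * (2 * e)
  l = solve-∀
  q = ℕ→ℚ
  u = q ∣ U ∣
  N = q n
  e = q (edgesIn G U)
  ½ = ℤ.+ 1 ℚ./ 2
  scale = (q 2 ℚ.* q D) ℚ.* q R
  scale≥0 : 0ℚ ℚ.≤ scale
  scale≥0 = *-nonNeg (*-nonNeg (0≤ℕ→ℚ 2) (0≤ℕ→ℚ D)) (0≤ℕ→ℚ R)
  moved : d ℚ.* u ℚ.* u ℚ.* ½ ℚ.≤ e ℚ.+ ρ ℚ.* N ℚ.* N
  moved = ℚₚ.≤-trans (ℚₚ.≤-reflexive (restore (d ℚ.* u ℚ.* u ℚ.* ½) (ρ ℚ.* N ℚ.* N))) (ℚₚ.+-monoˡ-≤ (ρ ℚ.* N ℚ.* N) (dense U))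
    where
    restore : ∀ X A → X ≡ (X ℚ.- A) ℚ.+ A
    restore X A = sym (trans (ℚₚ.+-assoc X (ℚ.- A) A) (trans (cong (X ℚ.+_) (ℚₚ.+-inverseˡ A)) (ℚₚ.+-identityʳ X)))
  left : ∀ t D R d u h → ((t ℚ.* D) ℚ.* R) ℚ.* (d ℚ.* u ℚ.* u ℚ.* h) ≡ (h ℚ.* t) ℚ.* ((R ℚ.* (u ℚ.* u)) ℚ.* (d ℚ.* D))
  left = Tactic.RingSolver.solve-∀ ℚ-ring
  right : ∀ t D R e r N → ((t ℚ.* D) ℚ.* R) ℚ.* (e ℚ.+ r ℚ.* N ℚ.* N) ≡ ((t ℚ.* D) ℚ.* R) ℚ.* e ℚ.+ ((t ℚ.* D) ℚ.* (N ℚ.* N)) ℚ.* (r ℚ.* R)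
  right = Tactic.RingSolver.solve-∀ ℚ-ring
  scaled : q (R * (∣ U ∣ * ∣ U ∣)) ℚ.≤ q (2 * D * R * edgesIn G U + 2 * D * (n * n))
  scaled = ℚₚ.≤-trans (ℚₚ.≤-reflexive (trans (ℕ→ℚ-* R (∣ U ∣ * ∣ U ∣)) (trans (cong (q R ℚ.*_) (ℕ→ℚ-* ∣ U ∣ ∣ U ∣)) (sym (ℚₚ.*-identityʳ _)))))
    (ℚₚ.≤-trans (*-monoˡ (q R ℚ.* (u ℚ.* u)) (*-nonNeg (0≤ℕ→ℚ R) (*-nonNeg (0≤ℕ→ℚ ∣ U ∣) (0≤ℕ→ℚ ∣ U ∣))) dD)
    (ℚₚ.≤-trans (ℚₚ.≤-reflexive (trans (sym (ℚₚ.*-identityˡ _)) (sym (left (q 2) (q D) (q R) d u ½))))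
    (ℚₚ.≤-trans (*-monoˡ scale scale≥0 moved)
    (ℚₚ.≤-reflexive (trans (right (q 2) (q D) (q R) e ρ N) (trans (cong (λ z → scale ℚ.* e ℚ.+ ((q 2 ℚ.* q D) ℚ.* (N ℚ.* N)) ℚ.* z) ρR)
      (trans (cong (scale ℚ.* e ℚ.+_) (ℚₚ.*-identityʳ _)) (sym (trans (ℕ→ℚ-+ (2 * D * R * edgesIn G U) _) (cong₂ ℚ._+_
        (trans (ℕ→ℚ-* (2 * D * R) _) (cong (ℚ._* e) (trans (ℕ→ℚ-* (2 * D) R) (cong (ℚ._* q R) (ℕ→ℚ-* 2 D)))))
        (trans (ℕ→ℚ-* (2 * D) (n * n)) (cong₂ ℚ._*_ (ℕ→ℚ-* 2 D) (ℕ→ℚ-* n n)))))))))))))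

dense-lin : ∀ {n} (G : Graph n) D C R → 4 * (C * C) * D < R → (∀ U → R * (∣ U ∣ * ∣ U ∣) ≤ R * D * E G U + 2 * D * (n * n)) → Lin G D C
dense-lin {n} G D C R hR h c c≤C U = *-cancelˡ-≤ R ⦃ >-nonZero (≤-trans (s≤s z≤n) hR) ⦄ (begin
  R * (4 * c * n * u) ≡⟨ l₁ R c n u ⟩
  2 * R * (2 * (c * u) * n) ≤⟨ *-monoʳ-≤ (2 * R) (am-gm (c * u) n) ⟩
  2 * R * ((c * u) * (c * u) + n * n) ≡⟨ l₂ R c u n ⟩
  2 * (c * c) * (R * (u * u)) + 2 * R * (n * n) ≤⟨ +-monoˡ-≤ (2 * R * (n * n)) (*-monoʳ-≤ (2 * (c * c)) (h U)) ⟩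
  2 * (c * c) * (R * D * e + 2 * D * (n * n)) + 2 * R * (n * n) ≡⟨ l₃ c R D e n ⟩
  R * (2 * (c * c * D) * e) + 2 * R * (n * n) + 4 * (c * c) * D * (n * n) ≤⟨ +-monoʳ-≤ (R * (2 * (c * c * D) * e) + 2 * R * (n * n)) (*-monoˡ-≤ (n * n) small) ⟩
  R * (2 * (c * c * D) * e) + 2 * R * (n * n) + R * (n * n) ≡⟨ l₄ R (2 * (c * c * D) * e) n ⟩
  R * (2 * (c * c * D) * e + 3 * (n * n)) ∎)
  where
  open ≤-Reasoning
  u = ∣ U ∣
  e = E G U
  small : 4 * (c * c) * D ≤ R
  small = ≤-trans (*-monoˡ-≤ D (*-monoʳ-≤ 4 (*-mono-≤ c≤C c≤C))) (<⇒≤ hR)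
  l₁ : ∀ R c n u → R * (4 * c * n * u) ≡ 2 * R * (2 * (c * u) * n)
  l₁ = solve-∀
  l₂ : ∀ R c u n → 2 * R * ((c * u) * (c * u) + n * n) ≡ 2 * (c * c) * (R * (u * u)) + 2 * R * (n * n)
  l₂ = solve-∀
  l₃ : ∀ c R D e n → 2 * (c * c) * (R * D * e + 2 * D * (n * n)) + 2 * R * (n * n) ≡ R * (2 * (c * c * D) * e) + 2 * R * (n * n) + 4 * (c * c) * D * (n * n)
  l₃ = solve-∀
  l₄ : ∀ R x n → R * x + 2 * R * (n * n) + R * (n * n) ≡ R * (x + 3 * (n * n))
  l₄ = solve-∀
  am-gm : ∀ a b → 2 * a * b ≤ a * a + b * b
  am-gm a b with ≤-total a b
  ... | inj₁ p with m≤n⇒∃[o]m+o≡n p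
  ...   | o , refl = ≤-trans (m≤m+n _ (o * o)) (≤-reflexive (l a o))
    where l : ∀ a o → 2 * a * (a + o) + o * o ≡ a * a + (a + o) * (a + o)
          l = solve-∀
  am-gm a b | inj₂ p with m≤n⇒∃[o]m+o≡n p
  ... | o , refl = ≤-trans (m≤m+n _ (o * o)) (≤-reflexive (l b o))
    where l : ∀ b o → 2 * (b + o) * b + o * o ≡ (b + o) * (b + o) + b * b
          l = solve-∀

degree-ℕ : ∀ {n} (G : Graph n) μ M → 1ℚ ℚ.≤ μ ℚ.* ℕ→ℚ M → MinDegreeAtLeast μ G → ∀ u → n ≤ M * Nb G u (λ _ → true)
degree-ℕ {n} G μ M hM h u = ≤-trans (ℕ→ℚ-reflect (ℚₚ.≤-trans (ℚₚ.≤-reflexive (sym (ℚₚ.*-identityʳ (ℕ→ℚ n))))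
    (ℚₚ.≤-trans (*-monoˡ (ℕ→ℚ n) (0≤ℕ→ℚ n) hM) (ℚₚ.≤-trans (ℚₚ.≤-reflexive (rearrange (ℕ→ℚ n) μ (ℕ→ℚ M)))
    (ℚₚ.≤-trans (*-monoˡ (ℕ→ℚ M) (0≤ℕ→ℚ M) (h u)) (ℚₚ.≤-reflexive (sym (ℕ→ℚ-* M (deg G u)))))))))
    (*-monoʳ-≤ M (≤-reflexive (∣∣-cong (λ v → sym (∧-identityʳ (adj G u v))))))
  where
  rearrange : ∀ N μ M → N ℚ.* (μ ℚ.* M) ≡ M ℚ.* (μ ℚ.* N)
  rearrange = Tactic.RingSolver.solve-∀ ℚ-ring

largest : ∀ (f : ℕ → ℕ) n → f 0 ≤ n → (∀ w → w ≤ f w) → ∃ λ w → f w ≤ n × n < f (suc w)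
largest f n h₀ grows = go (suc n) 0 (≤-reflexive (sym (+-identityʳ (suc n)))) h₀
  where
  go : ∀ fuel w → suc n ≤ fuel + w → f w ≤ n → ∃ λ w → f w ≤ n × n < f (suc w)
  go zero w le h = ⊥-elim (<-irrefl refl (≤-trans le (≤-trans (grows w) h)))
  go (suc fuel) w le h with f (suc w) ≤? n
  ... | yes h′ = go fuel (suc w) (≤-trans le (≤-reflexive (sym (+-suc fuel w)))) h′
  ... | no ¬h = w , h , ≰⇒> ¬h

exp-dominates : ∀ a x → 2 * a + 1 ≤ x → a * suc x ≤ 2 ^ x
exp-dominates a x le with m≤n⇒∃[o]m+o≡n le
... | o , refl = go o
  where
  go : ∀ o → a * suc (2 * a + 1 + o) ≤ 2 ^ (2 * a + 1 + o)
  go zero = begin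
    a * suc (2 * a + 1 + 0) ≡⟨ l a ⟩
    2 * (a * suc a) ≤⟨ *-monoʳ-≤ 2 (*-mono-≤ (<⇒≤ (n<2^n a)) (n<2^n a)) ⟩
    2 * (2 ^ a * 2 ^ a) ≡⟨ cong (2 *_) (^-distribˡ-+-* 2 a a) ⟨
    2 ^ suc (a + a) ≡⟨ cong (2 ^_) (l′ a) ⟩
    2 ^ (2 * a + 1 + 0) ∎
    where
    open ≤-Reasoning
    l : ∀ a → a * suc (2 * a + 1 + 0) ≡ 2 * (a * suc a)
    l = solve-∀
    l′ : ∀ a → suc (a + a) ≡ 2 * a + 1 + 0
    l′ = solve-∀
  go (suc o) = subst (λ y → a * suc y ≤ 2 ^ y) (sym (+-suc (2 * a + 1) o)) (≤-trans (≤-reflexive (*-suc a (suc y)))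
      (≤-trans (+-mono-≤ (≤-trans (m≤m*n a (suc y)) (go o)) (go o)) (≤-reflexive (cong (2 ^ y +_) (sym (+-identityʳ (2 ^ y)))))))
    where y = 2 * a + 1 + o

2^-cancel-≤ : ∀ a b → 2 ^ a ≤ 2 ^ b → a ≤ b
2^-cancel-≤ a b h = ≮⇒≥ (λ lt → <-irrefl refl (<-≤-trans (^-monoʳ-< 2 (s≤s (s≤s z≤n)) lt) h))

tile-order : ∀ K m n x → 32 * K + 1 ≤ x → 0 < n → 2 ^ x ≤ n → AtMostSqrtOverLog m n → K * (m * m * suc x) ≤ n
tile-order K m n x hx n>0 hn at = *-cancelˡ-≤ 16 (begin
  16 * (K * (m * m * suc x)) ≡⟨ l₁ K (m * m) x ⟩
  16 * K * suc x * (m * m) ≤⟨ *-monoˡ-≤ (m * m) big ⟩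
  x * x * (m * m) ≡⟨ l₂ x m ⟩
  (x * m) * (x * m) ≤⟨ *-mono-≤ xm≤ xm≤ ⟩
  2 * S * (2 * S) ≤⟨ *-mono-≤ (*-monoʳ-≤ 2 S≤) (*-monoʳ-≤ 2 S≤) ⟩
  2 * (2 * r) * (2 * (2 * r)) ≡⟨ l₃ r ⟩
  16 * (r * r) ≤⟨ *-monoʳ-≤ 16 lo ⟩
  16 * n ∎)
  where
  open ≤-Reasoning
  l₁ : ∀ K y x → 16 * (K * (y * suc x)) ≡ 16 * K * suc x * y
  l₁ = solve-∀
  l₂ : ∀ x m → x * x * (m * m) ≡ (x * m) * (x * m)
  l₂ = solve-∀
  l₃ : ∀ r → 2 * (2 * r) * (2 * (2 * r)) ≡ 16 * (r * r)
  l₃ = solve-∀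
  root = largest (λ r → r * r) n z≤n (λ { zero → z≤n ; (suc r) → m≤m+n (suc r) (r * suc r) })
  r = proj₁ root
  lo : r * r ≤ n
  lo = proj₁ (proj₂ root)
  S = suc r
  r>0 : 0 < r
  r>0 = ≮⇒≥ (λ h → <-irrefl refl (<-≤-trans (proj₂ (proj₂ root)) (≤-trans (≤-reflexive (cong (λ z → suc z * suc z) (n≤0⇒n≡0 (s≤s⁻¹ h)))) n>0)))
  S≤ : S ≤ 2 * r
  S≤ = ≤-trans (+-monoˡ-≤ r r>0) (≤-reflexive (cong (r +_) (sym (+-identityʳ r))))
  xm≤ : x * m ≤ 2 * S
  xm≤ = 2^-cancel-≤ (x * m) (2 * S) (≤-trans (≤-reflexive (sym (^-*-assoc 2 x m))) (≤-trans (^-monoˡ-≤ m hn)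
    (AtMostSqrtOverLog⇒ m n S (<⇒≤ (proj₂ (proj₂ root))) at)))
  x>0 : 0 < x
  x>0 = ≤-trans (m≤n+m 1 (32 * K)) hx
  big : 16 * K * suc x ≤ x * x
  big = ≤-trans (*-monoʳ-≤ (16 * K) (≤-trans (+-monoˡ-≤ x x>0) (≤-reflexive (cong (x +_) (sym (+-identityʳ x)))))) (≤-trans (≤-reflexive (l₄ K x))
    (*-monoˡ-≤ x (≤-trans (m≤m+n (32 * K) 1) hx)))
    where l₄ : ∀ K x → 16 * K * (2 * x) ≡ 32 * K * x
          l₄ = solve-∀

theorem1p4 : ∀ (k Δ : ℕ) (d μ : ℚ) → 1 Data.Nat.< k → 1 Data.Nat.< Δ
    → 0ℚ Data.Rational.< d → 0ℚ Data.Rational.< μ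
    → Σ ℚ λ ρ → 0ℚ Data.Rational.< ρ × Σ ℕ λ n₀ → ∀ (n : ℕ) → n ≥ n₀
    → (G H : Graph n) → Dense ρ d G → MinDegreeAtLeast μ G
    → IsTiling k (λ m → AtMostSqrtOverLog m n) H
    → ChromaticAtMost k H → MaxDegreeAtMost Δ H
    → SubgraphOf H G
theorem1p4 k Δ d μ 1<k 1<Δ d>0 μ>0 = choose (archimedes d d>0) (archimedes μ μ>0)
  where
  Goal : Set
  Goal = Σ ℚ λ ρ → 0ℚ ℚ.< ρ × Σ ℕ λ n₀ → ∀ (n : ℕ) → n ≥ n₀
    → (G H : Graph n) → Dense ρ d G → MinDegreeAtLeast μ G
    → IsTiling k (λ m → AtMostSqrtOverLog m n) H
    → ChromaticAtMost k H → MaxDegreeAtMost Δ H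
    → SubgraphOf H G
  Δ>0 : 0 < Δ
  Δ>0 = <⇒≤ 1<Δ
  with-constants : ∀ {D M} → 0 < D → 1ℚ ℚ.≤ d ℚ.* ℕ→ℚ D → 0 < M → 1ℚ ℚ.≤ μ ℚ.* ℕ→ℚ M → Setting Δ k D M → Goal
  with-constants {D} {M} D>0 dD M>0 μM st = ρ , ℚₚ.positive⁻¹ ρ ⦃ ℚₚ.normalize-pos 1 R ⦄ , threshold , embed
    where
    open Setting st
    open Constants consts using (C; w₀; n₀)
    R = suc (4 * (C * C) * D)
    ρ = ℤ.+ 1 ℚ./ R
    a = K * (suc w₀ * suc w₀)
    L = (32 * K + 1) + (2 * a + 1)
    threshold = 2 ^ L + (n₀ + c)
    embed : ∀ n → n ≥ threshold → (G H : Graph n) → Dense ρ d G → MinDegreeAtLeast μ G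
      → IsTiling k (λ m → AtMostSqrtOverLog m n) H → ChromaticAtMost k H → MaxDegreeAtMost Δ H → SubgraphOf H G
    embed n large G H dense degree (part , part-adj , tiles) (col , proper) maxdeg = with-log (largest (2 ^_) n n>0 (λ w → <⇒≤ (n<2^n w)))
      where
      2^L≤n : 2 ^ L ≤ n
      2^L≤n = ≤-trans (m≤m+n (2 ^ L) _) large
      n>0 : 0 < n
      n>0 = ≤-trans (m^n>0 2 L) 2^L≤n
      with-log : (∃ λ x → 2 ^ x ≤ n × n < 2 ^ suc x) → SubgraphOf H G
      with-log (x , lo , hi) = with-w (largest f n (≤-trans (≤-reflexive (*-zeroʳ K)) z≤n) f-grows)
        where
        f : ℕ → ℕ
        f w = K * (w * w * suc x)
        K>0 : 0 < K
        K>0 = subst (0 <_) (sym K≡) (*-mono-≤ (≤-trans M>0 (m≤n*m M 2)) (≤-trans (s≤s z≤n) (reserve-factor≥ J)))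
        f-grows : ∀ w → w ≤ f w
        f-grows zero = z≤n
        f-grows (suc w) = ≤-trans (≤-trans (m≤m*n (suc w) (suc w)) (m≤m*n (suc w * suc w) (suc x))) (m≤n*m (suc w * suc w * suc x) K ⦃ >-nonZero K>0 ⦄)
        f-mono : ∀ {v w} → v ≤ w → f v ≤ f w
        f-mono le = *-monoʳ-≤ K (*-monoˡ-≤ (suc x) (*-mono-≤ le le))
        L≤x : L ≤ x
        L≤x = s≤s⁻¹ (≰⇒> (λ h → <-irrefl refl (<-≤-trans hi (≤-trans (^-monoʳ-≤ 2 h) 2^L≤n))))
        with-w : (∃ λ w → f w ≤ n × n < f (suc w)) → SubgraphOf H G
        with-w (zero , _ , n<f) = ⊥-elim (<-irrefl refl (<-≤-trans n<f (≤-trans (f-mono {1} {suc w₀} (s≤s z≤n)) fw₀)))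
          where
          fw₀ : f (suc w₀) ≤ n
          fw₀ = ≤-trans (≤-reflexive (sym (*-assoc K (suc w₀ * suc w₀) (suc x)))) (≤-trans (exp-dominates a x (≤-trans (m≤n+m (2 * a + 1) (32 * K + 1)) L≤x)) lo)
        with-w (suc w′ , fits , n<f) = finish (spanning-embedding st D>0 M>0 Δ>0 w′ (suc x) n>0
            (≤-trans (≤-trans (m≤n+m c n₀) (m≤n+m (n₀ + c) (2 ^ L))) large) (≤-trans (≤-trans (m≤m+n n₀ c) (m≤n+m (n₀ + c) (2 ^ L))) large)
            w₀≤ (s≤s z≤n) hi fits G H (dense-lin G D C R ≤-refl (dense-ℕ G ρ d D R dD (fraction-* 1 R) dense)) (degree-ℕ G μ M μM degree)
            maxdeg col (λ i j → proper i j refl refl) part part-adj small (λ v → proj₂ (proj₂ (tiles v))))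
          where
          fw₀ : f (suc w₀) ≤ n
          fw₀ = ≤-trans (≤-reflexive (sym (*-assoc K (suc w₀ * suc w₀) (suc x)))) (≤-trans (exp-dominates a x (≤-trans (m≤n+m (2 * a + 1) (32 * K + 1)) L≤x)) lo)
          below : ∀ m → f m ≤ n → m ≤ suc w′
          below m h = ≮⇒≥ (λ lt → <-irrefl refl (<-≤-trans n<f (≤-trans (f-mono lt) h)))
          w₀≤ : w₀ ≤ suc w′
          w₀≤ = ≤-trans (n≤1+n w₀) (below (suc w₀) fw₀)
          small : ∀ v → ∣ (λ u → ⌊ part u ≟F part v ⌋) ∣ ≤ suc w′
          small v = below (count (λ u → ⌊ part u ≟F part v ⌋)) (tile-order K (count (λ u → ⌊ part u ≟F part v ⌋)) n x (≤-trans (m≤m+n (32 * K + 1) (2 * a + 1)) L≤x) n>0 lo (proj₁ (tiles v)))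
          finish : (∃ λ θ → Emb G H (λ _ → true) (λ _ → true) θ) → SubgraphOf H G
          finish (θ , e) = θ , (λ i j → inj e i j refl refl) , (λ i j → hom e i j refl refl)
  choose : (∃ λ D → 0 < D × 1ℚ ℚ.≤ d ℚ.* ℕ→ℚ D) → (∃ λ M → 0 < M × 1ℚ ℚ.≤ μ ℚ.* ℕ→ℚ M) → Goal
  choose (D , D>0 , dD) (M , M>0 , μM) = with-constants D>0 dD M>0 μM (setting Δ k D M)
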